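{- Let $m$ and $n$ be positive integers, and put $\kappa := m + 2n-1$ and $n':=2n-1$. Then \begin{align*} &\sum_{s_*}\mathcal{B}_{m,n'}(s_*;q^{n'})\left(\prod_{i=1}^{m-1}(-q^{n-1/2};q^{n-1/2})_{s_{i}^{(0)}-s_{i+1}^{(0)}}\right)q^{\mathcal{A}_{m,n'}(s_*)+\frac{1}{2}s^{(0)}} \\ &\qquad = \frac{(q^\kappa;q^\kappa)_\infty^n}{(q;q)_\infty^{n-1}(q^{1/2};q^{1/2})_\infty} \prod_{i=1}^n\theta(q^{i+m/2-1/2};q^\kappa) \prod_{1 \leq i < j \leq n}\theta(q^{j-i},q^{i+j-2};q^\kappa), \end{align*} where the sum ranges over all families of integers $s_i^{(j)}$ ($1\le i\le m$, $0\le j\le n'-1$) with $s_1^{(j)}\ge\cdots\ge s_m^{(j)}$ for each $j$ and $s_i^{(j)}\ge s_i^{(j+1)}$ for $0\le j\le n'-1$ (where $s_i^{(n')}=0$).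
   Context: Notation: for $k\ge 0$ an integer, $(a;p)_k=(1-a)(1-ap)\cdots(1-ap^{k-1})$, $(a;p)_\infty=\prod_{j\ge0}(1-ap^j)$; $\theta(a;p)=(a;p)_\infty(p/a;p)_\infty$ and $\theta(a_1,\dots,a_k;p)=\theta(a_1;p)\cdots\theta(a_k;p)$. Identities are of formal power series in $q^{1/2}$. For positive integers $M,N$ and integers $s_i^{(j)}$ ($1\le i\le M$, $0\le j\le N$), with the conventions $s_i^{(N)}=0$ for all $i$ and $s_{M+1}^{(j)}=0$ for all $j$, and $s^{(j)}:=s_1^{(j)}+\cdots+s_M^{(j)}$, define $$\mathcal{A}_{M,N}(s_*)= -\tfrac{N}{2}s^{(0)}+s^{(1)}+\cdots+s^{(N-1)}+\tfrac{N}{2}\sum_{i=1}^M\sum_{a=1}^N\big(s_i^{(a-1)}-s_i^{(a)}\big)^2,$$ $$\mathcal{B}_{M,N}(s_*;p)=\prod_{i=1}^M\prod_{a=1}^N\frac{(p;p)_{s_i^{(a-1)}-s_{i+1}^{(a)}}}{(p;p)_{s_i^{(a-1)}-s_i^{(a)}}\,(p;p)_{s_i^{(a)}-s_{i+1}^{(a)}}}\ \prod_{i=1}^M\frac{1}{(p;p)_{s_i^{(0)}-s_{i+1}^{(0)}}}.$$ -}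

module Defs where

open import Data.Nat as ℕ using (ℕ; zero; suc; _∸_; _≤ᵇ_; _≡ᵇ_; _<?_)
open import Data.Integer as ℤ using (ℤ; +_; -[1+_])
open import Data.Bool using (Bool; true; false; if_then_else_; _∧_)
open import Data.List using (List; []; _∷_; map; foldr; upTo; concatMap; filterᵇ)
open import Data.Fin using (Fin; fromℕ<)
import Data.Fin as Fin
open import Relation.Nullary using (yes; no)

-- Formal power series in t = q^{1/2} with integer coefficients,
-- represented by their coefficient sequences.

Series : Set
Series = ℕ → ℤ

sumℤ : List ℤ → ℤ
sumℤ = foldr ℤ._+_ (+ 0)

_⊛_ : Series → Series → Series
(f ⊛ g) K = sumℤ (map (λ i → f i ℤ.* g (K ∸ i)) (upTo (suc K)))

infixl 7 _⊛_

_⊕_ : Series → Series → Series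
(f ⊕ g) K = f K ℤ.+ g K

oneS : Series
oneS zero    = + 1
oneS (suc _) = + 0

monoS : ℤ → ℕ → Series
monoS c e K = if K ≡ᵇ e then c else + 0

prodS : List Series → Series
prodS = foldr _⊛_ oneS

powS : Series → ℕ → Series
powS f zero    = oneS
powS f (suc k) = f ⊛ powS f k

shiftZ : ℤ → Series → Series
shiftZ e F K with (+ K) ℤ.- e
... | + k      = F k
... | -[1+ _ ] = + 0

-- Multiplicative inverse of a series f with f 0 = 1:
-- b 0 = 1,  b j = - Σ_{i=1}^{j} f i · b (j - i).
-- invCoeffs f K j is b j for every j ≤ K.
invCoeffs : Series → ℕ → (ℕ → ℤ)
invCoeffs f zero    j = if j ≡ᵇ 0 then + 1 else + 0
invCoeffs f (suc K) j =
  if j ≤ᵇ K then invCoeffs f K j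
  else ℤ.- sumℤ (map (λ i → f (suc i) ℤ.* invCoeffs f K (K ∸ i)) (upTo (suc K)))

invS : Series → Series
invS f K = invCoeffs f K K

poch : ℤ → ℕ → ℕ → ℕ → Series
poch c α β k = prodS (map (λ j → oneS ⊕ monoS (ℤ.- c) (α ℕ.+ j ℕ.* β)) (upTo k))

-- (c t^α ; t^β)_∞ for β ≥ 1: factors with j ≥ K+1 have exponent > K,
-- so the coefficient of t^K equals that of the first K+1 factors.
pochInf : ℤ → ℕ → ℕ → Series
pochInf c α β K = poch c α β (suc K) K

-- θ(t^α ; t^β) = (t^α; t^β)_∞ (t^{β-α}; t^β)_∞   (used with α ≤ β)
theta : ℕ → ℕ → Series
theta α β = pochInf (+ 1) α β ⊛ pochInf (+ 1) (β ∸ α) β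

-- Families s_i^{(j)}, 0-indexed: i < M (paper's i-1), j < N.
Fam : ℕ → ℕ → Set
Fam M N = Fin M → Fin N → ℕ

-- extension by the conventions s_i^{(N)} = 0, s_{M+1}^{(j)} = 0
ext : ∀ {M N} → Fam M N → ℕ → ℕ → ℕ
ext {M} {N} s i j with i <? M | j <? N
... | yes p | yes q = s (fromℕ< p) (fromℕ< q)
... | _     | _     = 0

funs : ∀ {A : Set} (k : ℕ) → List A → List (Fin k → A)
funs zero    xs = (λ ()) ∷ []
funs (suc k) xs =
  concatMap (λ x → map (λ g → λ { Fin.zero → x ; (Fin.suc i) → g i }) (funs k xs)) xs

allB : List ℕ → (ℕ → Bool) → Bool
allB xs p = foldr (λ x b → p x ∧ b) true xs

valid : ∀ {M N} → Fam M N → Bool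
valid {M} {N} s =
  allB (upTo M) (λ i → allB (upTo N) (λ j →
    (ext s (suc i) j ≤ᵇ ext s i j) ∧ (ext s i (suc j) ≤ᵇ ext s i j)))

colSum : ∀ {M N} → Fam M N → ℕ → ℕ
colSum {M} s j = foldr ℕ._+_ 0 (map (λ i → ext s i j) (upTo M))

twoA : ∀ {M N} → Fam M N → ℤ
twoA {M} {N} s =
    ℤ.- ((+ N) ℤ.* (+ colSum s 0))
  ℤ.+ (+ 2) ℤ.* sumℤ (map (λ j → + colSum s (suc j)) (upTo (N ∸ 1)))
  ℤ.+ (+ N) ℤ.* sumℤ (map (λ i → sumℤ (map (λ a →
          let d = (+ ext s i a) ℤ.- (+ ext s i (suc a)) in d ℤ.* d)
        (upTo N))) (upTo M))

qp : ℕ → ℕ → Series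
qp π k = poch (+ 1) π π k

calB : ∀ {M N} → ℕ → Fam M N → Series
calB {M} {N} π s =
  prodS (concatMap (λ i → map (λ a →
      qp π (ext s i a ∸ ext s (suc i) (suc a))
        ⊛ invS (qp π (ext s i a ∸ ext s i (suc a)) ⊛ qp π (ext s i (suc a) ∸ ext s (suc i) (suc a))))
    (upTo N)) (upTo M))
  ⊛ prodS (map (λ i → invS (qp π (ext s i 0 ∸ ext s (suc i) 0))) (upTo M))

n′ : ℕ → ℕ
n′ n = 2 ℕ.* n ∸ 1

summand : (m n : ℕ) → Fam m (n′ n) → Series
summand m n s =
  shiftZ (twoA s ℤ.+ (+ colSum s 0))
    (calB (2 ℕ.* n′ n) s
      ⊛ prodS (map (λ i → poch (ℤ.- (+ 1)) (n′ n) (n′ n) (ext s i 0 ∸ ext s (suc i) 0))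
                   (upTo (m ∸ 1))))

lhsPartial : (m n B K : ℕ) → ℤ
lhsPartial m n B K =
  sumℤ (map (λ s → summand m n s K)
            (filterᵇ valid (funs m (funs (n′ n) (upTo (suc B))))))

rhs : (m n : ℕ) → Series
rhs m n =
  (powS (pochInf (+ 1) (2 ℕ.* κ) (2 ℕ.* κ)) n
    ⊛ prodS (map (λ i′ → theta (2 ℕ.* i′ ℕ.+ m ℕ.+ 1) (2 ℕ.* κ)) (upTo n))
    ⊛ prodS (concatMap (λ j′ → map (λ i′ →
         theta (2 ℕ.* (j′ ∸ i′)) (2 ℕ.* κ) ⊛ theta (2 ℕ.* (i′ ℕ.+ j′)) (2 ℕ.* κ))
        (upTo j′)) (upTo n)))
  ⊛ invS (powS (pochInf (+ 1) 2 2) (n ∸ 1) ⊛ pochInf (+ 1) 1 1)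
  where κ = m ℕ.+ n′ n

-- Put h = q^{1/2}, N = 2n-1 and κ = m+N. With t = h^{2N}, the multisum is the column-by-column
-- expansion of a Littlewood sum of Hall–Littlewood polynomials P_λ(Y; t) over λ₁ ≤ m, where the
-- alphabet Y of odd powers of h is cut into N geometric progressions of ratio t. By partial
-- fractions this Littlewood sum equals Σ_{J ⊂ Y} mon(J)^m A(-J ∪ Y∖J), where
-- A(E) = ∏_e φ(e) ∏_{e<e'} a(e+e') has zeros that only allow J to be a union of initial segments
-- of the progressions. The surviving J are indexed by r ∈ ℤ^n, and quasi-periodicity of theta
-- products turns the sum into A(Y) times det(Σ_r (-1)^r h^{w(Pr²+2cr)} (h^{2jβ} + h^{-2jβ})) / V
-- with β = c+Pr, P = N, w = κ and V a Vandermonde product. Exchanging P and w transposes this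
-- matrix; for P = κ, w = N the sum is the one of level 0, which has the closed form (h^κ; h^{2κ}).
-- So the multisum is a quotient of two values of A, both explicit products. All of this takes
-- place in Laurent series in h, modulo h^K.
module Submission where

open import Defs
open import Level using (0ℓ)
open import Algebra.Bundles using (CommutativeRing; RawRing)
open import Algebra.Solver.Ring.AlmostCommutativeRing using (fromCommutativeRing; AlmostCommutativeRing; _-Raw-AlmostCommutative⟶_)
import Algebra.Solver.Ring
import Algebra.Properties.Ring
open import Data.Bool using (Bool; true; false; if_then_else_; _∧_; T)
open import Data.Empty using (⊥; ⊥-elim)
open import Data.Fin using (Fin; fromℕ<)
import Data.Fin as Fin
import Data.Fin.Properties as FinP
open import Data.Integer as ℤ using (ℤ; +_; -[1+_]; -1ℤ; _⊖_; ∣_∣)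
open import Data.Integer using () renaming (_+_ to _+'_; _*_ to _*'_; _-_ to _-'_; -_ to -'_; _≤_ to _≤'_; _<_ to _<'_; 0ℤ to 0'; 1ℤ to 1')
import Data.Integer.Properties as ℤP
open import Data.Integer.Tactic.RingSolver using () renaming (solve-∀ to ℤsolve)
open import Data.List using (List; []; _∷_; map; foldr; upTo; concatMap; filterᵇ; _++_; length)
import Data.List.Properties as ListP
open import Data.List.Relation.Binary.Permutation.Propositional using (_↭_; prep; swap; ↭-sym; ↭-refl; ↭-reflexive)
import Data.List.Relation.Binary.Permutation.Propositional as Perm
import Data.List.Relation.Binary.Permutation.Propositional.Properties as PermP
open import Data.List.Relation.Unary.All using (All; []; _∷_)
import Data.List.Relation.Unary.All as All
import Data.List.Relation.Unary.All.Properties as AllP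
open import Data.List.Relation.Unary.AllPairs using (AllPairs; []; _∷_)
import Data.List.Relation.Unary.AllPairs as AllPairs
import Data.List.Relation.Unary.AllPairs.Properties as AllPairsP
open import Data.Maybe using (Maybe; just; nothing)
open import Data.Nat as ℕ using (ℕ; zero; suc; _∸_; _≤_; _<_; z≤n; s≤s; _≤ᵇ_; _≡ᵇ_)
import Data.Nat.Properties as ℕP
open import Data.Nat.Tactic.RingSolver using () renaming (solve-∀ to ℕsolve)
open import Data.Product using (∃; _×_; _,_; proj₁; proj₂)
open import Data.Sum using (_⊎_; inj₁; inj₂)
open import Data.Unit using (⊤; tt)
open import Data.Vec using (Vec; []; _∷_)
import Data.Vec.Properties as VecP
open import Function using (_∘_; id)
open import Relation.Binary.PropositionalEquality as ≡ using (_≡_; _≢_; refl; cong; cong₂; subst; subst₂; module ≡-Reasoning)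
open import Relation.Nullary using (¬_; Dec; yes; no; contradiction)
open import Relation.Binary.Definitions using (tri<; tri≈; tri>)
open import Data.List.Membership.Propositional using (_∈_)
import Data.List.Membership.Propositional.Properties as MemP
import Data.List.Relation.Unary.Any as Any

-- Since h^y is a fixed power and not a variable, arguments with poles and residues are replaced by
-- one identity for the product of two simple poles (`γ-mul`); expansions follow by induction, and
-- the constant function 1 takes the part of the value at h^y = 0. The Littlewood sum for every
-- bound m then results from three identities for an associative convolution `⋆`. Hall-Littlewood
-- polynomials are not evaluated on progressions from their definition: the branching rule is
-- deduced from the Pieri rule, which determines them, and then iterated. Changing the sign of a
-- letter creates negative powers of h, and congruences modulo h^K do not survive multiplication by
-- these; values of `A` are therefore compared up to units close to 1 (`≅`), and congruence returns
-- only for integral quantities. The level-0 sum depends on the number of letters alone, which is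
-- why exchanging P = N, w = κ for P = κ, w = N evaluates the determinant. The products obtained for
-- the two alphabets have to be completed by the same finitely many factors, collected in `corr`,
-- which therefore drop out.

record ℤ-Algebra : Set1 where
 field
  commRing : CommutativeRing 0ℓ 0ℓ
 open CommutativeRing commRing public using (Carrier; _≈_; _+_; _*_; -_; _-_; 0#; 1#)
 field
  const : ℤ -> Carrier
  const-+ : ∀ x y -> const (x +' y) ≈ const x + const y
  const-* : ∀ x y -> const (x *' y) ≈ const x * const y
  const-- : ∀ x -> const (-' x) ≈ - const x
  const-0 : const 0' ≈ 0#
  const-1 : const 1' ≈ 1#

-- Commutative rings with integer constants: laws and a solver.

module RingTools (𝓐 : ℤ-Algebra) where
 open ℤ-Algebra 𝓐 public
 private
  module R = CommutativeRing commRing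
  module 𝐑 = Algebra.Properties.Ring R.ring

 -- The laws of the ring are restated because the types they inherit from the record
 -- hierarchy are so large that every use of them would be expensive to check.
 rfl : ∀ {x} -> x ≈ x
 rfl = R.refl
 sym : ∀ {x y} -> x ≈ y -> y ≈ x
 sym = R.sym
 trans : ∀ {x y z} -> x ≈ y -> y ≈ z -> x ≈ z
 trans = R.trans
 reflexive : ∀ {x y} -> x ≡ y -> x ≈ y
 reflexive = R.reflexive
 +-cong : ∀ {x y u v} -> x ≈ y -> u ≈ v -> x + u ≈ y + v
 +-cong = R.+-cong
 +ˡ : ∀ {x y z} -> y ≈ z -> x + y ≈ x + z
 +ˡ = R.+-congˡ
 +ʳ : ∀ {x y z} -> y ≈ z -> y + x ≈ z + x
 +ʳ = R.+-congʳ
 *-cong : ∀ {x y u v} -> x ≈ y -> u ≈ v -> x * u ≈ y * v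
 *-cong = R.*-cong
 *ˡ : ∀ {x y z} -> y ≈ z -> x * y ≈ x * z
 *ˡ = R.*-congˡ
 *ʳ : ∀ {x y z} -> y ≈ z -> y * x ≈ z * x
 *ʳ = R.*-congʳ
 -‿cong : ∀ {x y} -> x ≈ y -> - x ≈ - y
 -‿cong = R.-‿cong
 +-assoc : ∀ x y z -> x + y + z ≈ x + (y + z)
 +-assoc = R.+-assoc
 +-comm : ∀ x y -> x + y ≈ y + x
 +-comm = R.+-comm
 +-identityˡ : ∀ x -> 0# + x ≈ x
 +-identityˡ = R.+-identityˡ
 +-identityʳ : ∀ x -> x + 0# ≈ x
 +-identityʳ = R.+-identityʳ
 -‿inverseˡ : ∀ x -> - x + x ≈ 0#
 -‿inverseˡ = R.-‿inverseˡ
 -‿inverseʳ : ∀ x -> x + - x ≈ 0#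
 -‿inverseʳ = R.-‿inverseʳ
 *-assoc : ∀ x y z -> x * y * z ≈ x * (y * z)
 *-assoc = R.*-assoc
 *-comm : ∀ x y -> x * y ≈ y * x
 *-comm = R.*-comm
 *-identityˡ : ∀ x -> 1# * x ≈ x
 *-identityˡ = R.*-identityˡ
 *-identityʳ : ∀ x -> x * 1# ≈ x
 *-identityʳ = R.*-identityʳ
 distribˡ : ∀ x y z -> x * (y + z) ≈ x * y + x * z
 distribˡ = R.distribˡ
 distribʳ : ∀ x y z -> (y + z) * x ≈ y * x + z * x
 distribʳ = R.distribʳ
 zeroˡ : ∀ x -> 0# * x ≈ 0#
 zeroˡ = R.zeroˡ
 zeroʳ : ∀ x -> x * 0# ≈ 0#
 zeroʳ = R.zeroʳ
 -‿distribˡ-* : ∀ x y -> - (x * y) ≈ - x * y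
 -‿distribˡ-* = 𝐑.-‿distribˡ-*
 -‿distribʳ-* : ∀ x y -> - (x * y) ≈ x * - y
 -‿distribʳ-* = 𝐑.-‿distribʳ-*
 -0#≈0# : - 0# ≈ 0#
 -0#≈0# = 𝐑.-0#≈0#
 -‿involutive : ∀ x -> - - x ≈ x
 -‿involutive = 𝐑.-‿involutive
 -‿+-comm : ∀ x y -> - x + - y ≈ - (x + y)
 -‿+-comm = 𝐑.-‿+-comm

 infix 1 begin_
 infixr 2 _≈⟨_⟩_
 infix 3 _∎
 begin_ : ∀ {x y} -> x ≈ y -> x ≈ y
 begin p = p
 _≈⟨_⟩_ : ∀ x {y z} -> x ≈ y -> y ≈ z -> x ≈ z
 _ ≈⟨ p ⟩ q = trans p q
 _∎ : ∀ x -> x ≈ x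
 _ ∎ = rfl

 private
  acr : AlmostCommutativeRing 0ℓ 0ℓ
  acr = fromCommutativeRing commRing

  ℤraw : RawRing 0ℓ 0ℓ
  ℤraw = record { Carrier = ℤ ; _≈_ = _≡_ ; _+_ = _+'_ ; _*_ = _*'_ ; -_ = -'_ ; 0# = 0' ; 1# = 1' }

  -- Agrees with const, but makes the constants 0 and 1 of the solver reduce to 0# and 1#.
  ⟦_⟧ℤ : ℤ -> Carrier
  ⟦ + 0 ⟧ℤ = 0#
  ⟦ + 1 ⟧ℤ = 1#
  ⟦ x ⟧ℤ = const x

  ⟦⟧≈const : ∀ x -> ⟦ x ⟧ℤ ≈ const x
  ⟦⟧≈const (+ 0) = sym const-0
  ⟦⟧≈const (+ 1) = sym const-1
  ⟦⟧≈const (+ suc (suc _)) = rfl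
  ⟦⟧≈const -[1+ _ ] = rfl

  hom : ℤraw -Raw-AlmostCommutative⟶ acr
  hom = record
   { ⟦_⟧ = ⟦_⟧ℤ
   ; +-homo = \x y -> trans (⟦⟧≈const (x +' y))(trans (const-+ x y)(sym (+-cong (⟦⟧≈const x)(⟦⟧≈const y))))
   ; *-homo = \x y -> trans (⟦⟧≈const (x *' y))(trans (const-* x y)(sym (*-cong (⟦⟧≈const x)(⟦⟧≈const y))))
   ; -‿homo = \x -> trans (⟦⟧≈const (-' x))(trans (const-- x)(sym (-‿cong (⟦⟧≈const x))))
   ; 0-homo = rfl
   ; 1-homo = rfl }

  coeff≟ : (x y : ℤ) -> Maybe (⟦ x ⟧ℤ ≈ ⟦ y ⟧ℤ)
  coeff≟ x y with x ℤP.≟ y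
  ... | yes refl = just rfl
  ... | no _ = nothing

 module Solver = Algebra.Solver.Ring ℤraw acr hom coeff≟
 open Solver public using (solve; con; _:=_; _:+_; _:*_; _:-_; :-_)

 :0 :1 : ∀ {n} -> Solver.Polynomial n
 :0 = con 0'
 :1 = con 1'

 -x≈1-x-1 : ∀ x -> - x ≈ 1# - x - 1#
 -x≈1-x-1 = solve 1 (\x -> :- x := :1 :- x :- :1) rfl
 x+[1-x]*1≈1 : ∀ x -> x + (1# - x) * 1# ≈ 1#
 x+[1-x]*1≈1 = solve 1 (\x -> x :+ (:1 :- x) :* :1 := :1) rfl
 [1-x]*y≈y-x*y : ∀ x y -> (1# - x) * y ≈ y - x * y
 [1-x]*y≈y-x*y = solve 2 (\x y -> (:1 :- x) :* y := y :- x :* y) rfl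
 -[[x-1]*y]≈y-x*y : ∀ x y -> - ((x - 1#) * y) ≈ y - x * y
 -[[x-1]*y]≈y-x*y = solve 2 (\x y -> :- ((x :- :1) :* y) := y :- x :* y) rfl
 x*[y*z]≈x*z*y : ∀ x y z -> x * (y * z) ≈ x * z * y
 x*[y*z]≈x*z*y = solve 3 (\x y z -> x :* (y :* z) := x :* z :* y) rfl
 x*[y*z]≈y*[x*z] : ∀ x y z -> x * (y * z) ≈ y * (x * z)
 x*[y*z]≈y*[x*z] = solve 3 (\x y z -> x :* (y :* z) := y :* (x :* z)) rfl
 x*[y*z]≈y*x*z : ∀ x y z -> x * (y * z) ≈ y * x * z
 x*[y*z]≈y*x*z = solve 3 (\x y z -> x :* (y :* z) := y :* x :* z) rfl
 x*[y*z]≈z*[x*y] : ∀ x y z -> x * (y * z) ≈ z * (x * y)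
 x*[y*z]≈z*[x*y] = solve 3 (\x y z -> x :* (y :* z) := z :* (x :* y)) rfl
 x*y*z≈x*z*y : ∀ x y z -> x * y * z ≈ x * z * y
 x*y*z≈x*z*y = solve 3 (\x y z -> x :* y :* z := x :* z :* y) rfl
 x*y*z≈z*y*x : ∀ x y z -> x * y * z ≈ z * y * x
 x*y*z≈z*y*x = solve 3 (\x y z -> x :* y :* z := z :* y :* x) rfl
 x*y-x*z≈x*[y-z] : ∀ x y z -> x * y - x * z ≈ x * (y - z)
 x*y-x*z≈x*[y-z] = solve 3 (\x y z -> x :* y :- x :* z := x :* (y :- z)) rfl
 x*z≈y*z+[x-y]*z : ∀ x y z -> x * z ≈ y * z + (x - y) * z
 x*z≈y*z+[x-y]*z = solve 3 (\x y z -> x :* z := y :* z :+ (x :- y) :* z) rfl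
 [x+y]+[z+u]≈[x+z]+[y+u] : ∀ x y z u -> (x + y) + (z + u) ≈ (x + z) + (y + u)
 [x+y]+[z+u]≈[x+z]+[y+u] = solve 4 (\x y z u -> (x :+ y) :+ (z :+ u) := (x :+ z) :+ (y :+ u)) rfl
 x*[y*z*u]≈y*u*[x*z] : ∀ x y z u -> x * (y * z * u) ≈ y * u * (x * z)
 x*[y*z*u]≈y*u*[x*z] = solve 4 (\x y z u -> x :* (y :* z :* u) := y :* u :* (x :* z)) rfl
 x*y*[z*u]≈[x*z]*[y*u] : ∀ x y z u -> x * y * (z * u) ≈ (x * z) * (y * u)
 x*y*[z*u]≈[x*z]*[y*u] = solve 4 (\x y z u -> x :* y :* (z :* u) := (x :* z) :* (y :* u)) rfl
 x*y*[z*u]≈x*z*[y*u] : ∀ x y z u -> x * y * (z * u) ≈ x * z * (y * u)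
 x*y*[z*u]≈x*z*[y*u] = solve 4 (\x y z u -> x :* y :* (z :* u) := x :* z :* (y :* u)) rfl
 x*y+u*[x*z]≈x*[y+u*z] : ∀ x y z u -> x * y + u * (x * z) ≈ x * (y + u * z)
 x*y+u*[x*z]≈x*[y+u*z] = solve 4 (\x y z u -> x :* y :+ u :* (x :* z) := x :* (y :+ u :* z)) rfl
 x*y+z*[x*u]≈x*[y+z*u] : ∀ x y z u -> x * y + z * (x * u) ≈ x * (y + z * u)
 x*y+z*[x*u]≈x*[y+z*u] = solve 4 (\x y z u -> x :* y :+ z :* (x :* u) := x :* (y :+ z :* u)) rfl
 x+y-[z+u]≈x-z+[y-u] : ∀ x y z u -> x + y - (z + u) ≈ x - z + (y - u)
 x+y-[z+u]≈x-z+[y-u] = solve 4 (\x y z u -> x :+ y :- (z :+ u) := x :- z :+ (y :- u)) rfl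
 z*[x*y+x*u]≈x*[z*[y+u]] : ∀ x y z u -> z * (x * y + x * u) ≈ x * (z * (y + u))
 z*[x*y+x*u]≈x*[z*[y+u]] = solve 4 (\x y z u -> z :* (x :* y :+ x :* u) := x :* (z :* (y :+ u))) rfl
 x*[y*z]+u*[y*v]≈y*[x*z+u*v] : ∀ x y z u v -> x * (y * z) + u * (y * v) ≈ y * (x * z + u * v)
 x*[y*z]+u*[y*v]≈y*[x*z+u*v] = solve 5 (\x y z u v -> x :* (y :* z) :+ u :* (y :* v) := y :* (x :* z :+ u :* v)) rfl
 x*y*[z*1+u*v]≈z*[x*1*y]+x*v*y*u : ∀ x y z u v -> x * y * (z * 1# + u * v) ≈ z * (x * 1# * y) + x * v * y * u
 x*y*[z*1+u*v]≈z*[x*1*y]+x*v*y*u = solve 5 (\x y z u v -> x :* y :* (z :* :1 :+ u :* v) := z :* (x :* :1 :* y) :+ x :* v :* y :* u) rfl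

 unit-cancel : ∀ {u v x y} -> v * u ≈ 1# -> u * x ≈ u * y -> x ≈ y
 unit-cancel {u} {v} {x} {y} vu p = begin
  x ≈⟨ sym (*-identityˡ x) ⟩
  _ ≈⟨ *ʳ (sym vu) ⟩
  _ ≈⟨ *-assoc v u x ⟩
  _ ≈⟨ *ˡ p ⟩
  _ ≈⟨ sym (*-assoc v u y) ⟩
  _ ≈⟨ *ʳ vu ⟩
  _ ≈⟨ *-identityˡ y ⟩
  y ∎

-- The ring of formal power series.

infix 4 _≋_
_≋_ : Series -> Series -> Set
f ≋ g = ∀ K -> f K ≡ g K

private
 tail : Series -> Series
 tail f K = f (suc K)

map-upTo-suc : ∀ {A : Set} (F : ℕ -> A) n -> map F (upTo (suc n)) ≡ F 0 ∷ map (F ∘ suc)(upTo n)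
map-upTo-suc F n = cong (F 0 ∷_)(≡.trans (ListP.map-applyUpTo suc F n)(≡.sym (ListP.map-upTo (F ∘ suc) n)))

⊛-suc : ∀ f g K -> (f ⊛ g)(suc K) ≡ f 0 *' g (suc K) +' (tail f ⊛ g) K
⊛-suc f g K = cong sumℤ (map-upTo-suc (\i -> f i *' g (suc K ∸ i))(suc K))

⊛-zero : ∀ f g -> (f ⊛ g) 0 ≡ f 0 *' g 0
⊛-zero f g = ℤP.+-identityʳ _

⊛-cong : ∀ {f f' g g'} -> f ≋ f' -> g ≋ g' -> f ⊛ g ≋ f' ⊛ g'
⊛-cong p q K = cong sumℤ (ListP.map-cong (\i -> cong₂ _*'_ (p i)(q (K ∸ i)))(upTo (suc K)))

scaleS : ℤ -> Series -> Series
scaleS c f K = c *' f K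

negS : Series -> Series
negS f K = -' f K

zeroS : Series
zeroS _ = 0'

tail-⊛ : ∀ f g -> tail (f ⊛ g) ≋ scaleS (f 0)(tail g) ⊕ (tail f ⊛ g)
tail-⊛ = ⊛-suc

⊛-distribʳ : ∀ h f g -> (f ⊕ g) ⊛ h ≋ (f ⊛ h) ⊕ (g ⊛ h)
⊛-distribʳ h f g zero = begin
 ((f ⊕ g) ⊛ h) 0 ≡⟨ ⊛-zero (f ⊕ g) h ⟩
 (f 0 +' g 0) *' h 0 ≡⟨ ℤP.*-distribʳ-+ (h 0)(f 0)(g 0) ⟩
 f 0 *' h 0 +' g 0 *' h 0 ≡⟨ cong₂ _+'_ (≡.sym (⊛-zero f h))(≡.sym (⊛-zero g h)) ⟩
 (f ⊛ h) 0 +' (g ⊛ h) 0 ∎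
 where open ≡-Reasoning
⊛-distribʳ h f g (suc K) = begin
 ((f ⊕ g) ⊛ h)(suc K)
  ≡⟨ ⊛-suc (f ⊕ g) h K ⟩
 (f 0 +' g 0) *' h (suc K) +' ((tail f ⊕ tail g) ⊛ h) K
  ≡⟨ cong (\u -> (f 0 +' g 0) *' h (suc K) +' u)(⊛-distribʳ h (tail f)(tail g) K) ⟩
 (f 0 +' g 0) *' h (suc K) +' ((tail f ⊛ h) K +' (tail g ⊛ h) K)
  ≡⟨ shuffle (f 0)(g 0)(h (suc K)) _ _ ⟩
 (f 0 *' h (suc K) +' (tail f ⊛ h) K) +' (g 0 *' h (suc K) +' (tail g ⊛ h) K)
  ≡⟨ cong₂ _+'_ (≡.sym (⊛-suc f h K))(≡.sym (⊛-suc g h K)) ⟩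
 (f ⊛ h)(suc K) +' (g ⊛ h)(suc K) ∎
 where
 open ≡-Reasoning
 shuffle : ∀ a b c d e -> (a +' b) *' c +' (d +' e) ≡ (a *' c +' d) +' (b *' c +' e)
 shuffle = ℤsolve

scaleS-⊛ : ∀ c f g -> scaleS c f ⊛ g ≋ scaleS c (f ⊛ g)
scaleS-⊛ c f g zero = ≡.trans (⊛-zero (scaleS c f) g)(≡.trans (ℤP.*-assoc c (f 0)(g 0))(cong (c *'_)(≡.sym (⊛-zero f g))))
scaleS-⊛ c f g (suc K) = begin
 (scaleS c f ⊛ g)(suc K) ≡⟨ ⊛-suc (scaleS c f) g K ⟩
 c *' f 0 *' g (suc K) +' (scaleS c (tail f) ⊛ g) K ≡⟨ cong (\u -> c *' f 0 *' g (suc K) +' u)(scaleS-⊛ c (tail f) g K) ⟩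
 c *' f 0 *' g (suc K) +' c *' (tail f ⊛ g) K ≡⟨ factor c (f 0)(g (suc K)) _ ⟩
 c *' (f 0 *' g (suc K) +' (tail f ⊛ g) K) ≡⟨ cong (c *'_)(≡.sym (⊛-suc f g K)) ⟩
 c *' (f ⊛ g)(suc K) ∎
 where
 open ≡-Reasoning
 factor : ∀ a b c d -> a *' b *' c +' a *' d ≡ a *' (b *' c +' d)
 factor = ℤsolve

⊛-assoc : ∀ f g h -> (f ⊛ g) ⊛ h ≋ f ⊛ (g ⊛ h)
⊛-assoc f g h zero = begin
 ((f ⊛ g) ⊛ h) 0 ≡⟨ ⊛-zero (f ⊛ g) h ⟩
 (f ⊛ g) 0 *' h 0 ≡⟨ cong (_*' h 0)(⊛-zero f g) ⟩
 f 0 *' g 0 *' h 0 ≡⟨ ℤP.*-assoc (f 0)(g 0)(h 0) ⟩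
 f 0 *' (g 0 *' h 0) ≡⟨ cong (f 0 *'_)(≡.sym (⊛-zero g h)) ⟩
 f 0 *' (g ⊛ h) 0 ≡⟨ ≡.sym (⊛-zero f (g ⊛ h)) ⟩
 (f ⊛ (g ⊛ h)) 0 ∎
 where open ≡-Reasoning
⊛-assoc f g h (suc K) = begin
 ((f ⊛ g) ⊛ h)(suc K)
  ≡⟨ ⊛-suc (f ⊛ g) h K ⟩
 (f ⊛ g) 0 *' h (suc K) +' (tail (f ⊛ g) ⊛ h) K
  ≡⟨ cong₂ (\u v -> u *' h (suc K) +' v)(⊛-zero f g)(⊛-cong {g = h} (tail-⊛ f g)(\_ -> refl) K) ⟩
 f 0 *' g 0 *' h (suc K) +' ((scaleS (f 0)(tail g) ⊕ (tail f ⊛ g)) ⊛ h) K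
  ≡⟨ cong (\u -> f 0 *' g 0 *' h (suc K) +' u)(⊛-distribʳ h (scaleS (f 0)(tail g))(tail f ⊛ g) K) ⟩
 f 0 *' g 0 *' h (suc K) +' ((scaleS (f 0)(tail g) ⊛ h) K +' ((tail f ⊛ g) ⊛ h) K)
  ≡⟨ cong₂ (\u v -> f 0 *' g 0 *' h (suc K) +' (u +' v))(scaleS-⊛ (f 0)(tail g) h K)(⊛-assoc (tail f) g h K) ⟩
 f 0 *' g 0 *' h (suc K) +' (f 0 *' (tail g ⊛ h) K +' (tail f ⊛ (g ⊛ h)) K)
  ≡⟨ regroup (f 0)(g 0)(h (suc K)) _ _ ⟩
 f 0 *' (g 0 *' h (suc K) +' (tail g ⊛ h) K) +' (tail f ⊛ (g ⊛ h)) K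
  ≡⟨ cong (\u -> f 0 *' u +' (tail f ⊛ (g ⊛ h)) K)(≡.sym (⊛-suc g h K)) ⟩
 f 0 *' (g ⊛ h)(suc K) +' (tail f ⊛ (g ⊛ h)) K
  ≡⟨ ≡.sym (⊛-suc f (g ⊛ h) K) ⟩
 (f ⊛ (g ⊛ h))(suc K) ∎
 where
 open ≡-Reasoning
 regroup : ∀ a b c d e -> a *' b *' c +' (a *' d +' e) ≡ a *' (b *' c +' d) +' e
 regroup = ℤsolve

-- Splits off the last term of the convolution where `⊛-suc` splits off the first; commutativity
-- follows by matching the two recursions.
⊛-suc' : ∀ f g K -> (f ⊛ g)(suc K) ≡ (f ⊛ tail g) K +' f (suc K) *' g 0
⊛-suc' f g zero = begin
 (f ⊛ g) 1 ≡⟨ ⊛-suc f g 0 ⟩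
 f 0 *' g 1 +' (tail f ⊛ g) 0 ≡⟨ cong₂ _+'_ (≡.sym (⊛-zero f (tail g)))(⊛-zero (tail f) g) ⟩
 (f ⊛ tail g) 0 +' f 1 *' g 0 ∎
 where open ≡-Reasoning
⊛-suc' f g (suc K) = begin
 (f ⊛ g)(suc (suc K))
  ≡⟨ ⊛-suc f g (suc K) ⟩
 f 0 *' g (suc (suc K)) +' (tail f ⊛ g)(suc K)
  ≡⟨ cong (\u -> f 0 *' g (suc (suc K)) +' u)(⊛-suc' (tail f) g K) ⟩
 f 0 *' g (suc (suc K)) +' ((tail f ⊛ tail g) K +' f (suc (suc K)) *' g 0)
  ≡⟨ ≡.sym (ℤP.+-assoc (f 0 *' g (suc (suc K))) _ _) ⟩
 f 0 *' g (suc (suc K)) +' (tail f ⊛ tail g) K +' f (suc (suc K)) *' g 0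
  ≡⟨ cong (_+' (f (suc (suc K)) *' g 0))(≡.sym (⊛-suc f (tail g) K)) ⟩
 (f ⊛ tail g)(suc K) +' f (suc (suc K)) *' g 0 ∎
 where open ≡-Reasoning

⊛-comm : ∀ f g -> f ⊛ g ≋ g ⊛ f
⊛-comm f g zero = ≡.trans (⊛-zero f g)(≡.trans (ℤP.*-comm (f 0)(g 0))(≡.sym (⊛-zero g f)))
⊛-comm f g (suc K) = begin
 (f ⊛ g)(suc K) ≡⟨ ⊛-suc f g K ⟩
 f 0 *' g (suc K) +' (tail f ⊛ g) K ≡⟨ cong₂ _+'_ (ℤP.*-comm (f 0)(g (suc K)))(⊛-comm (tail f) g K) ⟩
 g (suc K) *' f 0 +' (g ⊛ tail f) K ≡⟨ ℤP.+-comm (g (suc K) *' f 0)((g ⊛ tail f) K) ⟩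
 (g ⊛ tail f) K +' g (suc K) *' f 0 ≡⟨ ≡.sym (⊛-suc' g f K) ⟩
 (g ⊛ f)(suc K) ∎
 where open ≡-Reasoning

zeroS-⊛ : ∀ g -> zeroS ⊛ g ≋ zeroS
zeroS-⊛ g zero = ⊛-zero zeroS g
zeroS-⊛ g (suc K) = ≡.trans (⊛-suc zeroS g K)(cong (\u -> 0' *' g (suc K) +' u)(zeroS-⊛ g K))

constS : ℤ -> Series
constS c zero = c
constS c (suc _) = 0'

constS-⊛ : ∀ c g -> constS c ⊛ g ≋ scaleS c g
constS-⊛ c g zero = ⊛-zero (constS c) g
constS-⊛ c g (suc K) = ≡.trans (⊛-suc (constS c) g K)(≡.trans (cong (\u -> c *' g (suc K) +' u)(zeroS-⊛ g K))(ℤP.+-identityʳ _))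

oneS≋ : oneS ≋ constS 1'
oneS≋ zero = refl
oneS≋ (suc _) = refl

⊛-identityˡ : ∀ f -> oneS ⊛ f ≋ f
⊛-identityˡ f K = ≡.trans (⊛-cong {g = f} oneS≋ (\_ -> refl) K)(≡.trans (constS-⊛ 1' f K)(ℤP.*-identityˡ (f K)))

seriesRing : CommutativeRing 0ℓ 0ℓ
seriesRing = record
 { Carrier = Series ; _≈_ = _≋_ ; _+_ = _⊕_ ; _*_ = _⊛_ ; -_ = negS ; 0# = zeroS ; 1# = oneS
 ; isCommutativeRing = record
  { isRing = record
   { +-isAbelianGroup = record
    { isGroup = record
     { isMonoid = record
      { isSemigroup = record
       { isMagma = record
        { isEquivalence = record { refl = \_ -> refl ; sym = \p K -> ≡.sym (p K) ; trans = \p q K -> ≡.trans (p K)(q K) }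
        ; ∙-cong = \p q K -> cong₂ _+'_ (p K)(q K) }
       ; assoc = \f g h K -> ℤP.+-assoc (f K)(g K)(h K) }
      ; identity = (\f K -> ℤP.+-identityˡ (f K)) , (\f K -> ℤP.+-identityʳ (f K)) }
     ; inverse = (\f K -> ℤP.+-inverseˡ (f K)) , (\f K -> ℤP.+-inverseʳ (f K))
     ; ⁻¹-cong = \p K -> cong -'_ (p K) }
    ; comm = \f g K -> ℤP.+-comm (f K)(g K) }
   ; *-cong = ⊛-cong
   ; *-assoc = ⊛-assoc
   ; *-identity = ⊛-identityˡ , (\f K -> ≡.trans (⊛-comm f oneS K)(⊛-identityˡ f K))
   ; distrib = (\h f g K -> ≡.trans (⊛-comm h (f ⊕ g) K)
          (≡.trans (⊛-distribʳ h f g K)(cong₂ _+'_ (⊛-comm f h K)(⊛-comm g h K))))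
        , ⊛-distribʳ }
  ; *-comm = ⊛-comm } }

seriesAlgebra : ℤ-Algebra
seriesAlgebra = record
 { commRing = seriesRing
 ; const = constS
 ; const-+ = \ { x y zero -> refl ; x y (suc K) -> refl }
 ; const-* = \ { x y zero -> ≡.sym (constS-⊛ x (constS y) 0)
        ; x y (suc K) -> ≡.sym (≡.trans (constS-⊛ x (constS y)(suc K))(ℤP.*-zeroʳ x)) }
 ; const-- = \ { x zero -> refl ; x (suc K) -> refl }
 ; const-0 = \ { zero -> refl ; (suc K) -> refl }
 ; const-1 = \ { zero -> refl ; (suc K) -> refl } }

-- The table computed for the bound K agrees with the diagonal, which turns the bounded recursion
-- into a recursion for `invS` itself.
invCoeffs-stable : ∀ f K j -> j ≤ K -> invCoeffs f K j ≡ invS f j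
invCoeffs-stable f zero zero z≤n = refl
invCoeffs-stable f (suc K) j j≤ with ℕP.m≤n⇒m<n∨m≡n j≤
... | inj₂ refl = refl
... | inj₁ (s≤s j≤K) with j ≤ᵇ K in eq
... | true = invCoeffs-stable f K j j≤K
... | false = contradiction (subst T eq (ℕP.≤⇒≤ᵇ j≤K))(\())

invS-suc : ∀ f K -> invS f (suc K) ≡ -' (tail f ⊛ invS f) K
invS-suc f K with suc K ≤ᵇ K in eq
... | true = contradiction (ℕP.≤ᵇ⇒≤ (suc K) K (subst T (≡.sym eq) tt))(ℕP.<-irrefl refl)
... | false = cong (-'_ ∘ sumℤ)(ListP.map-cong-local (AllP.applyUpTo⁺₂ id (suc K)
        (\i -> cong (f (suc i) *'_)(invCoeffs-stable f K (K ∸ i)(ℕP.m∸n≤m K i)))))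

invS-inverseʳ : ∀ f -> f 0 ≡ 1' -> f ⊛ invS f ≋ oneS
invS-inverseʳ f f0 zero = ≡.trans (⊛-zero f (invS f))(cong (_*' 1') f0)
invS-inverseʳ f f0 (suc K) = begin
 (f ⊛ invS f)(suc K) ≡⟨ ⊛-suc f (invS f) K ⟩
 f 0 *' invS f (suc K) +' (tail f ⊛ invS f) K ≡⟨ cong₂ (\u v -> u *' v +' (tail f ⊛ invS f) K) f0 (invS-suc f K) ⟩
 1' *' (-' (tail f ⊛ invS f) K) +' (tail f ⊛ invS f) K ≡⟨ cancel ((tail f ⊛ invS f) K) ⟩
 0' ∎
 where
 open ≡-Reasoning
 cancel : ∀ a -> 1' *' (-' a) +' a ≡ 0'
 cancel = ℤsolve

X^ : ℕ -> Series
X^ = monoS 1'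

-- Multiplication by h^d in explicit form; with it, cancelling h^d is a matter of reading off
-- coefficients.
delay : ℕ -> Series -> Series
delay zero f K = f K
delay (suc d) f zero = 0'
delay (suc d) f (suc K) = delay d f K

X^-⊛ : ∀ d f -> X^ d ⊛ f ≋ delay d f
X^-⊛ zero f K = ≡.trans (⊛-cong {g = f} X0 (\_ -> refl) K)(⊛-identityˡ f K)
 where
 X0 : X^ 0 ≋ oneS
 X0 zero = refl
 X0 (suc _) = refl
X^-⊛ (suc d) f zero = ⊛-zero (X^ (suc d)) f
X^-⊛ (suc d) f (suc K) = ≡.trans (⊛-suc (X^ (suc d)) f K)(≡.trans (ℤP.+-identityˡ _)(X^-⊛ d f K))

X^-+ : ∀ d e -> X^ (d ℕ.+ e) ≋ X^ d ⊛ X^ e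
X^-+ d e K = ≡.trans (lemma d K)(≡.sym (X^-⊛ d (X^ e) K))
 where
 lemma : ∀ d K -> X^ (d ℕ.+ e) K ≡ delay d (X^ e) K
 lemma zero K = refl
 lemma (suc d) zero = refl
 lemma (suc d)(suc K) = lemma d K

delay-shift : ∀ d f K -> delay d f (d ℕ.+ K) ≡ f K
delay-shift zero f K = refl
delay-shift (suc d) f K = delay-shift d f K

delay-small : ∀ d f {K} -> K < d -> delay d f K ≡ 0'
delay-small (suc d) f {zero} _ = refl
delay-small (suc d) f {suc K} (s≤s K<d) = delay-small d f K<d

X^-cancel : ∀ d {f g} -> X^ d ⊛ f ≋ X^ d ⊛ g -> f ≋ g
X^-cancel d {f} {g} p K = begin
 f K ≡⟨ ≡.sym (delay-shift d f K) ⟩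
 delay d f (d ℕ.+ K) ≡⟨ ≡.sym (X^-⊛ d f (d ℕ.+ K)) ⟩
 (X^ d ⊛ f)(d ℕ.+ K) ≡⟨ p (d ℕ.+ K) ⟩
 (X^ d ⊛ g)(d ℕ.+ K) ≡⟨ X^-⊛ d g (d ℕ.+ K) ⟩
 delay d g (d ℕ.+ K) ≡⟨ delay-shift d g K ⟩
 g K ∎
 where open ≡-Reasoning

-- Laurent series in h, axiomatised.

-- `mono x` is h^x, `γ x` is 1/(1 - h^x) expanded as a power series whatever the sign of x, and
-- `Int` is the subring of power series. `halve` will remove the factor 2 that the determinants
-- carry. Laurent series stay abstract until the end.
record Frame : Set1 where
 field
  algebra : ℤ-Algebra
 open ℤ-Algebra algebra public
 field
  mono : ℤ -> Carrier
  mono-0 : mono 0' ≈ 1#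
  mono-+ : ∀ x y -> mono (x +' y) ≈ mono x * mono y
  γ : ℤ -> Carrier
  γ-inv : ∀ {x} -> x ≢ 0' -> γ x * (1# - mono x) ≈ 1#
  Int : Carrier -> Set
  Int-resp : ∀ {x y} -> x ≈ y -> Int x -> Int y
  Int-+ : ∀ {x y} -> Int x -> Int y -> Int (x + y)
  Int-* : ∀ {x y} -> Int x -> Int y -> Int (x * y)
  Int-- : ∀ {x} -> Int x -> Int (- x)
  Int-1 : Int 1#
  Int-mono : ∀ n -> Int (mono (+ n))
  Int-γ : ∀ {x} -> x ≢ 0' -> Int (γ x)
  halve : ∀ {x y} -> (1# + 1#) * x ≈ (1# + 1#) * y -> x ≈ y

-- Sums, products and congruences modulo powers of h.

module Core (𝓕 : Frame) where
 open Frame 𝓕 public using (mono; mono-0; mono-+; γ; γ-inv; Int; Int-resp; Int-+; Int-*; Int--; Int-1; Int-mono; Int-γ; halve)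
 open RingTools (Frame.algebra 𝓕) public

 ∑ ∏ : ∀ {A : Set} -> List A -> (A -> Carrier) -> Carrier
 ∑ xs F = foldr (\x s -> F x + s) 0# xs
 ∏ xs F = foldr (\x s -> F x * s) 1# xs

 module _ {A : Set} where
  ∑-congAll : ∀ {xs} {F G : A -> Carrier} -> All (\x -> F x ≈ G x) xs -> ∑ xs F ≈ ∑ xs G
  ∑-congAll [] = rfl
  ∑-congAll (p ∷ ps) = +-cong p (∑-congAll ps)

  ∑-cong : ∀ xs {F G : A -> Carrier} -> (∀ x -> F x ≈ G x) -> ∑ xs F ≈ ∑ xs G
  ∑-cong xs p = ∑-congAll (All.universal p xs)

  ∏-congAll : ∀ {xs} {F G : A -> Carrier} -> All (\x -> F x ≈ G x) xs -> ∏ xs F ≈ ∏ xs G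
  ∏-congAll [] = rfl
  ∏-congAll (p ∷ ps) = *-cong p (∏-congAll ps)

  ∏-cong : ∀ xs {F G : A -> Carrier} -> (∀ x -> F x ≈ G x) -> ∏ xs F ≈ ∏ xs G
  ∏-cong xs p = ∏-congAll (All.universal p xs)

  ∑-0 : ∀ xs -> ∑ xs (\(_ : A) -> 0#) ≈ 0#
  ∑-0 [] = rfl
  ∑-0 (x ∷ xs) = trans (+-identityˡ _)(∑-0 xs)

  ∑-zero : ∀ xs {F : A -> Carrier} -> (∀ x -> F x ≈ 0#) -> ∑ xs F ≈ 0#
  ∑-zero xs p = trans (∑-cong xs p)(∑-0 xs)

  ∑-+ : ∀ xs (F G : A -> Carrier) -> ∑ xs (\x -> F x + G x) ≈ ∑ xs F + ∑ xs G
  ∑-+ [] F G = sym (+-identityˡ 0#)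
  ∑-+ (x ∷ xs) F G = trans (+ˡ (∑-+ xs F G))
   ([x+y]+[z+u]≈[x+z]+[y+u] (F x)(G x)(∑ xs F)(∑ xs G))

  ∑-*ˡ : ∀ a xs (F : A -> Carrier) -> ∑ xs (\x -> a * F x) ≈ a * ∑ xs F
  ∑-*ˡ a [] F = sym (zeroʳ a)
  ∑-*ˡ a (x ∷ xs) F = trans (+ˡ (∑-*ˡ a xs F))(sym (distribˡ a (F x)(∑ xs F)))

  ∑-*ʳ : ∀ a xs (F : A -> Carrier) -> ∑ xs (\x -> F x * a) ≈ ∑ xs F * a
  ∑-*ʳ a xs F = trans (∑-cong xs (\x -> *-comm (F x) a))(trans (∑-*ˡ a xs F)(*-comm a _))

  ∑-neg : ∀ xs (F : A -> Carrier) -> ∑ xs (\x -> - F x) ≈ - ∑ xs F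
  ∑-neg [] F = sym -0#≈0#
  ∑-neg (x ∷ xs) F = trans (+ˡ (∑-neg xs F))(-‿+-comm _ _)

  ∑-++ : ∀ xs ys (F : A -> Carrier) -> ∑ (xs ++ ys) F ≈ ∑ xs F + ∑ ys F
  ∑-++ [] ys F = sym (+-identityˡ _)
  ∑-++ (x ∷ xs) ys F = trans (+ˡ (∑-++ xs ys F))(sym (+-assoc _ _ _))

  ∏-++ : ∀ xs ys (F : A -> Carrier) -> ∏ (xs ++ ys) F ≈ ∏ xs F * ∏ ys F
  ∏-++ [] ys F = sym (*-identityˡ _)
  ∏-++ (x ∷ xs) ys F = trans (*ˡ (∏-++ xs ys F))(sym (*-assoc _ _ _))

  ∏-* : ∀ xs (F G : A -> Carrier) -> ∏ xs (\x -> F x * G x) ≈ ∏ xs F * ∏ xs G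
  ∏-* [] F G = sym (*-identityˡ 1#)
  ∏-* (x ∷ xs) F G = trans (*ˡ (∏-* xs F G))
   (solve 4 (\a b c d -> (a :* b) :* (c :* d) := (a :* c) :* (b :* d)) rfl (F x)(G x)(∏ xs F)(∏ xs G))

  ∏-1 : ∀ xs -> ∏ xs (\(_ : A) -> 1#) ≈ 1#
  ∏-1 [] = rfl
  ∏-1 (x ∷ xs) = trans (*-identityˡ _)(∏-1 xs)

  ∏-↭ : ∀ {xs ys} (F : A -> Carrier) -> xs ↭ ys -> ∏ xs F ≈ ∏ ys F
  ∏-↭ F Perm.refl = rfl
  ∏-↭ F (prep x p) = *ˡ (∏-↭ F p)
  ∏-↭ F (swap {xs} {ys} x y p) = trans (*ˡ (*ˡ (∏-↭ F p)))
   (x*[y*z]≈y*[x*z] (F x)(F y)(∏ ys F))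
  ∏-↭ F (Perm.trans p q) = trans (∏-↭ F p)(∏-↭ F q)

 module _ {A B : Set} where
  ∑-map : ∀ (f : A -> B) xs (F : B -> Carrier) -> ∑ (map f xs) F ≈ ∑ xs (F ∘ f)
  ∑-map f [] F = rfl
  ∑-map f (x ∷ xs) F = +ˡ (∑-map f xs F)

  ∏-map : ∀ (f : A -> B) xs (F : B -> Carrier) -> ∏ (map f xs) F ≈ ∏ xs (F ∘ f)
  ∏-map f [] F = rfl
  ∏-map f (x ∷ xs) F = *ˡ (∏-map f xs F)

  ∑-swap : ∀ xs ys (F : A -> B -> Carrier) -> ∑ xs (\x -> ∑ ys (F x)) ≈ ∑ ys (\y -> ∑ xs (\x -> F x y))
  ∑-swap [] ys F = sym (∑-0 ys)
  ∑-swap (x ∷ xs) ys F = trans (+ˡ (∑-swap xs ys F))(sym (∑-+ ys (F x) _))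

  ∑-concatMap : ∀ (f : A -> List B) xs (F : B -> Carrier) -> ∑ (concatMap f xs) F ≈ ∑ xs (\x -> ∑ (f x) F)
  ∑-concatMap f [] F = rfl
  ∑-concatMap f (x ∷ xs) F = trans (∑-++ (f x)(concatMap f xs) F)(+ˡ (∑-concatMap f xs F))

  ∏-swap : ∀ xs ys (F : A -> B -> Carrier) -> ∏ xs (\x -> ∏ ys (F x)) ≈ ∏ ys (\y -> ∏ xs (\x -> F x y))
  ∏-swap [] ys F = sym (∏-1 ys)
  ∏-swap (x ∷ xs) ys F = trans (*ˡ (∏-swap xs ys F))(sym (∏-* ys (F x) _))

 ∑-upTo-suc : ∀ n (F : ℕ -> Carrier) -> ∑ (upTo (suc n)) F ≈ F 0 + ∑ (upTo n)(F ∘ suc)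
 ∑-upTo-suc n F = +ˡ (trans (reflexive (cong (\l -> ∑ l F)(≡.sym (ListP.map-upTo suc n))))(∑-map suc (upTo n) F))

 ∏-upTo-suc : ∀ n (F : ℕ -> Carrier) -> ∏ (upTo (suc n)) F ≈ F 0 * ∏ (upTo n)(F ∘ suc)
 ∏-upTo-suc n F = *ˡ (trans (reflexive (cong (\l -> ∏ l F)(≡.sym (ListP.map-upTo suc n))))(∏-map suc (upTo n) F))

 ∏-upTo-last : ∀ n (F : ℕ -> Carrier) -> ∏ (upTo (suc n)) F ≈ ∏ (upTo n) F * F n
 ∏-upTo-last n F = trans (reflexive (cong (\l -> ∏ l F)(≡.sym (ListP.upTo-∷ʳ n))))
  (trans (∏-++ (upTo n) _ F)(*ˡ (*-identityʳ (F n))))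

 ∑-upTo-last : ∀ n (F : ℕ -> Carrier) -> ∑ (upTo (suc n)) F ≈ ∑ (upTo n) F + F n
 ∑-upTo-last n F = trans (reflexive (cong (\l -> ∑ l F)(≡.sym (ListP.upTo-∷ʳ n))))
  (trans (∑-++ (upTo n) _ F)(+ˡ (+-identityʳ (F n))))

 mono-cong : ∀ {x y} -> x ≡ y -> mono x ≈ mono y
 mono-cong p = reflexive (cong mono p)

 γ-cong : ∀ {x y} -> x ≡ y -> γ x ≈ γ y
 γ-cong p = reflexive (cong γ p)

 mono-inv : ∀ x -> mono (-' x) * mono x ≈ 1#
 mono-inv x = trans (sym (mono-+ (-' x) x))(trans (mono-cong (ℤP.+-inverseˡ x)) mono-0)

 one-minus : ∀ {x} -> x ≢ 0' -> (1# - mono x) * γ x ≈ 1#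
 one-minus x≢0 = trans (*-comm _ _)(γ-inv x≢0)

 mono-γ : ∀ {x} -> x ≢ 0' -> mono x * γ x ≈ γ x - 1#
 mono-γ {x} x≢0 = begin
  mono x * γ x ≈⟨ solve 2 (\m g -> m :* g := g :- g :* (:1 :- m)) rfl (mono x)(γ x) ⟩
  _ ≈⟨ +ˡ (-‿cong (γ-inv x≢0)) ⟩
  γ x - 1# ∎

 neg≢0 : ∀ {x} -> x ≢ 0' -> -' x ≢ 0'
 neg≢0 {x} p q = p (≡.trans (≡.sym (ℤP.neg-involutive x))(cong -'_ q))

 γ-neg : ∀ {x} -> x ≢ 0' -> γ (-' x) ≈ 1# - γ x
 γ-neg {x} x≢0 = unit-cancel {u = 1# - n} (γ-inv (neg≢0 x≢0))(begin
  (1# - n) * γ (-' x) ≈⟨ one-minus (neg≢0 x≢0) ⟩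
  _ ≈⟨ solve 1 (\n -> :1 := :1 :- n :+ n :* :1) rfl n ⟩
  _ ≈⟨ +ˡ (*ˡ (sym (one-minus x≢0))) ⟩
  _ ≈⟨ solve 3 (\n m g -> :1 :- n :+ n :* ((:1 :- m) :* g) := :1 :- n :+ n :* g :- (n :* m) :* g) rfl n m g ⟩
  _ ≈⟨ +ˡ (-‿cong (*ʳ (mono-inv x))) ⟩
  _ ≈⟨ solve 2 (\n g -> :1 :- n :+ n :* g :- :1 :* g := (:1 :- n) :* (:1 :- g)) rfl n g ⟩
  (1# - n) * (1# - g) ∎)
  where
  m = mono x
  n = mono (-' x)
  g = γ x

 -- With X = h^x and Y = h^y: 1/((1-X)(1-Y)) = 1/((1-Y/X)(1-X)) + 1/((1-X/Y)(1-Y)). Every pole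
 -- expansion below rests on this.
 γ-mul : ∀ {x y} -> x ≢ 0' -> y ≢ 0' -> y -' x ≢ 0' -> γ x * γ y ≈ γ (y -' x) * γ x + γ (x -' y) * γ y
 γ-mul {x} {y} x≢0 y≢0 d≢0 = sym (begin
  gd * gx + γ (x -' y) * gy ≈⟨ +ˡ (*ʳ (trans (γ-cong (flip x y))(γ-neg d≢0))) ⟩
  _ ≈⟨ solve 3 (\d a b -> d :* a :+ (:1 :- d) :* b := b :+ d :* (a :* :1 :- b :* :1)) rfl gd gx gy ⟩
  _ ≈⟨ +ˡ (*ˡ (+-cong (*ˡ (sym (one-minus y≢0)))(-‿cong (*ˡ (sym (one-minus x≢0)))))) ⟩
  _
   ≈⟨ +ˡ (*ˡ (+ʳ (*ˡ (*ʳ (+ˡ (-‿cong my≈)))))) ⟩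
  _
   ≈⟨ solve 5 (\d a b x e -> b :+ d :* (a :* ((:1 :- e :* x) :* b) :- b :* ((:1 :- x) :* a)) := b :+ d :* (:1 :- e) :* (x :* a) :* b) rfl gd gx gy mx md ⟩
  _ ≈⟨ +ˡ (*ʳ (*-cong (γ-inv d≢0)(mono-γ x≢0))) ⟩
  _ ≈⟨ solve 2 (\a b -> b :+ :1 :* (a :- :1) :* b := a :* b) rfl gx gy ⟩
  gx * gy ∎)
  where
  gx = γ x
  gy = γ y
  gd = γ (y -' x)
  mx = mono x
  my = mono y
  md = mono (y -' x)
  flip : ∀ x y -> x -' y ≡ -' (y -' x)
  flip = ℤsolve
  back : ∀ x y -> y ≡ y -' x +' x
  back = ℤsolve
  my≈ : my ≈ md * mx
  my≈ = trans (mono-cong (back x y))(mono-+ (y -' x) x)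

 Int-0 : Int 0#
 Int-0 = Int-resp (-‿inverseʳ 1#)(Int-+ Int-1 (Int-- Int-1))

 -- Divisibility by h^K inside the power series, so that multiplication by integral elements
 -- preserves it, but multiplication by negative powers of h does not.
 Small : ℕ -> Carrier -> Set
 Small K x = ∃ \y -> Int y × x ≈ mono (+ K) * y

 Small-resp : ∀ {K x y} -> x ≈ y -> Small K x -> Small K y
 Small-resp p (z , iz , q) = z , iz , trans (sym p) q

 Small-0 : ∀ {K} -> Small K 0#
 Small-0 = 0# , Int-0 , sym (zeroʳ _)

 Small-+ : ∀ {K x y} -> Small K x -> Small K y -> Small K (x + y)
 Small-+ (u , iu , p)(v , iv , q) = u + v , Int-+ iu iv , trans (+-cong p q)(sym (distribˡ _ u v))

 Small-neg : ∀ {K x} -> Small K x -> Small K (- x)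
 Small-neg (u , iu , p) = - u , Int-- iu , trans (-‿cong p)(-‿distribʳ-* _ u)

 Small-*Int : ∀ {K x y} -> Small K x -> Int y -> Small K (x * y)
 Small-*Int {y = y} (u , iu , p) iy = u * y , Int-* iu iy , trans (*ʳ p)(*-assoc _ u y)

 Int-*Small : ∀ {K x y} -> Int x -> Small K y -> Small K (x * y)
 Int-*Small ix sy = Small-resp (*-comm _ _)(Small-*Int sy ix)

 Small-mono : ∀ {K} n -> K ≤ n -> Small K (mono (+ n))
 Small-mono {K} n K≤n = mono (+ (n ∸ K)) , Int-mono (n ∸ K) ,
  trans (mono-cong (cong +_ (≡.sym (ℕP.m+[n∸m]≡n K≤n))))(mono-+ (+ K)(+ (n ∸ K)))

 Small-* : ∀ {K L x y} -> Small K x -> Small L y -> Small (K ℕ.+ L)(x * y)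
 Small-* {K} {L} (u , iu , p)(v , iv , q) = u * v , Int-* iu iv , (begin
  _ ≈⟨ *-cong p q ⟩
  _ ≈⟨ x*y*[z*u]≈[x*z]*[y*u] (mono (+ K)) u (mono (+ L)) v ⟩
  _ ≈⟨ *ʳ (sym (mono-+ (+ K)(+ L))) ⟩
  mono (+ (K ℕ.+ L)) * (u * v) ∎)

 Small-≤ : ∀ {K L x} -> K ≤ L -> Small L x -> Small K x
 Small-≤ K≤L (u , iu , p) = Small-resp (sym p)(Small-*Int (Small-mono _ K≤L) iu)

 Small⇒Int : ∀ {K x} -> Small K x -> Int x
 Small⇒Int (u , iu , p) = Int-resp (sym p)(Int-* (Int-mono _) iu)

 Int⇒Small : ∀ {x} -> Int x -> Small 0 x
 Int⇒Small ix = _ , ix , sym (trans (*ʳ mono-0)(*-identityˡ _))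

 infix 4 _≡[_]_
 record _≡[_]_ (x : Carrier)(K : ℕ)(y : Carrier) : Set where
  constructor cgr
  field small : Small K (x - y)
 open _≡[_]_ public

 ≡[]-reflexive : ∀ {K x y} -> x ≈ y -> x ≡[ K ] y
 ≡[]-reflexive p = cgr (Small-resp (sym (trans (+ʳ p)(-‿inverseʳ _))) Small-0)

 ≡[]-sym : ∀ {K x y} -> x ≡[ K ] y -> y ≡[ K ] x
 ≡[]-sym {x = x} {y} (cgr s) = cgr (Small-resp (solve 2 (\x y -> :- (x :- y) := y :- x) rfl x y)(Small-neg s))

 ≡[]-trans : ∀ {K x y z} -> x ≡[ K ] y -> y ≡[ K ] z -> x ≡[ K ] z
 ≡[]-trans {x = x} {y} {z} (cgr s)(cgr r) = cgr (Small-resp (solve 3 (\x y z -> (x :- y) :+ (y :- z) := x :- z) rfl x y z)(Small-+ s r))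

 ≡[]-+ : ∀ {K x y u v} -> x ≡[ K ] y -> u ≡[ K ] v -> x + u ≡[ K ] y + v
 ≡[]-+ {x = x} {y} {u} {v} (cgr s)(cgr r) = cgr (Small-resp (solve 4 (\x y u v -> (x :- y) :+ (u :- v) := x :+ u :- (y :+ v)) rfl x y u v)(Small-+ s r))

 ≡[]-*ʳ : ∀ {K x y z} -> Int z -> x ≡[ K ] y -> x * z ≡[ K ] y * z
 ≡[]-*ʳ {x = x} {y} {z} iz (cgr s) = cgr (Small-resp (solve 3 (\x y z -> (x :- y) :* z := x :* z :- y :* z) rfl x y z)(Small-*Int s iz))

 ≡[]-*ˡ : ∀ {K x y z} -> Int z -> x ≡[ K ] y -> z * x ≡[ K ] z * y
 ≡[]-*ˡ iz p = ≡[]-trans (≡[]-reflexive (*-comm _ _))(≡[]-trans (≡[]-*ʳ iz p)(≡[]-reflexive (*-comm _ _)))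

 ≡[]-* : ∀ {K x y u v} -> Int u -> Int y -> x ≡[ K ] y -> u ≡[ K ] v -> x * u ≡[ K ] y * v
 ≡[]-* iu iy p q = ≡[]-trans (≡[]-*ʳ iu p)(≡[]-*ˡ iy q)

 ≡[]-∑ : ∀ {K} {A : Set} {xs : List A} {F G : A -> Carrier} -> All (\x -> F x ≡[ K ] G x) xs -> ∑ xs F ≡[ K ] ∑ xs G
 ≡[]-∑ [] = ≡[]-reflexive rfl
 ≡[]-∑ (p ∷ ps) = ≡[]-+ p (≡[]-∑ ps)

 Small⇒≡[]0 : ∀ {K x} -> Small K x -> x ≡[ K ] 0#
 Small⇒≡[]0 {x = x} s = cgr (Small-resp (solve 1 (\x -> x := x :- :0) rfl x) s)

 Int-∏ : ∀ {A : Set} {xs : List A} {F : A -> Carrier} -> All (\x -> Int (F x)) xs -> Int (∏ xs F)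
 Int-∏ [] = Int-1
 Int-∏ (p ∷ ps) = Int-* p (Int-∏ ps)

 Int-∑ : ∀ {A : Set} {xs : List A} {F : A -> Carrier} -> All (\x -> Int (F x)) xs -> Int (∑ xs F)
 Int-∑ [] = Int-0
 Int-∑ (p ∷ ps) = Int-+ p (Int-∑ ps)

-- Choosing an element of a list, splitting a list in two, and admissible alphabets.

module _ {A : Set} where
 -- `Sel x xs ys`: taking x out of ys leaves xs. The order is kept, and equal elements at different
 -- places count as different choices.
 data Sel : A -> List A -> List A -> Set where
  here : ∀ {x xs} -> Sel x xs (x ∷ xs)
  there : ∀ {x y xs ys} -> Sel y ys xs -> Sel y (x ∷ ys)(x ∷ xs)

 -- `Spl I J Y`: Y is an interleaving of I and J, that is, a subset I together with its complement
 -- J.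
 data Spl : List A -> List A -> List A -> Set where
  nil : Spl [] [] []
  left : ∀ {y I J Y} -> Spl I J Y -> Spl (y ∷ I) J (y ∷ Y)
  right : ∀ {y I J Y} -> Spl I J Y -> Spl I (y ∷ J)(y ∷ Y)

 sels : List A -> List (A × List A)
 sels [] = []
 sels (x ∷ xs) = (x , xs) ∷ map (\p -> proj₁ p , x ∷ proj₂ p)(sels xs)

 splits : List A -> List (List A × List A)
 splits [] = ([] , []) ∷ []
 splits (y ∷ Y) = map (\p -> y ∷ proj₁ p , proj₂ p)(splits Y) ++ map (\p -> proj₁ p , y ∷ proj₂ p)(splits Y)

 sels-Sel : ∀ xs -> All (\p -> Sel (proj₁ p)(proj₂ p) xs)(sels xs)
 sels-Sel [] = []
 sels-Sel (x ∷ xs) = here ∷ AllP.map⁺ (All.map there (sels-Sel xs))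

 splits-Spl : ∀ Y -> All (\p -> Spl (proj₁ p)(proj₂ p) Y)(splits Y)
 splits-Spl [] = nil ∷ []
 splits-Spl (y ∷ Y) = AllP.++⁺ (AllP.map⁺ (All.map left (splits-Spl Y)))(AllP.map⁺ (All.map right (splits-Spl Y)))

 Sel-↭ : ∀ {x xs ys} -> Sel x xs ys -> x ∷ xs ↭ ys
 Sel-↭ here = ↭-refl
 Sel-↭ (there p) = Perm.trans (swap _ _ ↭-refl)(prep _ (Sel-↭ p))

 Spl-↭ : ∀ {I J Y} -> Spl I J Y -> I ++ J ↭ Y
 Spl-↭ nil = ↭-refl
 Spl-↭ (left p) = prep _ (Spl-↭ p)
 Spl-↭ (right {y} {I} {J} p) = Perm.trans (PermP.shift y I J)(prep y (Spl-↭ p))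

 Sel-length : ∀ {x xs ys} -> Sel x xs ys -> length ys ≡ suc (length xs)
 Sel-length here = refl
 Sel-length (there p) = cong suc (Sel-length p)

 Spl-length : ∀ {I J Y} -> Spl I J Y -> length I ℕ.+ length J ≡ length Y
 Spl-length nil = refl
 Spl-length (left p) = cong suc (Spl-length p)
 Spl-length (right {I = I} {J} p) = ≡.trans (ℕP.+-suc (length I)(length J))(cong suc (Spl-length p))

 AllPairs-↭ : ∀ {R : A -> A -> Set} -> (∀ {x y} -> R x y -> R y x) -> ∀ {xs ys} -> xs ↭ ys -> AllPairs R xs -> AllPairs R ys
 AllPairs-↭ s Perm.refl ps = ps
 AllPairs-↭ s (prep x p)(q ∷ ps) = PermP.All-resp-↭ p q ∷ AllPairs-↭ s p ps
 AllPairs-↭ s (swap x y p)((qx ∷ q) ∷ r ∷ ps) =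
  (s qx ∷ PermP.All-resp-↭ p r) ∷ PermP.All-resp-↭ p q ∷ AllPairs-↭ s p ps
 AllPairs-↭ s (Perm.trans p q) ps = AllPairs-↭ s q (AllPairs-↭ s p ps)

neg : List ℤ -> List ℤ
neg = map (\x -> -' x)

-- Nonzero integers with distinct absolute values: then no exponent x ± y occurring below vanishes.
Good : List ℤ -> Set
Good Y = AllPairs _≢_ (0 ∷ map ∣_∣ Y)

Good-↭ : ∀ {X Y} -> X ↭ Y -> Good X -> Good Y
Good-↭ p = AllPairs-↭ (\ne eq -> ne (≡.sym eq))(prep 0 (PermP.map⁺ ∣_∣ p))

Good-tail : ∀ {y Y} -> Good (y ∷ Y) -> Good Y
Good-tail ((_ ∷ p) ∷ _ ∷ q) = p ∷ q

Good-++ʳ : ∀ X {Y} -> Good (X ++ Y) -> Good Y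
Good-++ʳ [] g = g
Good-++ʳ (x ∷ X) g = Good-++ʳ X (Good-tail {x} g)

Good-Spl : ∀ {I J Y} -> Spl I J Y -> Good Y -> Good I × Good J
Good-Spl {I} {J} s g = Good-++ʳ J (Good-↭ (PermP.++-comm I J) g') , Good-++ʳ I g'
 where g' = Good-↭ (↭-sym (Spl-↭ s)) g

map-abs-neg : ∀ J -> map ∣_∣ (neg J) ≡ map ∣_∣ J
map-abs-neg J = ≡.trans (≡.sym (ListP.map-∘ J))(ListP.map-cong ℤP.∣-i∣≡∣i∣ J)

-- Only absolute values enter `Good`, so it survives changes of sign.
Good-signs : ∀ {I J Y} -> Spl J I Y -> Good Y -> Good (neg J ++ I)
Good-signs {I} {J} s g = subst (\l -> AllPairs _≢_ (0 ∷ l)) eq (Good-↭ (↭-sym (Spl-↭ s)) g)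
 where
 eq : map ∣_∣ (J ++ I) ≡ map ∣_∣ (neg J ++ I)
 eq = ≡.trans (ListP.map-++ ∣_∣ J I)(≡.trans (cong (_++ map ∣_∣ I)(≡.sym (map-abs-neg J)))(≡.sym (ListP.map-++ ∣_∣ (neg J) I)))

Good⇒≢0 : ∀ {y Y} -> Good (y ∷ Y) -> y ≢ 0'
Good⇒≢0 ((p ∷ _) ∷ _) refl = p refl

abs≢⇒+≢0 : ∀ x y -> ∣ x ∣ ≢ ∣ y ∣ -> x +' y ≢ 0'
abs≢⇒+≢0 x y ne eq = ne (≡.trans (cong ∣_∣ (≡.trans (lem x y)(≡.trans (cong (_+' (-' y)) eq)(ℤP.+-identityˡ (-' y)))))(ℤP.∣-i∣≡∣i∣ y))
 where
 lem : ∀ x y -> x ≡ x +' y +' (-' y)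
 lem = ℤsolve

-- Sums over splittings, and expansion in partial fractions.

module Sums (𝓕 : Frame) where
 open Core 𝓕 public

 module _ {A : Set} where
  Σs : List A -> (List A -> List A -> Carrier) -> Carrier
  Σs Y F = ∑ (splits Y)(\p -> F (proj₁ p)(proj₂ p))

  Σl : List A -> (A -> List A -> Carrier) -> Carrier
  Σl xs F = ∑ (sels xs)(\p -> F (proj₁ p)(proj₂ p))

  Σs-cong : ∀ Y {F G} -> (∀ {I J} -> Spl I J Y -> F I J ≈ G I J) -> Σs Y F ≈ Σs Y G
  Σs-cong Y p = ∑-congAll (All.map p (splits-Spl Y))

  Σl-cong : ∀ xs {F G} -> (∀ {x ys} -> Sel x ys xs -> F x ys ≈ G x ys) -> Σl xs F ≈ Σl xs G
  Σl-cong xs p = ∑-congAll (All.map p (sels-Sel xs))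

  Σs-[] : ∀ F -> Σs [] F ≈ F [] []
  Σs-[] F = +-identityʳ _

  Σs-∷ : ∀ y Y F -> Σs (y ∷ Y) F ≈ Σs Y (\I J -> F (y ∷ I) J) + Σs Y (\I J -> F I (y ∷ J))
  Σs-∷ y Y F = trans (∑-++ (map _ (splits Y)) _ _)(+-cong (∑-map _ (splits Y) _)(∑-map _ (splits Y) _))

  Σl-∷ : ∀ x xs F -> Σl (x ∷ xs) F ≈ F x xs + Σl xs (\y ys -> F y (x ∷ ys))
  Σl-∷ x xs F = +ˡ (∑-map _ (sels xs) _)

  Σl-++ : ∀ xs ys F -> Σl (xs ++ ys) F ≈ Σl xs (\x xs' -> F x (xs' ++ ys)) + Σl ys (\y ys' -> F y (xs ++ ys'))
  Σl-++ [] ys F = sym (+-identityˡ _)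
  Σl-++ (x ∷ xs) ys F = begin
   Σl (x ∷ xs ++ ys) F ≈⟨ Σl-∷ x (xs ++ ys) F ⟩
   _ ≈⟨ +ˡ (Σl-++ xs ys _) ⟩
   _ ≈⟨ sym (+-assoc _ _ _) ⟩
   _ ≈⟨ +ʳ (sym (Σl-∷ x xs (\z zs -> F z (zs ++ ys)))) ⟩
   _ ∎

  -- Choosing a subset and then one of its elements amounts to choosing the element first and
  -- splitting what is left.
  Σs-Σl-left : ∀ Y (F : A -> List A -> List A -> Carrier) ->
   Σs Y (\I J -> Σl I (\x I0 -> F x I0 J)) ≈ Σl Y (\x Y0 -> Σs Y0 (F x))
  Σs-Σl-left [] F = +-identityʳ 0#
  Σs-Σl-left (y ∷ Y) F = begin
   Σs (y ∷ Y)(\I J -> Σl I (\x I0 -> F x I0 J))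
    ≈⟨ Σs-∷ y Y _ ⟩
   _
    ≈⟨ +-cong (trans (Σs-cong Y (\ {I} {J} _ -> Σl-∷ y I (\x I0 -> F x I0 J)))(∑-+ (splits Y) _ _))(Σs-Σl-left Y (\x I J -> F x I (y ∷ J))) ⟩
   _
    ≈⟨ +ʳ (+ˡ (Σs-Σl-left Y (\x I J -> F x (y ∷ I) J))) ⟩
   _
    ≈⟨ trans (+-assoc _ _ _)(+ˡ (sym (∑-+ (sels Y) _ _))) ⟩
   _
    ≈⟨ +ˡ (Σl-cong Y (\ {x} {Y0} _ -> sym (Σs-∷ y Y0 (F x)))) ⟩
   _
    ≈⟨ sym (Σl-∷ y Y (\x Y0 -> Σs Y0 (F x))) ⟩
   Σl (y ∷ Y)(\x Y0 -> Σs Y0 (F x)) ∎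

  Σs-flip : ∀ Y F -> Σs Y F ≈ Σs Y (\I J -> F J I)
  Σs-flip [] F = rfl
  Σs-flip (y ∷ Y) F = begin
   Σs (y ∷ Y) F ≈⟨ Σs-∷ y Y F ⟩
   _ ≈⟨ +-comm _ _ ⟩
   _ ≈⟨ +-cong (Σs-flip Y _)(Σs-flip Y _) ⟩
   _ ≈⟨ sym (Σs-∷ y Y (\I J -> F J I)) ⟩
   Σs (y ∷ Y)(\I J -> F J I) ∎

  Σs-Σl-right : ∀ Y (F : A -> List A -> List A -> Carrier) ->
   Σs Y (\I J -> Σl J (\x J0 -> F x I J0)) ≈ Σl Y (\x Y0 -> Σs Y0 (F x))
  Σs-Σl-right Y F = trans (Σs-flip Y _)(trans (Σs-Σl-left Y (\x J I -> F x I J))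
   (Σl-cong Y (\ {x} {Y0} _ -> Σs-flip Y0 (\J I -> F x I J))))

  -- Both sides run over the ways to cut Y into three; associativity of `⋆` will rest on this.
  Σs-assoc : ∀ Y (F : List A -> List A -> List A -> Carrier) ->
   Σs Y (\X J -> Σs X (\I1 I2 -> F I1 I2 J)) ≈ Σs Y (\I X -> Σs X (F I))
  Σs-assoc [] F = rfl
  Σs-assoc (y ∷ Y) F = begin
   Σs (y ∷ Y)(\X J -> Σs X (\I1 I2 -> F I1 I2 J))
    ≈⟨ Σs-∷ y Y _ ⟩
   _
    ≈⟨ +ʳ (trans (Σs-cong Y (\ {X} {J} _ -> Σs-∷ y X (\I1 I2 -> F I1 I2 J)))(∑-+ (splits Y) _ _)) ⟩
   _
    ≈⟨ +-cong (+-cong (Σs-assoc Y (\I -> F (y ∷ I)))(Σs-assoc Y (\I J -> F I (y ∷ J))))(Σs-assoc Y (\I J K -> F I J (y ∷ K))) ⟩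
   _
    ≈⟨ trans (+-assoc _ _ _)(+ˡ (sym (∑-+ (splits Y) _ _))) ⟩
   _
    ≈⟨ +ˡ (Σs-cong Y (\ {I} {X} _ -> sym (Σs-∷ y X (F I)))) ⟩
   _
    ≈⟨ sym (Σs-∷ y Y (\I X -> Σs X (F I))) ⟩
   Σs (y ∷ Y)(\I X -> Σs X (F I)) ∎

  ∏-Spl : ∀ {I J Y} (F : A -> Carrier) -> Spl I J Y -> ∏ I F * ∏ J F ≈ ∏ Y F
  ∏-Spl {I} {J} F s = trans (sym (∏-++ I J F))(∏-↭ F (Spl-↭ s))

  ∏-Sel : ∀ {x xs ys} (F : A -> Carrier) -> Sel x xs ys -> F x * ∏ xs F ≈ ∏ ys F
  ∏-Sel F s = ∏-↭ F (Sel-↭ s)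

 Σl-map : ∀ {A B : Set} (f : A -> B) xs F -> Σl (map f xs) F ≈ Σl xs (\x xs' -> F (f x)(map f xs'))
 Σl-map f [] F = rfl
 Σl-map f (x ∷ xs) F = begin
  Σl (map f (x ∷ xs)) F ≈⟨ Σl-∷ (f x)(map f xs) F ⟩
  _ ≈⟨ +ˡ (Σl-map f xs _) ⟩
  _ ≈⟨ sym (Σl-∷ x xs (\y ys -> F (f y)(map f ys))) ⟩
  Σl (x ∷ xs)(\y ys -> F (f y)(map f ys)) ∎

 γ-at : ℤ -> ℤ -> Carrier
 γ-at p x = γ (x -' p)

 -- The property of a simple pole that allows an expansion in partial fractions, isolated so that
 -- `γ` of a translate and the constant 1 can be treated alike.
 Compatible : (ℤ -> Carrier) -> (ℤ -> Set) -> Set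
 Compatible d Q = ∀ {x y} -> Q x -> Q y -> x ≢ y -> d x * d y ≈ γ-at x y * d x + γ-at y x * d y

 private
  x-y≢0 : ∀ {x y} -> x ≢ y -> y -' x ≢ 0'
  x-y≢0 {x} {y} ne eq = ne (≡.sym (ℤP.i-j≡0⇒i≡j y x eq))

 γ-at-compatible : ∀ p -> Compatible (γ-at p)(\x -> p ≢ x)
 γ-at-compatible p {x} {y} px py xy = trans (γ-mul (x-y≢0 px)(x-y≢0 py)(\e -> x-y≢0 xy (≡.trans (≡.sym (lem p x y)) e)))
  (+-cong (*ʳ (γ-cong (lem p x y)))(*ʳ (γ-cong (lem p y x))))
  where
  lem : ∀ p x y -> (y -' p) -' (x -' p) ≡ y -' x
  lem = ℤsolve

 γ-shift-compatible : ∀ y -> Compatible (\x -> γ (y +' x))(\x -> y +' x ≢ 0')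
 γ-shift-compatible y {u} {v} pu pv uv = trans (γ-mul pu pv (\e -> x-y≢0 uv (≡.trans (≡.sym (lem y u v)) e)))
  (+-cong (*ʳ (γ-cong (lem y u v)))(*ʳ (γ-cong (lem y v u))))
  where
  lem : ∀ p x y -> (p +' y) -' (p +' x) ≡ y -' x
  lem = ℤsolve

 -- The limiting case h^y = 0 of `γ-shift-compatible`, where γ(y + x) becomes 1; the expansions it
 -- yields evaluate sums of residues.
 one-compatible : Compatible (\_ -> 1#)(\_ -> ⊤)
 one-compatible {x} {y} _ _ ne = begin
  1# * 1# ≈⟨ solve 1 (\g -> :1 :* :1 := g :* :1 :+ (:1 :- g) :* :1) rfl (γ-at x y) ⟩
  _ ≈⟨ +ˡ (*ʳ (sym (trans (γ-cong (lem x y))(γ-neg (x-y≢0 ne))))) ⟩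
  γ-at x y * 1# + γ-at y x * 1# ∎
  where
  lem : ∀ x y -> x -' y ≡ -' (y -' x)
  lem = ℤsolve

 All-Sel : ∀ {A : Set} {R : A -> Set} {x xs ys} -> Sel x xs ys -> All R ys -> R x
 All-Sel here (p ∷ _) = p
 All-Sel (there s)(_ ∷ ps) = All-Sel s ps

 AllPairs-Sel : ∀ {A : Set} {R : A -> A -> Set} -> (∀ {x y} -> R x y -> R y x) -> ∀ {x xs ys} -> Sel x xs ys -> AllPairs R ys -> All (R x) xs
 AllPairs-Sel sy here (p ∷ _) = p
 AllPairs-Sel sy (there s)(p ∷ ps) = sy (All-Sel s p) ∷ AllPairs-Sel sy s ps

 -- Induction on the factors: the new pole d(p) times a pole d(q) is separated by compatibility, and
 -- the terms with a pole at p reassemble to the same statement for the function `γ-at (pos p)`, the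
 -- value of the remaining product at p.
 partial-fractions : ∀ {A : Set} (pos : A -> ℤ)(α β : A -> Carrier)(d : ℤ -> Carrier)(Q : ℤ -> Set) -> Compatible d Q -> ∀ ps ->
  All (Q ∘ pos) ps -> AllPairs (\p q -> pos p ≢ pos q) ps ->
  let value = \(d : ℤ -> Carrier) p -> α p + β p * d (pos p) in
  ∏ ps (value d) ≈ ∏ ps α + Σl ps (\p rest -> β p * d (pos p) * ∏ rest (value (γ-at (pos p))))
 partial-fractions pos α β d Q comp [] _ _ = sym (+-identityʳ 1#)
 partial-fractions {A} pos α β d Q comp (p ∷ ps)(qp ∷ qs)(ne ∷ nes) = begin
  value d p * ∏ ps (value d)
   ≈⟨ *ˡ (partial-fractions pos α β d Q comp ps qs nes) ⟩
  _
   ≈⟨ solve 5 (\a b d A S -> (a :+ b :* d) :* (A :+ S) := a :* A :+ (b :* d :* A :+ (a :+ b :* d) :* S)) rfl (α p)(β p)(d (pos p))(∏ ps α)(Σl ps S) ⟩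
  _
   ≈⟨ +ˡ (+ˡ (trans (sym (∑-*ˡ (value d p)(sels ps) _))
      (trans (Σl-cong ps (\ {q} {rest} s -> step q rest (All-Sel s qs)(All-Sel s ne)))(∑-+ (sels ps) _ _)))) ⟩
  _
   ≈⟨ +ˡ (+ˡ (+ʳ (∑-*ˡ (β p * d (pos p))(sels ps) _))) ⟩
  _
   ≈⟨ +ˡ (trans (sym (+-assoc _ _ _))(+ʳ (sym (distribˡ _ _ _)))) ⟩
  _
   ≈⟨ +ˡ (+ʳ (*ˡ (sym (partial-fractions pos α β (γ-at (pos p)) _ (γ-at-compatible (pos p)) ps ne nes)))) ⟩
  _
   ≈⟨ +ˡ (sym (Σl-∷ p ps (\p rest -> β p * d (pos p) * ∏ rest (value (γ-at (pos p)))))) ⟩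
  α p * ∏ ps α + Σl (p ∷ ps)(\p rest -> β p * d (pos p) * ∏ rest (value (γ-at (pos p)))) ∎
  where
  value : (ℤ -> Carrier) -> A -> Carrier
  value d p = α p + β p * d (pos p)
  S S' S″ : A -> List A -> Carrier
  S q rest = β q * d (pos q) * ∏ rest (value (γ-at (pos q)))
  S' q rest = β q * γ-at (pos p)(pos q) * ∏ rest (value (γ-at (pos q)))
  S″ q rest = β q * d (pos q) * (value (γ-at (pos q)) p * ∏ rest (value (γ-at (pos q))))
  step : ∀ q rest -> Q (pos q) -> pos p ≢ pos q -> value d p * S q rest ≈ β p * d (pos p) * S' q rest + S″ q rest
  step q rest qq nq = begin
   (α p + β p * d (pos p)) * (β q * d (pos q) * U)
    ≈⟨ solve 6 (\a b d e f t -> (a :+ b :* d) :* (f :* e :* t) := (d :* e) :* (b :* f :* t) :+ a :* f :* e :* t) rfl (α p)(β p)(d (pos p))(d (pos q))(β q) U ⟩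
   _
    ≈⟨ +ʳ (*ʳ (comp qp qq nq)) ⟩
   _
    ≈⟨ solve 8 (\a b d e f t g h -> (g :* d :+ h :* e) :* (b :* f :* t) :+ a :* f :* e :* t := b :* d :* (f :* g :* t) :+ f :* e :* ((a :+ b :* h) :* t)) rfl (α p)(β p)(d (pos p))(d (pos q))(β q) U (γ-at (pos p)(pos q))(γ-at (pos q)(pos p)) ⟩
   β p * d (pos p) * S' q rest + S″ q rest ∎
   where U = ∏ rest (value (γ-at (pos q)))

-- Sums over subsets with Hall-Littlewood weights.

module Bounded (𝓕 : Frame)(P : ℕ) where
 open Sums 𝓕 public

 τ t : Carrier
 τ = mono (+ P)
 t = mono (+ (P ℕ.+ P))

 t≈ττ : t ≈ τ * τ
 t≈ττ = mono-+ (+ P)(+ P)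

 infixr 8 _^_
 _^_ : Carrier -> ℕ -> Carrier
 x ^ zero = 1#
 x ^ suc n = x * x ^ n

 -- With X = h^x these are (1 - tX)/(1 - X) and (1 + τX)/(1 - X), written as a constant plus a
 -- simple pole.
 a φ : ℤ -> Carrier
 a x = t + (1# - t) * γ x
 φ x = - τ + (1# + τ) * γ x

 a-cong : ∀ {x y} -> x ≡ y -> a x ≈ a y
 a-cong p = reflexive (cong a p)

 φ-cong : ∀ {x y} -> x ≡ y -> φ x ≈ φ y
 φ-cong p = reflexive (cong φ p)

 a-neg : ∀ {x} -> x ≢ 0' -> 1# + - (1# - t) * γ (-' x) ≈ a x
 a-neg {x} x≢0 = trans (+ˡ (*ˡ (γ-neg x≢0)))
  (solve 2 (\t g -> :1 :+ (:- (:1 :- t)) :* (:1 :- g) := t :+ (:1 :- t) :* g) rfl t (γ x))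

 module _ (α0 β0 : Carrier)(f : ℤ -> ℤ) where
  private
   -- The factors of the product to be expanded: one at position 0, one at f i for each i in I, one
   -- at -j for each j in J.
   data Kind : Set where
    base : Kind
    tᵏ uᵏ : ℤ -> Kind

   pos : Kind -> ℤ
   pos base = 0'
   pos (tᵏ i) = f i
   pos (uᵏ j) = -' j

   α β : Kind -> Carrier
   α base = α0
   α (tᵏ i) = t
   α (uᵏ j) = 1#
   β base = β0
   β (tᵏ i) = 1# - t
   β (uᵏ j) = - (1# - t)

   nice : ℤ -> Kind -> Carrier
   nice p base = α0 + β0 * γ (-' p)
   nice p (tᵏ i) = a (f i -' p)
   nice p (uᵏ j) = a (j +' p)

   nice-value : ∀ p k -> p ≢ pos k -> α k + β k * γ-at p (pos k) ≈ nice p k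
   nice-value p base ne = +ˡ (*ˡ (γ-cong (ℤP.+-identityˡ (-' p))))
   nice-value p (tᵏ i) ne = rfl
   nice-value p (uᵏ j) ne = trans (+ˡ (*ˡ (γ-cong (lem j p))))(a-neg (\e -> ne (lem2 j p e)))
    where
    lem : ∀ j p -> -' j -' p ≡ -' (j +' p)
    lem = ℤsolve
    lem2 : ∀ j p -> j +' p ≡ 0' -> p ≡ -' j
    lem2 j p e = ≡.trans (lem3 j p)(≡.trans (cong (_-' j) e)(ℤP.+-identityˡ (-' j)))
     where
     lem3 : ∀ j p -> p ≡ j +' p -' j
     lem3 = ℤsolve

   kinds : List ℤ -> List ℤ -> List Kind
   kinds I J = base ∷ map tᵏ I ++ map uᵏ J

   pos-kinds : ∀ I J -> map pos (kinds I J) ≡ 0' ∷ map f I ++ neg J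
   pos-kinds I J = cong (0' ∷_)(≡.trans (ListP.map-++ pos (map tᵏ I)(map uᵏ J))
    (cong₂ _++_ (≡.sym (ListP.map-∘ I))(≡.sym (ListP.map-∘ J))))

   ∏-kinds : ∀ I J (F : Kind -> Carrier) -> ∏ (map tᵏ I ++ map uᵏ J) F ≈ ∏ I (F ∘ tᵏ) * ∏ J (F ∘ uᵏ)
   ∏-kinds I J F = trans (∏-++ (map tᵏ I)(map uᵏ J) F)(*-cong (∏-map tᵏ I F)(∏-map uᵏ J F))

   ∏-const : ∀ x (I : List ℤ) -> ∏ I (\_ -> x) ≈ x ^ length I
   ∏-const x [] = rfl
   ∏-const x (i ∷ I) = *ˡ (∏-const x I)

  -- The common form of the expansions needed below: f is the identity or the negation, and the
  -- first factor α0 + β0 d(0) is 1 or a value of `φ`.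
  mixed-fractions : ∀ (d : ℤ -> Carrier)(Q : ℤ -> Set) -> Compatible d Q -> ∀ I J ->
   All Q (0' ∷ map f I ++ neg J) -> AllPairs _≢_ (0' ∷ map f I ++ neg J) ->
   (α0 + β0 * d 0') * (∏ I (\i -> t + (1# - t) * d (f i)) * ∏ J (\j -> 1# + - (1# - t) * d (-' j)))
   ≈ α0 * t ^ length I
    + (β0 * d 0' * (∏ I (\i -> a (f i)) * ∏ J a)
    + (Σl I (\i I0 -> (1# - t) * d (f i) * ((α0 + β0 * γ (-' f i)) * (∏ I0 (\i' -> a (f i' -' f i)) * ∏ J (\j -> a (j +' f i)))))
    + Σl J (\j J0 -> - (1# - t) * d (-' j) * ((α0 + β0 * γ j) * (∏ I (\i -> a (f i +' j)) * ∏ J0 (\j' -> a (j' -' j)))))))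
  mixed-fractions d Q comp I J allQ dist = begin
   (α0 + β0 * d 0') * (∏ I (\i -> t + (1# - t) * d (f i)) * ∏ J (\j -> 1# + - (1# - t) * d (-' j)))
    ≈⟨ *ˡ (sym (∏-kinds I J (\k -> α k + β k * d (pos k)))) ⟩
   _
    ≈⟨ partial-fractions pos α β d Q comp (kinds I J)(AllP.map⁻ allQ') dist' ⟩
   _
    ≈⟨ +-cong (*ˡ αs)(trans (Σl-cong (kinds I J)(\s -> *ˡ (∏-congAll (All.map (\ {k} ne -> nice-value _ k ne)(AllPairs-Sel (\ne e -> ne (≡.sym e)) s dist'))))) split) ⟩
   _ ∎
   where
   allQ' : All Q (map pos (kinds I J))
   allQ' = subst (All Q)(≡.sym (pos-kinds I J)) allQ
   dist' : AllPairs (\p q -> pos p ≢ pos q)(kinds I J)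
   dist' = AllPairsP.map⁻ (subst (AllPairs _≢_)(≡.sym (pos-kinds I J)) dist)
   αs : ∏ (map tᵏ I ++ map uᵏ J) α ≈ t ^ length I
   αs = trans (∏-kinds I J α)(trans (*-cong (∏-const t I)(∏-1 J))(*-identityʳ _))
   G : Kind -> List Kind -> Carrier
   G p rest = β p * d (pos p) * ∏ rest (nice (pos p))
   base-term : G base (map tᵏ I ++ map uᵏ J) ≈ β0 * d 0' * (∏ I (\i -> a (f i)) * ∏ J a)
   base-term = *ˡ (trans (∏-kinds I J (nice 0'))
    (*-cong (∏-cong I (\i -> a-cong (ℤP.+-identityʳ (f i))))(∏-cong J (\j -> a-cong (ℤP.+-identityʳ j)))))
   t-term : ∀ i I0 -> G (tᵏ i)(base ∷ map tᵏ I0 ++ map uᵏ J)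
       ≈ (1# - t) * d (f i) * ((α0 + β0 * γ (-' f i)) * (∏ I0 (\i' -> a (f i' -' f i)) * ∏ J (\j -> a (j +' f i))))
   t-term i I0 = *ˡ (*ˡ (∏-kinds I0 J (nice (f i))))
   u-term : ∀ j J0 -> G (uᵏ j)(base ∷ map tᵏ I ++ map uᵏ J0)
       ≈ - (1# - t) * d (-' j) * ((α0 + β0 * γ j) * (∏ I (\i -> a (f i +' j)) * ∏ J0 (\j' -> a (j' -' j))))
   u-term j J0 = *ˡ (*-cong (+ˡ (*ˡ (γ-cong (ℤP.neg-involutive j))))
    (trans (∏-kinds I J0 (nice (-' j)))(*ʳ (∏-cong I (\i -> a-cong (cong (\z -> f i +' z)(ℤP.neg-involutive j)))))))
   split : Σl (kinds I J) G ≈ _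
   split = trans (Σl-∷ base (map tᵏ I ++ map uᵏ J) G)(+-cong base-term
    (trans (Σl-++ (map tᵏ I)(map uᵏ J)(\k rest -> G k (base ∷ rest)))
     (+-cong (trans (Σl-map tᵏ I _)(Σl-cong I (\ {i} {I0} _ -> t-term i I0)))
         (trans (Σl-map uᵏ J _)(Σl-cong J (\ {j} {J0} _ -> u-term j J0))))))

 -- The product of (y_i - t y_j)/(y_i - y_j) with y_i = h^i, known from the definition of
 -- Hall-Littlewood polynomials by symmetrisation.
 ω : List ℤ -> List ℤ -> Carrier
 ω I J = ∏ I (\i -> ∏ J (\j -> a (j -' i)))

 mon : List ℤ -> Carrier
 mon Y = ∏ Y mono

 -- The product side of Kawanaka's Littlewood identity, the one for the sum over all partitions, in
 -- the variables h^e.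
 A : List ℤ -> Carrier
 A [] = 1#
 A (e ∷ E) = φ e * ∏ E (\x -> a (e +' x)) * A E

 A-↭ : ∀ {X Y} -> X ↭ Y -> A X ≈ A Y
 A-↭ Perm.refl = rfl
 A-↭ (prep x p) = *-cong (*ˡ (∏-↭ _ p))(A-↭ p)
 A-↭ (swap {X} {Y} x y p) = begin
  φ x * (a (x +' y) * ∏ X _) * (φ y * ∏ X _ * A X)
   ≈⟨ solve 6 (\f b p g q c -> f :* (b :* p) :* (g :* q :* c) := g :* (b :* q) :* (f :* p :* c)) rfl _ _ _ _ _ _ ⟩
  _
   ≈⟨ *-cong (*ˡ (*-cong (a-cong (ℤP.+-comm x y))(∏-↭ _ p)))(*-cong (*ˡ (∏-↭ _ p))(A-↭ p)) ⟩
  φ y * (a (y +' x) * ∏ Y _) * (φ x * ∏ Y _ * A Y) ∎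
 A-↭ (Perm.trans p q) = trans (A-↭ p)(A-↭ q)

 cross : List ℤ -> List ℤ -> Carrier
 cross X Z = ∏ X (\x -> ∏ Z (\z -> a (x +' z)))

 A-++ : ∀ X Z -> A (X ++ Z) ≈ A X * A Z * cross X Z
 A-++ [] Z = solve 1 (\x -> x := :1 :* x :* :1) rfl (A Z)
 A-++ (x ∷ X) Z = trans (*-cong (*ˡ (∏-++ X Z _))(A-++ X Z))
  (solve 6 (\f p q b c d -> f :* (p :* q) :* (b :* c :* d) := f :* p :* b :* c :* (q :* d)) rfl _ _ _ _ _ _)

 ω-selˡ : ∀ {i I0 I} J -> Sel i I0 I -> ω I J ≈ ∏ J (\j -> a (j -' i)) * ω I0 J
 ω-selˡ J s = sym (∏-Sel _ s)

 ω-selʳ : ∀ {j J0 J} I -> Sel j J0 J -> ω I J ≈ ∏ I (\i -> a (j -' i)) * ω I J0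
 ω-selʳ I s = trans (∏-cong I (\i -> sym (∏-Sel _ s)))(∏-* I _ _)

 private
  q-left : ℤ -> List ℤ -> Carrier
  q-left i I0 = ∏ I0 (\i' -> a (i -' i'))

  q-right : ℤ -> List ℤ -> Carrier
  q-right j J0 = ∏ J0 (\j' -> a (j' -' j))

  -- Both sides are the sum over an element x and a splitting of the rest: taking x out of J turns
  -- `ω` into a multiple of `q-left`, taking it out of I into a multiple of `q-right`.
  pole-exchange : ∀ Y (X : ℤ -> List ℤ -> List ℤ -> Carrier) ->
   Σs Y (\I J -> ω I J * Σl J (\j J0 -> q-right j J0 * X j I J0)) ≈
   Σs Y (\I J -> ω I J * Σl I (\i I0 -> q-left i I0 * X i I0 J))
  pole-exchange Y X = trans
   (trans (Σs-cong Y (\ {I} {J} _ -> trans (sym (∑-*ˡ (ω I J)(sels J) _))(Σl-cong J (\ {j} {J0} s -> begin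
     ω I J * (q-right j J0 * X j I J0) ≈⟨ *ʳ (ω-selʳ I s) ⟩
     _ ≈⟨ solve 4 (\p w q x -> p :* w :* (q :* x) := w :* (p :* q) :* x) rfl _ _ _ _ ⟩
     Z j I J0 ∎))))
    (Σs-Σl-right Y Z))
   (sym (trans (Σs-cong Y (\ {I} {J} _ -> trans (sym (∑-*ˡ (ω I J)(sels I) _))(Σl-cong I (\ {i} {I0} s -> begin
     ω I J * (q-left i I0 * X i I0 J) ≈⟨ *ʳ (ω-selˡ J s) ⟩
     _ ≈⟨ solve 4 (\p w q x -> p :* w :* (q :* x) := w :* (q :* p) :* x) rfl _ _ _ _ ⟩
     Z i I0 J ∎))))
    (Σs-Σl-left Y Z)))
   where
   Z : ℤ -> List ℤ -> List ℤ -> Carrier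
   Z x I J = ω I J * (q-left x I * q-right x J) * X x I J

 -- Adding y to a set creates apparent poles at y = x for x ∈ Y; those of the summand (I , J)
 -- with x ∈ J cancel those of the summand obtained by moving x into I.
 poles-cancel : ∀ Y (X : ℤ -> List ℤ -> List ℤ -> Carrier) {A1 A2 B1 B2 : List ℤ -> List ℤ -> Carrier} ->
  (∀ {I J} -> Spl I J Y -> A1 I J ≈ B1 I J - Σl J (\j J0 -> q-right j J0 * X j I J0)) ->
  (∀ {I J} -> Spl I J Y -> A2 I J ≈ B2 I J + Σl I (\i I0 -> q-left i I0 * X i I0 J)) ->
  Σs Y (\I J -> ω I J * (A1 I J + A2 I J)) ≈ Σs Y (\I J -> ω I J * (B1 I J + B2 I J))
 poles-cancel Y X {A1} {A2} {B1} {B2} h1 h2 = begin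
  Σs Y (\I J -> ω I J * (A1 I J + A2 I J))
   ≈⟨ Σs-cong Y (\ {I} {J} s -> trans (*ˡ (+-cong (h1 s)(h2 s)))
      (solve 5 (\w b c p q -> w :* ((b :- p) :+ (c :+ q)) := w :* (b :+ c) :+ (w :* q :+ :- (w :* p))) rfl (ω I J)(B1 I J)(B2 I J) _ _)) ⟩
  _
   ≈⟨ ∑-+ (splits Y) _ _ ⟩
  _
   ≈⟨ +ˡ (trans (∑-+ (splits Y) _ _)(+ˡ (∑-neg (splits Y) _))) ⟩
  _
   ≈⟨ +ˡ (trans (+ˡ (-‿cong (pole-exchange Y X)))(-‿inverseʳ _)) ⟩
  _
   ≈⟨ +-identityʳ _ ⟩
  Σs Y (\I J -> ω I J * (B1 I J + B2 I J)) ∎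
  where
  L R : List ℤ -> List ℤ -> Carrier
  L I J = ω I J * Σl I (\i I0 -> q-left i I0 * X i I0 J)
  R I J = ω I J * Σl J (\j J0 -> q-right j J0 * X j I J0)

 Σω-∷ : ∀ y Y (W : List ℤ -> List ℤ -> Carrier) ->
  Σs (y ∷ Y)(\I J -> ω I J * W I J) ≈ Σs Y (\I J -> ω I J * (q-right y J * W (y ∷ I) J + q-left y I * W I (y ∷ J)))
 Σω-∷ y Y W = begin
  Σs (y ∷ Y)(\I J -> ω I J * W I J)
   ≈⟨ Σs-∷ y Y _ ⟩
  _
   ≈⟨ sym (∑-+ (splits Y) _ _) ⟩
  _
   ≈⟨ Σs-cong Y (\ {I} {J} _ -> trans (+ˡ (*ʳ (ω-selʳ {y} {J} I here)))
      (solve 5 (\q w u p v -> q :* w :* u :+ p :* w :* v := w :* (q :* u :+ p :* v)) rfl _ _ _ _ _)) ⟩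
  Σs Y (\I J -> ω I J * (q-right y J * W (y ∷ I) J + q-left y I * W I (y ∷ J))) ∎

 module _ y {Y} (g : Good (y ∷ Y))(f : ℤ -> ℤ)(f-abs : ∀ i -> ∣ f i ∣ ≡ ∣ i ∣) {I J} (s : Spl I J Y) where
  private
   abs-list : map ∣_∣ (map f I ++ neg J) ≡ map ∣_∣ (I ++ J)
   abs-list = ≡.trans (ListP.map-++ ∣_∣ (map f I)(neg J))
    (≡.trans (cong₂ _++_ (≡.trans (≡.sym (ListP.map-∘ I))(ListP.map-cong f-abs I))(map-abs-neg J))
     (≡.sym (ListP.map-++ ∣_∣ I J)))

  positions-distinct : AllPairs _≢_ (0' ∷ map f I ++ neg J)
  positions-distinct = AllPairs.map (\ne e -> ne (cong ∣_∣ e))(AllPairsP.map⁻ {f = ∣_∣}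
   (subst (\l -> AllPairs _≢_ (0 ∷ l))(≡.sym abs-list)(Good-↭ (↭-sym (Spl-↭ s))(Good-tail {y} g))))

  positions-apart : All (\x -> y +' x ≢ 0')(0' ∷ map f I ++ neg J)
  positions-apart = All.map (\ {x} ne -> abs≢⇒+≢0 y x ne)(apart0 g ∷ AllP.map⁻ {f = ∣_∣} (subst (All _)(≡.sym abs-list)
    (PermP.All-resp-↭ (PermP.map⁺ ∣_∣ (↭-sym (Spl-↭ s)))(apart g))))
   where
   apart : Good (y ∷ Y) -> All (\n -> ∣ y ∣ ≢ n)(map ∣_∣ Y)
   apart (_ ∷ p ∷ _) = p
   apart0 : Good (y ∷ Y) -> ∣ y ∣ ≢ 0
   apart0 ((p ∷ _) ∷ _) e = p (≡.sym e)

 private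
  id-abs : ∀ i -> ∣ i ∣ ≡ ∣ i ∣
  id-abs i = refl


  ⊤s : ∀ (xs : List ℤ) -> All (\_ -> ⊤) xs
  ⊤s = All.universal (\_ -> tt)

  all-left : ∀ (I : List ℤ) -> Spl I [] I
  all-left [] = nil
  all-left (i ∷ I) = left (all-left I)

  all-right : ∀ (I : List ℤ) -> Spl [] I I
  all-right [] = nil
  all-right (i ∷ I) = right (all-right I)

  drop-pole : ∀ {p q d r u v w} -> (1# + 0# * d) * (p * q) ≈ 1# * r + (0# * d * w + (u + v)) -> p * q ≈ r + (u + v)
  drop-pole {p} {q} {d} {r} {u} {v} {w} h = trans (solve 3 (\p q d -> p :* q := (:1 :+ :0 :* d) :* (p :* q)) rfl p q d)
   (trans h (solve 5 (\r d w u v -> :1 :* r :+ (:0 :* d :* w :+ (u :+ v)) := r :+ (u :+ v)) rfl r d w u v))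

 right-fractions : ∀ (d : ℤ -> Carrier)(Q : ℤ -> Set) -> Compatible d Q -> ∀ J ->
  All Q (0' ∷ neg J) -> AllPairs _≢_ (0' ∷ neg J) ->
  ∏ J (\j -> 1# + - (1# - t) * d (-' j)) ≈ 1# - Σl J (\j J0 -> q-right j J0 * ((1# - t) * d (-' j)))
 right-fractions d Q comp J aq ds = begin
  ∏ J (\j -> 1# + - (1# - t) * d (-' j))
   ≈⟨ sym (*-identityˡ _) ⟩
  _
   ≈⟨ drop-pole (mixed-fractions 1# 0# id d Q comp [] J aq ds) ⟩
  _
   ≈⟨ +ˡ (trans (+-identityˡ _)(trans (Σl-cong J (\ {j} {J0} _ ->
      solve 4 (\t d g q -> (:- (:1 :- t)) :* d :* ((:1 :+ :0 :* g) :* (:1 :* q)) := :- (q :* ((:1 :- t) :* d))) rfl t _ _ _))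
      (∑-neg (sels J) _))) ⟩
  1# - Σl J (\j J0 -> q-right j J0 * ((1# - t) * d (-' j))) ∎

 left-fractions : ∀ (d : ℤ -> Carrier)(Q : ℤ -> Set) -> Compatible d Q -> ∀ I ->
  All Q (0' ∷ neg I) -> AllPairs _≢_ (0' ∷ neg I) ->
  ∏ I (\i -> t + (1# - t) * d (-' i)) ≈ t ^ length I + Σl I (\i I0 -> q-left i I0 * ((1# - t) * d (-' i)))
 left-fractions d Q comp I aq ds = begin
  ∏ I (\i -> t + (1# - t) * d (-' i))
   ≈⟨ sym (*-identityʳ _) ⟩
  _
   ≈⟨ drop-pole (mixed-fractions 1# 0# (\x -> -' x) d Q comp I [] (subst (All Q) e aq)(subst (AllPairs _≢_) e ds)) ⟩
  _
   ≈⟨ +ˡ (trans (+-identityʳ _)(Σl-cong I (\ {i} {I0} _ -> trans (*ˡ (*ˡ (*ʳ (∏-cong I0 (\i' -> a-cong (flip i i'))))))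
      (solve 4 (\t d g q -> (:1 :- t) :* d :* ((:1 :+ :0 :* g) :* (q :* :1)) := q :* ((:1 :- t) :* d)) rfl t _ _ _)))) ⟩
  t ^ length I + Σl I (\i I0 -> q-left i I0 * ((1# - t) * d (-' i))) ∎
  where
  e : 0' ∷ neg I ≡ 0' ∷ neg I ++ []
  e = cong (0' ∷_)(≡.sym (ListP.++-identityʳ (neg I)))
  flip : ∀ i i' -> -' i' -' -' i ≡ i -' i'
  flip = ℤsolve

 module _ y {Y} (g : Good (y ∷ Y)) where
  private
   y≢ : ∀ {x X Y'} -> Sel x X Y' -> All (\x -> y +' x ≢ 0')(neg Y') -> y -' x ≢ 0'
   y≢ s al = All-Sel s (AllP.map⁻ al)

   posʳ : ∀ {I J} -> Spl I J Y -> All (\x -> y +' x ≢ 0')(0' ∷ neg J) × AllPairs _≢_ (0' ∷ neg J)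
   posʳ {I} {J} s = positions-apart y gJ id id-abs (all-right J) , positions-distinct y gJ id id-abs (all-right J)
    where
    gJ : Good (y ∷ J)
    gJ = Good-++ʳ I (Good-↭ (Perm.trans (prep y (↭-sym (Spl-↭ s)))(↭-sym (PermP.shift y I J))) g)

   posˡ : ∀ {I J} -> Spl I J Y -> All (\x -> y +' x ≢ 0')(0' ∷ neg I) × AllPairs _≢_ (0' ∷ neg I)
   posˡ {I} {J} s = positions-apart y gI id id-abs (all-right I) , positions-distinct y gI id id-abs (all-right I)
    where
    gI : Good (y ∷ I)
    gI = Good-++ʳ J (Good-↭ (Perm.trans (prep y (↭-sym (Spl-↭ s)))(PermP.++-comm (y ∷ I) J)) g)

  right-poles : ∀ {I J} -> Spl I J Y -> q-right y J ≈ 1# - Σl J (\j J0 -> q-right j J0 * ((1# - t) * γ (y -' j)))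
  right-poles {I} {J} s = trans
   (∏-congAll (All.map (\ {j} ne -> sym (trans (+ˡ (*ˡ (γ-cong (lem y j))))(a-neg (\e -> ne (≡.trans (lem y j)(cong -'_ e))))))
    (AllP.map⁻ (All.tail (proj₁ (posʳ s))))))
   (right-fractions (\x -> γ (y +' x)) _ (γ-shift-compatible y) J (proj₁ (posʳ s))(proj₂ (posʳ s)))
   where
   lem : ∀ y j -> y -' j ≡ -' (j -' y)
   lem = ℤsolve

  left-poles : ∀ {I J} -> Spl I J Y -> q-left y I ≈ t ^ length I + Σl I (\i I0 -> q-left i I0 * ((1# - t) * γ (y -' i)))
  left-poles {I} s = left-fractions (\x -> γ (y +' x)) _ (γ-shift-compatible y) I (proj₁ (posˡ s))(proj₂ (posˡ s))

  -- The expansion `left-poles` at h^y = 0, where the product and every γ(y - i) become 1.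
  left-residues : ∀ {I J} -> Spl I J Y -> 1# ≈ t ^ length I + Σl I (\i I0 -> q-left i I0 * ((1# - t) * 1#))
  left-residues {I} s = trans (sym (trans (∏-cong I (\_ -> x+[1-x]*1≈1 t))(∏-1 I)))
   (left-fractions (\_ -> 1#) _ one-compatible I (⊤s _)(proj₂ (posˡ s)))

  apart-right : ∀ {I J j J0} -> Spl I J Y -> Sel j J0 J -> y -' j ≢ 0'
  apart-right s l = y≢ l (All.tail (proj₁ (posʳ s)))

  apart-left : ∀ {I J i I0} -> Spl I J Y -> Sel i I0 I -> y -' i ≢ 0'
  apart-left s l = y≢ l (All.tail (proj₁ (posˡ s)))

 Σl-*ʳ : ∀ {A : Set} (xs : List A) F c -> Σl xs F * c ≈ Σl xs (\x ys -> F x ys * c)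
 Σl-*ʳ xs F c = sym (∑-*ʳ c (sels xs) _)

 -- The sum of w k l over k + l = n with t-binomial coefficients, built by one of the two Pascal
 -- recursions.
 bin : (ℕ -> ℕ -> Carrier) -> ℕ -> Carrier
 bin w zero = w 0 0
 bin w (suc n) = bin (\k l -> w (suc k) l + t ^ k * w k (suc l)) n

 bin-cong : ∀ n {w v : ℕ -> ℕ -> Carrier} -> (∀ k l -> k ℕ.+ l ≡ n -> w k l ≈ v k l) -> bin w n ≈ bin v n
 bin-cong zero h = h 0 0 refl
 bin-cong (suc n) h = bin-cong n (\k l e -> +-cong (h (suc k) l (cong suc e))(*ˡ (h k (suc l)(≡.trans (ℕP.+-suc k l)(cong suc e)))))

 bin-+ : ∀ n w v -> bin (\k l -> w k l + v k l) n ≈ bin w n + bin v n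
 bin-+ zero w v = rfl
 bin-+ (suc n) w v = trans (bin-cong n (\k l _ -> solve 5 (\a b c d e -> a :+ b :+ e :* (c :+ d) := (a :+ e :* c) :+ (b :+ e :* d)) rfl _ _ _ _ _))(bin-+ n _ _)

 bin-* : ∀ n x w -> bin (\k l -> x * w k l) n ≈ x * bin w n
 bin-* zero x w = rfl
 bin-* (suc n) x w = trans (bin-cong n (\k l _ -> x*y+u*[x*z]≈x*[y+u*z] _ _ _ _))(bin-* n x _)

 -- The other Pascal recursion; comparing the two gives the symmetry `bin-sym`.
 bin-suc' : ∀ n w -> bin w (suc n) ≈ bin (\k l -> t ^ l * w (suc k) l + w k (suc l)) n
 bin-suc' zero w = solve 2 (\a b -> a :+ :1 :* b := :1 :* a :+ b) rfl _ _
 bin-suc' (suc n) w = trans (bin-suc' n (\k l -> w (suc k) l + t ^ k * w k (suc l)))(bin-cong n (\k l _ ->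
  solve 6 (\p q t a b c -> p :* (a :+ t :* q :* b) :+ (b :+ q :* c) := p :* a :+ b :+ q :* (t :* p :* b :+ c)) rfl (t ^ l)(t ^ k) t _ _ _))

 bin-sym : ∀ n w -> bin (\k l -> w l k) n ≈ bin w n
 bin-sym zero w = rfl
 bin-sym (suc n) w = trans (bin-suc' n (\k l -> w l k))(trans (bin-cong n (\k l _ -> +-comm _ _))(bin-sym n (\k l -> w (suc k) l + t ^ k * w k (suc l))))

 -- Summed over the subsets of a given size, `ω` yields a t-binomial coefficient: the poles in y
 -- cancel, and the constants 1 and t^|I| that remain are those of Pascal's recursion.
 Σω-size : ∀ Y -> Good Y -> ∀ w -> Σs Y (\I J -> ω I J * w (length I)(length J)) ≈ bin w (length Y)
 Σω-size [] _ w = solve 1 (\x -> :1 :* x :+ :0 := x) rfl (w 0 0)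
 Σω-size (y ∷ Y) g w = begin
  Σs (y ∷ Y)(\I J -> ω I J * w (length I)(length J))
   ≈⟨ Σω-∷ y Y (\I J -> w (length I)(length J)) ⟩
  _
   ≈⟨ poles-cancel Y X h1 h2 ⟩
  _
   ≈⟨ Σω-size Y (Good-tail {y} g)(\k l -> w (suc k) l + t ^ k * w k (suc l)) ⟩
  bin w (suc (length Y)) ∎
  where
  X : ℤ -> List ℤ -> List ℤ -> Carrier
  X x I J = (1# - t) * γ (y -' x) * w (suc (length I))(suc (length J))
  h1 : ∀ {I J} -> Spl I J Y -> q-right y J * w (suc (length I))(length J) ≈ w (suc (length I))(length J) - Σl J (\j J0 -> q-right j J0 * X j I J0)
  h1 {I} {J} s = trans (*ʳ (right-poles y g s))(trans ([1-x]*y≈y-x*y _ _)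
   (+ˡ (-‿cong (trans (Σl-*ʳ J _ _)(Σl-cong J (\ {j} {J0} l -> trans (*-assoc _ _ _)(*ˡ (*ˡ
    (reflexive (cong (w (suc (length I)))(Sel-length l)))))))))))
  h2 : ∀ {I J} -> Spl I J Y -> q-left y I * w (length I)(suc (length J)) ≈ t ^ length I * w (length I)(suc (length J)) + Σl I (\i I0 -> q-left i I0 * X i I0 J)
  h2 {I} {J} s = trans (*ʳ (left-poles y g s))(trans (distribʳ _ _ _)
   (+ˡ (trans (Σl-*ʳ I _ _)(Σl-cong I (\ {i} {I0} l -> trans (*-assoc _ _ _)(*ˡ (*ˡ
    (reflexive (cong (\k -> w k (suc (length J)))(Sel-length l))))))))))

 -- Generating function Σ_k g(k) e_k of the elementary symmetric functions.
 esym : (ℕ -> Carrier) -> List ℤ -> Carrier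
 esym g [] = g 0
 esym g (y ∷ Y) = esym g Y + mono y * esym (g ∘ suc) Y

 esym-cong : ∀ Y {g h : ℕ -> Carrier} -> (∀ k -> g k ≈ h k) -> esym g Y ≈ esym h Y
 esym-cong [] p = p 0
 esym-cong (y ∷ Y) p = +-cong (esym-cong Y p)(*ˡ (esym-cong Y (p ∘ suc)))

 esym-+ : ∀ Y g h -> esym (\k -> g k + h k) Y ≈ esym g Y + esym h Y
 esym-+ [] g h = rfl
 esym-+ (y ∷ Y) g h = trans (+-cong (esym-+ Y g h)(*ˡ (esym-+ Y (g ∘ suc)(h ∘ suc))))
  (solve 5 (\a b c d m -> a :+ b :+ m :* (c :+ d) := a :+ m :* c :+ (b :+ m :* d)) rfl _ _ _ _ _)

 esym-* : ∀ Y x g -> esym (\k -> x * g k) Y ≈ x * esym g Y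
 esym-* [] x g = rfl
 esym-* (y ∷ Y) x g = trans (+-cong (esym-* Y x g)(*ˡ (esym-* Y x (g ∘ suc))))
  (x*y+u*[x*z]≈x*[y+u*z] _ _ _ _)

 esym-Spl : ∀ {I J Y} -> Spl I J Y -> ∀ g -> esym g Y ≈ esym (\k -> esym (\l -> g (k ℕ.+ l)) J) I
 esym-Spl nil g = rfl
 esym-Spl (left s) g = +-cong (esym-Spl s g)(*ˡ (esym-Spl s (g ∘ suc)))
 esym-Spl (right {y} {I} {J} s) g = trans (+-cong (esym-Spl s g)(*ˡ (esym-Spl s (g ∘ suc))))
  (sym (trans (esym-+ I _ _)(+ˡ (trans (esym-* I (mono y) _)
   (*ˡ (esym-cong I (\k -> esym-cong J (\l -> reflexive (cong g (ℕP.+-suc k l))))))))))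

 -- The elementary symmetric function e_k is the Hall-Littlewood polynomial of one column: once the
 -- poles have cancelled, the recursion of e_k is left.
 Σω-esym : ∀ Y -> Good Y -> ∀ g -> Σs Y (\I J -> ω I J * (mon I * g (length I))) ≈ esym g Y
 Σω-esym [] _ g = solve 1 (\x -> :1 :* (:1 :* x) :+ :0 := x) rfl (g 0)
 Σω-esym (y ∷ Y) gd g = begin
  Σs (y ∷ Y)(\I J -> ω I J * (mon I * g (length I)))
   ≈⟨ Σω-∷ y Y (\I J -> mon I * g (length I)) ⟩
  _
   ≈⟨ poles-cancel Y X h1 h2 ⟩
  _
   ≈⟨ trans (Σs-cong Y (\ {I} {J} _ -> solve 5 (\w m y g h -> w :* (y :* m :* g :+ m :* h) := w :* (m :* h) :+ y :* (w :* (m :* g))) rfl (ω I J)(mon I)(mono y) _ _))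
      (trans (∑-+ (splits Y) _ _)(+ˡ (∑-*ˡ (mono y)(splits Y) _))) ⟩
  _
   ≈⟨ +-cong (Σω-esym Y gY g)(*ˡ (Σω-esym Y gY (g ∘ suc))) ⟩
  esym g Y + mono y * esym (g ∘ suc) Y ∎
  where
  gY = Good-tail {y} gd
  X : ℤ -> List ℤ -> List ℤ -> Carrier
  X x I J = (1# - t) * (γ (y -' x) - 1#) * (mono x * mon I * g (suc (length I)))
  yγ : ∀ j -> y -' j ≢ 0' -> γ (y -' j) * mono y ≈ (γ (y -' j) - 1#) * mono j
  yγ j ne = begin
   γ (y -' j) * mono y ≈⟨ *ˡ (trans (mono-cong (lem y j))(mono-+ (y -' j) j)) ⟩
   _ ≈⟨ x*[y*z]≈y*x*z _ _ _ ⟩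
   _ ≈⟨ *ʳ (mono-γ ne) ⟩
   (γ (y -' j) - 1#) * mono j ∎
   where
   lem : ∀ y j -> y ≡ y -' j +' j
   lem = ℤsolve
  h1 : ∀ {I J} -> Spl I J Y -> q-right y J * (mono y * mon I * g (suc (length I))) ≈ mono y * mon I * g (suc (length I)) - Σl J (\j J0 -> q-right j J0 * X j I J0)
  h1 {I} {J} s = trans (*ʳ (right-poles y gd s))(trans ([1-x]*y≈y-x*y _ _)
   (+ˡ (-‿cong (trans (Σl-*ʳ J _ _)(Σl-cong J (\ {j} {J0} l -> begin
    q-right j J0 * ((1# - t) * γ (y -' j)) * (mono y * mon I * g (suc (length I)))
     ≈⟨ solve 6 (\q t c y m h -> q :* (t :* c) :* (y :* m :* h) := q :* t :* (c :* y) :* m :* h) rfl _ _ _ _ _ _ ⟩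
    _
     ≈⟨ *ʳ (*ʳ (*ˡ (yγ j (apart-right y gd s l)))) ⟩
    _
     ≈⟨ solve 6 (\q t c y m h -> q :* t :* (c :* y) :* m :* h := q :* (t :* c :* (y :* m :* h))) rfl _ _ _ _ _ _ ⟩
    q-right j J0 * X j I J0 ∎))))))
  h2 : ∀ {I J} -> Spl I J Y -> q-left y I * (mon I * g (length I)) ≈ mon I * g (length I) + Σl I (\i I0 -> q-left i I0 * X i I0 J)
  h2 {I} {J} s = begin
   q-left y I * w
    ≈⟨ solve 2 (\q w -> q :* w := w :+ (q :- :1) :* w) rfl _ _ ⟩
   _
    ≈⟨ +ˡ (*ʳ (+-cong (left-poles y gd s)(-‿cong (left-residues y gd s)))) ⟩
   _
    ≈⟨ +ˡ (trans (solve 4 (\e p q w -> (e :+ p :- (e :+ q)) :* w := p :* w :+ :- (q :* w)) rfl _ _ _ _)(+-cong (Σl-*ʳ I _ _)(trans (-‿cong (Σl-*ʳ I _ _))(sym (∑-neg (sels I) _))))) ⟩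
   _
    ≈⟨ +ˡ (trans (sym (∑-+ (sels I) _ _))(Σl-cong I (\ {i} {I0} l -> begin
       q-left i I0 * ((1# - t) * γ (y -' i)) * w + - (q-left i I0 * ((1# - t) * 1#) * w)
        ≈⟨ solve 4 (\q t c w -> q :* (t :* c) :* w :+ :- (q :* (t :* :1) :* w) := q :* (t :* (c :- :1) :* w)) rfl _ _ _ _ ⟩
       _
        ≈⟨ *ˡ (*ˡ (*-cong (sym (∏-Sel mono l))(reflexive (cong g (Sel-length l))))) ⟩
       q-left i I0 * X i I0 J ∎))) ⟩
   w + Σl I (\i I0 -> q-left i I0 * X i I0 J) ∎
   where
   w S1 S2 : Carrier
   w = mon I * g (length I)
   S1 = Σl I (\i I0 -> q-left i I0 * ((1# - t) * γ (y -' i)))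
   S2 = Σl I (\i I0 -> q-left i I0 * ((1# - t) * 1#))

 pochτ : ℕ -> Carrier
 pochτ zero = 1#
 pochτ (suc k) = pochτ k * (1# - τ * t ^ k)

 φ-one : - τ + (1# + τ) * 1# ≈ 1#
 φ-one = solve 1 (\x -> :- x :+ (:1 :+ x) :* :1 := :1) rfl τ

 a-one : t + (1# - t) * 1# ≈ 1#
 a-one = x+[1-x]*1≈1 t

 module _ (y : ℤ) {E : List ℤ} (g : Good (y ∷ E)) where
  private
   res : ℤ -> List ℤ -> Carrier
   res e rest = (1# - t) * (φ (-' e) * ∏ rest (\x -> a (x -' e)))

   h : ℤ -> Carrier
   h z = φ z * ∏ E (\x -> a (z +' x))

   r0 : Carrier
   r0 = (1# + τ) * ∏ E a

   tidy : ∀ (d : ℤ -> Carrier) -> (- τ) * t ^ length E + ((1# + τ) * d 0' * (∏ E a * 1#)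
          + (Σl E (\e rest -> (1# - t) * d e * (φ (-' e) * (∏ rest (\x -> a (x -' e)) * 1#))) + 0#))
       ≈ - (τ * t ^ length E) + r0 * d 0' + Σl E (\e rest -> res e rest * d e)
   tidy d = trans
    (solve 5 (\x q c p s -> (:- x) :* q :+ ((:1 :+ x) :* c :* (p :* :1) :+ (s :+ :0)) := :- (x :* q) :+ (:1 :+ x) :* p :* c :+ s) rfl τ _ (d 0') _ _)
    (+ˡ (Σl-cong E (\ {e} {rest} _ -> solve 4 (\t c f p -> t :* c :* (f :* (p :* :1)) := t :* (f :* p) :* c) rfl _ _ _ _)))

   expand : ∀ z -> Good (z ∷ E) -> h z ≈ - (τ * t ^ length E) + r0 * γ z + Σl E (\e rest -> res e rest * γ (z +' e))
   expand z gz = trans (*-cong (φ-cong (≡.sym (ℤP.+-identityʳ z)))(sym (*-identityʳ _)))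
    (trans (mixed-fractions (- τ)(1# + τ) id (\x -> γ (z +' x)) _ (γ-shift-compatible z) E []
      (positions-apart z gz id id-abs (all-left E))
      (positions-distinct z gz id id-abs (all-left E)))
     (trans (tidy (\x -> γ (z +' x)))(+ʳ (+ˡ (*ˡ (γ-cong (ℤP.+-identityʳ z)))))))

   residues : 1# ≈ - (τ * t ^ length E) + r0 + Σl E res
   residues = trans (sym (trans (*-cong φ-one (trans (*-identityʳ _)(trans (∏-cong E (\_ -> a-one))(∏-1 E))))(*-identityˡ 1#)))
    (trans (mixed-fractions (- τ)(1# + τ) id (\_ -> 1#) _ one-compatible E [] (⊤s _)(positions-distinct y g id id-abs (all-left E)))
     (trans (tidy (\_ -> 1#))(+-cong (+ˡ (*-identityʳ _))(Σl-cong E (\_ -> *-identityʳ _)))))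

  -- The poles at h^y = 1 of the two values add up to a constant, and the sum of all residues is
  -- known from the expansion with the function 1. What is left becomes odd in each e after
  -- multiplication by A E.
  two-signs : h y + h (-' y) ≈ 1# - τ * t ^ length E + Σl E (\e rest -> res e rest * (γ (y +' e) - γ (y -' e)))
  two-signs = begin
   h y + h (-' y)
    ≈⟨ +-cong (expand y g)(expand (-' y) g⁻) ⟩
   _
    ≈⟨ +ˡ (+-cong (+ˡ (*ˡ (γ-neg (Good⇒≢0 g))))(Σl-cong E (\ {e} s -> *ˡ (trans (γ-cong (flip y e))(γ-neg (y-e≢0 s)))))) ⟩
   _
    ≈⟨ +ˡ (+ˡ (trans (Σl-cong E (\_ -> solve 2 (\r c -> r :* (:1 :- c) := r :+ :- (r :* c)) rfl _ _))(trans (∑-+ (sels E) _ _)(+ˡ (∑-neg (sels E) _))))) ⟩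
   _
    ≈⟨ solve 6 (\q r c s t u -> (q :+ r :* c :+ s) :+ (q :+ r :* (:1 :- c) :+ (t :+ :- u)) := (q :+ r :+ t) :+ q :+ (s :+ :- u)) rfl q r0 (γ y) S1 (Σl E res) S2 ⟩
   _
    ≈⟨ +-cong (+ʳ (sym residues))(trans (+ˡ (sym (∑-neg (sels E) _)))(trans (sym (∑-+ (sels E) _ _))
       (Σl-cong E (\_ -> solve 3 (\r c d -> r :* c :+ :- (r :* d) := r :* (c :- d)) rfl _ _ _)))) ⟩
   1# - τ * t ^ length E + Σl E (\e rest -> res e rest * (γ (y +' e) - γ (y -' e))) ∎
   where
   q = - (τ * t ^ length E)
   S1 = Σl E (\e rest -> res e rest * γ (y +' e))
   S2 = Σl E (\e rest -> res e rest * γ (y -' e))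
   flip : ∀ y e -> -' y +' e ≡ -' (y -' e)
   flip = ℤsolve
   g⁻ : Good (-' y ∷ E)
   g⁻ = subst (\n -> AllPairs _≢_ (0 ∷ n ∷ map ∣_∣ E))(≡.sym (ℤP.∣-i∣≡∣i∣ y)) g
   y-e≢0 : ∀ {e rest} -> Sel e rest E -> y -' e ≢ 0'
   y-e≢0 {e} s = abs≢⇒+≢0 y (-' e)(\eq -> All-Sel s (apart g)(≡.trans eq (ℤP.∣-i∣≡∣i∣ e)))
    where
    apart : Good (y ∷ E) -> All (\x -> ∣ y ∣ ≢ ∣ x ∣) E
    apart (_ ∷ p ∷ _) = AllP.map⁻ p

 signed : ℕ -> List ℤ -> Carrier
 signed m Y = Σs Y (\J I -> mon J ^ m * A (neg J ++ I))

 -- Induction on Y: the constant in `two-signs` supplies the next factor of (τ; t)_k, and its other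
 -- terms change sign with e, so they cancel between e in I and e in J. The result depends on the
 -- size of Y alone.
 signed-sum : ∀ Y -> Good Y -> Σs Y (\J I -> A (neg J ++ I)) ≈ pochτ (length Y)
 signed-sum [] _ = +-identityʳ 1#
 signed-sum (y ∷ Y) g = begin
  Σs (y ∷ Y)(\J I -> A (neg J ++ I))
   ≈⟨ Σs-∷ y Y _ ⟩
  _
   ≈⟨ +ˡ (Σs-cong Y (\ {J} {I} _ -> A-↭ (PermP.shift y (neg J) I))) ⟩
  _
   ≈⟨ sym (∑-+ (splits Y) _ _) ⟩
  _
   ≈⟨ Σs-cong Y (\ {J} {I} s -> trans (solve 3 (\p q b -> p :* b :+ q :* b := (q :+ p) :* b) rfl _ _ (A (neg J ++ I)))
      (trans (*ʳ (two-signs y (Good-y s)))(distribʳ _ _ _))) ⟩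
  _
   ≈⟨ ∑-+ (splits Y) _ _ ⟩
  _
   ≈⟨ +-cong (trans (Σs-cong Y (\ {J} {I} s -> *ʳ (+ˡ (-‿cong (*ˡ (reflexive (cong (t ^_)(len s))))))))
         (trans (∑-*ˡ _ (splits Y) _)(*ˡ (signed-sum Y (Good-tail {y} g))))) vanish ⟩
  _
   ≈⟨ trans (+-identityʳ _)(*-comm _ _) ⟩
  pochτ (length (y ∷ Y)) ∎
  where
  Good-y : ∀ {J I} -> Spl J I Y -> Good (y ∷ neg J ++ I)
  Good-y {J} {I} s = Good-↭ (PermP.shift y (neg J) I)(Good-signs (right s) g)
  len : ∀ {J I} -> Spl J I Y -> length (neg J ++ I) ≡ length Y
  len {J} {I} s = ≡.trans (ListP.length-++ (neg J))(≡.trans (cong (ℕ._+ length I)(ListP.length-map _ J))(Spl-length s))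
  res : List ℤ -> ℤ -> List ℤ -> Carrier
  res E e rest = (1# - t) * (φ (-' e) * ∏ rest (\x -> a (x -' e))) * (γ (y +' e) - γ (y -' e))
  H : ℤ -> List ℤ -> Carrier
  H e rest = (1# - t) * (φ e * φ (-' e)) * (∏ rest (\x -> a (e +' x)) * ∏ rest (\x -> a (x -' e))) * A rest * (γ (y +' e) - γ (y -' e))
  H-odd : ∀ e rest -> H (-' e) rest + H e rest ≈ 0#
  H-odd e rest = trans (+ʳ (*-cong (*ʳ (*-cong (*ˡ (*ˡ (φ-cong (ℤP.neg-involutive e))))
    (*-cong (∏-cong rest (\x -> a-cong (ℤP.+-comm (-' e) x)))(∏-cong rest (\x -> a-cong (lem x e))))))
    (+ˡ (-‿cong (γ-cong (cong (\z -> y +' z)(ℤP.neg-involutive e)))))))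
   (solve 8 (\t f g p q b c d -> t :* (g :* f) :* (q :* p) :* b :* (d :- c) :+ t :* (f :* g) :* (p :* q) :* b :* (c :- d) := :0) rfl _ _ _ _ _ _ _ _)
   where
   lem : ∀ x e -> x -' -' e ≡ e +' x
   lem = ℤsolve
  absorb : ∀ {e rest E} -> Sel e rest E -> res E e rest * A E ≈ H e rest
  absorb s = trans (*ˡ (sym (A-↭ (Sel-↭ s))))
   (solve 7 (\t f g p q b c -> t :* (g :* q) :* c :* (f :* p :* b) := t :* (f :* g) :* (p :* q) :* b :* c) rfl _ _ _ _ _ _ _)
  vanish : Σs Y (\J I -> Σl (neg J ++ I)(res (neg J ++ I)) * A (neg J ++ I)) ≈ 0#
  vanish = begin
   Σs Y (\J I -> Σl (neg J ++ I)(res (neg J ++ I)) * A (neg J ++ I))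
    ≈⟨ Σs-cong Y (\ {J} {I} _ -> trans (Σl-*ʳ (neg J ++ I) _ _)(trans (Σl-cong (neg J ++ I) absorb)
       (trans (Σl-++ (neg J) I H)(+ʳ (Σl-map (\x -> -' x) J _))))) ⟩
   _
    ≈⟨ ∑-+ (splits Y) _ _ ⟩
   _
    ≈⟨ +-cong (Σs-Σl-left Y (\x J I -> H (-' x)(neg J ++ I)))(Σs-Σl-right Y (\x J I -> H x (neg J ++ I))) ⟩
   _
    ≈⟨ trans (sym (∑-+ (sels Y) _ _))(∑-zero (sels Y)(\p -> trans (sym (∑-+ (splits (proj₂ p)) _ _))
       (∑-zero (splits (proj₂ p))(\q -> H-odd (proj₁ p)(neg (proj₁ q) ++ proj₂ q))))) ⟩
   0# ∎

 -- (-1)^k t^{k(k-1)/2}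
 alt : ℕ -> Carrier
 alt zero = 1#
 alt (suc k) = - (t ^ k * alt k)

 private
  weight : List ℤ -> List ℤ -> Carrier
  weight I J = alt (length J) - mon I * mon J * τ ^ length J

  D : List ℤ -> Carrier
  D Y = Σs Y (\I J -> ω I J * (A I * weight I J))

  -- A numerator u - m v, linear in m = h^y, over a simple pole d: it splits into its value u at m =
  -- 0 and a multiple of d - 1 whose coefficient u - vP is the numerator at the pole.
  linear : ∀ {u m v vP d m·d} -> m * d ≈ m·d -> v * m·d ≈ vP * (d - 1#) -> (u - m * v) * d ≈ u * 1# + (u - vP) * (d - 1#)
  linear {u} {m} {v} {vP} {d} {w} p q = begin
   (u - m * v) * d ≈⟨ solve 4 (\u m v d -> (u :- m :* v) :* d := u :* d :- v :* (m :* d)) rfl u m v d ⟩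
   _ ≈⟨ +ˡ (-‿cong (trans (*ˡ p) q)) ⟩
   _ ≈⟨ solve 3 (\u v d -> u :* d :- v :* (d :- :1) := u :* :1 :+ (u :- v) :* (d :- :1)) rfl u vP d ⟩
   u * 1# + (u - vP) * (d - 1#) ∎

  -- The poles at h^y = h^x with x in Y cancel between the summands, and so do the parts that are
  -- polynomial in h^y. The remaining poles, at h^y = 1 and at the inverses of the letters, have
  -- residues that are multiples of `D Y` and of `D` of Y without that letter.
  D-step : ∀ y Y -> Good (y ∷ Y) -> D Y ≈ 0# -> (∀ {x Y0} -> Sel x Y0 Y -> D Y0 ≈ 0#) -> D (y ∷ Y) ≈ 0#
  D-step y Y g ih ih0 = begin
   D (y ∷ Y)
    ≈⟨ Σω-∷ y Y (\I J -> A I * weight I J) ⟩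
   _
    ≈⟨ poles-cancel Y X h1 h2 ⟩
   _
    ≈⟨ Σs-cong Y (\ {I} {J} _ -> begin
       ω I J * (B1 I J + B2 I J)
        ≈⟨ *ˡ (solve 9 (\b s r u l v m τ z -> b :* (m :* v :* τ :* z :+ u :* l :+ (s :+ r)) :+ b :* (:- (l :* u) :- m :* (v :* τ) :* z) := b :* (s :+ r)) rfl
          (A I)(R0 I J)(R1 I J)(alt (length J))(t ^ length J)(mon I * mon J * τ ^ length J)(mono y) τ (t ^ length I)) ⟩
       _
        ≈⟨ solve 4 (\w b r s -> w :* (b :* (r :+ s)) := w :* (b :* r) :+ w :* (b :* s)) rfl _ _ _ _ ⟩
       ω I J * (A I * R0 I J) + ω I J * (A I * R1 I J) ∎) ⟩
   Σs Y (\I J -> ω I J * (A I * R0 I J) + ω I J * (A I * R1 I J))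
    ≈⟨ ∑-+ (splits Y) _ _ ⟩
   Σs Y (\I J -> ω I J * (A I * R0 I J)) + Σs Y (\I J -> ω I J * (A I * R1 I J))
    ≈⟨ +-cong vanish0 vanish1 ⟩
   0# + 0#
    ≈⟨ +-identityʳ 0# ⟩
   0# ∎
   where
   gY : Good Y
   gY = Good-tail {y} g
   my = mono y
   V : List ℤ -> List ℤ -> Carrier
   V I J = mon I * mon J * τ ^ length J
   X : ℤ -> List ℤ -> List ℤ -> Carrier
   X x I J = (1# - t) * (γ (y -' x) - 1#) * (A (x ∷ I) * (alt (suc (length J)) - mono x * (mono x * mon I * mon J * τ ^ suc (length J))))
   C : ℤ -> List ℤ -> List ℤ -> Carrier
   C i I0 J = (1# - t) * (γ (y +' i) - 1#) * (φ (-' i) * (∏ I0 (\x -> a (x -' i)) * ∏ J (\j -> a (j +' i))))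
   R0 R1 R2 B1 B2 : List ℤ -> List ℤ -> Carrier
   R0 I J = (1# + τ) * (γ y - 1#) * (∏ I a * ∏ J a) * (alt (length J) - V I J)
   R1 I J = Σl I (\i I0 -> C i I0 J * (alt (length J) - mon I0 * mon J * τ ^ length J))
   R2 I J = Σl J (\j J0 -> - (1# - t) * (γ (y -' j) - 1#) * (φ j * (∏ I (\i -> a (i +' j)) * ∏ J0 (\j' -> a (j' -' j)))) * (alt (length J) - mono j * V I J))
   B1 I J = A I * (my * V I J * τ * t ^ length I + alt (length J) * t ^ length J + (R0 I J + R1 I J))
   B2 I J = A I * (- (t ^ length J * alt (length J)) - my * (V I J * τ) * t ^ length I)
   yc : y ≢ 0'
   yc = Good⇒≢0 g
   h2 : ∀ {I J} -> Spl I J Y -> ∏ I (\i -> a (y -' i)) * (A I * weight I (y ∷ J)) ≈ B2 I J + Σl I (\i I0 -> ∏ I0 (\i' -> a (i -' i')) * X i I0 J)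
   h2 {I} {J} s = begin
    ∏ I (\i -> a (y -' i)) * (A I * weight I (y ∷ J))
     ≈⟨ solve 8 (\p b u m k z q τ -> p :* (b :* (u :- m :* (q :* k) :* (τ :* z))) := b :* ((u :- q :* (m :* k :* z :* τ)) :* p)) rfl
        _ (A I) u' (mon I)(mon J)(τ ^ length J) my τ ⟩
    _
     ≈⟨ *ˡ (trans (*ˡ (left-poles y g s))(distribˡ _ _ _)) ⟩
    _
     ≈⟨ *ˡ (+ˡ (trans (sym (∑-*ˡ _ (sels I) _))(trans (Σl-cong I per)(trans (∑-+ (sels I) _ _)(+ʳ (∑-*ˡ u' (sels I) _)))))) ⟩
    _
     ≈⟨ *ˡ (solve 6 (\u m v e s r -> (u :- m :* v) :* e :+ (u :* s :+ r) := u :* (e :+ s) :- m :* v :* e :+ r) rfl _ _ _ _ _ _) ⟩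
    _
     ≈⟨ *ˡ (+ʳ (+ʳ (trans (*ˡ (sym (left-residues y g s)))(*-identityʳ _)))) ⟩
    _
     ≈⟨ distribˡ _ _ _ ⟩
    _
     ≈⟨ +ˡ (trans (sym (∑-*ˡ (A I)(sels I) _))(Σl-cong I (\ {i} {I0} l -> begin
        A I * (∏ I0 (\i' -> a (i -' i')) * ((1# - t) * (γ (y -' i) - 1#)) * (u' - mono i * v))
         ≈⟨ *-cong (sym (A-↭ (Sel-↭ l)))(*ˡ (+ˡ (-‿cong (*ˡ (*ʳ (*ʳ (*ʳ (sym (∏-Sel mono l))))))))) ⟩
        _
         ≈⟨ solve 9 (\b q c u m k j τ z -> b :* (q :* c :* (u :- m :* (m :* k :* j :* z :* τ))) := q :* (c :* (b :* (u :- m :* (m :* k :* j :* (τ :* z)))))) rfl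
           (A (i ∷ I0)) _ ((1# - t) * (γ (y -' i) - 1#)) u' (mono i)(mon I0)(mon J) τ (τ ^ length J) ⟩
        ∏ I0 (\i' -> a (i -' i')) * X i I0 J ∎))) ⟩
    B2 I J + Σl I (\i I0 -> ∏ I0 (\i' -> a (i -' i')) * X i I0 J) ∎
    where
    u' = alt (suc (length J))
    v = V I J * τ
    S1 S2 S3 : ℤ -> List ℤ -> Carrier
    S1 i I0 = ∏ I0 (\i' -> a (i -' i')) * ((1# - t) * γ (y -' i))
    S2 i I0 = ∏ I0 (\i' -> a (i -' i')) * ((1# - t) * 1#)
    S3 i I0 = ∏ I0 (\i' -> a (i -' i')) * ((1# - t) * (γ (y -' i) - 1#)) * (u' - mono i * v)
    per : ∀ {i I0} -> Sel i I0 I -> (u' - my * v) * S1 i I0 ≈ u' * S2 i I0 + S3 i I0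
    per {i} {I0} l = begin
     (u' - my * v) * S1 i I0
      ≈⟨ solve 4 (\w q t d -> w :* (q :* (t :* d)) := q :* t :* (w :* d)) rfl _ _ _ _ ⟩
     _
      ≈⟨ *ˡ (linear (yγ i (apart-left y g s l))(x*[y*z]≈y*x*z _ _ _)) ⟩
     _
      ≈⟨ solve 5 (\q t u w d -> q :* t :* (u :* :1 :+ w :* d) := u :* (q :* (t :* :1)) :+ q :* (t :* d) :* w) rfl _ _ _ _ _ ⟩
     u' * S2 i I0 + S3 i I0 ∎
     where
     yγ : ∀ j -> y -' j ≢ 0' -> my * γ (y -' j) ≈ mono j * (γ (y -' j) - 1#)
     yγ j ne = trans (*ʳ (trans (mono-cong (lem y j))(mono-+ j (y -' j))))(trans (*-assoc _ _ _)(*ˡ (mono-γ ne)))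
      where
      lem : ∀ y j -> y ≡ j +' (y -' j)
      lem = ℤsolve
   h1 : ∀ {I J} -> Spl I J Y -> ∏ J (\j -> a (j -' y)) * (A (y ∷ I) * weight (y ∷ I) J) ≈ B1 I J - Σl J (\j J0 -> ∏ J0 (\j' -> a (j' -' j)) * X j I J0)
   h1 {I} {J} s = begin
    ∏ J (\j -> a (j -' y)) * (A (y ∷ I) * weight (y ∷ I) J)
     ≈⟨ solve 9 (\q f p b u m i j z -> q :* (f :* p :* b :* (u :- m :* i :* j :* z)) := b :* ((u :- m :* (i :* j :* z)) :* (f :* (p :* q)))) rfl
        _ (φ y) _ (A I) u my (mon I)(mon J)(τ ^ length J) ⟩
    _
     ≈⟨ *ˡ (*ˡ (trans (*-cong (φ-cong (≡.sym (ℤP.+-identityʳ y))) to-fractions)(trans (mf (\x -> γ (y +' x)) _ (γ-shift-compatible y) apart)(+ˡ (+ʳ (*ʳ (*ˡ (γ-cong (ℤP.+-identityʳ y))))))))) ⟩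
    _
     ≈⟨ *ˡ (solve 8 (\u m τ e c p x z -> let w = u :- m in w :* ((:- τ) :* e :+ ((:1 :+ τ) :* c :* p :+ (x :+ z))) := :- (u :* τ :* e) :+ m :* τ :* e :+ ((:1 :+ τ) :* p :* (w :* c) :+ (w :* x :+ w :* z))) rfl
        u (my * v) τ (t ^ length I)(γ y) Π0 _ _) ⟩
    _
     ≈⟨ *ˡ (+ˡ (+-cong (*ˡ (linear {vP = v} (mono-γ yc) rfl))(+-cong
        (trans (sym (∑-*ˡ _ (sels I) _))(trans (Σl-cong I per1)(trans (∑-+ (sels I) _ _)(+ʳ (∑-*ˡ u (sels I) _)))))
        (trans (sym (∑-*ˡ _ (sels J) _))(trans (Σl-cong J per2)(trans (∑-+ (sels J) _ _)(+ʳ (∑-*ˡ u (sels J) _)))))))) ⟩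
    _
     ≈⟨ *ˡ (solve 11 (\u τ e w p v c x r z q -> :- (u :* τ :* e) :+ w :+ ((:1 :+ τ) :* p :* (u :* :1 :+ (u :- v) :* c) :+ ((u :* x :+ r) :+ (u :* z :+ q)))
        := w :+ u :* ((:- τ) :* e :+ ((:1 :+ τ) :* :1 :* p :+ (x :+ z))) :+ ((:1 :+ τ) :* c :* p :* (u :- v) :+ r) :+ q) rfl
        u τ (t ^ length I)(my * v * τ * t ^ length I) Π0 v (γ y - 1#) _ (R1 I J) _ (R2 I J)) ⟩
    _
     ≈⟨ *ˡ (+ʳ (+ʳ (+ˡ (*ˡ (trans (sym (mf (\_ -> 1#) _ one-compatible (⊤s _))) ones))))) ⟩
    _
     ≈⟨ distribˡ _ _ _ ⟩
    _
     ≈⟨ +ˡ (trans (sym (∑-*ˡ (A I)(sels J) _))(trans (Σl-cong J last)(∑-neg (sels J) _))) ⟩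
    B1 I J - Σl J (\j J0 -> ∏ J0 (\j' -> a (j' -' j)) * X j I J0) ∎
    where
    u = alt (length J)
    v = V I J
    Π0 = ∏ I a * ∏ J a
    F1 F2 : (ℤ -> Carrier) -> ℤ -> List ℤ -> Carrier
    F1 d i I0 = (1# - t) * d i * (φ (-' i) * (∏ I0 (\i' -> a (i' -' i)) * ∏ J (\j -> a (j +' i))))
    F2 d j J0 = - (1# - t) * d (-' j) * (φ j * (∏ I (\i -> a (i +' j)) * ∏ J0 (\j' -> a (j' -' j))))
    apart : All (\x -> y +' x ≢ 0')(0' ∷ map id I ++ neg J)
    apart = positions-apart y g id id-abs s
    mf : ∀ (d : ℤ -> Carrier)(Q : ℤ -> Set) -> Compatible d Q -> All Q (0' ∷ map id I ++ neg J) -> _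
    mf d Q c al = mixed-fractions (- τ)(1# + τ) id d Q c I J al (positions-distinct y g id id-abs s)
    to-fractions : ∏ I (\x -> a (y +' x)) * ∏ J (\j -> a (j -' y)) ≈ ∏ I (\i -> t + (1# - t) * γ (y +' i)) * ∏ J (\j -> 1# + - (1# - t) * γ (y +' -' j))
    to-fractions = *ˡ (∏-congAll (All.map (\ {j} ne -> sym (trans (+ˡ (*ˡ (γ-cong (lem y j))))(a-neg (\e -> ne (≡.trans (lem y j)(cong -'_ e))))))
      (AllP.map⁻ (AllP.++⁻ʳ (map id I)(All.tail apart)))))
     where
     lem : ∀ y j -> y -' j ≡ -' (j -' y)
     lem = ℤsolve
    ones : (- τ + (1# + τ) * 1#) * (∏ I (\i -> t + (1# - t) * 1#) * ∏ J (\j -> 1# + - (1# - t) * 1#)) ≈ t ^ length J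
    ones = trans (*-cong φ-one (*-cong (trans (∏-cong I (\_ -> a-one))(∏-1 I))(consts J)))(trans (*-identityˡ _)(*-identityˡ _))
     where
     consts : ∀ K -> ∏ K (\j -> 1# + - (1# - t) * 1#) ≈ t ^ length K
     consts [] = rfl
     consts (k ∷ K) = *-cong (solve 1 (\t -> :1 :+ (:- (:1 :- t)) :* :1 := t) rfl t)(consts K)
    per1 : ∀ {i I0} -> Sel i I0 I -> (u - my * v) * F1 (\x -> γ (y +' x)) i I0 ≈ u * F1 (\_ -> 1#) i I0 + C i I0 J * (u - mon I0 * mon J * τ ^ length J)
    per1 {i} {I0} l = begin
     (u - my * v) * F1 (\x -> γ (y +' x)) i I0
      ≈⟨ x*[y*z*u]≈y*u*[x*z] _ _ _ _ ⟩
     _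
      ≈⟨ *ˡ (linear {vP = mon I0 * mon J * τ ^ length J} rfl (trans (*ʳ (*ʳ (*ʳ (sym (∏-Sel mono l)))))
         (trans (solve 6 (\i k j z y c -> i :* k :* j :* z :* (y :* c) := k :* j :* z :* ((y :* i) :* c)) rfl _ _ _ _ _ _)
          (*ˡ (trans (*ʳ (sym (mono-+ y i)))(mono-γ (All-Sel l (AllP.map⁻ (AllP.++⁻ˡ (map id I)(All.tail apart)))))))))) ⟩
     _
      ≈⟨ x*y*[z*1+u*v]≈z*[x*1*y]+x*v*y*u _ _ _ _ _ ⟩
     u * F1 (\_ -> 1#) i I0 + C i I0 J * (u - mon I0 * mon J * τ ^ length J) ∎
    per2 : ∀ {j J0} -> Sel j J0 J -> (u - my * v) * F2 (\x -> γ (y +' x)) j J0 ≈ u * F2 (\_ -> 1#) j J0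
        + - (1# - t) * (γ (y -' j) - 1#) * (φ j * (∏ I (\i -> a (i +' j)) * ∏ J0 (\j' -> a (j' -' j)))) * (u - mono j * v)
    per2 {j} {J0} l = begin
     (u - my * v) * F2 (\x -> γ (y +' x)) j J0
      ≈⟨ x*[y*z*u]≈y*u*[x*z] _ _ _ _ ⟩
     _
      ≈⟨ *ˡ (linear (trans (*ʳ (trans (mono-cong (lem y j))(mono-+ j (y -' j))))(trans (*-assoc _ _ _)(*ˡ (mono-γ (apart-right y g s l)))))
         (x*[y*z]≈y*x*z _ _ _)) ⟩
     _
      ≈⟨ x*y*[z*1+u*v]≈z*[x*1*y]+x*v*y*u _ _ _ _ _ ⟩
     _ ∎
     where
     lem : ∀ y j -> y ≡ j +' (y -' j)
     lem = ℤsolve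
    last : ∀ {j J0} -> Sel j J0 J -> A I * (- (1# - t) * (γ (y -' j) - 1#) * (φ j * (∏ I (\i -> a (i +' j)) * ∏ J0 (\j' -> a (j' -' j)))) * (u - mono j * v))
        ≈ - (∏ J0 (\j' -> a (j' -' j)) * X j I J0)
    last {j} {J0} l = begin
     A I * (- (1# - t) * (γ (y -' j) - 1#) * (φ j * (∏ I (\i -> a (i +' j)) * ∏ J0 (\j' -> a (j' -' j)))) * (u - mono j * v))
      ≈⟨ *ˡ (*-cong (*ˡ (*ˡ (*ʳ (∏-cong I (\i -> a-cong (ℤP.+-comm i j))))))
         (+-cong (reflexive (cong alt (Sel-length l)))(-‿cong (*ˡ (*-cong (*ˡ (sym (∏-Sel mono l)))(reflexive (cong (τ ^_)(Sel-length l)))))))) ⟩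
     _
      ≈⟨ solve 11 (\b t c f p q u m i k z -> b :* ((:- t) :* c :* (f :* (p :* q)) :* (u :- m :* (i :* (m :* k) :* z))) := :- (q :* (t :* c :* (f :* p :* b :* (u :- m :* (m :* i :* k :* z)))))) rfl
         (A I)(1# - t)(γ (y -' j) - 1#)(φ j) _ _ (alt (suc (length J0)))(mono j)(mon I)(mon J0)(τ ^ suc (length J0)) ⟩
     - (∏ J0 (\j' -> a (j' -' j)) * X j I J0) ∎
   vanish0 : Σs Y (\I J -> ω I J * (A I * R0 I J)) ≈ 0#
   vanish0 = begin
    Σs Y (\I J -> ω I J * (A I * R0 I J))
     ≈⟨ Σs-cong Y (\ {I} {J} s -> trans (solve 6 (\w b t c p d -> w :* (b :* (t :* c :* p :* d)) := t :* c :* p :* (w :* (b :* d))) rfl _ _ _ _ _ _)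
        (*ʳ (*ˡ (∏-Spl a s)))) ⟩
    _
     ≈⟨ ∑-*ˡ _ (splits Y) _ ⟩
    _
     ≈⟨ trans (*ˡ ih)(zeroʳ _) ⟩
    0# ∎
   vanish1 : Σs Y (\I J -> ω I J * (A I * R1 I J)) ≈ 0#
   vanish1 = begin
    Σs Y (\I J -> ω I J * (A I * R1 I J))
     ≈⟨ Σs-cong Y (\ {I} {J} s -> trans (sym (*-assoc _ _ _))(trans (sym (∑-*ˡ _ (sels I) _))(Σl-cong I (\ {i} {I0} l ->
        trans (*ʳ (*-cong (ω-selˡ J l)(sym (A-↭ (Sel-↭ l)))))
         (trans (*ˡ (*ʳ (*ˡ (*ˡ (*ˡ (∏-cong J (\j -> a-cong (ℤP.+-comm j i))))))))
         (solve 11 (\r w f p b t c k q o d -> r :* w :* (f :* p :* b) :* (t :* c :* (k :* (q :* o)) :* d) := t :* c :* (f :* k) :* (p :* o :* (q :* r)) :* (w :* (b :* d))) rfl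
          _ _ _ _ _ _ _ _ _ _ _)))))) ⟩
    _
     ≈⟨ Σs-Σl-left Y G ⟩
    _
     ≈⟨ Σl-cong Y (\ {x} {Y0} l -> trans (Σs-cong Y0 (\ {I} {J} s -> *ʳ (*ˡ (*-cong (∏-Spl _ s)(∏-Spl _ s)))))
        (trans (∑-*ˡ _ (splits Y0) _)(trans (*ˡ (ih0 l))(zeroʳ _)))) ⟩
    _
     ≈⟨ ∑-0 (sels Y) ⟩
    0# ∎
    where
    G : ℤ -> List ℤ -> List ℤ -> Carrier
    G x I J = (1# - t) * (γ (y +' x) - 1#) * (φ x * φ (-' x)) * (∏ I (\z -> a (x +' z)) * ∏ J (\z -> a (x +' z)) * (∏ I (\z -> a (z -' x)) * ∏ J (\z -> a (z -' x)))) * (ω I J * (A I * weight I J))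

  D-zero : ∀ n Y -> length Y ≤ n -> Good Y -> D Y ≈ 0#
  D-zero n [] _ _ = solve 0 (:1 :* (:1 :* (:1 :- :1 :* :1 :* :1)) :+ :0 := :0) rfl
  D-zero (suc n)(y ∷ Y)(s≤s p) g = D-step y Y g (D-zero n Y p gY)
   (\ {x} {Y0} l -> D-zero n Y0 (ℕP.≤-trans (ℕP.n≤1+n _)(subst (_≤ n)(Sel-length l) p))(Good-tail {x} (Good-↭ (↭-sym (Sel-↭ l)) gY)))
   where gY = Good-tail {y} g

 -- The vanishing of `D`. In terms of the convolution below it reads A ⋆ alt = mon·(A ⋆ τ), the
 -- relation that drives the induction on the bound m.
 kawanaka : ∀ Y -> Good Y -> Σs Y (\I J -> ω I J * (A I * alt (length J))) ≈ mon Y * Σs Y (\I J -> ω I J * (A I * τ ^ length J))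
 kawanaka Y g = begin
  Σs Y (\I J -> ω I J * (A I * alt (length J)))
   ≈⟨ Σs-cong Y (\ {I} {J} s -> trans (solve 4 (\w b u v -> w :* (b :* u) := v :* (w :* (b :* :1)) :+ w :* (b :* (u :- v))) rfl (ω I J)(A I)(alt (length J))(mon I * mon J * τ ^ length J))
      (+ʳ (trans (*ʳ (*ʳ (∏-Spl mono s)))(solve 4 (\m z w b -> m :* z :* (w :* (b :* :1)) := m :* (w :* (b :* z))) rfl _ _ _ _)))) ⟩
  _
   ≈⟨ trans (∑-+ (splits Y) _ _)(+-cong (∑-*ˡ _ (splits Y) _)(D-zero (length Y) Y ℕP.≤-refl g)) ⟩
  _
   ≈⟨ +-identityʳ _ ⟩
  mon Y * Σs Y (\I J -> ω I J * (A I * τ ^ length J)) ∎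

 -- The convolution algebra and the bounded Littlewood identity.

 Fun : Set
 Fun = List ℤ -> Carrier

 infixl 7 _⋆_
 _⋆_ : Fun -> Fun -> Fun
 (f ⋆ g) Y = Σs Y (\I J -> ω I J * (f I * g J))

 infix 4 _≐_
 _≐_ : Fun -> Fun -> Set
 f ≐ g = ∀ Y -> Good Y -> f Y ≈ g Y

 ≐-trans : ∀ {f g h} -> f ≐ g -> g ≐ h -> f ≐ h
 ≐-trans p q Y gY = trans (p Y gY)(q Y gY)

 ≐-sym : ∀ {f g} -> f ≐ g -> g ≐ f
 ≐-sym p Y gY = sym (p Y gY)

 ⋆-cong : ∀ {f f' g g'} -> f ≐ f' -> g ≐ g' -> f ⋆ g ≐ f' ⋆ g'
 ⋆-cong p q Y gY = Σs-cong Y (\s -> *ˡ (*-cong (p _ (proj₁ (Good-Spl s gY)))(q _ (proj₂ (Good-Spl s gY)))))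

 ω-Splˡ : ∀ {I J X} K -> Spl I J X -> ω I K * ω J K ≈ ω X K
 ω-Splˡ K s = ∏-Spl _ s

 ω-Splʳ : ∀ {I J X} K -> Spl I J X -> ω K I * ω K J ≈ ω K X
 ω-Splʳ K s = trans (sym (∏-* K _ _))(∏-cong K (\k -> ∏-Spl _ s))

 -- `ω` is multiplicative in each argument, so both sides are sums over the cuts of Y into three
 -- with the same weight.
 ⋆-assoc : ∀ f g h -> (f ⋆ g) ⋆ h ≐ f ⋆ (g ⋆ h)
 ⋆-assoc f g h Y _ = begin
  Σs Y (\X K -> ω X K * (Σs X (\I J -> ω I J * (f I * g J)) * h K))
   ≈⟨ Σs-cong Y (\ {X} {K} _ -> trans (x*[y*z]≈y*[x*z] _ _ _)(trans (sym (∑-*ʳ _ (splits X) _))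
      (Σs-cong X (\ {I} {J} s -> trans (*ˡ (*ʳ (sym (ω-Splˡ K s))))
       (solve 6 (\w f g p q h -> w :* (f :* g) :* (p :* q :* h) := w :* p :* q :* (f :* g :* h)) rfl _ _ _ _ _ _))))) ⟩
  _
   ≈⟨ Σs-assoc Y (\I J K -> ω I J * ω I K * ω J K * (f I * g J * h K)) ⟩
  _
   ≈⟨ Σs-cong Y (\ {I} {X} _ -> trans (Σs-cong X (\ {J} {K} s -> trans (*ʳ (*ʳ (ω-Splʳ I s)))
       (solve 5 (\w p f g h -> w :* p :* (f :* g :* h) := w :* f :* (p :* (g :* h))) rfl _ _ _ _ _)))
      (trans (∑-*ˡ _ (splits X) _)(*-assoc _ _ _))) ⟩
  Σs Y (\I X -> ω I X * (f I * Σs X (\J K -> ω J K * (g J * h K)))) ∎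

 mon· : Fun -> Fun
 mon· f Y = mon Y * f Y

 mon·-⋆ : ∀ f g -> mon· (f ⋆ g) ≐ mon· f ⋆ mon· g
 mon·-⋆ f g Y _ = trans (sym (∑-*ˡ (mon Y)(splits Y) _))(Σs-cong Y (\ {I} {J} s ->
  trans (*ʳ (sym (∏-Spl mono s)))(solve 5 (\m n w f g -> m :* n :* (w :* (f :* g)) := w :* (m :* f :* (n :* g))) rfl _ _ _ _ _)))

 size : (ℕ -> Carrier) -> Fun
 size w Y = w (length Y)

 ⋆-size : ∀ w v -> size w ⋆ size v ≐ size (bin (\k l -> w k * v l))
 ⋆-size w v Y gY = Σω-size Y gY (\k l -> w k * v l)

 onesᶠ τᶠ altᶠ δᶠ : Fun
 onesᶠ = size (\_ -> 1#)
 τᶠ = size (τ ^_)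
 altᶠ = size alt

 δ0 : ℕ -> Carrier
 δ0 zero = 1#
 δ0 (suc _) = 0#
 δᶠ = size δ0

 -- χ k = (-τ; τ)_k
 χ : ℕ -> Carrier
 χ zero = 1#
 χ (suc k) = χ k * (1# + τ ^ suc k)

 τ^+ : ∀ k l -> τ ^ (k ℕ.+ l) ≈ τ ^ k * τ ^ l
 τ^+ zero l = sym (*-identityˡ _)
 τ^+ (suc k) l = trans (*ˡ (τ^+ k l))(sym (*-assoc _ _ _))

 t^≈ : ∀ k -> t ^ k ≈ τ ^ k * τ ^ k
 t^≈ zero = sym (*-identityˡ 1#)
 t^≈ (suc k) = trans (*-cong t≈ττ (t^≈ k))(solve 2 (\x y -> x :* x :* (y :* y) := x :* y :* (x :* y)) rfl τ (τ ^ k))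

 -- Because t = τ^2, one has t^k τ^(l+1) = τ^(n+1) τ^k for k + l = n; each step of the recursion
 -- thus produces the factor 1 + τ^(n+1), and χ = 1 ⋆ τ.
 bin-χ : ∀ n -> bin (\k l -> 1# * τ ^ l) n ≈ χ n
 bin-χ zero = *-identityˡ 1#
 bin-χ (suc n) = begin
  bin (\k l -> 1# * τ ^ l + t ^ k * (1# * τ ^ suc l)) n
   ≈⟨ bin-cong n (\k l e -> +ˡ (begin
      t ^ k * (1# * τ ^ suc l) ≈⟨ *ʳ (t^≈ k) ⟩
      _ ≈⟨ solve 3 (\x k l -> k :* k :* (:1 :* (x :* l)) := x :* (k :* l) :* (:1 :* k)) rfl τ (τ ^ k)(τ ^ l) ⟩
      _ ≈⟨ *ʳ (*ˡ (trans (sym (τ^+ k l))(reflexive (cong (τ ^_) e)))) ⟩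
      τ ^ suc n * (1# * τ ^ k) ∎)) ⟩
  bin (\k l -> 1# * τ ^ l + τ ^ suc n * (1# * τ ^ k)) n
   ≈⟨ trans (bin-+ n _ _)(+ˡ (trans (bin-* n (τ ^ suc n) _)(*ˡ (bin-sym n (\k l -> 1# * τ ^ l))))) ⟩
  bin (\k l -> 1# * τ ^ l) n + τ ^ suc n * bin (\k l -> 1# * τ ^ l) n
   ≈⟨ +-cong (bin-χ n)(*ˡ (bin-χ n)) ⟩
  χ n + τ ^ suc n * χ n
   ≈⟨ solve 2 (\c x -> c :+ x :* c := c :* (:1 :+ x)) rfl (χ n)(τ ^ suc n) ⟩
  χ (suc n) ∎

 -- Each step of the recursion collapses: (τ; t)_(k+1) τ^l + t^k (τ; t)_k τ^(l+1) = (τ; t)_k τ^l.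
 bin-one : ∀ n -> bin (\k l -> pochτ k * τ ^ l) n ≈ 1#
 bin-one zero = *-identityˡ 1#
 bin-one (suc n) = trans (bin-cong n (\k l _ -> solve 4 (\p x e z -> p :* (:1 :- x :* e) :* z :+ e :* (p :* (x :* z)) := p :* z) rfl (pochτ k) τ (t ^ k)(τ ^ l)))(bin-one n)

 -- Makes `altᶠ` a left inverse of `onesᶠ`; the two terms of a single step already cancel.
 bin-alt : ∀ n -> bin (\k l -> alt k * 1#) n ≈ δ0 n
 bin-alt zero = *-identityˡ 1#
 bin-alt (suc n) = trans (bin-cong n (\k l _ -> solve 2 (\e u -> (:- (e :* u)) :* :1 :+ e :* (u :* :1) := :0 :* :1) rfl (t ^ k)(alt k)))
  (trans (bin-* n 0# (\_ _ -> 1#))(zeroˡ _))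

 ω-[] : ∀ I -> ω I [] ≈ 1#
 ω-[] I = ∏-1 I

 ⋆-δ : ∀ f -> f ⋆ δᶠ ≐ f
 ⋆-δ f Y _ = trans (go Y (\I J -> ω I J * (f I * δ0 (length J)))(\I j J -> trans (*ˡ (zeroʳ _))(zeroʳ _)))
  (trans (*-cong (ω-[] Y)(*-identityʳ _))(*-identityˡ _))
  where
  go : ∀ Y F -> (∀ I j J -> F I (j ∷ J) ≈ 0#) -> Σs Y F ≈ F Y []
  go [] F z = Σs-[] F
  go (y ∷ Y) F z = trans (Σs-∷ y Y F)(trans (+-cong (go Y (\I J -> F (y ∷ I) J)(\I -> z (y ∷ I)))(∑-zero (splits Y)(\p -> z (proj₁ p) y (proj₂ p))))(+-identityʳ _))

 B : ℕ -> Fun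
 B m J = mon J ^ m * A (neg J)

 G : Fun
 G = A ⋆ τᶠ

 neg-cross : ∀ J I -> cross (neg J) I ≈ ω J I
 neg-cross J I = trans (∏-map _ J _)(∏-cong J (\j -> ∏-cong I (\i -> a-cong (ℤP.+-comm (-' j) i))))

 signed-⋆ : ∀ m -> signed m ≐ B m ⋆ A
 signed-⋆ m Y _ = Σs-cong Y (\ {J} {I} _ -> trans (*ˡ (A-++ (neg J) I))(trans (*ˡ (*ˡ (neg-cross J I)))
  (solve 4 (\m b c w -> m :* (b :* c :* w) := w :* (m :* b :* c)) rfl _ _ _ _)))

 -- `signed-sum` says that B 0 ⋆ A is (τ; t)_k, and convolving this with τ^l gives 1 by `bin-one`.
 B-⋆-G : onesᶠ ≐ B 0 ⋆ G
 B-⋆-G = ≐-sym (≐-trans (≐-sym (⋆-assoc (B 0) A τᶠ))(≐-trans (⋆-cong (≐-trans (≐-sym (signed-⋆ 0))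
   (\Y gY -> trans (Σs-cong Y (\_ -> *-identityˡ _))(signed-sum Y gY)))(\_ _ -> rfl))
  (≐-trans (⋆-size pochτ (τ ^_))(\Y _ -> bin-one (length Y)))))

 -- The relation A ⋆ alt = mon·G of `kawanaka`, multiplied by the inverse of `altᶠ`.
 mon·G-⋆-ones : mon· G ⋆ onesᶠ ≐ A
 mon·G-⋆-ones = ≐-trans (⋆-cong (\Y gY -> sym (kawanaka Y gY))(\_ _ -> rfl))
  (≐-trans (⋆-assoc A altᶠ onesᶠ)(≐-trans (⋆-cong {f = A} (\_ _ -> rfl)(≐-trans (⋆-size alt (\_ -> 1#))(\Y _ -> bin-alt (length Y))))(⋆-δ A)))

 mon·G-⋆-χ : mon· G ⋆ size χ ≐ G
 mon·G-⋆-χ = ≐-trans (⋆-cong {f = mon· G} (\_ _ -> rfl)(≐-sym (≐-trans (⋆-size (\_ -> 1#)(τ ^_))(\Y _ -> bin-χ (length Y)))))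
  (≐-trans (≐-sym (⋆-assoc (mon· G) onesᶠ τᶠ))(⋆-cong mon·G-⋆-ones (\_ _ -> rfl)))

 -- T m = Σ_λ ∏_{0≤i<m} (-τ;τ)_{m_i(λ)} P_λ over λ with λ₁ ≤ m; S m omits the factor with i = 0.
 T̂ S : ℕ -> Fun
 T̂ zero = onesᶠ
 T̂ (suc m) = mon· (T̂ m) ⋆ size χ
 S zero = onesᶠ
 S (suc m) = mon· (T̂ m) ⋆ onesᶠ

 mon·B : ∀ m -> mon· (B m) ≐ B (suc m)
 mon·B m Y _ = sym (*-assoc _ _ _)

 -- Induction on m: multiplication by `mon` raises B m to B (m + 1) and G to mon·G, and the
 -- convolution with χ restores G.
 T̂≐ : ∀ m -> T̂ m ≐ B m ⋆ G

 mon·T̂ : ∀ m -> mon· (T̂ m) ≐ B (suc m) ⋆ mon· G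
 mon·T̂ m = ≐-trans (\Y gY -> *ˡ (T̂≐ m Y gY))(≐-trans (mon·-⋆ (B m) G)(⋆-cong (mon·B m)(\_ _ -> rfl)))

 T̂≐ zero = B-⋆-G
 T̂≐ (suc m) = ≐-trans (⋆-cong (mon·T̂ m)(\_ _ -> rfl))(≐-trans (⋆-assoc (B (suc m))(mon· G)(size χ))(⋆-cong {f = B (suc m)} (\_ _ -> rfl) mon·G-⋆-χ))

 -- As in `T̂≐`, but the last factor is `onesᶠ` instead of χ, which turns mon·G into A.
 bounded-littlewood : ∀ m -> S (suc m) ≐ signed (suc m)
 bounded-littlewood m = ≐-trans (⋆-cong (mon·T̂ m)(\_ _ -> rfl))(≐-trans (⋆-assoc (B (suc m))(mon· G) onesᶠ)
  (≐-trans (⋆-cong {f = B (suc m)} (\_ _ -> rfl) mon·G-⋆-ones)(≐-sym (signed-⋆ (suc m)))))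

-- Partitions given by their columns.

hd : ∀ {m} -> Vec ℤ m -> ℤ
hd [] = 0'
hd (x ∷ _) = x

total : ∀ {m} -> Vec ℤ m -> ℤ
total [] = 0'
total (x ∷ xs) = x +' total xs

-- Since `hd` of the empty vector is 0, this includes nonnegativity of all entries.
Valid : ∀ {m} -> Vec ℤ m -> Set
Valid [] = ⊤
Valid (s ∷ ss) = hd ss ≤' s × Valid ss

valid? : ∀ {m} (s : Vec ℤ m) -> Dec (Valid s)
valid? [] = yes tt
valid? (s ∷ ss) with hd ss ℤP.≤? s | valid? ss
... | yes p | yes q = yes (p , q)
... | no ¬p | _ = no (\v -> ¬p (proj₁ v))
... | _ | no ¬q = no (\v -> ¬q (proj₂ v))

Valid⇒0≤hd : ∀ {m} (s : Vec ℤ m) -> Valid s -> 0' ≤' hd s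
Valid⇒0≤hd [] _ = ℤP.≤-refl
Valid⇒0≤hd (s ∷ ss)(p , v) = ℤP.≤-trans (Valid⇒0≤hd ss v) p

box : ℕ -> (m : ℕ) -> List (Vec ℤ m)
box B zero = [] ∷ []
box B (suc m) = concatMap (\s -> map (+ s ∷_)(box B m))(upTo (suc B))

-- Hall-Littlewood polynomials and t-binomial coefficients.

module Chain (𝓕 : Frame)(P : ℕ)(0<P : 0 < P) where
 open Bounded 𝓕 P public

 2P : ℤ
 2P = + (P ℕ.+ P)

 tp : ℤ -> Carrier
 tp k = mono (2P *' k)

 tp-+ : ∀ k l -> tp (k +' l) ≈ tp k * tp l
 tp-+ k l = trans (mono-cong (ℤP.*-distribˡ-+ 2P k l))(mono-+ _ _)

 tp-cong : ∀ {k l} -> k ≡ l -> tp k ≈ tp l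
 tp-cong e = reflexive (cong tp e)

 tp-0 : tp 0' ≈ 1#
 tp-0 = trans (mono-cong (ℤP.*-zeroʳ 2P)) mono-0

 tp-ℕ : ∀ k -> tp (+ k) ≈ t ^ k
 tp-ℕ zero = tp-0
 tp-ℕ (suc k) = trans (tp-+ 1' (+ k))(*-cong (mono-cong (ℤP.*-identityʳ 2P))(tp-ℕ k))

 2P≢0 : ∀ n -> 2P *' + suc n ≢ 0'
 2P≢0 n e with ℤP.i*j≡0⇒i≡0∨j≡0 2P e
 ... | inj₁ q = ℕP.<-irrefl (≡.sym (ℕP.m+n≡0⇒m≡0 P (ℤP.+-injective q))) 0<P
 ... | inj₂ ()

 -- (t; t)_k and its inverse, both set to 0 for k < 0. With this convention the inequalities between
 -- neighbouring columns need not be spelled out in sums: terms that violate them vanish.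
 qf iq : ℤ -> Carrier
 qf (+ zero) = 1#
 qf (+ suc n) = qf (+ n) * (1# - tp (+ suc n))
 qf -[1+ _ ] = 0#
 iq (+ zero) = 1#
 iq (+ suc n) = iq (+ n) * γ (2P *' + suc n)
 iq -[1+ _ ] = 0#

 qf-cong : ∀ {k l} -> k ≡ l -> qf k ≈ qf l
 qf-cong e = reflexive (cong qf e)

 iq-cong : ∀ {k l} -> k ≡ l -> iq k ≈ iq l
 iq-cong e = reflexive (cong iq e)

 iq-pred : ∀ k -> (1# - tp k) * iq k ≈ iq (k -' 1')
 iq-pred (+ zero) = trans (*ʳ (trans (+ˡ (-‿cong tp-0))(-‿inverseʳ 1#)))(zeroˡ _)
 iq-pred (+ suc n) = trans (x*[y*z]≈y*[x*z] _ _ _)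
  (trans (*ˡ (one-minus (2P≢0 n)))(*-identityʳ _))
 iq-pred -[1+ n ] = zeroʳ _

 iq-suc : ∀ k -> (1# - tp (k +' 1')) * iq (k +' 1') ≈ iq k
 iq-suc k = trans (iq-pred (k +' 1'))(iq-cong (lem k))
  where
  lem : ∀ k -> k +' 1' -' 1' ≡ k
  lem = ℤsolve

 qf-suc : ∀ {k} -> 0' ≤' k -> qf (k +' 1') ≈ qf k * (1# - tp (k +' 1'))
 qf-suc {+ n} _ = trans (qf-cong e)(*ˡ (+ˡ (-‿cong (tp-cong (≡.sym e)))))
  where
  e : + n +' 1' ≡ + suc n
  e = cong +_ (ℕP.+-comm n 1)

 qf-iq : ∀ n -> qf (+ n) * iq (+ n) ≈ 1#
 qf-iq zero = *-identityˡ 1#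
 qf-iq (suc n) = trans (x*y*[z*u]≈x*z*[y*u] _ _ _ _)
  (trans (*-cong (qf-iq n)(one-minus (2P≢0 n)))(*-identityˡ 1#))

 sign-cases : ∀ k -> 0' ≤' k ⊎ iq k ≈ 0#
 sign-cases (+ n) = inj₁ (ℤ.+≤+ z≤n)
 sign-cases -[1+ n ] = inj₂ rfl

 -- The t-binomial coefficient (t)_{k+l} / ((t)_k (t)_l), zero unless k, l ≥ 0.
 binom : ℤ -> ℤ -> Carrier
 binom k l = qf (k +' l) * iq k * iq l

 binom-cong : ∀ {k k' l l'} -> k ≡ k' -> l ≡ l' -> binom k l ≈ binom k' l'
 binom-cong p q = reflexive (cong₂ binom p q)

 binom-pascal : ∀ k l -> 0' ≤' k +' l -> binom (k +' 1') l ≈ binom (k +' 1')(l -' 1') + tp l * binom k l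
 binom-pascal k l nn = begin
  qf (k +' 1' +' l) * i1 * i2
   ≈⟨ *ʳ (*ʳ (trans (qf-cong (lem1 k l))(trans (qf-suc nn)(*ˡ (+ˡ (-‿cong (trans (tp-cong (lem2 k l))(tp-+ (k +' 1') l)))))))) ⟩
  _
   ≈⟨ solve 5 (\q x y a b -> q :* (:1 :- x :* y) :* a :* b := q :* a :* ((:1 :- y) :* b) :+ y :* (q :* ((:1 :- x) :* a) :* b)) rfl q (tp (k +' 1'))(tp l) i1 i2 ⟩
  _
   ≈⟨ +-cong (*-cong (*ʳ (qf-cong (lem3 k l)))(iq-pred l))(*ˡ (*ʳ (*ˡ (iq-suc k)))) ⟩
  binom (k +' 1')(l -' 1') + tp l * binom k l ∎
  where
  q = qf (k +' l)
  i1 = iq (k +' 1')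
  i2 = iq l
  lem1 : ∀ k l -> k +' 1' +' l ≡ k +' l +' 1'
  lem1 = ℤsolve
  lem2 : ∀ k l -> k +' l +' 1' ≡ (k +' 1') +' l
  lem2 = ℤsolve
  lem3 : ∀ k l -> k +' l ≡ k +' 1' +' (l -' 1')
  lem3 = ℤsolve

 binom-0ʳ : ∀ k -> 0' ≤' k -> binom k 0' ≈ 1#
 binom-0ʳ (+ n) _ = trans (*-identityʳ _)(trans (*ʳ (qf-cong (ℤP.+-identityʳ (+ n))))(qf-iq n))

 binom-negˡ : ∀ k l -> iq k ≈ 0# -> binom k l ≈ 0#
 binom-negˡ k l z = trans (*ʳ (trans (*ˡ z)(zeroʳ _)))(zeroˡ _)

 binom-negʳ : ∀ k l -> iq l ≈ 0# -> binom k l ≈ 0#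
 binom-negʳ k l z = trans (*ˡ z)(zeroʳ _)

 is : ℕ -> ℤ -> Carrier
 is n s with (+ n) ℤP.≟ s
 ... | yes _ = 1#
 ... | no _ = 0#

 is-yes : ∀ n -> is n (+ n) ≈ 1#
 is-yes n with (+ n) ℤP.≟ (+ n)
 ... | yes _ = rfl
 ... | no ¬p = contradiction refl ¬p

 is-no : ∀ {n s} -> + n ≢ s -> is n s ≈ 0#
 is-no {n} {s} ne with (+ n) ℤP.≟ s
 ... | yes p = contradiction p ne
 ... | no _ = rfl

 is-iff : ∀ {n n′ s s'} -> (+ n ≡ s -> + n′ ≡ s') -> (+ n′ ≡ s' -> + n ≡ s) -> is n s ≈ is n′ s'
 is-iff {n} {n′} {s} {s'} f g with (+ n) ℤP.≟ s | (+ n′) ℤP.≟ s'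
 ... | yes _ | yes _ = rfl
 ... | no _ | no _ = rfl
 ... | yes p | no ¬q = contradiction (f p) ¬q
 ... | no ¬p | yes q = contradiction (g q) ¬p

 is-subst : ∀ n s {x y} -> (+ n ≡ s -> x ≈ y) -> is n s * x ≈ is n s * y
 is-subst n s h with (+ n) ℤP.≟ s
 ... | yes p = *ˡ (h p)
 ... | no _ = trans (zeroˡ _)(sym (zeroˡ _))

 ∑-is : ∀ n B (f : ℤ -> Carrier) -> n ≤ B -> ∑ (upTo (suc B))(\s -> is n (+ s) * f (+ s)) ≈ f (+ n)
 ∑-is zero B f _ = trans (∑-upTo-suc B _)(trans (+-cong (trans (*ʳ (is-yes 0))(*-identityˡ _))
  (∑-zero (upTo B)(\s -> trans (*ʳ (is-no {0} {+ suc s} (\())))(zeroˡ _))))(+-identityʳ _))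
 ∑-is (suc n)(suc B) f (s≤s p) = trans (∑-upTo-suc (suc B) _)(trans (+-cong (trans (*ʳ (is-no {suc n} {+ 0} (\())))(zeroˡ _))
  (trans (∑-cong (upTo (suc B))(\s -> *ʳ (is-iff {suc n} {n} (\e -> cong +_ (ℕP.suc-injective (ℤP.+-injective e)))(\e -> cong +_ (cong suc (ℤP.+-injective e))))))
   (∑-is n B (\x -> f (1' +' x)) p)))(+-identityˡ _))

 ∑-box : ∀ B m (F : Vec ℤ (suc m) -> Carrier) -> ∑ (box B (suc m)) F ≈ ∑ (upTo (suc B))(\s -> ∑ (box B m)(\ss -> F (+ s ∷ ss)))
 ∑-box B m F = trans (∑-concatMap (\s -> map (+ s ∷_)(box B m))(upTo (suc B)) F)(∑-cong (upTo (suc B))(\s -> ∑-map (+ s ∷_)(box B m) F))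

 bin-is : ∀ n k -> bin (\a _ -> is a k) n ≈ binom (+ n -' k) k
 bin-is zero (+ zero) = trans (is-yes 0)(sym (binom-0ʳ 0' (ℤ.+≤+ z≤n)))
 bin-is zero (+ suc k) = trans (is-no {0} {+ suc k} (\()))(sym (binom-negˡ -[1+ k ] (+ suc k) rfl))
 bin-is zero -[1+ k ] = trans (is-no {0} { -[1+ k ]} (\()))(sym (binom-negʳ (+ suc k) -[1+ k ] rfl))
 bin-is (suc n) k = begin
  bin (\a _ -> is (suc a) k + t ^ a * is a k) n
   ≈⟨ bin-cong n (\a _ _ -> +-cong (is-iff {suc a} {a} {k} {k -' 1'} (\e -> ≡.trans (lem1 (+ a))(cong (_-' 1') e))(\e -> ≡.trans (cong (\z -> 1' +' z) e)(lem2 k)))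
      (trans (*-comm _ _)(trans (is-subst a k (\e -> trans (sym (tp-ℕ a))(tp-cong e)))(*-comm _ _)))) ⟩
  _
   ≈⟨ trans (bin-+ n _ _)(+-cong (bin-is n (k -' 1'))(trans (bin-* n (tp k) _)(*ˡ (bin-is n k)))) ⟩
  _
   ≈⟨ +ʳ (binom-cong (lem3 (+ n) k) refl) ⟩
  _
   ≈⟨ sym (binom-pascal (+ n -' k) k (subst (0' ≤'_)(lem4 (+ n) k)(ℤ.+≤+ z≤n))) ⟩
  _
   ≈⟨ binom-cong (≡.trans (lem5 (+ n) k) refl) refl ⟩
  binom (+ suc n -' k) k ∎
  where
  lem1 : ∀ a -> a ≡ 1' +' a -' 1'
  lem1 = ℤsolve
  lem2 : ∀ k -> 1' +' (k -' 1') ≡ k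
  lem2 = ℤsolve
  lem3 : ∀ n k -> n -' (k -' 1') ≡ n -' k +' 1'
  lem3 = ℤsolve
  lem4 : ∀ n k -> n ≡ n -' k +' k
  lem4 = ℤsolve
  lem5 : ∀ n k -> n -' k +' 1' ≡ (1' +' n) -' k
  lem5 = ℤsolve

 -- The Hall–Littlewood polynomial P_λ(Y; t), indexed by the column lengths of λ.
 Pc : ∀ {m} -> Vec ℤ m -> Fun
 Pc [] Y = 1#
 Pc (s ∷ ss) Y = Σs Y (\I J -> ω I J * (is (length I) s * (mon I * Pc ss I)))

 Σs-length : ∀ {I J : List ℤ} {Y} -> Spl I J Y -> + length J ≡ + length Y -' + length I
 Σs-length {I} {J} {Y} s = ≡.trans (lem (+ length I)(+ length J))(cong (_-' (+ length I))(cong +_ (Spl-length s)))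
  where
  lem : ∀ i j -> j ≡ i +' j -' i
  lem = ℤsolve

 -- The sets of size k that contain the subset chosen by the first column are counted by `Σω-size`
 -- on the complement of that subset; for no columns at all this is `Σω-size` itself.
 Pc-restrict : ∀ {m} (s : Vec ℤ m) k Y -> Good Y ->
  Σs Y (\I J -> ω I J * (is (length I) k * Pc s I)) ≈ binom (+ length Y -' k)(k -' hd s) * Pc s Y
 Pc-restrict [] k Y g = trans (Σs-cong Y (\_ -> *ˡ (*-identityʳ _)))(trans (Σω-size Y g (\a _ -> is a k))
  (trans (bin-is (length Y) k)(trans (binom-cong {+ length Y -' k} refl (≡.sym (ℤP.+-identityʳ k)))(sym (*-identityʳ _)))))
 Pc-restrict (s ∷ ss) k Y g = begin
  Σs Y (\X K -> ω X K * (is (length X) k * Pc (s ∷ ss) X))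
   ≈⟨ Σs-cong Y (\ {X} {K} _ -> trans (sym (*-assoc _ _ _))(trans (sym (∑-*ˡ _ (splits X) _))(Σs-cong X (\ {I} {J} sp ->
      trans (*ʳ (*-cong (sym (ω-Splˡ K sp))(trans (reflexive (cong (\n -> is n k)(≡.sym (Spl-length sp))))(is-iff {length I ℕ.+ length J} {length J} (fwd (length I)(length J))(bwd (length I)(length J))))))
       (solve 5 (\p q c w x -> p :* q :* c :* (w :* x) := w :* p :* x :* (q :* c)) rfl _ _ _ _ _))))) ⟩
  _
   ≈⟨ Σs-assoc Y (\I J K -> ω I J * ω I K * W I * (ω J K * is (length J)(k -' + length I))) ⟩
  _
   ≈⟨ Σs-cong Y (\ {I} {X} sp -> begin
      Σs X (\J K -> ω I J * ω I K * W I * (ω J K * is (length J)(k -' + length I)))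
       ≈⟨ trans (Σs-cong X (\ {J} {K} sp' -> *ʳ (*ʳ (ω-Splʳ I sp'))))(∑-*ˡ _ (splits X) _) ⟩
      _
       ≈⟨ *ˡ (trans (Σω-size X (proj₂ (Good-Spl sp g))(\a _ -> is a (k -' + length I)))(bin-is (length X)(k -' + length I))) ⟩
      _
       ≈⟨ *ˡ (binom-cong (≡.trans (cong (_-' (k -' + length I))(Σs-length sp))(lem (+ length Y) k (+ length I))) refl) ⟩
      _
       ≈⟨ solve 4 (\w i m b -> w :* (i :* m) :* b := w :* m :* (i :* b)) rfl _ _ _ _ ⟩
      _
       ≈⟨ *ˡ (is-subst (length I) s (\e -> binom-cong {+ length Y -' k} refl (cong (\z -> k -' z) e))) ⟩
      _
       ≈⟨ solve 4 (\w i m b -> w :* m :* (i :* b) := b :* (w :* (i :* m))) rfl _ _ _ _ ⟩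
      binom (+ length Y -' k)(k -' s) * (ω I X * W I) ∎) ⟩
  Σs Y (\I X -> binom (+ length Y -' k)(k -' s) * (ω I X * W I))
   ≈⟨ ∑-*ˡ _ (splits Y) _ ⟩
  binom (+ length Y -' k)(k -' s) * Pc (s ∷ ss) Y ∎
  where
  W : Fun
  W I = is (length I) s * (mon I * Pc ss I)
  fwd : ∀ i j -> + (i ℕ.+ j) ≡ k -> + j ≡ k -' + i
  fwd i j e = ≡.trans (l (+ i)(+ j))(cong (_-' (+ i)) e)
   where
   l : ∀ i j -> j ≡ i +' j -' i
   l = ℤsolve
  bwd : ∀ i j -> + j ≡ k -' + i -> + (i ℕ.+ j) ≡ k
  bwd i j e = ≡.trans (cong (\z -> + i +' z) e)(l (+ i) k)
   where
   l : ∀ i k -> i +' (k -' i) ≡ k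
   l = ℤsolve
  lem : ∀ y k i -> y -' i -' (k -' i) ≡ y -' k
  lem = ℤsolve

 -- The Pieri rule.

 -- The coefficient of P_λ in e_r P_μ, where s lists the columns of λ and v those of μ: the product
 -- of the t-binomial coefficients "λ'_i - λ'_(i+1) over λ'_i - μ'_i".
 Pi : ∀ {m} -> Vec ℤ (suc m) -> Vec ℤ m -> Carrier
 Pi (s ∷ []) [] = binom s 0'
 Pi (s ∷ ss@(_ ∷ _))(v ∷ vs) = binom (s -' v)(v -' hd ss) * Pi ss vs

 Pi-∷ : ∀ {m} s (ss : Vec ℤ (suc m)) v vs -> Pi (s ∷ ss)(v ∷ vs) ≈ binom (s -' v)(v -' hd ss) * Pi ss vs
 Pi-∷ s (_ ∷ _) v vs = rfl

 esym-ℤ : (ℤ -> Carrier) -> Fun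
 esym-ℤ g = esym (\k -> g (+ k))

 -- Both sides are expanded along a first column. On the left e_k splits over the subset I and its
 -- complement, the rule for one column fewer applies to I, the part of e_k on the complement
 -- enlarges I to X by `Σω-esym`, and `Pc-restrict` evaluates the sum over I inside X.
 pieri : ∀ {m} (v : Vec ℤ m)(g : ℤ -> Carrier) Y -> Good Y -> ∀ B -> length Y ≤ B ->
  esym-ℤ g Y * Pc v Y ≈ ∑ (box B (suc m))(\s -> g (total s -' total v) * Pi s v * Pc s Y)
 pieri [] g Y gY B Y≤B = sym (begin
  ∑ (box B 1)(\s -> g (total s -' 0') * Pi s [] * Pc s Y)
   ≈⟨ ∑-box B 0 _ ⟩
  _
   ≈⟨ ∑-cong (upTo (suc B))(\s -> trans (+-identityʳ _)(trans (*ʳ (trans (*-cong (reflexive (cong g (lem (+ s))))(binom-0ʳ (+ s)(ℤ.+≤+ z≤n)))(*-identityʳ _)))(sym (∑-*ˡ _ (splits Y) _)))) ⟩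
  _
   ≈⟨ ∑-swap (upTo (suc B))(splits Y) _ ⟩
  _
   ≈⟨ Σs-cong Y (\ {I} {J} sp -> trans (∑-cong (upTo (suc B))(\s -> solve 4 (\g w i m -> g :* (w :* (i :* (m :* :1))) := i :* (w :* (m :* g))) rfl _ _ _ _))
      (∑-is (length I) B (\x -> ω I J * (mon I * g x))(ℕP.≤-trans (subst (length I ≤_)(Spl-length sp)(ℕP.m≤m+n _ _)) Y≤B))) ⟩
  _
   ≈⟨ Σω-esym Y gY (\k -> g (+ k)) ⟩
  _
   ≈⟨ sym (*-identityʳ _) ⟩
  esym-ℤ g Y * 1# ∎)
  where
  lem : ∀ s -> s +' 0' -' 0' ≡ s
  lem = ℤsolve
 pieri {suc m} (v ∷ vs) g Y gY B Y≤B = trans left≈ (sym right≈)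
  where
  bx = box B (suc m)
  middle : Carrier
  middle = ∑ bx (\ss -> Pi ss vs * Σs Y (\X K -> ω X K * (mon X * (g (+ length X +' total ss -' (v +' total vs)) * (binom (+ length X -' v)(v -' hd ss) * Pc ss X)))))
  right≈ : ∑ (box B (suc (suc m)))(\s -> g (total s -' total (v ∷ vs)) * Pi s (v ∷ vs) * Pc s Y) ≈ middle
  right≈ = begin
   ∑ (box B (suc (suc m)))(\s -> g (total s -' total (v ∷ vs)) * Pi s (v ∷ vs) * Pc s Y)
    ≈⟨ trans (∑-box B (suc m) _)(∑-swap (upTo (suc B)) bx _) ⟩
   _
    ≈⟨ ∑-cong bx (\ss -> begin
       ∑ (upTo (suc B))(\s -> g (+ s +' total ss -' (v +' total vs)) * Pi (+ s ∷ ss)(v ∷ vs) * Pc (+ s ∷ ss) Y)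
        ≈⟨ ∑-cong (upTo (suc B))(\s -> trans (*ʳ (*ˡ (Pi-∷ (+ s) ss v vs)))(sym (∑-*ˡ _ (splits Y) _))) ⟩
       _
        ≈⟨ ∑-swap (upTo (suc B))(splits Y) _ ⟩
       _
        ≈⟨ Σs-cong Y (\ {X} {K} sp -> trans (∑-cong (upTo (suc B))(\s -> solve 7 (\g b p w i m c -> g :* (b :* p) :* (w :* (i :* (m :* c))) := i :* (p :* (w :* (m :* (g :* (b :* c)))))) rfl _ _ _ _ _ _ _))
          (∑-is (length X) B (\x -> Pi ss vs * (ω X K * (mon X * (g (x +' total ss -' (v +' total vs)) * (binom (x -' v)(v -' hd ss) * Pc ss X)))))
           (ℕP.≤-trans (subst (length X ≤_)(Spl-length sp)(ℕP.m≤m+n _ _)) Y≤B))) ⟩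
       _
        ≈⟨ ∑-*ˡ _ (splits Y) _ ⟩
       _ ∎) ⟩
   middle ∎
  gJ : List ℤ -> ℤ -> Carrier
  gJ J x = esym (\l -> g (x +' + l)) J
  Z : Vec ℤ (suc m) -> List ℤ -> List ℤ -> List ℤ -> Carrier
  Z ss I J K = ω I J * ω I K * ω J K * (is (length I) v * (mon I * mon J * (Pc ss I * g (total ss -' total vs +' + length J))))
  left≈ : esym-ℤ g Y * Pc (v ∷ vs) Y ≈ middle
  left≈ = begin
   esym-ℤ g Y * Pc (v ∷ vs) Y
    ≈⟨ sym (∑-*ˡ _ (splits Y) _) ⟩
   _
    ≈⟨ Σs-cong Y (\ {I} {X} sp -> begin
       esym-ℤ g Y * (ω I X * (is (length I) v * (mon I * Pc vs I)))
        ≈⟨ trans (*ʳ (esym-Spl sp (\k -> g (+ k))))(solve 5 (\e w i m p -> e :* (w :* (i :* (m :* p))) := w :* (i :* m) :* (e :* p)) rfl _ _ _ _ _) ⟩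
       _
        ≈⟨ *ˡ (pieri vs (gJ X) I (proj₁ (Good-Spl sp gY)) B (ℕP.≤-trans (subst (length I ≤_)(Spl-length sp)(ℕP.m≤m+n _ _)) Y≤B)) ⟩
       _
        ≈⟨ sym (∑-*ˡ _ bx _) ⟩
       _
        ≈⟨ ∑-cong bx (\ss -> begin
          ω I X * (is (length I) v * mon I) * (gJ X (total ss -' total vs) * Pi ss vs * Pc ss I)
           ≈⟨ *ˡ (*ʳ (*ʳ (sym (Σω-esym X (proj₂ (Good-Spl sp gY))(\l -> g (total ss -' total vs +' + l)))))) ⟩
          _
           ≈⟨ solve 5 (\w i s p c -> w :* i :* (s :* p :* c) := p :* (w :* i :* c :* s)) rfl _ _ _ _ _ ⟩
          _
           ≈⟨ *ˡ (trans (sym (∑-*ˡ _ (splits X) _))(Σs-cong X (\ {J} {K} sp' -> trans (*ʳ (*ʳ (*ʳ (sym (ω-Splʳ I sp')))))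
              (solve 8 (\p q i m c w n g -> p :* q :* (i :* m) :* c :* (w :* (n :* g)) := p :* q :* w :* (i :* (m :* n :* (c :* g)))) rfl _ _ _ _ _ _ _ _)))) ⟩
          Pi ss vs * Σs X (Z ss I) ∎) ⟩
       ∑ bx (\ss -> Pi ss vs * Σs X (Z ss I)) ∎) ⟩
   Σs Y (\I X -> ∑ bx (\ss -> Pi ss vs * Σs X (Z ss I)))
    ≈⟨ ∑-swap (splits Y) bx _ ⟩
   ∑ bx (\ss -> Σs Y (\I X -> Pi ss vs * Σs X (Z ss I)))
    ≈⟨ ∑-cong bx (\ss -> trans (∑-*ˡ _ (splits Y) _)(*ˡ (trans (sym (Σs-assoc Y (Z ss)))(Σs-cong Y (\ {X} {K} sp -> regroup ss X K (proj₁ (Good-Spl sp gY))))))) ⟩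
   middle ∎
   where
   lem : ∀ a b x v -> a -' b +' (x -' v) ≡ x +' a -' (v +' b)
   lem = ℤsolve
   regroup : ∀ ss X K -> Good X -> Σs X (\I J -> Z ss I J K) ≈ ω X K * (mon X * (g (+ length X +' total ss -' (v +' total vs)) * (binom (+ length X -' v)(v -' hd ss) * Pc ss X)))
   regroup ss X K gX = begin
    Σs X (\I J -> Z ss I J K)
     ≈⟨ Σs-cong X (\ {I} {J} sp -> trans (*ˡ (is-subst (length I) v (\e -> *-cong (∏-Spl mono sp)(*ˡ (reflexive (cong g (≡.trans (cong (\z -> total ss -' total vs +' z)(≡.trans (Σs-length sp)(cong (\z -> + length X -' z) e)))(lem (total ss)(total vs)(+ length X) v))))))))
        (trans (solve 7 (\w p q i m c g -> w :* p :* q :* (i :* (m :* (c :* g))) := p :* q :* (m :* g) :* (w :* (i :* c))) rfl _ _ _ _ _ _ _)(*ʳ (*ʳ (ω-Splˡ K sp))))) ⟩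
    _
     ≈⟨ trans (∑-*ˡ _ (splits X) _)(*ˡ (Pc-restrict ss v X gX)) ⟩
    _
     ≈⟨ solve 4 (\w m g b -> w :* (m :* g) :* b := w :* (m :* (g :* b))) rfl _ _ _ _ ⟩
    _ ∎

 -- The branching rule, deduced from the Pieri rule.

 up : (ℤ -> Carrier) -> ℤ -> Carrier
 up g k = g (1' +' k)

 private
  -- For fixed ρ and v, `l₀` and `l1` sum Pieri coefficients over u = v - θ, `r0` and `r1` over s =
  -- ρ + θ, with θ a vector of zeros and ones. The index is the first entry of θ, and g weighs |θ|.
  -- The summands factor column by column, hence the recursions.
  l₀ l1 r0 r1 : ∀ {m} -> Vec ℤ (suc m) -> Vec ℤ m -> (ℤ -> Carrier) -> Carrier
  l₀ (ρ ∷ []) [] g = binom ρ 0' * g 0'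
  l₀ (ρ ∷ ρs@(_ ∷ _))(v ∷ vs) g = binom (ρ -' v)(v -' hd ρs) * (l₀ ρs vs g + (1# - tp (v -' hd vs +' 1')) * l1 ρs vs g)
  l1 (ρ ∷ []) [] g = 0#
  l1 (ρ ∷ ρs@(_ ∷ _))(v ∷ vs) g = binom (ρ -' v +' 1')(v -' hd ρs -' 1') * (l₀ ρs vs (up g) + l1 ρs vs (up g))
  r0 (ρ ∷ []) [] g = binom ρ 0' * g 0'
  r0 (ρ ∷ ρs@(_ ∷ _))(v ∷ vs) g = binom (ρ -' v)(v -' hd ρs) * r0 ρs vs g
                  + binom (ρ -' v)(v -' hd ρs -' 1') * (1# - tp (ρ -' hd ρs)) * r1 ρs vs g
  r1 (ρ ∷ []) [] g = binom (ρ +' 1') 0' * g 1'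
  r1 (ρ ∷ ρs@(_ ∷ _))(v ∷ vs) g = binom (ρ -' v +' 1')(v -' hd ρs) * r0 ρs vs (up g)
                  + binom (ρ -' v +' 1')(v -' hd ρs -' 1') * r1 ρs vs (up g)

  σ : ∀ {m} -> Vec ℤ (suc m) -> Vec ℤ m -> (ℤ -> Carrier) -> Carrier
  σ ρ v g = l₀ ρ v g + l1 ρ v g

  vanish : ∀ k l -> k +' l ≡ 0' -> iq k * iq (l -' 1') ≈ 0#
  vanish -[1+ n ] l e = zeroˡ _
  vanish (+ n) l e = trans (*ˡ (iq-cong l-1≡))(zeroʳ _)
   where
   lem : ∀ k l -> l -' 1' ≡ (k +' l) -' (1' +' k)
   lem = ℤsolve
   l-1≡ : l -' 1' ≡ -[1+ n ]
   l-1≡ = ≡.trans (lem (+ n) l)(cong (_-' (1' +' + n)) e)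

  -- qf(k+l-1)(1 - t^{k+l}) = qf(k+l) fails only where iq k · iq (l-1) = 0.
  absorb : ∀ k l -> 0' ≤' k +' l -> binom k (l -' 1') * (1# - tp (k +' l)) ≈ binom k l * (1# - tp l)
  absorb k l nn = trans (*ʳ (*ʳ (*ʳ (qf-cong (lem1 k l)))))(trans (go (k +' l) nn refl)
    (sym (trans (solve 4 (\q i j x -> q :* i :* j :* x := q :* i :* (x :* j)) rfl _ _ _ _)(*ˡ (iq-pred l)))))
   where
   lem1 : ∀ k l -> k +' (l -' 1') ≡ k +' l -' 1'
   lem1 = ℤsolve
   go : ∀ s -> 0' ≤' s -> s ≡ k +' l -> qf (s -' 1') * iq k * iq (l -' 1') * (1# - tp s) ≈ qf s * iq k * iq (l -' 1')
   go (+ zero) _ e = trans (solve 4 (\q i j x -> q :* i :* j :* x := q :* (i :* j) :* x) rfl _ _ _ _)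
    (trans (*ʳ (trans (*ˡ (vanish k l (≡.sym e)))(zeroʳ _)))(trans (zeroˡ _)
     (sym (trans (*-assoc _ _ _)(trans (*ˡ (vanish k l (≡.sym e)))(zeroʳ _))))))
   go (+ suc n) _ e = solve 4 (\q i j x -> q :* i :* j :* x := q :* x :* i :* j) rfl _ _ _ _

  exchange : ∀ k l -> binom (k +' 1')(l -' 1') * (1# - tp (k +' 1')) ≈ binom k l * (1# - tp l)
  exchange k l = begin
   qf (k +' 1' +' (l -' 1')) * iq (k +' 1') * iq (l -' 1') * (1# - tp (k +' 1'))
    ≈⟨ trans (solve 4 (\q i j x -> q :* i :* j :* x := q :* (x :* i) :* j) rfl _ _ _ _)
       (*-cong (*-cong (qf-cong (lem k l))(iq-suc k))(sym (iq-pred l))) ⟩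
   _
    ≈⟨ solve 4 (\q i j x -> q :* i :* (x :* j) := q :* i :* j :* x) rfl _ _ _ _ ⟩
   binom k l * (1# - tp l) ∎
   where
   lem : ∀ k l -> k +' 1' +' (l -' 1') ≡ k +' l
   lem = ℤsolve

  -- The first equation is what is wanted: Pieri and branching steps commute. The second carries the
  -- induction, as the two together express `r0` and `r1` separately through σ and `l1`.
  transfer : ∀ {m} (ρ : Vec ℤ (suc m))(v : Vec ℤ m) -> Valid ρ -> ∀ g ->
   (r0 ρ v g + r1 ρ v g ≈ σ ρ v g + σ ρ v (up g)) × (r1 ρ v g ≈ σ ρ v (up g) + tp (hd ρ -' hd v +' 1') * l1 ρ v g)
  transfer (ρ ∷ []) [] (nn , _) g =
    trans (+ˡ (trans (*ʳ (binom-0ʳ (ρ +' 1')(ℤP.≤-trans nn (ℤP.i≤i+j ρ 1'))))(*ʳ (sym (binom-0ʳ ρ nn)))))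
     (+-cong (sym (+-identityʳ _))(sym (+-identityʳ _)))
   , trans (trans (*ʳ (binom-0ʳ (ρ +' 1')(ℤP.≤-trans nn (ℤP.i≤i+j ρ 1'))))(*ʳ (sym (binom-0ʳ ρ nn))))
     (sym (trans (+-cong (+-identityʳ _)(zeroʳ _))(+-identityʳ _)))
  transfer (ρ ∷ ρs@(ρ' ∷ _))(v ∷ vs)(ρ'≤ρ , val) g = sum≈ , second
   where
   α = ρ -' v
   β = v -' ρ'
   α' = ρ' -' hd vs
   b = binom α β
   b' = binom (α +' 1')(β -' 1')
   α+β : 0' ≤' α +' β
   α+β = subst (0' ≤'_)(lem ρ v ρ')(ℤP.i≤j⇒0≤j-i ρ'≤ρ)
    where
    lem : ∀ a b c -> a -' c ≡ a -' b +' (b -' c)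
    lem = ℤsolve
   g⁺ = up g
   s : (ℤ -> Carrier) -> Carrier
   s g = σ ρs vs g
   λ1 : (ℤ -> Carrier) -> Carrier
   λ1 g = l1 ρs vs g
   x = tp β
   x' = tp (α' +' 1')
   ih : ∀ g -> (r0 ρs vs g + r1 ρs vs g ≈ s g + s (up g)) × (r1 ρs vs g ≈ s (up g) + x' * λ1 g)
   ih g = transfer ρs vs val g
   r0' : ∀ g -> r0 ρs vs g ≈ s g - x' * λ1 g
   r0' g = begin
    r0 ρs vs g
     ≈⟨ solve 2 (\p q -> p := (p :+ q) :- q) rfl (r0 ρs vs g)(r1 ρs vs g) ⟩
    _
     ≈⟨ +-cong (proj₁ (ih g))(-‿cong (proj₂ (ih g))) ⟩
    _
     ≈⟨ solve 3 (\p q r -> p :+ q :- (q :+ r) := p :- r) rfl _ _ _ ⟩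
    s g - x' * λ1 g ∎
   ψ : tp (v -' hd vs +' 1') ≈ x * x'
   ψ = trans (tp-cong (lem v ρ' (hd vs)))(tp-+ β (α' +' 1'))
    where
    lem : ∀ v r w -> v -' w +' 1' ≡ v -' r +' (r -' w +' 1')
    lem = ℤsolve
   L0 : ∀ g -> l₀ (ρ ∷ ρs)(v ∷ vs) g ≈ b * (s g - x * x' * λ1 g)
   L0 g = *ˡ (trans (+ˡ (*ʳ (+ˡ (-‿cong ψ))))(solve 3 (\p l z -> p :+ (:1 :- z) :* l := p :+ l :- z :* l) rfl (l₀ ρs vs g)(λ1 g)(x * x')))
   R0 : r0 (ρ ∷ ρs)(v ∷ vs) g ≈ b * (s g - x' * λ1 g) + b * (1# - x) * (s g⁺ + x' * λ1 g)
   R0 = +-cong (*ˡ (r0' g))(*-cong (trans (*ˡ (+ˡ (-‿cong (tp-cong (lem ρ v ρ')))))(absorb α β α+β))(proj₂ (ih g)))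
    where
    lem : ∀ a b c -> a -' c ≡ a -' b +' (b -' c)
    lem = ℤsolve
   R1 : r1 (ρ ∷ ρs)(v ∷ vs) g ≈ b' * (s g⁺ + s (up g⁺)) + x * b * (s g⁺ - x' * λ1 g⁺)
   R1 = begin
    binom (α +' 1') β * r0 ρs vs g⁺ + b' * r1 ρs vs g⁺
     ≈⟨ +ʳ (*ʳ (binom-pascal α β α+β)) ⟩
    _
     ≈⟨ solve 4 (\b c p q -> (b :+ c) :* p :+ b :* q := b :* (p :+ q) :+ c :* p) rfl b' (x * b) _ _ ⟩
    _
     ≈⟨ +-cong (*ˡ (proj₁ (ih g⁺)))(*ˡ (r0' g⁺)) ⟩
    b' * (s g⁺ + s (up g⁺)) + x * b * (s g⁺ - x' * λ1 g⁺) ∎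
   second : r1 (ρ ∷ ρs)(v ∷ vs) g ≈ σ (ρ ∷ ρs)(v ∷ vs) g⁺ + tp (α +' 1') * l1 (ρ ∷ ρs)(v ∷ vs) g
   second = begin
    r1 (ρ ∷ ρs)(v ∷ vs) g
     ≈⟨ R1 ⟩
    _
     ≈⟨ solve 7 (\c p q x b y l -> c :* (p :+ q) :+ x :* b :* (p :- y :* l) := b :* (p :- x :* y :* l) :+ c :* q :+ (c :* p :+ :- (b :* (:1 :- x) :* p))) rfl b' (s g⁺)(s (up g⁺)) x b x' (λ1 g⁺) ⟩
    _
     ≈⟨ +-cong (+ʳ (sym (L0 g⁺)))(+ˡ (-‿cong (*ʳ (sym (exchange α β))))) ⟩
    _
     ≈⟨ solve 5 (\p q c z s -> p :+ q :+ (c :* s :+ :- (c :* (:1 :- z) :* s)) := p :+ q :+ z :* (c :* s)) rfl _ _ _ _ _ ⟩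
    l₀ (ρ ∷ ρs)(v ∷ vs) g⁺ + b' * s (up g⁺) + tp (α +' 1') * (b' * s g⁺) ∎
   sum≈ : r0 (ρ ∷ ρs)(v ∷ vs) g + r1 (ρ ∷ ρs)(v ∷ vs) g ≈ σ (ρ ∷ ρs)(v ∷ vs) g + σ (ρ ∷ ρs)(v ∷ vs) g⁺
   sum≈ = begin
    r0 (ρ ∷ ρs)(v ∷ vs) g + r1 (ρ ∷ ρs)(v ∷ vs) g
     ≈⟨ +-cong R0 R1 ⟩
    _
     ≈⟨ solve 9 (\b p y l x q c r k -> b :* (p :- y :* l) :+ b :* (:1 :- x) :* (q :+ y :* l) :+ (c :* (q :+ r) :+ x :* b :* (q :- y :* k))
        := (b :* (p :- x :* y :* l) :+ c :* q) :+ (b :* (q :- x :* y :* k) :+ c :* r)) rfl b (s g) x' (λ1 g) x (s g⁺) b' (s (up g⁺))(λ1 g⁺) ⟩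
    _
     ≈⟨ +-cong (+ʳ (sym (L0 g)))(+ʳ (sym (L0 g⁺))) ⟩
    σ (ρ ∷ ρs)(v ∷ vs) g + σ (ρ ∷ ρs)(v ∷ vs) g⁺ ∎

 Br0 Br1 : ∀ {m} -> ℤ -> Vec ℤ m -> (Vec ℤ m -> Carrier) -> Carrier
 Br0 e [] F = F []
 Br0 e (s ∷ ss) F = Br0 e ss (\u -> F (s ∷ u)) + (1# - tp (s -' hd ss +' 1')) * Br1 e ss (\u -> F (s ∷ u))
 Br1 e [] F = 0#
 Br1 e (s ∷ ss) F = mono e * (Br0 e ss (\u -> F (s -' 1' ∷ u)) + Br1 e ss (\u -> F (s -' 1' ∷ u)))

 -- Σ_θ ψ y^{|θ|} F(s - θ) over θ ∈ {0,1}^m, split according to the first entry of θ; here y = h^e.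
 Br : ∀ {m} -> ℤ -> Vec ℤ m -> (Vec ℤ m -> Carrier) -> Carrier
 Br e s F = Br0 e s F + Br1 e s F

 Br0-cong : ∀ {m} e (s : Vec ℤ m) {F G} -> (∀ u -> hd u ≡ hd s -> F u ≈ G u) -> Br0 e s F ≈ Br0 e s G
 Br1-cong : ∀ {m} e (s : Vec ℤ m) {F G} -> (∀ u -> hd u ≡ hd s -' 1' -> F u ≈ G u) -> Br1 e s F ≈ Br1 e s G
 Br0-cong e [] h = h [] refl
 Br0-cong e (s ∷ ss) h = +-cong (Br0-cong e ss (\u _ -> h (s ∷ u) refl))(*ˡ (Br1-cong e ss (\u _ -> h (s ∷ u) refl)))
 Br1-cong e [] h = rfl
 Br1-cong e (s ∷ ss) h = *ˡ (+-cong (Br0-cong e ss (\u _ -> h (s -' 1' ∷ u) refl))(Br1-cong e ss (\u _ -> h (s -' 1' ∷ u) refl)))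

 Br0-* : ∀ {m} e (s : Vec ℤ m) x F -> Br0 e s (\u -> x * F u) ≈ x * Br0 e s F
 Br1-* : ∀ {m} e (s : Vec ℤ m) x F -> Br1 e s (\u -> x * F u) ≈ x * Br1 e s F
 Br0-* e [] x F = rfl
 Br0-* e (s ∷ ss) x F = trans (+-cong (Br0-* e ss x _)(*ˡ (Br1-* e ss x _)))(x*y+z*[x*u]≈x*[y+z*u] _ _ _ _)
 Br1-* e [] x F = sym (zeroʳ x)
 Br1-* e (s ∷ ss) x F = trans (*ˡ (+-cong (Br0-* e ss x _)(Br1-* e ss x _)))(z*[x*y+x*u]≈x*[z*[y+u]] _ _ _ _)

 Br-cong : ∀ {m} e (s : Vec ℤ m) {F G} -> (∀ u -> F u ≈ G u) -> Br e s F ≈ Br e s G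
 Br-cong e s h = +-cong (Br0-cong e s (\u _ -> h u))(Br1-cong e s (\u _ -> h u))

 Br-* : ∀ {m} e (s : Vec ℤ m) x F -> Br e s (\u -> x * F u) ≈ x * Br e s F
 Br-* e s x F = trans (+-cong (Br0-* e s x F)(Br1-* e s x F))(sym (distribˡ _ _ _))

 module _ {A : Set} where
  Br0-∑ : ∀ {m} e (s : Vec ℤ m) xs (F : A -> Vec ℤ m -> Carrier) -> Br0 e s (\u -> ∑ xs (\x -> F x u)) ≈ ∑ xs (\x -> Br0 e s (F x))
  Br1-∑ : ∀ {m} e (s : Vec ℤ m) xs (F : A -> Vec ℤ m -> Carrier) -> Br1 e s (\u -> ∑ xs (\x -> F x u)) ≈ ∑ xs (\x -> Br1 e s (F x))
  Br0-∑ e [] xs F = rfl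
  Br0-∑ e (s ∷ ss) xs F = trans (+-cong (Br0-∑ e ss xs (\x u -> F x (s ∷ u)))(trans (*ˡ (Br1-∑ e ss xs (\x u -> F x (s ∷ u))))(sym (∑-*ˡ _ xs _))))(sym (∑-+ xs _ _))
  Br1-∑ e [] xs F = sym (∑-0 xs)
  Br1-∑ e (s ∷ ss) xs F = trans (*ˡ (trans (+-cong (Br0-∑ e ss xs (\x u -> F x (s -' 1' ∷ u)))(Br1-∑ e ss xs (\x u -> F x (s -' 1' ∷ u))))(sym (∑-+ xs _ _))))(sym (∑-*ˡ _ xs _))

  Br-∑ : ∀ {m} e (s : Vec ℤ m) xs (F : A -> Vec ℤ m -> Carrier) -> Br e s (\u -> ∑ xs (\x -> F x u)) ≈ ∑ xs (\x -> Br e s (F x))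
  Br-∑ e s xs F = trans (+-cong (Br0-∑ e s xs F)(Br1-∑ e s xs F))(sym (∑-+ xs _ _))

 private
  -- The adjoint of Br, a sum over s = ρ + θ.
  U0 U1 : ∀ {m} -> ℤ -> Vec ℤ m -> (Vec ℤ m -> Carrier) -> Carrier
  U0 e [] K = K []
  U0 e (ρ ∷ ρs) K = U0 e ρs (\s -> K (ρ ∷ s)) + (1# - tp (ρ -' hd ρs)) * U1 e ρs (\s -> K (ρ ∷ s))
  U1 e [] K = 0#
  U1 e (ρ ∷ ρs) K = mono e * (U0 e ρs (\s -> K (ρ +' 1' ∷ s)) + U1 e ρs (\s -> K (ρ +' 1' ∷ s)))

  U0-cong : ∀ {m} e (ρ : Vec ℤ m) {F G} -> (∀ u -> hd u ≡ hd ρ -> F u ≈ G u) -> U0 e ρ F ≈ U0 e ρ G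
  U1-cong : ∀ {m} e (ρ : Vec ℤ m) {F G} -> (∀ u -> hd u ≡ hd ρ +' 1' -> F u ≈ G u) -> U1 e ρ F ≈ U1 e ρ G
  U0-cong e [] h = h [] refl
  U0-cong e (s ∷ ss) h = +-cong (U0-cong e ss (\u _ -> h (s ∷ u) refl))(*ˡ (U1-cong e ss (\u _ -> h (s ∷ u) refl)))
  U1-cong e [] h = rfl
  U1-cong e (s ∷ ss) h = *ˡ (+-cong (U0-cong e ss (\u _ -> h (s +' 1' ∷ u) refl))(U1-cong e ss (\u _ -> h (s +' 1' ∷ u) refl)))

  U0-* : ∀ {m} e (s : Vec ℤ m) x F -> U0 e s (\u -> x * F u) ≈ x * U0 e s F
  U1-* : ∀ {m} e (s : Vec ℤ m) x F -> U1 e s (\u -> x * F u) ≈ x * U1 e s F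
  U0-* e [] x F = rfl
  U0-* e (s ∷ ss) x F = trans (+-cong (U0-* e ss x _)(*ˡ (U1-* e ss x _)))(x*y+z*[x*u]≈x*[y+z*u] _ _ _ _)
  U1-* e [] x F = sym (zeroʳ x)
  U1-* e (s ∷ ss) x F = trans (*ˡ (+-cong (U0-* e ss x _)(U1-* e ss x _)))(z*[x*y+x*u]≈x*[z*[y+u]] _ _ _ _)

  pull : ∀ {c b b' p} -> b ≈ b' -> c * (b * p) ≈ b' * (c * p)
  pull {c} {b} {b'} {p} h = trans (*ˡ (*ʳ h))(x*[y*z]≈y*[x*z] c b' p)

  U0-factor : ∀ {m} e (ρ : Vec ℤ m) b F G -> (∀ u -> hd u ≡ hd ρ -> F u ≈ b * G u) -> U0 e ρ F ≈ b * U0 e ρ G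
  U0-factor e ρ b F G h = trans (U0-cong e ρ h)(U0-* e ρ b G)

  U1-factor : ∀ {m} e (ρ : Vec ℤ m) b F G -> (∀ u -> hd u ≡ hd ρ +' 1' -> F u ≈ b * G u) -> U1 e ρ F ≈ b * U1 e ρ G
  U1-factor e ρ b F G h = trans (U1-cong e ρ h)(U1-* e ρ b G)

  -- Vectors just outside the box: where F vanishes on them, a summation variable may be shifted by
  -- one.
  data Out (B : ℕ) : ∀ {m} -> Vec ℤ m -> Set where
   low : ∀ {m} {ss : Vec ℤ m} -> Out B (-1ℤ ∷ ss)
   high : ∀ {m} {ss : Vec ℤ m} -> Out B (+ B ∷ ss)
   later : ∀ {m s} {ss : Vec ℤ m} -> Out B ss -> Out B (s ∷ ss)

  ∑-shift : ∀ B (f : ℤ -> ℤ -> Carrier) -> (∀ x -> f -1ℤ x ≈ 0#) -> (∀ x -> f (+ B) x ≈ 0#) ->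
   ∑ (upTo (suc B))(\s -> f (+ s -' 1')(+ s)) ≈ ∑ (upTo (suc B))(\s -> f (+ s)(+ s +' 1'))
  ∑-shift B f z1 z2 = begin
   ∑ (upTo (suc B))(\s -> f (+ s -' 1')(+ s))
    ≈⟨ ∑-upTo-suc B _ ⟩
   _
    ≈⟨ +-cong (z1 0')(∑-cong (upTo B)(\s -> reflexive (cong (f (+ s))(cong +_ (ℕP.+-comm 1 s))))) ⟩
   _
    ≈⟨ +-comm _ _ ⟩
   _
    ≈⟨ +ˡ (sym (z2 _)) ⟩
   _
    ≈⟨ sym (∑-upTo-last B _) ⟩
   ∑ (upTo (suc B))(\s -> f (+ s)(+ s +' 1')) ∎

  reindex0 : ∀ {m} e B (K F : Vec ℤ m -> Carrier) -> (∀ {s} -> Out B s -> F s ≈ 0#) ->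
   ∑ (box B m)(\s -> K s * Br0 e s F) ≈ ∑ (box B m)(\ ρ -> F ρ * U0 e ρ K)
  reindex1 : ∀ {m} e B (K F : Vec ℤ m -> Carrier) -> (∀ {s} -> Out B s -> F s ≈ 0#) ->
   ∑ (box B m)(\s -> K s * Br1 e s F) ≈ ∑ (box B m)(\ ρ -> F ρ * U1 e ρ K)
  reindex0 {zero} e B K F out = +ʳ (*-comm _ _)
  reindex0 {suc m} e B K F out = trans (∑-box B m _)(trans (∑-cong (upTo (suc B)) row)(sym (∑-box B m _)))
   where
   row : ∀ s -> ∑ (box B m)(\ss -> K (+ s ∷ ss) * Br0 e (+ s ∷ ss) F) ≈ ∑ (box B m)(\ ρs -> F (+ s ∷ ρs) * U0 e (+ s ∷ ρs) K)
   row s = begin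
    ∑ (box B m)(\ss -> Kₛ ss * (Br0 e ss Fₛ + (1# - tp (+ s -' hd ss +' 1')) * Br1 e ss Fₛ))
     ≈⟨ trans (∑-cong (box B m)(\ss -> solve 4 (\k p c q -> k :* (p :+ c :* q) := k :* p :+ (c :* k) :* q) rfl _ _ _ _))(∑-+ (box B m) _ _) ⟩
    _
     ≈⟨ +-cong (reindex0 e B Kₛ Fₛ (\o -> out (later o)))(reindex1 e B _ Fₛ (\o -> out (later o))) ⟩
    _
     ≈⟨ sym (∑-+ (box B m) _ _) ⟩
    _
     ≈⟨ ∑-cong (box B m)(\ ρs -> trans (+ˡ (*ˡ (trans (U1-cong e ρs (\u eq -> *ʳ (+ˡ (-‿cong (tp-cong (≡.trans (cong (\z -> + s -' z +' 1') eq)(lem (+ s)(hd ρs))))))))(U1-* e ρs _ Kₛ))))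
        (sym (distribˡ _ _ _))) ⟩
    ∑ (box B m)(\ ρs -> Fₛ ρs * U0 e (+ s ∷ ρs) K) ∎
    where
    Kₛ Fₛ : Vec ℤ m -> Carrier
    Kₛ ss = K (+ s ∷ ss)
    Fₛ ss = F (+ s ∷ ss)
    lem : ∀ s h -> s -' (h +' 1') +' 1' ≡ s -' h
    lem = ℤsolve
  reindex1 {zero} e B K F out = +ʳ (trans (zeroʳ _)(sym (zeroʳ _)))
  reindex1 {suc m} e B K F out = begin
   ∑ (box B (suc m))(\s -> K s * Br1 e s F)
    ≈⟨ trans (∑-box B m _)(∑-cong (upTo (suc B))(\s -> row (+ s -' 1')(+ s))) ⟩
   _
    ≈⟨ ∑-shift B f (\x -> ∑-zero (box B m)(\ ρs -> trans (*ʳ (out low))(zeroˡ _)))(\x -> ∑-zero (box B m)(\ ρs -> trans (*ʳ (out high))(zeroˡ _))) ⟩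
   _
    ≈⟨ sym (∑-box B m _) ⟩
   ∑ (box B (suc m))(\ ρ -> F ρ * U1 e ρ K) ∎
   where
   f : ℤ -> ℤ -> Carrier
   f x s = ∑ (box B m)(\ ρs -> F (x ∷ ρs) * (mono e * (U0 e ρs (\ss -> K (s ∷ ss)) + U1 e ρs (\ss -> K (s ∷ ss)))))
   row : ∀ x s -> ∑ (box B m)(\ss -> K (s ∷ ss) * (mono e * (Br0 e ss (\u -> F (x ∷ u)) + Br1 e ss (\u -> F (x ∷ u))))) ≈ f x s
   row x s = begin
    ∑ (box B m)(\ss -> K (s ∷ ss) * (mono e * (Br0 e ss Fₓ + Br1 e ss Fₓ)))
     ≈⟨ trans (∑-cong (box B m)(\ss -> solve 4 (\k y p q -> k :* (y :* (p :+ q)) := y :* (k :* p :+ k :* q)) rfl _ _ _ _))(∑-*ˡ _ (box B m) _) ⟩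
    _
     ≈⟨ *ˡ (trans (∑-+ (box B m) _ _)(trans (+-cong (reindex0 e B Kₛ Fₓ (\o -> out (later o)))(reindex1 e B Kₛ Fₓ (\o -> out (later o))))(sym (∑-+ (box B m) _ _)))) ⟩
    _
     ≈⟨ trans (sym (∑-*ˡ _ (box B m) _))(∑-cong (box B m)(\ ρs -> solve 4 (\k y p q -> y :* (k :* p :+ k :* q) := k :* (y :* (p :+ q))) rfl _ _ _ _)) ⟩
    f x s ∎
    where
    Kₛ Fₓ : Vec ℤ m -> Carrier
    Kₛ ss = K (s ∷ ss)
    Fₓ ss = F (x ∷ ss)

  weights : ℤ -> (ℤ -> Carrier) -> ℤ -> Carrier
  weights e c k = mono (e *' k) * c k

  l0-cong : ∀ {m} (ρ : Vec ℤ (suc m)) v {g h} -> (∀ k -> g k ≈ h k) -> l₀ ρ v g ≈ l₀ ρ v h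
  l1-cong : ∀ {m} (ρ : Vec ℤ (suc m)) v {g h} -> (∀ k -> g k ≈ h k) -> l1 ρ v g ≈ l1 ρ v h
  l0-cong (ρ ∷ []) [] p = *ˡ (p 0')
  l0-cong (ρ ∷ ρs@(_ ∷ _))(v ∷ vs) p = *ˡ (+-cong (l0-cong ρs vs p)(*ˡ (l1-cong ρs vs p)))
  l1-cong (ρ ∷ []) [] p = rfl
  l1-cong (ρ ∷ ρs@(_ ∷ _))(v ∷ vs) p = *ˡ (+-cong (l0-cong ρs vs (\k -> p _))(l1-cong ρs vs (\k -> p _)))

  r0-cong : ∀ {m} (ρ : Vec ℤ (suc m)) v {g h} -> (∀ k -> g k ≈ h k) -> r0 ρ v g ≈ r0 ρ v h
  r1-cong : ∀ {m} (ρ : Vec ℤ (suc m)) v {g h} -> (∀ k -> g k ≈ h k) -> r1 ρ v g ≈ r1 ρ v h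
  r0-cong (ρ ∷ []) [] p = *ˡ (p 0')
  r0-cong (ρ ∷ ρs@(_ ∷ _))(v ∷ vs) p = +-cong (*ˡ (r0-cong ρs vs p))(*ˡ (r1-cong ρs vs p))
  r1-cong (ρ ∷ []) [] p = *ˡ (p 1')
  r1-cong (ρ ∷ ρs@(_ ∷ _))(v ∷ vs) p = +-cong (*ˡ (r0-cong ρs vs (\k -> p _)))(*ˡ (r1-cong ρs vs (\k -> p _)))

  l0-* : ∀ {m} (ρ : Vec ℤ (suc m)) v x g -> l₀ ρ v (\k -> x * g k) ≈ x * l₀ ρ v g
  l1-* : ∀ {m} (ρ : Vec ℤ (suc m)) v x g -> l1 ρ v (\k -> x * g k) ≈ x * l1 ρ v g
  l0-* (ρ ∷ []) [] x g = x*[y*z]≈y*[x*z] _ _ _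
  l0-* (ρ ∷ ρs@(_ ∷ _))(v ∷ vs) x g = trans (*ˡ (+-cong (l0-* ρs vs x g)(*ˡ (l1-* ρs vs x g))))(solve 5 (\b x p c q -> b :* (x :* p :+ c :* (x :* q)) := x :* (b :* (p :+ c :* q))) rfl _ _ _ _ _)
  l1-* (ρ ∷ []) [] x g = sym (zeroʳ x)
  l1-* (ρ ∷ ρs@(_ ∷ _))(v ∷ vs) x g = trans (*ˡ (+-cong (l0-* ρs vs x _)(l1-* ρs vs x _)))(solve 4 (\b x p q -> b :* (x :* p :+ x :* q) := x :* (b :* (p :+ q))) rfl _ _ _ _)

  r0-* : ∀ {m} (ρ : Vec ℤ (suc m)) v x g -> r0 ρ v (\k -> x * g k) ≈ x * r0 ρ v g
  r1-* : ∀ {m} (ρ : Vec ℤ (suc m)) v x g -> r1 ρ v (\k -> x * g k) ≈ x * r1 ρ v g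
  r0-* (ρ ∷ []) [] x g = x*[y*z]≈y*[x*z] _ _ _
  r0-* (ρ ∷ ρs@(_ ∷ _))(v ∷ vs) x g = trans (+-cong (*ˡ (r0-* ρs vs x g))(*ˡ (r1-* ρs vs x g)))(x*[y*z]+u*[y*v]≈y*[x*z+u*v] _ _ _ _ _)
  r1-* (ρ ∷ []) [] x g = x*[y*z]≈y*[x*z] _ _ _
  r1-* (ρ ∷ ρs@(_ ∷ _))(v ∷ vs) x g = trans (+-cong (*ˡ (r0-* ρs vs x _))(*ˡ (r1-* ρs vs x _)))(x*[y*z]+u*[y*v]≈y*[x*z+u*v] _ _ _ _ _)

  up-weights : ∀ e c k -> mono e * weights e (\j -> c (1' +' j)) k ≈ up (weights e c) k
  up-weights e c k = trans (sym (*-assoc _ _ _))(*ʳ (trans (sym (mono-+ e (e *' k)))(mono-cong (lem e k))))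
   where
   lem : ∀ e k -> e +' e *' k ≡ e *' (1' +' k)
   lem = ℤsolve

  weight-0 : ∀ e c -> weights e c 0' ≈ c 0'
  weight-0 e c = trans (*ʳ (trans (mono-cong (ℤP.*-zeroʳ e)) mono-0))(*-identityˡ _)

  Br0-l : ∀ {m} e (ρ : Vec ℤ (suc m)) v (c : ℤ -> Carrier) -> Br0 e v (\u -> c (total u) * Pi ρ u) ≈ l₀ ρ v (weights e (\k -> c (total v -' k)))
  Br1-l : ∀ {m} e (ρ : Vec ℤ (suc m)) v (c : ℤ -> Carrier) -> Br1 e v (\u -> c (total u) * Pi ρ u) ≈ l1 ρ v (weights e (\k -> c (total v -' k)))
  Br0-l e (ρ ∷ []) [] c = trans (*-comm _ _)(*ˡ (sym (weight-0 e (\k -> c (0' -' k)))))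
  Br0-l e (ρ ∷ ρs@(_ ∷ _))(v ∷ vs) c = begin
   Br0 e vs F + (1# - tp (v -' hd vs +' 1')) * Br1 e vs F
    ≈⟨ +-cong (trans (trans (Br0-cong e vs (\u _ -> x*[y*z]≈y*[x*z] _ _ _))(Br0-* e vs b _))(*ˡ (trans (Br0-l e ρs vs (\x -> c (v +' x)))(l0-cong ρs vs shift))))
       (*ˡ (trans (trans (Br1-cong e vs (\u _ -> x*[y*z]≈y*[x*z] _ _ _))(Br1-* e vs b _))(*ˡ (trans (Br1-l e ρs vs (\x -> c (v +' x)))(l1-cong ρs vs shift))))) ⟩
   _
    ≈⟨ x*y+z*[x*u]≈x*[y+z*u] _ _ _ _ ⟩
   b * (l₀ ρs vs g + (1# - tp (v -' hd vs +' 1')) * l1 ρs vs g) ∎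
   where
   b = binom (ρ -' v)(v -' hd ρs)
   g = weights e (\k -> c (v +' total vs -' k))
   F : Vec ℤ _ -> Carrier
   F u = c (v +' total u) * (b * Pi ρs u)
   shift : ∀ k -> weights e (\k -> c (v +' (total vs -' k))) k ≈ g k
   shift k = *ˡ (reflexive (cong c (lem v (total vs) k)))
    where
    lem : ∀ v t k -> v +' (t -' k) ≡ v +' t -' k
    lem = ℤsolve
  Br1-l e (ρ ∷ []) [] c = rfl
  Br1-l e (ρ ∷ ρs@(_ ∷ _))(v ∷ vs) c = begin
   mono e * (Br0 e vs F + Br1 e vs F)
    ≈⟨ *ˡ (+-cong (trans (trans (Br0-cong e vs (\u _ -> x*[y*z]≈y*[x*z] _ _ _))(Br0-* e vs b _))(*-cong bb (Br0-l e ρs vs (\x -> c (v -' 1' +' x)))))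
       (trans (trans (Br1-cong e vs (\u _ -> x*[y*z]≈y*[x*z] _ _ _))(Br1-* e vs b _))(*-cong bb (Br1-l e ρs vs (\x -> c (v -' 1' +' x)))))) ⟩
   _
    ≈⟨ solve 4 (\m b p q -> m :* (b :* p :+ b :* q) := b :* (m :* p :+ m :* q)) rfl _ _ _ _ ⟩
   _
    ≈⟨ *ˡ (+-cong (trans (sym (l0-* ρs vs (mono e) h))(l0-cong ρs vs shift))(trans (sym (l1-* ρs vs (mono e) h))(l1-cong ρs vs shift))) ⟩
   b' * (l₀ ρs vs (up g) + l1 ρs vs (up g)) ∎
   where
   b = binom (ρ -' (v -' 1'))(v -' 1' -' hd ρs)
   b' = binom (ρ -' v +' 1')(v -' hd ρs -' 1')
   bb : b ≈ b'
   bb = binom-cong (lem1 ρ v)(lem2 v (hd ρs))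
    where
    lem1 : ∀ r v -> r -' (v -' 1') ≡ r -' v +' 1'
    lem1 = ℤsolve
    lem2 : ∀ v h -> v -' 1' -' h ≡ v -' h -' 1'
    lem2 = ℤsolve
   g = weights e (\k -> c (v +' total vs -' k))
   h = weights e (\k -> c (v -' 1' +' (total vs -' k)))
   F : Vec ℤ _ -> Carrier
   F u = c (v -' 1' +' total u) * (b * Pi ρs u)
   shift : ∀ k -> mono e * h k ≈ up g k
   shift k = trans (*ˡ (*ˡ (reflexive (cong c (lem v (total vs) k)))))(up-weights e (\k -> c (v +' total vs -' k)) k)
    where
    lem : ∀ v t k -> v -' 1' +' (t -' k) ≡ v +' t -' (1' +' k)
    lem = ℤsolve

  U0-r : ∀ {m} e (ρ : Vec ℤ (suc m)) v (c : ℤ -> Carrier) -> U0 e ρ (\s -> c (total s) * Pi s v) ≈ r0 ρ v (weights e (\k -> c (total ρ +' k)))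
  U1-r : ∀ {m} e (ρ : Vec ℤ (suc m)) v (c : ℤ -> Carrier) -> U1 e ρ (\s -> c (total s) * Pi s v) ≈ r1 ρ v (weights e (\k -> c (total ρ +' k)))
  U0-r e (ρ ∷ []) [] c = trans (trans (+ˡ (zeroʳ _))(+-identityʳ _))(trans (*-comm _ _)
   (*ˡ (sym (trans (weight-0 e (\k -> c (ρ +' 0' +' k)))(reflexive (cong c (ℤP.+-identityʳ _)))))))
  U0-r e (ρ ∷ ρs@(_ ∷ _))(v ∷ vs) c = begin
   U0 e ρs F + (1# - tp (ρ -' hd ρs)) * U1 e ρs F
    ≈⟨ +-cong (trans (U0-factor e ρs b F F' (\ { (x ∷ u) eq -> pull (binom-cong {ρ -' v} refl (cong (\z -> v -' z) eq)) }))
          (*ˡ (trans (U0-r e ρs vs (\x -> c (ρ +' x)))(r0-cong ρs vs shift))))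
       (*ˡ (trans (U1-factor e ρs b' F F' (\ { (x ∷ u) eq -> pull (binom-cong {ρ -' v} refl (≡.trans (cong (\z -> v -' z) eq)(lem v (hd ρs)))) }))
          (*ˡ (trans (U1-r e ρs vs (\x -> c (ρ +' x)))(r1-cong ρs vs shift))))) ⟩
   _
    ≈⟨ +ˡ (x*[y*z]≈y*x*z _ _ _) ⟩
   b * r0 ρs vs g + b' * (1# - tp (ρ -' hd ρs)) * r1 ρs vs g ∎
   where
   b = binom (ρ -' v)(v -' hd ρs)
   b' = binom (ρ -' v)(v -' hd ρs -' 1')
   lem : ∀ v h -> v -' (h +' 1') ≡ v -' h -' 1'
   lem = ℤsolve
   g = weights e (\k -> c (ρ +' total ρs +' k))
   F : Vec ℤ _ -> Carrier
   F u = c (ρ +' total u) * Pi (ρ ∷ u)(v ∷ vs)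
   F' : Vec ℤ _ -> Carrier
   F' u = c (ρ +' total u) * Pi u vs
   shift : ∀ k -> weights e (\k -> c (ρ +' (total ρs +' k))) k ≈ g k
   shift k = *ˡ (reflexive (cong c (≡.sym (ℤP.+-assoc ρ (total ρs) k))))
  U1-r e (ρ ∷ []) [] c = trans (*ˡ (+-identityʳ _))(trans (x*[y*z]≈z*[x*y] _ _ _)
   (*ˡ (*-cong (mono-cong (≡.sym (ℤP.*-identityʳ e)))(reflexive (cong c (lem ρ))))))
   where
   lem : ∀ r -> r +' 1' +' 0' ≡ r +' 0' +' 1'
   lem = ℤsolve
  U1-r e (ρ ∷ ρs@(_ ∷ _))(v ∷ vs) c = begin
   mono e * (U0 e ρs F + U1 e ρs F)
    ≈⟨ *ˡ (+-cong (trans (U0-factor e ρs b F F' (\ { (x ∷ u) eq -> pull (binom-cong (lem1 ρ v)(cong (\z -> v -' z) eq)) }))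
          (*ˡ (U0-r e ρs vs (\x -> c (ρ +' 1' +' x)))))
       (trans (U1-factor e ρs b' F F' (\ { (x ∷ u) eq -> pull (binom-cong (lem1 ρ v)(≡.trans (cong (\z -> v -' z) eq)(lem2 v (hd ρs)))) }))
          (*ˡ (U1-r e ρs vs (\x -> c (ρ +' 1' +' x)))))) ⟩
   _
    ≈⟨ solve 5 (\m b p c q -> m :* (b :* p :+ c :* q) := b :* (m :* p) :+ c :* (m :* q)) rfl _ _ _ _ _ ⟩
   _
    ≈⟨ +-cong (*ˡ (trans (sym (r0-* ρs vs (mono e) h))(r0-cong ρs vs shift)))(*ˡ (trans (sym (r1-* ρs vs (mono e) h))(r1-cong ρs vs shift))) ⟩
   b * r0 ρs vs (up g) + b' * r1 ρs vs (up g) ∎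
   where
   b = binom (ρ -' v +' 1')(v -' hd ρs)
   b' = binom (ρ -' v +' 1')(v -' hd ρs -' 1')
   lem1 : ∀ r v -> r +' 1' -' v ≡ r -' v +' 1'
   lem1 = ℤsolve
   lem2 : ∀ v h -> v -' (h +' 1') ≡ v -' h -' 1'
   lem2 = ℤsolve
   g = weights e (\k -> c (ρ +' total ρs +' k))
   h = weights e (\k -> c (ρ +' 1' +' (total ρs +' k)))
   F : Vec ℤ _ -> Carrier
   F u = c (ρ +' 1' +' total u) * Pi (ρ +' 1' ∷ u)(v ∷ vs)
   F' : Vec ℤ _ -> Carrier
   F' u = c (ρ +' 1' +' total u) * Pi u vs
   shift : ∀ k -> mono e * h k ≈ up g k
   shift k = trans (*ˡ (*ˡ (reflexive (cong c (lem ρ (total ρs) k)))))(up-weights e (\k -> c (ρ +' total ρs +' k)) k)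
    where
    lem : ∀ r t k -> r +' 1' +' (t +' k) ≡ r +' t +' (1' +' k)
    lem = ℤsolve

  Spl-length≤ : ∀ {I J Y : List ℤ} -> Spl I J Y -> length I ≤ length Y
  Spl-length≤ {I} s = subst (length I ≤_)(Spl-length s)(ℕP.m≤m+n _ _)

  Σs-is-zero : ∀ Y s (F : List ℤ -> Carrier) -> (∀ {I J} -> Spl I J Y -> + length I ≢ s ⊎ F I ≈ 0#) -> Σs Y (\I J -> ω I J * (is (length I) s * (mon I * F I))) ≈ 0#
  Σs-is-zero Y s F h = trans (Σs-cong Y (\ {I} {J} sp -> trans (*ˡ (zero-case (h sp)))(zeroʳ _)))(∑-0 (splits Y))
   where
   zero-case : ∀ {I} -> + length I ≢ s ⊎ F I ≈ 0# -> is (length I) s * (mon I * F I) ≈ 0#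
   zero-case (inj₁ ne) = trans (*ʳ (is-no ne))(zeroˡ _)
   zero-case (inj₂ z) = trans (*ˡ (trans (*ˡ z)(zeroʳ _)))(zeroʳ _)

  Pc-out : ∀ {m B} {s : Vec ℤ m} -> Out B s -> ∀ Y -> length Y < B -> Pc s Y ≈ 0#
  Pc-out {s = _ ∷ ss} low Y p = Σs-is-zero Y -1ℤ (Pc ss)(\_ -> inj₁ (\()))
  Pc-out {s = _ ∷ ss} high Y p = Σs-is-zero Y _ (Pc ss)(\sp -> inj₁ (\e -> ℕP.<-irrefl (ℤP.+-injective e)(ℕP.≤-<-trans (Spl-length≤ sp) p)))
  Pc-out {s = s ∷ ss} (later o) Y p = Σs-is-zero Y s (Pc ss)(\sp -> inj₂ (Pc-out o _ (ℕP.≤-<-trans (Spl-length≤ sp) p)))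

 Pc-small : ∀ {m} (s : Vec ℤ m) Y -> + length Y <' hd s -> Pc s Y ≈ 0#
 Pc-small [] Y (ℤ.+<+ ())
 Pc-small (s ∷ ss) Y p = Σs-is-zero Y s (Pc ss)(\sp -> inj₁ (\e -> ℤP.<-irrefl e (ℤP.≤-<-trans (ℤ.+≤+ (Spl-length≤ sp)) p)))

 Pc-invalid : ∀ {m} (s : Vec ℤ m) Y -> ¬ Valid s -> Pc s Y ≈ 0#
 Pc-invalid [] Y ¬v = contradiction tt ¬v
 Pc-invalid (s ∷ ss) Y ¬v with valid? ss
 ... | no ¬w = Σs-is-zero Y s (Pc ss)(\_ -> inj₂ (Pc-invalid ss _ ¬w))
 ... | yes w = Σs-is-zero Y s (Pc ss)(\ {I} _ -> cases I)
  where
  s<hd : s <' hd ss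
  s<hd = ℤP.≰⇒> (\p -> ¬v (p , w))
  cases : ∀ I -> + length I ≢ s ⊎ Pc ss I ≈ 0#
  cases I with (+ length I) ℤP.≟ s
  ... | no ne = inj₁ ne
  ... | yes e = inj₂ (Pc-small ss I (subst (_<' hd ss)(≡.sym e) s<hd))

 -- The branching sum obeys the Pieri rule of the alphabet e ∷ Y, whose e_k is e_k(Y) + h^e
 -- e_(k-1)(Y); the two orders of summation agree by `transfer`.
 pieri-Br : ∀ {m} e Y -> Good Y -> ∀ (v : Vec ℤ m) g B -> length Y < B ->
  esym-ℤ g (e ∷ Y) * Br e v (\u -> Pc u Y) ≈ ∑ (box B (suc m))(\s -> g (total s -' total v) * Pi s v * Br e s (\u -> Pc u Y))
 pieri-Br {m} e Y gY v g B Y<B = begin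
  (esym-ℤ g Y + mono e * esym-ℤ (up g) Y) * Br e v F
   ≈⟨ trans (solve 4 (\p y q b -> (p :+ y :* q) :* b := p :* b :+ y :* (q :* b)) rfl _ _ _ _)(+-cong (expand g)(*ˡ (expand (up g)))) ⟩
  _
   ≈⟨ trans (+ˡ (sym (∑-*ˡ _ bx _)))(sym (∑-+ bx _ _)) ⟩
  _
   ≈⟨ ∑-cong bx compare ⟩
  _
   ≈⟨ trans (∑-+ bx _ _)(sym (+-cong (reindex0 e B K F (\o -> Pc-out o Y Y<B))(reindex1 e B K F (\o -> Pc-out o Y Y<B)))) ⟩
  _
   ≈⟨ trans (sym (∑-+ bx _ _))(∑-cong bx (\s -> sym (distribˡ _ _ _))) ⟩
  ∑ bx (\s -> K s * Br e s F) ∎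
  where
  bx = box B (suc m)
  F : ∀ {m} -> Vec ℤ m -> Carrier
  F u = Pc u Y
  K : Vec ℤ (suc m) -> Carrier
  K s = g (total s -' total v) * Pi s v
  w : (ℤ -> Carrier) -> Vec ℤ (suc m) -> ℤ -> Carrier
  w g ρ = weights e (\k -> g (total ρ -' total v +' k))
  expand : ∀ g -> esym-ℤ g Y * Br e v F ≈ ∑ bx (\ ρ -> F ρ * σ ρ v (w g ρ))
  expand g = begin
   esym-ℤ g Y * Br e v F
    ≈⟨ sym (Br-* e v _ F) ⟩
   _
    ≈⟨ Br-cong e v (\u -> pieri u g Y gY B (ℕP.<⇒≤ Y<B)) ⟩
   _
    ≈⟨ Br-∑ e v bx (\ ρ u -> g (total ρ -' total u) * Pi ρ u * F ρ) ⟩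
   _
    ≈⟨ ∑-cong bx (\ ρ -> trans (Br-cong e v (\u -> *-comm _ (F ρ)))(trans (Br-* e v (F ρ) _)
       (*ˡ (+-cong (trans (Br0-l e ρ v (\x -> g (total ρ -' x)))(l0-cong ρ v (\k -> *ˡ (reflexive (cong g (lem (total ρ)(total v) k))))))
               (trans (Br1-l e ρ v (\x -> g (total ρ -' x)))(l1-cong ρ v (\k -> *ˡ (reflexive (cong g (lem (total ρ)(total v) k)))))))))) ⟩
   ∑ bx (\ ρ -> F ρ * σ ρ v (w g ρ)) ∎
   where
   lem : ∀ r v k -> r -' (v -' k) ≡ r -' v +' k
   lem = ℤsolve
  compare : ∀ ρ -> F ρ * σ ρ v (w g ρ) + mono e * (F ρ * σ ρ v (w (up g) ρ)) ≈ F ρ * U0 e ρ K + F ρ * U1 e ρ K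
  -- `transfer` speaks of valid ρ; for the others both sides carry the factor P_ρ(Y) = 0.
  compare ρ with valid? ρ
  ... | no ¬val = trans (x*y+z*[x*u]≈x*[y+z*u] _ _ _ _)
   (trans (trans (*ʳ (Pc-invalid ρ Y ¬val))(zeroˡ _))(sym (trans (sym (distribˡ _ _ _))(trans (*ʳ (Pc-invalid ρ Y ¬val))(zeroˡ _)))))
  ... | yes val = begin
   F ρ * σ ρ v (w g ρ) + mono e * (F ρ * σ ρ v (w (up g) ρ))
    ≈⟨ solve 5 (\f p y q r -> f :* p :+ y :* (f :* (q :+ r)) := f :* (p :+ (y :* q :+ y :* r))) rfl _ _ _ _ _ ⟩
   _
    ≈⟨ *ˡ (+ˡ (+-cong (trans (sym (l0-* ρ v (mono e) _))(l0-cong ρ v up≈))(trans (sym (l1-* ρ v (mono e) _))(l1-cong ρ v up≈)))) ⟩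
   _
    ≈⟨ *ˡ (sym (proj₁ (transfer ρ v val (w g ρ)))) ⟩
   _
    ≈⟨ *ˡ (sym (+-cong (trans (U0-r e ρ v (\x -> g (x -' total v)))(r0-cong ρ v rs))(trans (U1-r e ρ v (\x -> g (x -' total v)))(r1-cong ρ v rs)))) ⟩
   _
    ≈⟨ distribˡ _ _ _ ⟩
   F ρ * U0 e ρ K + F ρ * U1 e ρ K ∎
   where
   up≈ : ∀ k -> mono e * w (up g) ρ k ≈ up (w g ρ) k
   up≈ k = trans (*ˡ (*ˡ (reflexive (cong g (lem (total ρ -' total v) k)))))(up-weights e (\j -> g (total ρ -' total v +' j)) k)
    where
    lem : ∀ d k -> 1' +' (d +' k) ≡ d +' (1' +' k)
    lem = ℤsolve
   rs : ∀ k -> weights e (\k -> g (total ρ +' k -' total v)) k ≈ w g ρ k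
   rs k = *ˡ (reflexive (cong g (lem (total ρ)(total v) k)))
    where
    lem : ∀ r v k -> r +' k -' v ≡ r -' v +' k
    lem = ℤsolve

 Interlaced : ∀ {m} -> Vec ℤ (suc m) -> Vec ℤ m -> Set
 Interlaced (s ∷ []) [] = 0' ≤' s
 Interlaced (s ∷ ss@(_ ∷ _))(v ∷ vs) = v ≤' s × hd ss ≤' v × Interlaced ss vs

 private
  binom-cases : ∀ k l -> binom k l ≈ 0# ⊎ (0' ≤' k × 0' ≤' l)
  binom-cases k l with sign-cases k | sign-cases l
  ... | inj₁ p | inj₁ q = inj₂ (p , q)
  ... | inj₂ z | _ = inj₁ (binom-negˡ k l z)
  ... | _ | inj₂ z = inj₁ (binom-negʳ k l z)

  Pi-cases : ∀ {m} (s : Vec ℤ (suc m)) v -> Pi s v ≈ 0# ⊎ Interlaced s v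
  Pi-cases (s ∷ []) [] with binom-cases s 0'
  ... | inj₁ z = inj₁ z
  ... | inj₂ (p , _) = inj₂ p
  Pi-cases (s ∷ ss@(_ ∷ _))(v ∷ vs) with binom-cases (s -' v)(v -' hd ss) | Pi-cases ss vs
  ... | inj₁ z | _ = inj₁ (trans (*ʳ z)(zeroˡ _))
  ... | _ | inj₁ z = inj₁ (trans (*ˡ z)(zeroʳ _))
  ... | inj₂ (p , q) | inj₂ i = inj₂ (ℤP.0≤i-j⇒j≤i p , ℤP.0≤i-j⇒j≤i q , i)

  Interlaced-Valid : ∀ {m} (s : Vec ℤ (suc m)) v -> Interlaced s v -> Valid s
  Interlaced-Valid (s ∷ []) [] p = p , tt
  Interlaced-Valid (s ∷ ss@(_ ∷ _))(v ∷ vs)(p , q , i) = ℤP.≤-trans q p , Interlaced-Valid ss vs i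

  -- Triangularity of the Pieri matrix: apart from xs = v, every x ∷ xs that occurs has a tail of
  -- smaller total than v.
  Interlaced-tail : ∀ {m} x (xs v : Vec ℤ m) -> Interlaced (x ∷ xs) v -> total xs <' total v ⊎ xs ≡ v
  Interlaced-tail x [] [] _ = inj₂ refl
  Interlaced-tail x (x' ∷ xs)(v ∷ vs)(_ , q , i) with Interlaced-tail x' xs vs i | ℤP.<-cmp x' v
  ... | inj₁ lt | _ = inj₁ (ℤP.+-mono-≤-< q lt)
  ... | inj₂ refl | tri< lt _ _ = inj₁ (ℤP.+-mono-<-≤ lt ℤP.≤-refl)
  ... | inj₂ refl | tri≈ _ refl _ = inj₂ refl
  ... | inj₂ refl | tri> _ _ gt = contradiction gt (ℤP.≤⇒≯ q)

  Pi-diagonal : ∀ {m} s (ss : Vec ℤ m) -> Valid (s ∷ ss) -> Pi (s ∷ ss) ss ≈ 1#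
  Pi-diagonal s [] (p , _) = binom-0ʳ s p
  Pi-diagonal s (v ∷ vs)(p , w) = trans (*-cong (trans (binom-cong {s -' v} refl (ℤP.+-inverseʳ v))(binom-0ʳ (s -' v)(ℤP.i≤j⇒0≤j-i p)))(Pi-diagonal v vs w))(*-identityˡ 1#)

 Valid⇒0≤total : ∀ {m} (s : Vec ℤ m) -> Valid s -> 0' ≤' total s
 Valid⇒0≤total [] _ = ℤP.≤-refl
 Valid⇒0≤total (s ∷ ss)(p , v) = ℤP.+-mono-≤ (ℤP.≤-trans (Valid⇒0≤hd ss v) p)(Valid⇒0≤total ss v)

 InBox : ℕ -> ∀ {m} -> Vec ℤ m -> Set
 InBox B [] = ⊤
 InBox B (s ∷ ss) = (∃ \n -> s ≡ + n × n ≤ B) × InBox B ss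

 InBox-Valid : ∀ {m} B (s : Vec ℤ m) -> Valid s -> hd s ≤' + B -> InBox B s
 InBox-Valid B [] _ _ = tt
 InBox-Valid B (-[1+ _ ] ∷ ss)(p , w) q = contradiction (ℤP.≤-trans (Valid⇒0≤hd ss w) p)(\())
 InBox-Valid B (+ n ∷ ss)(p , w) q = (n , refl , ℤP.drop‿+≤+ q) , InBox-Valid B ss w (ℤP.≤-trans p q)

 upTo-≤ : ∀ B -> All (_≤ B)(upTo (suc B))
 upTo-≤ B = AllP.applyUpTo⁺₁ id (suc B)(\ { (s≤s p) -> p })

 ∑-upTo-single : ∀ n B (f : ℕ -> Carrier) -> n ≤ B -> (∀ k -> k ≤ B -> k ≢ n -> f k ≈ 0#) -> ∑ (upTo (suc B)) f ≈ f n
 ∑-upTo-single n B f p z = trans (∑-congAll (All.map (\ {k} k≤B -> at k k≤B)(upTo-≤ B)))(trans (∑-is n B (\x -> f ∣ x ∣) p) rfl)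
  where
  at : ∀ k -> k ≤ B -> f k ≈ is n (+ k) * f k
  at k k≤B with (+ n) ℤP.≟ (+ k)
  ... | yes _ = sym (*-identityˡ _)
  ... | no ne = trans (z k k≤B (\e -> ne (cong +_ (≡.sym e))))(sym (zeroˡ _))

 box-InBox : ∀ B m -> All (InBox B)(box B m)
 box-InBox B zero = tt ∷ []
 box-InBox B (suc m) = AllP.concat⁺ (AllP.map⁺ (All.map (\ {k} k≤B -> AllP.map⁺ (All.map (\ix -> (k , refl , k≤B) , ix)(box-InBox B m)))(upTo-≤ B)))

 ∑-box-single : ∀ {m} B (s : Vec ℤ m)(F : Vec ℤ m -> Carrier) -> InBox B s -> (∀ x -> InBox B x -> x ≢ s -> F x ≈ 0#) -> ∑ (box B m) F ≈ F s
 ∑-box-single B [] F _ z = +-identityʳ _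
 ∑-box-single {suc m} B (s ∷ ss) F ((n , refl , n≤B) , ib) z = begin
  ∑ (box B (suc m)) F
   ≈⟨ ∑-box B m F ⟩
  _
   ≈⟨ ∑-upTo-single n B _ n≤B (\k k≤B ne -> zeros k k≤B ne) ⟩
  _
   ≈⟨ ∑-box-single B ss (\xs -> F (+ n ∷ xs)) ib (\x ix ne -> z (+ n ∷ x)((n , refl , n≤B) , ix)(\e -> ne (VecP.∷-injectiveʳ e))) ⟩
  F (+ n ∷ ss) ∎
  where
  zeros : ∀ k -> k ≤ B -> k ≢ n -> ∑ (box B m)(\xs -> F (+ k ∷ xs)) ≈ 0#
  zeros k k≤B ne = trans (∑-congAll (All.map (\ {x} ix -> z (+ k ∷ x)((k , refl , k≤B) , ix)(\e -> ne (ℤP.+-injective (VecP.∷-injectiveˡ e))))(box-InBox B m)))(∑-0 (box B m))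

 private
  -- Multiplication by e_s expresses P of s ∷ ss through P of ss and of partitions whose tail has a
  -- smaller total. By induction on the number of columns and on that total, a solution d of the
  -- Pieri relations with d [] = 0 vanishes.
  module Uniqueness (B : ℕ)(d : ∀ {m} -> Vec ℤ m -> Carrier)(d-[] : d [] ≈ 0#)
   (pieri-d : ∀ {m} (v : Vec ℤ m)(g : ℤ -> Carrier) -> ∃ \c -> ∑ (box B (suc m))(\s -> g (total s -' total v) * Pi s v * d s) ≈ c * d v) where

   δ : ℤ -> ℤ -> Carrier
   δ x y with y ℤP.≟ x
   ... | yes _ = 1#
   ... | no _ = 0#

   unique-step : ∀ {m} s (ss : Vec ℤ m) -> Valid (s ∷ ss) -> s ≤' + B -> d ss ≈ 0# ->
    (∀ x (xs : Vec ℤ m) -> total xs <' total ss -> Valid (x ∷ xs) -> x ≤' + B -> d (x ∷ xs) ≈ 0#) -> d (s ∷ ss) ≈ 0#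
   unique-step {m} s ss val p dss ih = begin
    d (s ∷ ss)
     ≈⟨ sym (trans (*ʳ (trans (*-cong here≈ (Pi-diagonal s ss val))(*-identityˡ 1#)))(*-identityˡ _)) ⟩
    _
     ≈⟨ sym (∑-box-single B (s ∷ ss) _ (InBox-Valid B (s ∷ ss) val p) others) ⟩
    _
     -- The weight `δ s` selects multiplication by e_s.
     ≈⟨ proj₂ (pieri-d ss (δ s)) ⟩
    _
     ≈⟨ trans (*ˡ dss)(zeroʳ _) ⟩
    0# ∎
    where
    cancel : ∀ s t -> s +' t -' t ≡ s
    cancel = ℤsolve
    here≈ : δ s (total (s ∷ ss) -' total ss) ≈ 1#
    here≈ with (total (s ∷ ss) -' total ss) ℤP.≟ s
    ... | yes _ = rfl
    ... | no ne = contradiction (cancel s (total ss)) ne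
    others : ∀ x -> InBox B x -> x ≢ s ∷ ss -> δ s (total x -' total ss) * Pi x ss * d x ≈ 0#
    others (x ∷ xs)((n , refl , n≤B) , _) ne with (total (x ∷ xs) -' total ss) ℤP.≟ s | Pi-cases (x ∷ xs) ss
    ... | no _ | _ = trans (*ʳ (zeroˡ _))(zeroˡ _)
    ... | yes _ | inj₁ z = trans (*ʳ (trans (*ˡ z)(zeroʳ _)))(zeroˡ _)
    ... | yes e | inj₂ i with Interlaced-tail x xs ss i
    ... | inj₂ refl = contradiction (cong (_∷ ss)(≡.trans (≡.sym (cancel x (total ss))) e)) ne
    ... | inj₁ lt = trans (*ˡ (ih x xs lt (Interlaced-Valid (x ∷ xs) ss i)(ℤ.+≤+ n≤B)))(zeroʳ _)

   unique : ∀ {m} (s : Vec ℤ m) -> Valid s -> hd s ≤' + B -> d s ≈ 0#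
   unique-∷ : ∀ {m} N s (ss : Vec ℤ m) -> total ss ≤' + N -> Valid (s ∷ ss) -> s ≤' + B -> d (s ∷ ss) ≈ 0#
   unique [] _ _ = d-[]
   unique (s ∷ ss) val p = unique-∷ ∣ total ss ∣ s ss (i≤∣i∣ (total ss)) val p
    where
    i≤∣i∣ : ∀ i -> i ≤' + ∣ i ∣
    i≤∣i∣ (+ n) = ℤP.≤-refl
    i≤∣i∣ -[1+ n ] = ℤ.-≤+
   unique-∷ zero s ss tN val p = unique-step s ss val p (unique ss (proj₂ val)(ℤP.≤-trans (proj₁ val) p))
    (\x xs lt v _ -> contradiction (ℤP.<-≤-trans lt tN)(ℤP.≤⇒≯ (Valid⇒0≤total xs (proj₂ v))))
   unique-∷ (suc N) s ss tN val p = unique-step s ss val p (unique ss (proj₂ val)(ℤP.≤-trans (proj₁ val) p))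
    (\x xs lt v q -> unique-∷ N x xs (ℤP.i<j⇒i≤pred[j] (ℤP.<-≤-trans lt tN)) v q)

 -- Both sides satisfy the Pieri relations of the alphabet e ∷ Y, so their difference vanishes by
 -- uniqueness.
 branching : ∀ {m} e Y -> Good (e ∷ Y) -> ∀ (s : Vec ℤ m) -> Valid s -> Pc s (e ∷ Y) ≈ Br e s (\u -> Pc u Y)
 branching e Y g s val = begin
  Pc s (e ∷ Y) ≈⟨ solve 2 (\x y -> x := x :- y :+ y) rfl _ _ ⟩
  _ ≈⟨ +ʳ (Uniqueness.unique bound d d-[] pieri-d s val (hd≤ (hd s))) ⟩
  _ ≈⟨ +-identityˡ _ ⟩
  Br e s (\u -> Pc u Y) ∎
  where
  -- The box has to hold s as well as every column that fits into e ∷ Y.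
  bound = suc (length Y) ℕ.+ ∣ hd s ∣
  hd≤ : ∀ i -> i ≤' + (suc (length Y) ℕ.+ ∣ i ∣)
  hd≤ (+ n) = ℤ.+≤+ (ℕP.m≤n+m n _)
  hd≤ -[1+ n ] = ℤ.-≤+
  d : ∀ {m} -> Vec ℤ m -> Carrier
  d s = Pc s (e ∷ Y) - Br e s (\u -> Pc u Y)
  d-[] : d [] ≈ 0#
  d-[] = solve 0 (:1 :- (:1 :+ :0) := :0) rfl
  pieri-d : ∀ {m} (v : Vec ℤ m) g -> ∃ \c -> ∑ (box bound (suc m))(\s -> g (total s -' total v) * Pi s v * d s) ≈ c * d v
  pieri-d {m} v gw = esym-ℤ gw (e ∷ Y) , (begin
   ∑ bx (\s -> K s * (Pc s (e ∷ Y) - Br e s (\u -> Pc u Y)))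
    ≈⟨ trans (∑-cong bx (\s -> solve 3 (\k x y -> k :* (x :- y) := k :* x :+ :- (k :* y)) rfl _ _ _))(trans (∑-+ bx _ _)(+ˡ (∑-neg bx _))) ⟩
   _
    ≈⟨ +-cong (sym (pieri v gw (e ∷ Y) g bound (ℕP.m≤m+n _ _)))(-‿cong (sym (pieri-Br e Y (Good-tail {e} g) v gw bound (ℕP.m≤m+n _ _)))) ⟩
   _
    ≈⟨ x*y-x*z≈x*[y-z] _ _ _ ⟩
   esym-ℤ gw (e ∷ Y) * d v ∎)
   where
   bx = box bound (suc m)
   K : Vec ℤ (suc m) -> Carrier
   K s = gw (total s -' total v) * Pi s v

 -- Skew functions of a geometric progression.

 -- As t = h^(2P), this is t^(d(d-1)/2).
 tC : ℤ -> Carrier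
 tC d = mono (+ P *' (d *' d -' d))

 cell : ℤ -> ℤ -> ℤ -> ℤ -> ℤ -> Carrier
 cell e s v s' v' = mono (e *' (s -' v)) * (qf (s -' v') * iq (s -' v) * tC (s -' v)) * iq (s -' s')

 -- The skew function P_{λ/μ} of the alphabet h^e, h^{e+2P}, h^{e+4P}, …, with s and v the columns of λ and μ.
 W : ∀ {m} -> ℤ -> Vec ℤ m -> Vec ℤ m -> Carrier
 W e [] [] = 1#
 W e (s ∷ ss)(v ∷ vs) = cell e s v (hd ss)(hd vs) * W e ss vs

 private
  Br0-factor : ∀ {m} e (ρ : Vec ℤ m) b F G -> (∀ u -> hd u ≡ hd ρ -> F u ≈ b * G u) -> Br0 e ρ F ≈ b * Br0 e ρ G
  Br0-factor e ρ b F G h = trans (Br0-cong e ρ h)(Br0-* e ρ b G)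

  Br1-factor : ∀ {m} e (ρ : Vec ℤ m) b F G -> (∀ u -> hd u ≡ hd ρ -' 1' -> F u ≈ b * G u) -> Br1 e ρ F ≈ b * Br1 e ρ G
  Br1-factor e ρ b F G h = trans (Br1-cong e ρ h)(Br1-* e ρ b G)

  -- The factor 1 - t^k completes (t; t)_(k-1) for k ≥ 1; for smaller k the inequality d ≤ k makes
  -- `iq (d -' 1')` vanish.
  qf-step : ∀ d k -> d ≤' k -> qf (k -' 1') * iq (d -' 1') * (1# - tp k) ≈ qf k * iq (d -' 1')
  qf-step d k d≤k with sign-cases (d -' 1')
  ... | inj₂ z = trans (*ʳ (trans (*ˡ z)(zeroʳ _)))(trans (zeroˡ _)(sym (trans (*ˡ z)(zeroʳ _))))
  ... | inj₁ p = trans (x*y*z≈x*z*y _ _ _)(*ʳ (sym (trans (qf-cong (lem k))(trans (qf-suc (ℤP.≤-trans p (ℤP.+-monoˡ-≤ -1ℤ d≤k)))(*ˡ (+ˡ (-‿cong (tp-cong (≡.sym (lem k))))))))))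
   where
   lem : ∀ k -> k ≡ k -' 1' +' 1'
   lem = ℤsolve

 -- Among the terms of the branching sum, those with first entry 0 in θ make up the share t^(s_1 -
 -- v_1) and the others the share 1 - t^(s_1 - v_1); the induction on the columns needs the shares
 -- separately.
 Br0-W : ∀ {m} e (s v : Vec ℤ m) -> Valid v -> Br0 e s (\u -> W (e +' 2P) u v) ≈ tp (hd s -' hd v) * W e s v
 Br1-W : ∀ {m} e (s v : Vec ℤ m) -> Valid v -> Br1 e s (\u -> W (e +' 2P) u v) ≈ (1# - tp (hd s -' hd v)) * W e s v
 Br0-W e [] [] _ = sym (trans (*-identityʳ _) tp-0)
 Br0-W e (s ∷ ss)(v ∷ vs)(p , val) = begin
  Br0 e ss F + (1# - tp (s -' hd ss +' 1')) * Br1 e ss F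
   ≈⟨ +-cong (Br0-factor e ss c F F' (\u eq -> *ʳ (*ˡ (iq-cong (cong (\z -> s -' z) eq)))))
      (*ˡ (Br1-factor e ss (k * iq (s -' hd ss +' 1')) F F' (\u eq -> *ʳ (*ˡ (iq-cong (≡.trans (cong (\z -> s -' z) eq)(lem s (hd ss)))))))) ⟩
  _
   ≈⟨ +-cong (*ˡ (Br0-W e ss vs val))(trans (solve 4 (\x k i b -> x :* (k :* i :* b) := k :* (x :* i) :* b) rfl _ _ _ _)(*-cong (*ˡ (iq-suc (s -' hd ss)))(Br1-W e ss vs val))) ⟩
  _
   ≈⟨ solve 3 (\c x w -> c :* (x :* w) :+ c :* ((:1 :- x) :* w) := c :* w) rfl _ _ _ ⟩
  _
   ≈⟨ *ʳ (trans (*ʳ (*ʳ (trans (mono-cong (lem2 e 2P (s -' v)))(mono-+ _ _))))(solve 4 (\x y q i -> x :* y :* q :* i := x :* (y :* q :* i)) rfl _ _ _ _)) ⟩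
  _
   ≈⟨ *-assoc _ _ _ ⟩
  tp (s -' v) * W e (s ∷ ss)(v ∷ vs) ∎
  where
  k = mono ((e +' 2P) *' (s -' v)) * (qf (s -' hd vs) * iq (s -' v) * tC (s -' v))
  c = k * iq (s -' hd ss)
  F F' : Vec ℤ _ -> Carrier
  F u = cell (e +' 2P) s v (hd u)(hd vs) * W (e +' 2P) u vs
  F' u = W (e +' 2P) u vs
  lem : ∀ s h -> s -' (h -' 1') ≡ s -' h +' 1'
  lem = ℤsolve
  lem2 : ∀ e p d -> (e +' p) *' d ≡ p *' d +' e *' d
  lem2 = ℤsolve
 Br1-W e [] [] _ = sym (trans (*ʳ (trans (+ˡ (-‿cong tp-0))(-‿inverseʳ 1#)))(zeroˡ _))
 Br1-W e (s ∷ ss)(v ∷ vs)(p , val) = begin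
  mono e * (Br0 e ss F + Br1 e ss F)
   ≈⟨ *ˡ (+-cong (Br0-factor e ss (k * iq (s -' hd ss -' 1')) F F' (\u eq -> *ʳ (*ˡ (iq-cong (≡.trans (cong (\z -> s -' 1' -' z) eq)(lem1 s (hd ss)))))))
      (Br1-factor e ss (k * iq (s -' hd ss)) F F' (\u eq -> *ʳ (*ˡ (iq-cong (≡.trans (cong (\z -> s -' 1' -' z) eq)(lem2 s (hd ss)))))))) ⟩
  _
   ≈⟨ *ˡ (+-cong (*-cong (*ˡ (sym (iq-pred (s -' hd ss))))(Br0-W e ss vs val))(*ˡ (Br1-W e ss vs val))) ⟩
  _
   ≈⟨ solve 6 (\m k x i y w -> m :* (k :* ((:1 :- x) :* i) :* (y :* w) :+ k :* i :* ((:1 :- y) :* w)) := m :* k :* (:1 :- x :* y) :* (i :* w)) rfl (mono e) k (tp D1)(iq D1)(tp d') X ⟩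
  _
   ≈⟨ *ʳ (*ˡ (+ˡ (-‿cong (trans (sym (tp-+ D1 d'))(tp-cong (lem3 s (hd ss)(hd vs))))))) ⟩
  _
   ≈⟨ *ʳ (trans (solve 6 (\m n a b c x -> m :* (n :* (a :* b :* c)) :* x := m :* n :* c :* (a :* b :* x)) rfl _ _ _ _ _ _)
      (trans (*-cong monos (trans (*ʳ (*-cong (qf-cong (lem4 s (hd vs)))(iq-cong (lem4 s v))))(trans (qf-step d q (ℤP.+-monoʳ-≤ s (ℤP.neg-mono-≤ p)))(*ˡ (sym (iq-pred d)))))) rfl)) ⟩
  _
   ≈⟨ solve 7 (\m c q x i j w -> m :* c :* (q :* (x :* i)) :* (j :* w) := x :* (m :* (q :* i :* c) :* j :* w)) rfl _ _ _ _ _ _ _ ⟩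
  (1# - tp d) * W e (s ∷ ss)(v ∷ vs) ∎
  where
  d = s -' v
  d' = hd ss -' hd vs
  D1 = s -' hd ss
  q = s -' hd vs
  X = W e ss vs
  k = mono ((e +' 2P) *' (s -' 1' -' v)) * (qf (s -' 1' -' hd vs) * iq (s -' 1' -' v) * tC (s -' 1' -' v))
  F F' : Vec ℤ _ -> Carrier
  F u = cell (e +' 2P)(s -' 1') v (hd u)(hd vs) * W (e +' 2P) u vs
  F' u = W (e +' 2P) u vs
  lem1 : ∀ s h -> s -' 1' -' h ≡ s -' h -' 1'
  lem1 = ℤsolve
  lem2 : ∀ s h -> s -' 1' -' (h -' 1') ≡ s -' h
  lem2 = ℤsolve
  lem3 : ∀ s h v -> s -' h +' (h -' v) ≡ s -' v
  lem3 = ℤsolve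
  lem4 : ∀ s h -> s -' 1' -' h ≡ s -' h -' 1'
  lem4 = ℤsolve
  monos : mono e * mono ((e +' 2P) *' (s -' 1' -' v)) * tC (s -' 1' -' v) ≈ mono (e *' d) * tC d
  monos = trans (*ʳ (sym (mono-+ _ _)))(trans (sym (mono-+ _ _))(trans (mono-cong (exps e (+ P) s v))(mono-+ _ _)))
   where
   exps : ∀ e P s v -> e +' (e +' (P +' P)) *' (s -' 1' -' v) +' P *' ((s -' 1' -' v) *' (s -' 1' -' v) -' (s -' 1' -' v))
      ≡ e *' (s -' v) +' P *' ((s -' v) *' (s -' v) -' (s -' v))
   exps = ℤsolve

 -- Removes the first letter of the progression: branching splits off h^e, and the remaining
 -- progression starts at h^(e+2P).
 Br-W : ∀ {m} e (s v : Vec ℤ m) -> Valid v -> Br e s (\u -> W (e +' 2P) u v) ≈ W e s v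
 Br-W e s v val = trans (+-cong (Br0-W e s v val)(Br1-W e s v val))(solve 2 (\x w -> x :* w :+ (:1 :- x) :* w := w) rfl _ _)

 Int-t : Int t
 Int-t = Int-mono (P ℕ.+ P)

 Int-a : ∀ {x} -> x ≢ 0' -> Int (a x)
 Int-a p = Int-+ Int-t (Int-* (Int-+ Int-1 (Int-- Int-t))(Int-γ p))

 Int-ω : ∀ {I J Y} -> Spl I J Y -> Good Y -> Int (ω I J)
 Int-ω nil g = Int-1
 Int-ω {y ∷ I} {J} {_ ∷ Y} (left s) g = Int-* (Int-∏ (All.map (\ {j} ne -> Int-a (\e -> ne (≡.sym (cong ∣_∣ (ℤP.i-j≡0⇒i≡j j y e)))))(apartʳ s (headʳ y g))))(Int-ω s (Good-tail {y} g))
  where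
  headʳ : ∀ y {Y} -> Good (y ∷ Y) -> All (\x -> ∣ y ∣ ≢ ∣ x ∣) Y
  headʳ y (_ ∷ p ∷ _) = AllP.map⁻ p
  apartʳ : ∀ {I J Y : List ℤ} {Q : ℤ -> Set} -> Spl I J Y -> All Q Y -> All Q J
  apartʳ {I} s al = AllP.++⁻ʳ I (PermP.All-resp-↭ (↭-sym (Spl-↭ s)) al)
 Int-ω {I} {y ∷ J} {_ ∷ Y} (right s) g = Int-resp (sym (ω-selʳ {y} {J} I here))(Int-* (Int-∏ (All.map (\ {i} ne -> Int-a (\e -> ne (cong ∣_∣ (ℤP.i-j≡0⇒i≡j y i e))))(apartˡ s (headʳ y g))))(Int-ω s (Good-tail {y} g)))
  where
  headʳ : ∀ y {Y} -> Good (y ∷ Y) -> All (\x -> ∣ y ∣ ≢ ∣ x ∣) Y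
  headʳ y (_ ∷ p ∷ _) = AllP.map⁻ p
  apartˡ : ∀ {I J Y : List ℤ} {Q : ℤ -> Set} -> Spl I J Y -> All Q Y -> All Q I
  apartˡ {I} s al = AllP.++⁻ˡ I (PermP.All-resp-↭ (↭-sym (Spl-↭ s)) al)

 NonNeg : List ℤ -> Set
 NonNeg = All (0' ≤'_)

 Int-mono≥0 : ∀ {x} -> 0' ≤' x -> Int (mono x)
 Int-mono≥0 {+ n} _ = Int-mono n

 Int-is : ∀ n s -> Int (is n s)
 Int-is n s with (+ n) ℤP.≟ s
 ... | yes _ = Int-1
 ... | no _ = Int-0

 Int-Pc : ∀ {m} (s : Vec ℤ m) Y -> Good Y -> NonNeg Y -> Int (Pc s Y)
 Int-Pc [] Y g nn = Int-1
 Int-Pc (s ∷ ss) Y g nn = Int-∑ (All.map (\ {p} sp -> Int-* (Int-ω sp g)(Int-* (Int-is _ s)(Int-* (Int-∏ (All.map Int-mono≥0 (nnˡ sp)))(Int-Pc ss _ (proj₁ (Good-Spl sp g))(nnˡ sp)))))(splits-Spl Y))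
  where
  nnˡ : ∀ {I J} -> Spl I J Y -> NonNeg I
  nnˡ {I} sp = AllP.++⁻ˡ I (PermP.All-resp-↭ (↭-sym (Spl-↭ sp)) nn)

 Int-tp : ∀ {k} -> 0' ≤' k -> Int (tp k)
 Int-tp {+ n} _ = Int-mono≥0 (subst (0' ≤'_)(ℤP.pos-* (P ℕ.+ P) n)(ℤ.+≤+ z≤n))

 Int-qf : ∀ k -> Int (qf k)
 Int-qf (+ zero) = Int-1
 Int-qf (+ suc n) = Int-* (Int-qf (+ n))(Int-+ Int-1 (Int-- (Int-tp {+ suc n} (ℤ.+≤+ z≤n))))
 Int-qf -[1+ n ] = Int-0

 Int-iq : ∀ k -> Int (iq k)
 Int-iq (+ zero) = Int-1
 Int-iq (+ suc n) = Int-* (Int-iq (+ n))(Int-γ (2P≢0 n))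
 Int-iq -[1+ n ] = Int-0

 Int-tC : ∀ n -> Int (tC (+ n))
 Int-tC zero = Int-resp (mono-cong (≡.sym (ℤP.*-zeroʳ (+ P))))(Int-mono 0)
 Int-tC (suc n) = Int-resp (mono-cong eq)(Int-mono (P ℕ.* (suc n ℕ.* n)))
  where
  sq : ∀ n -> (1' +' n) *' n ≡ (1' +' n) *' (1' +' n) -' (1' +' n)
  sq = ℤsolve
  eq : + (P ℕ.* (suc n ℕ.* n)) ≡ + P *' (+ suc n *' + suc n -' + suc n)
  eq = ≡.trans (ℤP.pos-* P (suc n ℕ.* n))(cong (\z -> + P *' z)(≡.trans (ℤP.pos-* (suc n) n)(sq (+ n))))

 -- A progression that starts far out contributes almost nothing: off the diagonal W carries a power
 -- h^(n(s_i - v_i)) with s_i > v_i, or else it vanishes.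
 W-size : ∀ {m} n (s v : Vec ℤ m) -> W (+ n) s v ≈ 0# ⊎ (Int (W (+ n) s v) × (s ≡ v ⊎ Small n (W (+ n) s v)))
 W-size n [] [] = inj₂ (Int-1 , inj₁ refl)
 W-size n (s ∷ ss)(v ∷ vs) = go (s -' v) refl (W-size n ss vs)
  where
  cell-small : ∀ k -> + k ≡ s -' v -> Small (n ℕ.* k)(cell (+ n) s v (hd ss)(hd vs))
  cell-small k e = Small-*Int (Small-*Int (Small-resp (mono-cong (≡.trans (ℤP.pos-* n k)(cong (\z -> + n *' z) e)))(Small-mono (n ℕ.* k) ℕP.≤-refl))
   (Int-* (Int-* (Int-qf (s -' hd vs))(Int-iq (s -' v)))(Int-resp (reflexive (cong tC e))(Int-tC k))))(Int-iq (s -' hd ss))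
  go : ∀ d -> d ≡ s -' v -> W (+ n) ss vs ≈ 0# ⊎ (Int (W (+ n) ss vs) × (ss ≡ vs ⊎ Small n (W (+ n) ss vs))) ->
     W (+ n)(s ∷ ss)(v ∷ vs) ≈ 0# ⊎ (Int (W (+ n)(s ∷ ss)(v ∷ vs)) × (s ∷ ss ≡ v ∷ vs ⊎ Small n (W (+ n)(s ∷ ss)(v ∷ vs))))
  go d e (inj₁ z) = inj₁ (trans (*ˡ z)(zeroʳ _))
  go -[1+ k ] e (inj₂ _) = inj₁ (trans (*ʳ (trans (*ʳ (trans (*ˡ (trans (*ʳ (trans (*ˡ (iq-cong (≡.sym e)))(zeroʳ _)))(zeroˡ _)))(zeroʳ _)))(zeroˡ _)))(zeroˡ _))
  go (+ zero) e (inj₂ (iw , sw)) = inj₂ (Int-* (Small⇒Int (cell-small 0 e)) iw , which sw)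
   where
   which : ss ≡ vs ⊎ Small n (W (+ n) ss vs) -> s ∷ ss ≡ v ∷ vs ⊎ Small n (W (+ n)(s ∷ ss)(v ∷ vs))
   which (inj₁ p) = inj₁ (cong₂ _∷_ (ℤP.i-j≡0⇒i≡j s v (≡.sym e)) p)
   which (inj₂ q) = inj₂ (Int-*Small (Small⇒Int (cell-small 0 e)) q)
  go (+ suc k) e (inj₂ (iw , _)) = inj₂ (Int-* (Small⇒Int (cell-small (suc k) e)) iw , inj₂ (Small-*Int (Small-≤ (ℕP.m≤m*n n (suc k))(cell-small (suc k) e)) iw))

 W-invalid : ∀ {m} e (s v : Vec ℤ m) -> ¬ Valid s -> W e s v ≈ 0#
 W-invalid e [] [] ¬v = contradiction tt ¬v
 W-invalid e (s ∷ ss)(v ∷ vs) ¬v with valid? ss | sign-cases (s -' hd ss)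
 ... | no ¬w | _ = trans (*ˡ (W-invalid e ss vs ¬w))(zeroʳ _)
 ... | yes w | inj₂ z = trans (*ʳ (trans (*ˡ z)(zeroʳ _)))(zeroˡ _)
 ... | yes w | inj₁ p = contradiction (ℤP.0≤i-j⇒j≤i p , w) ¬v

 W-diagonal : ∀ {m} e (s : Vec ℤ m) -> Valid s -> W e s s ≈ 1#
 W-diagonal e [] _ = rfl
 W-diagonal e (s ∷ ss)(p , val) = trans (*-cong cell≈ (W-diagonal e ss val))(*-identityˡ 1#)
  where
  q = s -' hd ss
  cell≈ : cell e s s (hd ss)(hd ss) ≈ 1#
  cell≈ = begin
   mono (e *' (s -' s)) * (qf q * iq (s -' s) * tC (s -' s)) * iq q
    ≈⟨ *ʳ (*-cong (trans (mono-cong (≡.trans (cong (\z -> e *' z)(ℤP.+-inverseʳ s))(ℤP.*-zeroʳ e))) mono-0)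
       (*-cong (*ˡ (iq-cong (ℤP.+-inverseʳ s)))(trans (reflexive (cong tC (ℤP.+-inverseʳ s)))(trans (mono-cong (ℤP.*-zeroʳ (+ P))) mono-0)))) ⟩
   _
    ≈⟨ solve 2 (\x y -> :1 :* (x :* :1 :* :1) :* y := x :* y) rfl _ _ ⟩
   _
    ≈⟨ qi q (ℤP.i≤j⇒0≤j-i p) ⟩
   1# ∎
   where
   qi : ∀ k -> 0' ≤' k -> qf k * iq k ≈ 1#
   qi (+ n) _ = qf-iq n

 private
  Br0-≡ : ∀ {m K B} n (s : Vec ℤ m) -> Valid s -> hd s ≤' + B -> ∀ {F G} -> (∀ u -> hd u ≤' + B -> F u ≡[ K ] G u) -> Br0 (+ n) s F ≡[ K ] Br0 (+ n) s G
  Br1-≡ : ∀ {m K B} n (s : Vec ℤ m) -> Valid s -> hd s ≤' + B -> ∀ {F G} -> (∀ u -> hd u ≤' + B -> F u ≡[ K ] G u) -> Br1 (+ n) s F ≡[ K ] Br1 (+ n) s G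
  Br0-≡ n [] _ _ h = h [] (ℤ.+≤+ z≤n)
  Br0-≡ n (s ∷ ss)(p , v) q h = ≡[]-+ (Br0-≡ n ss v (ℤP.≤-trans p q)(\u _ -> h (s ∷ u) q))
   (≡[]-*ˡ (Int-+ Int-1 (Int-- (Int-tp (ℤP.≤-trans (ℤP.i≤j⇒0≤j-i p)(ℤP.i≤i+j _ 1')))))(Br1-≡ n ss v (ℤP.≤-trans p q)(\u _ -> h (s ∷ u) q)))
  Br1-≡ n [] _ _ h = ≡[]-reflexive rfl
  Br1-≡ n (s ∷ ss)(p , v) q h = ≡[]-*ˡ (Int-mono n)(≡[]-+ (Br0-≡ n ss v (ℤP.≤-trans p q)(\u _ -> h (s -' 1' ∷ u) q'))(Br1-≡ n ss v (ℤP.≤-trans p q)(\u _ -> h (s -' 1' ∷ u) q')))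
   where
   q' = ℤP.≤-trans (ℤP.i-j≤i s 1') q

 prog : ℤ -> ℕ -> List ℤ
 prog b zero = []
 prog b (suc k) = b ∷ prog (b +' 2P) k

 skew-sum : ∀ {m} -> ℕ -> ℕ -> Vec ℤ m -> Fun
 skew-sum {m} B n s Y = ∑ (box B m)(\v -> W (+ n) s v * Pc v Y)

 -- L branching steps move the start of the progression to n + 2PL, which is at least K; there W is
 -- congruent to the identity matrix by `W-size`.
 skew-prog : ∀ {m K} B L n (s : Vec ℤ m) Y -> Good (prog (+ n) L ++ Y) -> NonNeg Y -> K ≤ n ℕ.+ (P ℕ.+ P) ℕ.* L -> hd s ≤' + B ->
  Pc s (prog (+ n) L ++ Y) ≡[ K ] skew-sum B n s Y
 skew-prog {m} {K} B L n s Y g nn K≤ s≤B with valid? s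
 ... | no ¬val = ≡[]-reflexive (trans (Pc-invalid s _ ¬val)(sym (∑-zero (box B m)(\v -> trans (*ʳ (W-invalid (+ n) s v ¬val))(zeroˡ _)))))
 skew-prog {m} {K} B zero n s Y g nn K≤ s≤B | yes val = ≡[]-sym (≡[]-trans (≡[]-∑ (All.map (\ {v} ib -> term v)(box-InBox B m)))
   (≡[]-reflexive (trans (∑-box-single B s F' (InBox-Valid B s val s≤B)(\x _ ne -> off x ne))(on s refl))))
  where
  F' : Vec ℤ m -> Carrier
  F' v with VecP.≡-dec ℤP._≟_ v s
  ... | yes _ = Pc s Y
  ... | no _ = 0#
  off : ∀ x -> x ≢ s -> F' x ≈ 0#
  off x ne with VecP.≡-dec ℤP._≟_ x s
  ... | yes e = contradiction e ne
  ... | no _ = rfl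
  on : ∀ x -> x ≡ s -> F' x ≈ Pc s Y
  on x e with VecP.≡-dec ℤP._≟_ x s
  ... | yes _ = rfl
  ... | no ne = contradiction e ne
  K≤n : K ≤ n
  K≤n = subst (K ≤_)(≡.trans (cong (n ℕ.+_)(ℕP.*-zeroʳ (P ℕ.+ P)))(ℕP.+-identityʳ n)) K≤
  term : ∀ v -> W (+ n) s v * Pc v Y ≡[ K ] F' v
  term v with VecP.≡-dec ℤP._≟_ v s
  ... | yes refl = ≡[]-reflexive (trans (*ʳ (W-diagonal (+ n) s val))(*-identityˡ _))
  ... | no ne with W-size n s v
  ... | inj₁ z = ≡[]-reflexive (trans (*ʳ z)(zeroˡ _))
  ... | inj₂ (_ , inj₁ e) = contradiction (≡.sym e) ne
  ... | inj₂ (_ , inj₂ sm) = Small⇒≡[]0 (Small-*Int (Small-≤ K≤n sm)(Int-Pc v Y g nn))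
 skew-prog {m} {K} B (suc L) n s Y g nn K≤ s≤B | yes val =
  ≡[]-trans (≡[]-reflexive (branching (+ n)(prog (+ n +' 2P) L ++ Y) g s val))
  (≡[]-trans (≡[]-+ (Br0-≡ n s val s≤B ih)(Br1-≡ n s val s≤B ih))(≡[]-reflexive (begin
   Br (+ n) s (\u -> ∑ (box B m)(\v -> W (+ n +' 2P) u v * Pc v Y))
    ≈⟨ Br-∑ (+ n) s (box B m)(\v u -> W (+ n +' 2P) u v * Pc v Y) ⟩
   _
    ≈⟨ ∑-cong (box B m)(\v -> trans (trans (Br-cong (+ n) s (\u -> *-comm _ _))(Br-* (+ n) s (Pc v Y) _))(collapse v)) ⟩
   ∑ (box B m)(\v -> W (+ n) s v * Pc v Y) ∎)))
  where
  ih : ∀ u -> hd u ≤' + B -> Pc u (prog (+ n +' 2P) L ++ Y) ≡[ K ] skew-sum B (n ℕ.+ (P ℕ.+ P)) u Y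
  ih u p = skew-prog B L (n ℕ.+ (P ℕ.+ P)) u Y (Good-tail {+ n} g) nn (subst (K ≤_)(lem n (P ℕ.+ P) L) K≤) p
   where
   lem : ∀ n p L -> n ℕ.+ p ℕ.* suc L ≡ n ℕ.+ p ℕ.+ p ℕ.* L
   lem n p L = ≡.trans (cong (n ℕ.+_)(ℕP.*-suc p L))(≡.sym (ℕP.+-assoc n p (p ℕ.* L)))
  collapse : ∀ v -> Pc v Y * Br (+ n) s (\u -> W (+ n +' 2P) u v) ≈ W (+ n) s v * Pc v Y
  collapse v with valid? v
  ... | yes vv = trans (*ˡ (Br-W (+ n) s v vv))(*-comm _ _)
  ... | no ¬v = trans (*ʳ (Pc-invalid v Y ¬v))(trans (zeroˡ _)(sym (trans (*ˡ (Pc-invalid v Y ¬v))(zeroʳ _))))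

 -- From the Littlewood sum to the multisum, one skew function per progression.

 alphabet : List ℕ -> ℕ -> List ℤ
 alphabet [] L = []
 alphabet (z ∷ zs) L = prog (+ z) L ++ alphabet zs L

 prog-NonNeg : ∀ n L -> NonNeg (prog (+ n) L)
 prog-NonNeg n zero = []
 prog-NonNeg n (suc L) = ℤ.+≤+ z≤n ∷ prog-NonNeg (n ℕ.+ (P ℕ.+ P)) L

 alphabet-NonNeg : ∀ zs L -> NonNeg (alphabet zs L)
 alphabet-NonNeg [] L = []
 alphabet-NonNeg (z ∷ zs) L = AllP.++⁺ (prog-NonNeg z L)(alphabet-NonNeg zs L)

 chain : ∀ {m} -> ℕ -> List ℕ -> Vec ℤ m -> Carrier
 chain B [] s = Pc s []
 chain {m} B (z ∷ zs) s = ∑ (box B m)(\v -> W (+ z) s v * chain B zs v)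

 Pc-chain : ∀ {m K} B L zs -> Good (alphabet zs L) -> K ≤ (P ℕ.+ P) ℕ.* L -> ∀ (s : Vec ℤ m) -> hd s ≤' + B -> Pc s (alphabet zs L) ≡[ K ] chain B zs s
 Pc-chain B L [] g K≤ s p = ≡[]-reflexive rfl
 Pc-chain {m} B L (z ∷ zs) g K≤ s p = ≡[]-trans
  (skew-prog B L z s (alphabet zs L) g (alphabet-NonNeg zs L)(ℕP.≤-trans K≤ (ℕP.m≤n+m _ z)) p)
  (≡[]-∑ (All.map (\ {v} ib -> term v (InBox-hd v ib))(box-InBox B m)))
  where
  InBox-hd : ∀ {m} (v : Vec ℤ m) -> InBox B v -> hd v ≤' + B
  InBox-hd [] _ = ℤ.+≤+ z≤n
  InBox-hd (x ∷ xs)((n , refl , q) , _) = ℤ.+≤+ q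
  term : ∀ v -> hd v ≤' + B -> W (+ z) s v * Pc v (alphabet zs L) ≡[ _ ] W (+ z) s v * chain B zs v
  term v q with W-size z s v
  ... | inj₁ w0 = ≡[]-reflexive (trans (trans (*ʳ w0)(zeroˡ _))(sym (trans (*ʳ w0)(zeroˡ _))))
  ... | inj₂ (iw , _) = ≡[]-*ˡ iw (Pc-chain B L zs (Good-++ʳ (prog (+ z) L) g) K≤ v q)

 χℤ : ℤ -> Carrier
 χℤ (+ n) = χ n
 χℤ -[1+ n ] = 0#

 link : ∀ {m} -> ℤ -> Vec ℤ m -> Carrier
 link x [] = 1#
 link x (s ∷ ss) = χℤ (x -' s) * link s ss

 private
  Spl-≤ : ∀ {I J Y : List ℤ} {B} -> Spl I J Y -> length Y ≤ B -> length I ≤ B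
  Spl-≤ {I} s p = ℕP.≤-trans (subst (length I ≤_)(Spl-length s)(ℕP.m≤m+n _ _)) p

 T̂-expand : ∀ m B Y -> length Y ≤ B -> T̂ m Y ≈ ∑ (box B m)(\ss -> link (+ length Y) ss * Pc ss Y)
 columns-expand : ∀ m B (c : ℤ -> Carrier)(c' : ℕ -> Carrier) Y -> length Y ≤ B -> (∀ {I J} -> Spl I J Y -> c (+ length I) ≈ c' (length J)) ->
  (mon· (T̂ m) ⋆ size c') Y ≈ ∑ (upTo (suc B))(\s -> ∑ (box B m)(\ss -> c (+ s) * link (+ s) ss * Pc (+ s ∷ ss) Y))

 T̂-expand zero B Y p = sym (trans (+-identityʳ _)(*-identityˡ 1#))
 T̂-expand (suc m) B Y p = trans (columns-expand m B (\s -> χℤ (+ length Y -' s)) χ Y p (\ {I} {J} sp -> reflexive (cong χℤ (≡.sym (Σs-length sp)))))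
  (sym (∑-box B m _))
 columns-expand m B c c' Y p h = begin
  Σs Y (\I J -> ω I J * (mon I * T̂ m I * c' (length J)))
   ≈⟨ Σs-cong Y (\ {I} {J} sp -> begin
      ω I J * (mon I * T̂ m I * c' (length J))
       ≈⟨ *ˡ (*-cong (*ˡ (T̂-expand m B I (Spl-≤ sp p)))(sym (h sp))) ⟩
      _
       ≈⟨ trans (solve 4 (\w m s c -> w :* (m :* s :* c) := w :* m :* c :* s) rfl _ _ _ _)(sym (∑-*ˡ _ (box B m) _)) ⟩
      _
       ≈⟨ ∑-cong (box B m)(\ss -> trans (sym (∑-is (length I) B (\x -> ω I J * mon I * c x * (link x ss * Pc ss I))(Spl-≤ sp p)))
         (∑-cong (upTo (suc B))(\s -> solve 6 (\i w m c l q -> i :* (w :* m :* c :* (l :* q)) := c :* l :* (w :* (i :* (m :* q)))) rfl _ _ _ _ _ _))) ⟩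
      _
       ≈⟨ ∑-swap (box B m)(upTo (suc B)) _ ⟩
      ∑ (upTo (suc B))(\s -> ∑ (box B m)(\ss -> c (+ s) * link (+ s) ss * (ω I J * (is (length I)(+ s) * (mon I * Pc ss I))))) ∎) ⟩
  Σs Y (\I J -> ∑ (upTo (suc B))(\s -> ∑ (box B m)(\ss -> c (+ s) * link (+ s) ss * (ω I J * (is (length I)(+ s) * (mon I * Pc ss I))))))
   ≈⟨ ∑-swap (splits Y)(upTo (suc B)) _ ⟩
  ∑ (upTo (suc B))(\s -> Σs Y (\I J -> ∑ (box B m)(\ss -> c (+ s) * link (+ s) ss * (ω I J * (is (length I)(+ s) * (mon I * Pc ss I))))))
   ≈⟨ ∑-cong (upTo (suc B))(\s -> trans (∑-swap (splits Y)(box B m) _)(∑-cong (box B m)(\ss -> ∑-*ˡ _ (splits Y) _))) ⟩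
  ∑ (upTo (suc B))(\s -> ∑ (box B m)(\ss -> c (+ s) * link (+ s) ss * Pc (+ s ∷ ss) Y)) ∎

 S-expand : ∀ m B Y -> length Y ≤ B -> S (suc m) Y ≈ ∑ (upTo (suc B))(\s -> ∑ (box B m)(\ss -> link (+ s) ss * Pc (+ s ∷ ss) Y))
 S-expand m B Y p = trans (columns-expand m B (\_ -> 1#)(\_ -> 1#) Y p (\_ -> rfl))
  (∑-cong (upTo (suc B))(\s -> ∑-cong (box B m)(\ss -> *ʳ (*-identityˡ _))))

 Int-χℤ : ∀ x -> Int (χℤ x)
 Int-χℤ (+ n) = go n
  where
  pow : ∀ k -> Int (τ ^ k)
  pow zero = Int-1
  pow (suc k) = Int-* (Int-mono P)(pow k)
  go : ∀ n -> Int (χ n)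
  go zero = Int-1
  go (suc n) = Int-* (go n)(Int-+ Int-1 (pow (suc n)))
 Int-χℤ -[1+ n ] = Int-0

 Int-link : ∀ {m} x (s : Vec ℤ m) -> Int (link x s)
 Int-link x [] = Int-1
 Int-link x (s ∷ ss) = Int-* (Int-χℤ (x -' s))(Int-link s ss)

 multisum : ℕ -> ℕ -> List ℕ -> Carrier
 multisum m B zs = ∑ (upTo (suc B))(\s -> ∑ (box B m)(\ss -> link (+ s) ss * chain B zs (+ s ∷ ss)))

 -- With K ≤ 2PL the progressions of length L cannot be told from infinite ones modulo h^K.
 S-multisum : ∀ m {K} B L zs -> Good (alphabet zs L) -> K ≤ (P ℕ.+ P) ℕ.* L -> length (alphabet zs L) ≤ B -> S (suc m)(alphabet zs L) ≡[ K ] multisum m B zs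
 S-multisum m B L zs g K≤ len = ≡[]-trans (≡[]-reflexive (S-expand m B (alphabet zs L) len))
  (≡[]-∑ (All.map (\ {s} s≤B -> ≡[]-∑ (All.universal (\ss -> ≡[]-*ˡ (Int-link (+ s) ss)(Pc-chain B L zs g K≤ (+ s ∷ ss)(ℤ.+≤+ s≤B)))(box B m)))(upTo-≤ B)))

-- Equality up to units close to 1.

module Ratio (𝓕 : Frame)(P : ℕ)(0<P : 0 < P)(K : ℕ)(0<K : 0 < K) where
 open Chain 𝓕 P 0<P public

 -- A factor of this kind is preserved when both sides are multiplied or divided by arbitrary powers
 -- of h, whereas congruence modulo h^K is not.
 record Unit1 (u : Carrier) : Set where
  field
   inv : Carrier
   inverse : u * inv ≈ 1#
   Int-u : Int u
   Int-inv : Int inv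
   near-1 : Small K (u - 1#)

 open Unit1 public

 Unit1-1 : Unit1 1#
 Unit1-1 = record { inv = 1# ; inverse = *-identityˡ 1# ; Int-u = Int-1 ; Int-inv = Int-1 ; near-1 = Small-resp (sym (-‿inverseʳ 1#)) Small-0 }

 Unit1-* : ∀ {u v} -> Unit1 u -> Unit1 v -> Unit1 (u * v)
 Unit1-* {u} {v} U V = record
  { inv = inv U * inv V
  ; inverse = trans (x*y*[z*u]≈x*z*[y*u] _ _ _ _)(trans (*-cong (inverse U)(inverse V))(*-identityˡ 1#))
  ; Int-u = Int-* (Int-u U)(Int-u V) ; Int-inv = Int-* (Int-inv U)(Int-inv V)
  ; near-1 = Small-resp (solve 2 (\u v -> (u :- :1) :* v :+ (v :- :1) := u :* v :- :1) rfl u v)(Small-+ (Small-*Int (near-1 U)(Int-u V))(near-1 V)) }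

 Unit1-inv : ∀ {u} (U : Unit1 u) -> Unit1 (inv U)
 Unit1-inv {u} U = record
  { inv = u ; inverse = trans (*-comm _ _)(inverse U) ; Int-u = Int-inv U ; Int-inv = Int-u U
  ; near-1 = Small-resp (trans (-[[x-1]*y]≈y-x*y u (inv U))(+ˡ (-‿cong (inverse U))))(Small-neg (Small-*Int (near-1 U)(Int-inv U))) }

 -- Equality up to a factor that is ≡ 1 modulo h^K.
 infix 4 _≅_
 _≅_ : Carrier -> Carrier -> Set
 x ≅ y = ∃ \u -> Unit1 u × x ≈ u * y

 ≅-reflexive : ∀ {x y} -> x ≈ y -> x ≅ y
 ≅-reflexive p = 1# , Unit1-1 , trans p (sym (*-identityˡ _))

 ≅-refl : ∀ {x} -> x ≅ x
 ≅-refl = ≅-reflexive rfl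

 ≅-sym : ∀ {x y} -> x ≅ y -> y ≅ x
 ≅-sym {x} {y} (u , U , p) = inv U , Unit1-inv U , sym (begin
  inv U * x ≈⟨ *ˡ p ⟩
  _ ≈⟨ x*[y*z]≈y*x*z _ _ _ ⟩
  _ ≈⟨ *ʳ (inverse U) ⟩
  _ ≈⟨ *-identityˡ y ⟩
  y ∎)

 ≅-trans : ∀ {x y z} -> x ≅ y -> y ≅ z -> x ≅ z
 ≅-trans (u , U , p)(v , V , q) = u * v , Unit1-* U V , trans p (trans (*ˡ q)(sym (*-assoc _ _ _)))

 ≅-* : ∀ {x y z w} -> x ≅ y -> z ≅ w -> x * z ≅ y * w
 ≅-* (u , U , p)(v , V , q) = u * v , Unit1-* U V , trans (*-cong p q)(x*y*[z*u]≈x*z*[y*u] _ _ _ _)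

 ≅-*ʳ : ∀ {x y} z -> x ≅ y -> x * z ≅ y * z
 ≅-*ʳ z p = ≅-* p ≅-refl

 ≅-∏ : ∀ {A : Set} (xs : List A) {F G : A -> Carrier} -> (∀ x -> F x ≅ G x) -> ∏ xs F ≅ ∏ xs G
 ≅-∏ [] h = ≅-refl
 ≅-∏ (x ∷ xs) h = ≅-* (h x)(≅-∏ xs h)

 ≅-cancel : ∀ {u v x y} -> v * u ≈ 1# -> x * u ≅ y * u -> x ≅ y
 ≅-cancel {u} {v} {x} {y} vu (w , U , p) = w , U , unit-cancel vu (trans (*-comm _ _)(trans p (x*[y*z]≈z*[x*y] _ _ _)))

 infixr 2 _≅⟨_⟩_
 infix 3 _≅∎
 _≅⟨_⟩_ : ∀ x {y z} -> x ≅ y -> y ≅ z -> x ≅ z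
 x ≅⟨ p ⟩ q = ≅-trans p q
 _≅∎ : ∀ x -> x ≅ x
 x ≅∎ = ≅-refl

 large-unit : ∀ {x} -> + K ≤' x -> Unit1 (1# - mono x)
 large-unit {+ n} (ℤ.+≤+ K≤n) = record
  { inv = γ (+ n) ; inverse = one-minus n≢0
  ; Int-u = Int-+ Int-1 (Int-- (Int-mono n)) ; Int-inv = Int-γ n≢0
  ; near-1 = Small-resp (-x≈1-x-1 _)(Small-neg (Small-mono n K≤n)) }
  where
  n≢0 : + n ≢ 0'
  n≢0 e = ℕP.<-irrefl (≡.sym (ℤP.+-injective e))(ℕP.<-≤-trans 0<K K≤n)

 -- x is not a multiple of 2P, so no denominator 1 - h^z along the progression through x vanishes,
 -- in either direction.
 record NZ (x : ℤ) : Set where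
  constructor mkNZ
  field avoid : ∀ k -> x +' 2P *' k ≢ 0'

 NZ-0 : ∀ {x} -> NZ x -> x ≢ 0'
 NZ-0 {x} (mkNZ nz) e = nz 0' (≡.trans (cong₂ _+'_ e (ℤP.*-zeroʳ 2P)) refl)

 NZ-shift : ∀ {x y} k -> y ≡ x +' 2P *' k -> NZ x -> NZ y
 NZ-shift {x} k refl (mkNZ nz) = mkNZ \l e -> nz (k +' l)(≡.trans (lem x 2P k l) e)
  where
  lem : ∀ x p k l -> x +' p *' (k +' l) ≡ x +' p *' k +' p *' l
  lem = ℤsolve

 NZ-neg : ∀ {x} -> NZ x -> NZ (-' x)
 NZ-neg {x} (mkNZ nz) = mkNZ \l e -> nz (-' l)(≡.trans (lem x 2P l)(cong -'_ e))
  where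
  lem : ∀ x p l -> x +' p *' (-' l) ≡ -' (-' x +' p *' l)
  lem = ℤsolve

 NZ-small : ∀ d -> 0 < d -> d < P ℕ.+ P -> NZ (+ d)
 NZ-small d 0<d d<2P = mkNZ \k e -> multiple k e
  where
  multiple : ∀ k -> + d +' 2P *' k ≢ 0'
  multiple k e = absurd ∣ k ∣ refl
   where
   d≡ : + d ≡ -' (2P *' k)
   d≡ = ≡.trans (lem (+ d)(2P *' k))(≡.trans (cong (_-' (2P *' k)) e)(ℤP.+-identityˡ _))
    where
    lem : ∀ d x -> d ≡ d +' x -' x
    lem = ℤsolve
   abs≡ : d ≡ (P ℕ.+ P) ℕ.* ∣ k ∣
   abs≡ = ≡.trans (cong ∣_∣ d≡)(≡.trans (ℤP.∣-i∣≡∣i∣ (2P *' k))(ℤP.abs-* 2P k))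
   absurd : ∀ j -> ∣ k ∣ ≡ j -> ⊥
   absurd zero q = ℕP.<-irrefl (≡.sym (≡.trans abs≡ (≡.trans (cong ((P ℕ.+ P) ℕ.*_) q)(ℕP.*-zeroʳ (P ℕ.+ P))))) 0<d
   absurd (suc j) q = ℕP.<-irrefl refl (ℕP.<-≤-trans d<2P (subst (P ℕ.+ P ≤_)(≡.sym (≡.trans abs≡ (cong ((P ℕ.+ P) ℕ.*_) q)))(ℕP.m≤m*n (P ℕ.+ P)(suc j))))

 a-ratio : ∀ {x} -> x ≢ 0' -> a x ≈ (1# - mono (x +' 2P)) * γ x
 a-ratio {x} x≢0 = begin
  t + (1# - t) * γ x ≈⟨ solve 2 (\t g -> t :+ (:1 :- t) :* g := t :* :1 :+ (:1 :- t) :* g) rfl t (γ x) ⟩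
  _ ≈⟨ +ʳ (*ˡ (sym (one-minus x≢0))) ⟩
  _ ≈⟨ solve 3 (\t m g -> t :* ((:1 :- m) :* g) :+ (:1 :- t) :* g := (:1 :- m :* t) :* g) rfl t (mono x)(γ x) ⟩
  _ ≈⟨ *ʳ (+ˡ (-‿cong (sym (mono-+ x 2P)))) ⟩
  (1# - mono (x +' 2P)) * γ x ∎

 φ-ratio : ∀ {x} -> x ≢ 0' -> φ x ≈ (1# + mono (+ P +' x)) * γ x
 φ-ratio {x} x≢0 = begin
  - τ + (1# + τ) * γ x ≈⟨ solve 2 (\t g -> :- t :+ (:1 :+ t) :* g := :- (t :* :1) :+ (:1 :+ t) :* g) rfl τ (γ x) ⟩
  _ ≈⟨ +ʳ (-‿cong (*ˡ (sym (one-minus x≢0)))) ⟩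
  _ ≈⟨ solve 3 (\t m g -> :- (t :* ((:1 :- m) :* g)) :+ (:1 :+ t) :* g := (:1 :+ t :* m) :* g) rfl τ (mono x)(γ x) ⟩
  _ ≈⟨ *ʳ (+ˡ (sym (mono-+ (+ P) x))) ⟩
  (1# + mono (+ P +' x)) * γ x ∎

 -- The weaker condition for k steps upwards. It is needed for the class of c = 0, where the
 -- relevant exponents are multiples of 2P.
 record NZ≤ (k : ℕ)(x : ℤ) : Set where
  constructor mkNZ≤
  field avoid : ∀ j -> j ≤ k -> x +' 2P *' + j ≢ 0'

 NZ⇒NZ≤ : ∀ {k x} -> NZ x -> NZ≤ k x
 NZ⇒NZ≤ (mkNZ nz) = mkNZ≤ \j _ -> nz (+ j)

 pos⇒NZ≤ : ∀ {k x} -> 0' <' x -> NZ≤ k x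
 pos⇒NZ≤ {k} {+ n} 0<x = mkNZ≤ \j _ e -> ℤP.<-irrefl (≡.sym e)(ℤP.<-≤-trans 0<x (ℤP.≤-trans (ℤ.+≤+ (ℕP.m≤m+n n ((P ℕ.+ P) ℕ.* j)))(ℤP.≤-reflexive (cong (\z -> + n +' z)(ℤP.pos-* (P ℕ.+ P) j)))))

 NZ≤-0 : ∀ {k x} -> NZ≤ k x -> x ≢ 0'
 NZ≤-0 {x = x} (mkNZ≤ nz) e = nz 0 z≤n (≡.trans (cong₂ _+'_ e (ℤP.*-zeroʳ 2P)) refl)

 -- The product telescopes: t is the ratio of the progression, so the numerator of each factor is
 -- the denominator of the next.
 ∏-prog : ∀ b k z -> NZ≤ k (b +' z) -> ∏ (prog b k)(\x -> a (x +' z)) ≈ (1# - mono (b +' z +' 2P *' + k)) * γ (b +' z)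
 ∏-prog b zero z nz = sym (trans (*ʳ (+ˡ (-‿cong (mono-cong (≡.trans (cong (\y -> b +' z +' y)(ℤP.*-zeroʳ 2P))(ℤP.+-identityʳ _))))))(one-minus (NZ≤-0 nz)))
 ∏-prog b (suc k) z nz = begin
  a (b +' z) * ∏ (prog (b +' 2P) k)(\x -> a (x +' z))
   ≈⟨ *-cong (a-ratio (NZ≤-0 nz))(∏-prog (b +' 2P) k z nz') ⟩
  _
   ≈⟨ *-cong (*ʳ (+ˡ (-‿cong (mono-cong (lem1 b z 2P)))))(*ʳ (+ˡ (-‿cong (mono-cong (lem2 b z 2P (+ k)))))) ⟩
  _
   ≈⟨ solve 4 (\p g q h -> p :* g :* (q :* h) := p :* h :* (q :* g)) rfl _ _ _ _ ⟩
  _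
   ≈⟨ trans (*ʳ (one-minus (NZ≤-0 nz')))(*-identityˡ _) ⟩
  (1# - mono (b +' z +' 2P *' + suc k)) * γ (b +' z) ∎
  where
  lem1 : ∀ b z p -> b +' z +' p ≡ b +' p +' z
  lem1 = ℤsolve
  lem2 : ∀ b z p k -> b +' p +' z +' p *' k ≡ b +' z +' p *' (1' +' k)
  lem2 = ℤsolve
  nz' : NZ≤ k (b +' 2P +' z)
  nz' = mkNZ≤ \j j≤k e -> NZ≤.avoid nz (suc j)(s≤s j≤k)(≡.trans (≡.sym (lem2 b z 2P (+ j))) e)

 ∏-prog≅ : ∀ b k z -> NZ≤ k (b +' z) -> + K ≤' b +' z +' 2P *' + k -> ∏ (prog b k)(\x -> a (x +' z)) ≅ γ (b +' z)
 ∏-prog≅ b k z nz big = _ , large-unit big , ∏-prog b k z nz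

 Invertible : Carrier -> Set
 Invertible x = ∃ \y -> y * x ≈ 1#

 Inv-* : ∀ {x y} -> Invertible x -> Invertible y -> Invertible (x * y)
 Inv-* (u , p)(v , q) = u * v , trans (x*y*[z*u]≈x*z*[y*u] _ _ _ _)(trans (*-cong p q)(*-identityˡ 1#))

 Inv-mono : ∀ x -> Invertible (mono x)
 Inv-mono x = mono (-' x) , mono-inv x

 Inv-resp : ∀ {x y} -> x ≈ y -> Invertible x -> Invertible y
 Inv-resp p (u , q) = u , trans (*ˡ (sym p)) q

 Inv-γ : ∀ {x} -> x ≢ 0' -> Invertible (γ x)
 Inv-γ {x} p = 1# - mono x , one-minus p

 Inv-1- : ∀ {x} -> x ≢ 0' -> Invertible (1# - mono x)
 Inv-1- {x} p = γ x , γ-inv p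

 Inv-neg : ∀ {x} -> Invertible x -> Invertible (- x)
 Inv-neg (u , p) = - u , trans (solve 2 (\u x -> :- u :* :- x := u :* x) rfl _ _) p

 Inv-1 : Invertible 1#
 Inv-1 = 1# , *-identityˡ 1#

 Inv-∏ : ∀ {A : Set} (xs : List A) {F : A -> Carrier} -> All (\x -> Invertible (F x)) xs -> Invertible (∏ xs F)
 Inv-∏ [] [] = Inv-1
 Inv-∏ (x ∷ xs)(p ∷ ps) = Inv-* p (Inv-∏ xs ps)

 chain-up : ∀ R (f m : ℕ -> Carrier) -> (∀ k -> Invertible (m k)) ->
  (∀ k -> k < R -> f (suc k) * m k ≅ f k * m (suc k)) -> ∀ k -> k ≤ R -> f k * m 0 ≅ f 0 * m k
 chain-up R f m im step zero _ = ≅-refl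
 chain-up R f m im step (suc k) p = ≅-cancel (proj₂ (im k))
  (_ ≅⟨ ≅-reflexive (x*y*z≈x*z*y _ _ _) ⟩
   _ ≅⟨ ≅-*ʳ (m 0)(step k p) ⟩
   _ ≅⟨ ≅-reflexive (x*y*z≈x*z*y _ _ _) ⟩
   _ ≅⟨ ≅-*ʳ (m (suc k))(chain-up R f m im step k (ℕP.<⇒≤ p)) ⟩
   ≅-reflexive (x*y*z≈x*z*y _ _ _))

 -- If f(r+1) / f(r) ≅ m(r+1) / m(r) for -R ≤ r < R, then f(r) / f(0) ≅ m(r) / m(0).
 ratio-chain : ∀ R (f m : ℤ -> Carrier) -> (∀ r -> Invertible (m r)) ->
  (∀ r -> -' (+ R) ≤' r -> r <' + R -> f (r +' 1') * m r ≅ f r * m (r +' 1')) ->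
  ∀ r -> ∣ r ∣ ≤ R -> f r * m 0' ≅ f 0' * m r
 ratio-chain R f m im step (+ k) k≤R = chain-up R (\k -> f (+ k))(\k -> m (+ k))(\k -> im (+ k))(\k p ->
  subst (\z -> f z * m (+ k) ≅ f (+ k) * m z)(cong +_ (ℕP.+-comm k 1))(step (+ k)(ℤP.≤-trans (ℤP.neg-mono-≤ (ℤ.+≤+ (z≤n {R})))(ℤ.+≤+ z≤n))(ℤ.+<+ p))) k k≤R
 ratio-chain R f m im step -[1+ k ] k≤R = chain-up R (\k -> f (-' (+ k)))(\k -> m (-' (+ k)))(\k -> im (-' (+ k)))(\k p ->
  ≅-sym (subst (\z -> f z * m -[1+ k ] ≅ f -[1+ k ] * m z)(lem k)(step -[1+ k ] (ℤP.neg-mono-≤ (ℤ.+≤+ p)) ℤ.-<+)))(suc k) k≤R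
  where
  lem : ∀ k -> -[1+ k ] +' 1' ≡ -' (+ k)
  lem zero = refl
  lem (suc k) = refl

 X̂ : ℤ -> Carrier
 X̂ x = mono (x +' x) + mono (-' (x +' x))

 δ̂ : ℤ -> ℤ -> Carrier
 δ̂ x y = X̂ x - X̂ y

 mono-mono : ∀ x y -> mono x * mono y ≈ mono (x +' y)
 mono-mono x y = sym (mono-+ x y)

 δ̂-factor : ∀ x y -> δ̂ x y ≈ mono (-' (x +' x)) * ((1# - mono ((x +' x) +' (y +' y))) * (1# - mono ((x +' x) -' (y +' y))))
 δ̂-factor x y = begin
  mono u + mono (-' u) - (mono v + mono (-' v))
   ≈⟨ +-cong (+ʳ (mono-cong (l1 u v)))(-‿cong (+-cong (mono-cong (l2 u v))(mono-cong (l3 u v)))) ⟩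
  _
   ≈⟨ +-cong (+ʳ (trans (mono-+ _ _)(*ˡ (mono-+ _ _))))(-‿cong (+-cong (mono-+ _ _)(mono-+ _ _))) ⟩
  _
   ≈⟨ solve 3 (\m p q -> m :* (p :* q) :+ m :- (m :* p :+ m :* q) := m :* ((:1 :- p) :* (:1 :- q))) rfl _ _ _ ⟩
  mono (-' u) * ((1# - mono (u +' v)) * (1# - mono (u -' v))) ∎
  where
  u = x +' x
  v = y +' y
  l1 : ∀ u v -> u ≡ -' u +' (u +' v +' (u -' v))
  l1 = ℤsolve
  l2 : ∀ u v -> v ≡ -' u +' (u +' v)
  l2 = ℤsolve
  l3 : ∀ u v -> -' v ≡ -' u +' (u -' v)
  l3 = ℤsolve

 Inv-δ̂ : ∀ {x y} -> (x +' x) +' (y +' y) ≢ 0' -> (x +' x) -' (y +' y) ≢ 0' -> Invertible (δ̂ x y)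
 Inv-δ̂ {x} {y} p q = Inv-resp (sym (δ̂-factor x y))(Inv-* (Inv-mono _)(Inv-* (Inv-1- p)(Inv-1- q)))

 -- The factor by which δ̂ changes when β moves to β + P.
 δ̂-step : ∀ {β y G G'} -> NZ ((β +' β) +' (y +' y)) -> NZ ((β +' β) -' (y +' y)) -> G' ≡ G +' (β +' β +' + P) ->
  (1# - mono (2P +' ((β +' β) +' (y +' y)))) * (1# - mono (2P +' ((β +' β) -' (y +' y))))
   * (γ (-' ((β +' β) -' (y +' y))) * γ (-' ((β +' β) +' (y +' y)))) * (mono (G +' G) * δ̂ β y)
  ≈ mono (G' +' G') * δ̂ (β +' + P) y
 δ̂-step {β} {y} {G} {G'} nz₊ nz₋ refl = begin
  p * q * (γ (-' v) * γ (-' u)) * (mono (G +' G) * δ̂ β y)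
   ≈⟨ *ˡ (*ˡ (δ̂-factor β y)) ⟩
  _
   ≈⟨ solve 8 (\p q g h m n u v -> p :* q :* (g :* h) :* (m :* (n :* (u :* v))) := p :* q :* (m :* n) :* ((u :* h) :* (v :* g))) rfl _ _ _ _ _ _ _ _ ⟩
  _
   ≈⟨ *ˡ (*-cong (flip (NZ-0 nz₊))(flip (NZ-0 nz₋))) ⟩
  _
   ≈⟨ solve 6 (\p q m n u v -> p :* q :* (m :* n) :* (:- u :* :- v) := m :* n :* (u :* v) :* (p :* q)) rfl _ _ _ _ _ _ ⟩
  _
   ≈⟨ *ʳ (trans (*-cong (mono-mono _ _)(mono-mono _ _))(trans (mono-mono _ _)(trans (mono-cong (exps G β y (+ P)))(mono-+ _ _)))) ⟩
  _
   ≈⟨ trans (*-assoc _ _ _)(*ˡ (*ˡ (*-cong (+ˡ (-‿cong (mono-cong (l1 β y (+ P)))))(+ˡ (-‿cong (mono-cong (l2 β y (+ P)))))))) ⟩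
  _
   ≈⟨ *ˡ (sym (δ̂-factor β' y)) ⟩
  mono (G' +' G') * δ̂ β' y ∎
  where
  b = β +' β
  u = b +' (y +' y)
  v = b -' (y +' y)
  β' = β +' + P
  p = 1# - mono (2P +' u)
  q = 1# - mono (2P +' v)
  flip : ∀ {x} -> x ≢ 0' -> (1# - mono x) * γ (-' x) ≈ - mono x
  flip {x} ne = trans (*ˡ (γ-neg ne))(trans (solve 2 (\m g -> (:1 :- m) :* (:1 :- g) := :1 :- m :- (:1 :- m) :* g) rfl _ _)
   (trans (+ˡ (-‿cong (one-minus ne)))(solve 1 (\m -> :1 :- m :- :1 := :- m) rfl _)))
  exps : ∀ G β y P -> G +' G +' -' (β +' β) +' (β +' β +' (y +' y) +' (β +' β -' (y +' y)))
     ≡ (G +' (β +' β +' P) +' (G +' (β +' β +' P))) +' -' (β +' P +' (β +' P))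
  exps = ℤsolve
  l1 : ∀ β y P -> (P +' P) +' ((β +' β) +' (y +' y)) ≡ (β +' P +' (β +' P)) +' (y +' y)
  l1 = ℤsolve
  l2 : ∀ β y P -> (P +' P) +' ((β +' β) -' (y +' y)) ≡ (β +' P +' (β +' P)) -' (y +' y)
  l2 = ℤsolve

odd : ℕ -> ℕ
odd zero = 1
odd (suc n) = suc (suc (odd n))

-- How `A` changes when letters change their signs.

module Steps (𝓕 : Frame)(P : ℕ)(0<P : 0 < P)(K : ℕ)(0<K : 0 < K)(q : ℕ)(2q<P : q ℕ.+ q < P)(R : ℕ) where
 open Ratio 𝓕 P 0<P K 0<K public

 -- Long enough that after R sign changes the far end of every progression still has exponents of at
 -- least K in all products that occur, so that it contributes a unit close to 1.
 L : ℕ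
 L = R ℕ.+ suc K

 dbl : ℤ -> ℤ
 dbl x = x +' x

 -- After r sign changes the class c behaves like the point c + Pr. `Γ c r` is the exponent of the
 -- product of the letters whose signs were changed; negative r refers to the progression that
 -- starts at P - 2c.
 β̂ Γ : ℕ -> ℤ -> ℤ
 β̂ c r = + c +' + P *' r
 Γ c r = + P *' (r *' r) +' dbl (+ c) *' r

 -- The exponents ±P ± 2c mod 2P of a pair of classes, after r sign changes.
 blk : ℕ -> ℤ -> List ℤ
 blk c r = prog (+ P +' dbl (β̂ c r)) ∣ + L -' r ∣ ++ prog (+ P -' dbl (β̂ c r)) ∣ + L +' r ∣

 blk0 : ℕ -> List ℤ
 blk0 r = prog (+ P +' dbl (β̂ 0 (+ r))) ∣ + L -' + r ∣ ++ prog (+ P -' dbl (β̂ 0 (+ r))) r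

 Γ-suc : ∀ c r -> Γ c (r +' 1') ≡ Γ c r +' (dbl (β̂ c r) +' + P)
 Γ-suc c r = lem (+ c) r (+ P)
  where
  lem : ∀ c r P -> P *' ((r +' 1') *' (r +' 1')) +' (c +' c) *' (r +' 1') ≡ P *' (r *' r) +' (c +' c) *' r +' (c +' P *' r +' (c +' P *' r) +' P)
  lem = ℤsolve

 β̂-suc : ∀ c r -> β̂ c (r +' 1') ≡ β̂ c r +' + P
 β̂-suc c r = lem (+ c) r (+ P)
  where
  lem : ∀ c r P -> c +' P *' (r +' 1') ≡ c +' P *' r +' P
  lem = ℤsolve

 abs-bounds : ∀ {r} -> ∣ r ∣ ≤ R -> r ≤' + R × -' (+ R) ≤' r
 abs-bounds {+ n} p = ℤ.+≤+ p , ℤP.≤-trans (ℤP.neg-mono-≤ (ℤ.+≤+ (z≤n {R})))(ℤ.+≤+ z≤n)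
 abs-bounds { -[1+ n ]} p = ℤ.-≤+ , ℤP.neg-mono-≤ (ℤ.+≤+ p)

 bounds-abs : ∀ {r} -> -' (+ R) ≤' r -> r ≤' + R -> ∣ r ∣ ≤ R
 bounds-abs {+ n} _ (ℤ.+≤+ p) = p
 bounds-abs { -[1+ n ]} p _ = ℤP.drop‿+≤+ (subst (+ suc n ≤'_)(ℤP.neg-involutive (+ R))(ℤP.neg-mono-≤ p))

 R≤L : + R ≤' + L
 R≤L = ℤ.+≤+ (ℕP.m≤m+n R (suc K))

 count₋ : ∀ {r} -> ∣ r ∣ ≤ R -> + ∣ + L -' r ∣ ≡ + L -' r
 count₋ {r} p = ℤP.0≤i⇒+∣i∣≡i (ℤP.i≤j⇒0≤j-i (ℤP.≤-trans (proj₁ (abs-bounds {r} p)) R≤L))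

 count₊ : ∀ {r} -> ∣ r ∣ ≤ R -> + ∣ + L +' r ∣ ≡ + L +' r
 count₊ {r} p = ℤP.0≤i⇒+∣i∣≡i (subst (_≤' + L +' r)(ℤP.+-inverseʳ (+ L))(ℤP.+-monoʳ-≤ (+ L)(ℤP.≤-trans (ℤP.neg-mono-≤ R≤L)(proj₂ (abs-bounds {r} p)))))

 -- -`W0` bounds from below both `ê c r` and its negative for c ≤ q and |r| ≤ R, as `ê-bounds`
 -- shows.
 W0 : ℤ
 W0 = + P +' dbl (+ q) +' 2P *' + R

 private
  0≤pos-* : ∀ m {x} -> 0' ≤' x -> 0' ≤' + m *' x
  0≤pos-* m {+ n} _ = subst (0' ≤'_)(ℤP.pos-* m n)(ℤ.+≤+ z≤n)

  +-nonneg : ∀ {x y} -> 0' ≤' x -> 0' ≤' y -> 0' ≤' x +' y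
  +-nonneg = ℤP.+-mono-≤

  i-nonneg : ∀ {x y} -> x ≤' y -> 0' ≤' y -' x
  i-nonneg = ℤP.i≤j⇒0≤j-i

  ≤-by : ∀ {x y d} -> y ≡ d +' x -> 0' ≤' d -> x ≤' y
  ≤-by {x} {y} {d} refl p = subst (_≤' d +' x)(ℤP.+-identityˡ x)(ℤP.+-monoˡ-≤ x p)

  2q≤P : 0' ≤' + P -' dbl (+ q)
  2q≤P = i-nonneg (ℤ.+≤+ (ℕP.<⇒≤ 2q<P))

  K≤2PK : 0' ≤' 2P *' + K -' + K
  K≤2PK = i-nonneg (subst (+ K ≤'_)(ℤP.pos-* (P ℕ.+ P) K)(ℤ.+≤+ (ℕP.≤-trans (ℕP.m≤m+n K _)(ℕP.*-monoˡ-≤ K {1} {P ℕ.+ P} (ℕP.≤-trans 0<P (ℕP.m≤m+n P P))))))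

  big : ∀ {c w x} -> ∣ c ∣ ≤ q -> -' W0 ≤' w -> x ≡ + P +' dbl c +' w +' 2P *' + L -> + K ≤' x
  big {c} {w} c≤q w≥ refl = ≤-by (lem (+ P) c w (+ q)(+ R)(+ K))(+-nonneg (+-nonneg (i-nonneg w≥)(+-nonneg 2q≤P 2q≤P))(+-nonneg (+-nonneg c+q c+q) K≤2PK))
   where
   c+q : 0' ≤' c +' + q
   c+q = subst (_≤' c +' + q)(ℤP.+-inverseˡ (+ q))(ℤP.+-monoˡ-≤ (+ q)(lower c c≤q))
    where
    lower : ∀ c -> ∣ c ∣ ≤ q -> -' (+ q) ≤' c
    lower (+ n) _ = ℤP.≤-trans (ℤP.neg-mono-≤ (ℤ.+≤+ (z≤n {q})))(ℤ.+≤+ z≤n)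
    lower -[1+ n ] p = ℤP.neg-mono-≤ (ℤ.+≤+ p)
   lem : ∀ P c w q R K -> P +' (c +' c) +' w +' (P +' P) *' (R +' (1' +' K))
    ≡ ((w -' (-' (P +' (q +' q) +' (P +' P) *' R))) +' ((P -' (q +' q)) +' (P -' (q +' q)))) +' ((c +' q +' (c +' q)) +' ((P +' P) *' K -' K)) +' K
   lem = ℤsolve

 ∏-front : ∀ {c} r w -> c ≤ q -> ∣ r ∣ ≤ R -> -' W0 ≤' w -> NZ (+ P +' dbl (β̂ c r) +' w) ->
  ∏ (prog (+ P +' dbl (β̂ c r)) ∣ + L -' r ∣)(\x -> a (x +' w)) ≅ γ (+ P +' dbl (β̂ c r) +' w)
 ∏-front {c} r w c≤q r≤R w≥ nz = ∏-prog≅ (+ P +' dbl (β̂ c r)) ∣ + L -' r ∣ w (NZ⇒NZ≤ nz)(big {+ c} {w} c≤q w≥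
  (≡.trans (cong (\z -> + P +' dbl (β̂ c r) +' w +' 2P *' z)(count₋ {r} r≤R))(l1 (+ P)(+ c) r w (+ L))))
  where
  l1 : ∀ P c r w L -> P +' (c +' P *' r +' (c +' P *' r)) +' w +' (P +' P) *' (L -' r) ≡ P +' (c +' c) +' w +' (P +' P) *' L
  l1 = ℤsolve

 ∏-back : ∀ {c} r w -> c ≤ q -> ∣ r ∣ ≤ R -> -' W0 ≤' w -> NZ (+ P -' dbl (β̂ c r) +' w) ->
  ∏ (prog (+ P -' dbl (β̂ c r)) ∣ + L +' r ∣)(\x -> a (x +' w)) ≅ γ (+ P -' dbl (β̂ c r) +' w)
 ∏-back {c} r w c≤q r≤R w≥ nz = ∏-prog≅ (+ P -' dbl (β̂ c r)) ∣ + L +' r ∣ w (NZ⇒NZ≤ nz)(big { -' (+ c)} {w} (subst (_≤ q)(≡.sym (ℤP.∣-i∣≡∣i∣ (+ c))) c≤q) w≥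
  (≡.trans (cong (\z -> + P -' dbl (β̂ c r) +' w +' 2P *' z)(count₊ {r} r≤R))(l2 (+ P)(+ c) r w (+ L))))
  where
  l2 : ∀ P c r w L -> P -' (c +' P *' r +' (c +' P *' r)) +' w +' (P +' P) *' (L +' r) ≡ P +' (-' c +' -' c) +' w +' (P +' P) *' L
  l2 = ℤsolve

 -- The letter whose sign changes in the step from r to r + 1.
 ê : ℕ -> ℤ -> ℤ
 ê c r = + P +' dbl (β̂ c r)

 ê-bounds : ∀ {c r} -> c ≤ q -> ∣ r ∣ ≤ R -> -' W0 ≤' ê c r × -' W0 ≤' -' ê c r
 ê-bounds {c} {r} c≤q r≤R =
   ≤-by (l1 (+ P)(+ c) r (+ q)(+ R))(+-nonneg (+-nonneg (+-nonneg (ℤ.+≤+ (z≤n {P}))(ℤ.+≤+ (z≤n {P})))(+-nonneg cq cq))(0≤pos-* (P ℕ.+ P) r+R))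
  , ≤-by (l2 (+ P)(+ c) r (+ q)(+ R))(+-nonneg (+-nonneg q-c q-c)(0≤pos-* (P ℕ.+ P)(i-nonneg (proj₁ (abs-bounds {r} r≤R)))))
  where
  cq : 0' ≤' + c +' + q
  cq = ℤ.+≤+ z≤n
  q-c : 0' ≤' + q -' + c
  q-c = i-nonneg (ℤ.+≤+ c≤q)
  r+R : 0' ≤' r +' + R
  r+R = subst (_≤' r +' + R)(ℤP.+-inverseˡ (+ R))(ℤP.+-monoˡ-≤ (+ R)(proj₂ (abs-bounds {r} r≤R)))
  l1 : ∀ P c r q R -> P +' (c +' P *' r +' (c +' P *' r)) ≡ (P +' P +' (c +' q +' (c +' q)) +' (P +' P) *' (r +' R)) +' (-' (P +' (q +' q) +' (P +' P) *' R))
  l1 = ℤsolve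
  l2 : ∀ P c r q R -> -' (P +' (c +' P *' r +' (c +' P *' r))) ≡ (q -' c +' (q -' c) +' (P +' P) *' (R -' r)) +' (-' (P +' (q +' q) +' (P +' P) *' R))
  l2 = ℤsolve

 private
  NZ-eq : ∀ {x y} -> x ≡ y -> NZ x -> NZ y
  NZ-eq = subst NZ

  2d<2P : ∀ {d} -> d < P -> d ℕ.+ d < P ℕ.+ P
  2d<2P p = ℕP.+-mono-< p p

  NZ-dbl : ∀ d -> 0 < d -> d < P -> NZ (dbl (+ d))
  NZ-dbl d 0<d d<P = NZ-small (d ℕ.+ d)(ℕP.≤-trans 0<d (ℕP.m≤m+n d d))(2d<2P d<P)

  NZ-minus : ∀ {c c'} -> c ≢ c' -> c ≤ q -> c' ≤ q -> NZ (dbl (+ c) -' dbl (+ c'))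
  NZ-minus {c} {c'} ne p p' with ℕP.<-cmp c c'
  ... | tri≈ _ e _ = contradiction e ne
  ... | tri> _ _ c'<c = NZ-eq (lem c c' (ℕP.<⇒≤ c'<c))(NZ-dbl (c ∸ c')(ℕP.m<n⇒0<n∸m c'<c)(ℕP.≤-<-trans (ℕP.≤-trans (ℕP.m∸n≤m c c')(ℕP.≤-trans p (ℕP.m≤m+n q q))) 2q<P))
   where
   lem : ∀ c c' -> c' ≤ c -> dbl (+ (c ∸ c')) ≡ dbl (+ c) -' dbl (+ c')
   lem c c' le = ≡.trans (cong dbl (≡.trans (≡.sym (ℤP.⊖-≥ le))(≡.sym (ℤP.m-n≡m⊖n c c'))))(l (+ c)(+ c'))
    where
    l : ∀ a b -> (a -' b) +' (a -' b) ≡ (a +' a) -' (b +' b)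
    l = ℤsolve
  ... | tri< c<c' _ _ = NZ-eq (lem c c' (ℕP.<⇒≤ c<c'))(NZ-neg (NZ-dbl (c' ∸ c)(ℕP.m<n⇒0<n∸m c<c')(ℕP.≤-<-trans (ℕP.≤-trans (ℕP.m∸n≤m c' c)(ℕP.≤-trans p' (ℕP.m≤m+n q q))) 2q<P)))
   where
   lem : ∀ c c' -> c ≤ c' -> -' dbl (+ (c' ∸ c)) ≡ dbl (+ c) -' dbl (+ c')
   lem c c' le = ≡.trans (cong (\z -> -' dbl z)(≡.trans (≡.sym (ℤP.⊖-≥ le))(≡.sym (ℤP.m-n≡m⊖n c' c))))(l (+ c)(+ c'))
    where
    l : ∀ a b -> -' ((b -' a) +' (b -' a)) ≡ (a +' a) -' (b +' b)
    l = ℤsolve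

  NZ-plus : ∀ {c c'} -> c ≢ c' -> c ≤ q -> c' ≤ q -> NZ (dbl (+ c) +' dbl (+ c'))
  NZ-plus {c} {c'} ne p p' = NZ-eq (l (+ c)(+ c'))(NZ-dbl (c ℕ.+ c')(positive c c' ne)(ℕP.≤-<-trans (ℕP.+-mono-≤ p p') 2q<P))
   where
   positive : ∀ c c' -> c ≢ c' -> 0 < c ℕ.+ c'
   positive zero zero ne = contradiction refl ne
   positive zero (suc c') _ = s≤s z≤n
   positive (suc c) c' _ = s≤s z≤n
   l : ∀ a b -> (a +' b) +' (a +' b) ≡ (a +' a) +' (b +' b)
   l = ℤsolve

 NZ₊ : ∀ {c c'} r r' -> c ≢ c' -> c ≤ q -> c' ≤ q -> NZ (dbl (β̂ c r) +' dbl (β̂ c' r'))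
 NZ₊ {c} {c'} r r' ne p p' = NZ-shift (r +' r')(lem (+ c)(+ c') r r' (+ P))(NZ-plus ne p p')
  where
  lem : ∀ c d r s P -> (c +' P *' r) +' (c +' P *' r) +' ((d +' P *' s) +' (d +' P *' s)) ≡ (c +' c) +' (d +' d) +' (P +' P) *' (r +' s)
  lem = ℤsolve

 NZ₋ : ∀ {c c'} r r' -> c ≢ c' -> c ≤ q -> c' ≤ q -> NZ (dbl (β̂ c r) -' dbl (β̂ c' r'))
 NZ₋ {c} {c'} r r' ne p p' = NZ-shift (r -' r')(lem (+ c)(+ c') r r' (+ P))(NZ-minus ne p p')
  where
  lem : ∀ c d r s P -> (c +' P *' r) +' (c +' P *' r) -' ((d +' P *' s) +' (d +' P *' s)) ≡ (c +' c) -' (d +' d) +' (P +' P) *' (r -' s)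
  lem = ℤsolve

 NZ-self : ∀ {c} r -> 0 < c -> c ≤ q -> NZ (dbl (dbl (β̂ c r)))
 NZ-self {c} r 0<c p = NZ-shift (dbl r)(lem (+ c) r (+ P))(NZ-eq (l (+ c))(NZ-dbl (c ℕ.+ c)(ℕP.≤-trans 0<c (ℕP.m≤m+n c c))(ℕP.≤-<-trans (ℕP.+-mono-≤ p p) 2q<P)))
  where
  l : ∀ c -> (c +' c) +' (c +' c) ≡ dbl (dbl c)
  l c = refl
  lem : ∀ c r P -> (c +' P *' r +' (c +' P *' r)) +' (c +' P *' r +' (c +' P *' r)) ≡ c +' c +' (c +' c) +' (P +' P) *' (r +' r)
  lem = ℤsolve

 -- X′ arises from X by changing the sign of the element e.
 module Move {e U X X'} (old : X ↭ e ∷ U)(new : X' ↭ -' e ∷ U) where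
  private
   flip : ∀ x Z -> ∏ Z (\z -> a (x +' z)) ≈ ∏ Z (\z -> a (z +' x))
   flip x Z = ∏-cong Z (\z -> a-cong (ℤP.+-comm x z))

  cross-step : ∀ Z -> cross X' Z * ∏ Z (\z -> a (z +' e)) ≈ cross X Z * ∏ Z (\z -> a (z +' -' e))
  cross-step Z = begin
   cross X' Z * _ ≈⟨ *ʳ (trans (∏-↭ _ new)(*ʳ (flip (-' e) Z))) ⟩
   _ ≈⟨ x*y*z≈z*y*x _ _ _ ⟩
   _ ≈⟨ *ʳ (sym (trans (∏-↭ _ old)(*ʳ (flip e Z)))) ⟩
   cross X Z * _ ∎

  A-step : A X' * (φ e * ∏ U (\z -> a (z +' e))) ≈ A X * (φ (-' e) * ∏ U (\z -> a (z +' -' e)))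
  A-step = begin
   A X' * _ ≈⟨ *ʳ (trans (A-↭ new)(*ʳ (*ˡ (flip (-' e) U)))) ⟩
   _ ≈⟨ x*y*z≈z*y*x _ _ _ ⟩
   _ ≈⟨ *ʳ (sym (trans (A-↭ old)(*ʳ (*ˡ (flip e U))))) ⟩
   A X * _ ∎

 module _ (c : ℕ)(r : ℤ) where
  Uₛ Vₛ : List ℤ
  Uₛ = prog (ê c r +' 2P) ∣ + L -' (r +' 1') ∣
  Vₛ = prog (+ P -' dbl (β̂ c r)) ∣ + L +' r ∣

 ê-suc : ∀ c r -> ê c (r +' 1') ≡ ê c r +' 2P
 ê-suc c r = l1 (+ P)(+ c) r
  where
  l1 : ∀ P c r -> P +' (c +' P *' (r +' 1') +' (c +' P *' (r +' 1'))) ≡ P +' (c +' P *' r +' (c +' P *' r)) +' (P +' P)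
  l1 = ℤsolve

 -ê-suc : ∀ c r -> + P -' dbl (β̂ c (r +' 1')) ≡ -' ê c r
 -ê-suc c r = l2 (+ P)(+ c) r
  where
  l2 : ∀ P c r -> P -' (c +' P *' (r +' 1') +' (c +' P *' (r +' 1'))) ≡ -' (P +' (c +' P *' r +' (c +' P *' r)))
  l2 = ℤsolve

 -ê+2P : ∀ c r -> -' ê c r +' 2P ≡ + P -' dbl (β̂ c r)
 -ê+2P c r = l3 (+ P)(+ c) r
  where
  l3 : ∀ P c r -> -' (P +' (c +' P *' r +' (c +' P *' r))) +' (P +' P) ≡ P -' (c +' P *' r +' (c +' P *' r))
  l3 = ℤsolve

 module _ {c : ℕ} {r : ℤ} (r≥ : -' (+ R) ≤' r)(r< : r <' + R) where
  in-range : ∣ r ∣ ≤ R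
  in-range = bounds-abs r≥ (ℤP.<⇒≤ r<)

  private
   r+1≤R : ∣ r +' 1' ∣ ≤ R
   r+1≤R = bounds-abs (ℤP.≤-trans r≥ (ℤP.i≤i+j r 1'))(subst (_≤' + R)(ℤP.+-comm 1' r)(ℤP.i<j⇒suc[i]≤j r<))

  front-old : prog (ê c r) ∣ + L -' r ∣ ≡ ê c r ∷ Uₛ c r
  front-old = cong (prog (ê c r))(ℤP.+-injective (≡.trans (count₋ {r} in-range)(≡.trans (l (+ L) r)(cong (\z -> 1' +' z)(≡.sym (count₋ {r +' 1'} r+1≤R))))))
   where
   l : ∀ L r -> L -' r ≡ 1' +' (L -' (r +' 1'))
   l = ℤsolve

  blk-old : blk c r ↭ ê c r ∷ Uₛ c r ++ Vₛ c r
  blk-old = ↭-reflexive (cong (_++ Vₛ c r) front-old)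

  blk-new : blk c (r +' 1') ↭ -' ê c r ∷ Uₛ c r ++ Vₛ c r
  blk-new = Perm.trans (↭-reflexive (cong₂ _++_ (cong (\b -> prog b ∣ + L -' (r +' 1') ∣)(ê-suc c r))
   (≡.trans (cong₂ prog (-ê-suc c r)(ℤP.+-injective (≡.trans (count₊ {r +' 1'} r+1≤R)(≡.trans (l (+ L) r)(cong (\z -> 1' +' z)(≡.sym (count₊ {r} in-range)))))))
    (cong (\b -> -' ê c r ∷ prog b ∣ + L +' r ∣)(-ê+2P c r)))))(PermP.shift (-' ê c r)(Uₛ c r)(Vₛ c r))
   where
   l : ∀ L r -> L +' (r +' 1') ≡ 1' +' (L +' r)
   l = ℤsolve

  private
   piece : ∀ b k w x -> b +' w ≡ x -> NZ≤ k x -> + K ≤' b +' w +' 2P *' + k -> ∏ (prog b k)(\z -> a (z +' w)) ≅ γ x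
   piece b k w x refl nz bg = ∏-prog≅ b k w nz bg

   U-piece : c ≤ q -> ∀ {w x} -> -' W0 ≤' w -> ê c r +' 2P +' w ≡ x -> NZ≤ ∣ + L -' (r +' 1') ∣ x -> ∏ (Uₛ c r)(\z -> a (z +' w)) ≅ γ x
   U-piece c≤q {w} {x} w≥ e nz = piece _ ∣ + L -' (r +' 1') ∣ w x e nz (big {+ c} {w} c≤q w≥
    (≡.trans (cong (\z -> ê c r +' 2P +' w +' 2P *' z)(count₋ {r +' 1'} r+1≤R))(l (+ P)(+ c) r w (+ L))))
    where
    l : ∀ P c r w L -> P +' (c +' P *' r +' (c +' P *' r)) +' (P +' P) +' w +' (P +' P) *' (L -' (r +' 1')) ≡ P +' (c +' c) +' w +' (P +' P) *' L
    l = ℤsolve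

   V-piece : c ≤ q -> ∀ {w x} -> -' W0 ≤' w -> + P -' dbl (β̂ c r) +' w ≡ x -> NZ≤ ∣ + L +' r ∣ x -> ∏ (Vₛ c r)(\z -> a (z +' w)) ≅ γ x
   V-piece c≤q {w} {x} w≥ e nz = piece _ ∣ + L +' r ∣ w x e nz (big { -' (+ c)} {w} (subst (_≤ q)(≡.sym (ℤP.∣-i∣≡∣i∣ (+ c))) c≤q) w≥
    (≡.trans (cong (\z -> + P -' dbl (β̂ c r) +' w +' 2P *' z)(count₊ {r} in-range))(l (+ P)(+ c) r w (+ L))))
    where
    l : ∀ P c r w L -> P -' (c +' P *' r +' (c +' P *' r)) +' w +' (P +' P) *' (L +' r) ≡ P +' (-' c +' -' c) +' w +' (P +' P) *' L
    l = ℤsolve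

   0<2P : 0' <' 2P
   0<2P = ℤ.+<+ (ℕP.≤-trans 0<P (ℕP.m≤m+n P P))

  U₊ : c ≤ q -> NZ≤ ∣ + L -' (r +' 1') ∣ (2P +' dbl (ê c r)) -> ∏ (Uₛ c r)(\z -> a (z +' ê c r)) ≅ γ (2P +' dbl (ê c r))
  U₊ c≤q nz = U-piece c≤q (proj₁ (ê-bounds {c} {r} c≤q in-range))(l (ê c r) 2P) nz
   where
   l : ∀ e p -> e +' p +' e ≡ p +' (e +' e)
   l = ℤsolve

  U₋ : c ≤ q -> ∏ (Uₛ c r)(\z -> a (z +' -' ê c r)) ≅ γ 2P
  U₋ c≤q = U-piece c≤q (proj₂ (ê-bounds {c} {r} c≤q in-range))(l (ê c r) 2P)(pos⇒NZ≤ {∣ + L -' (r +' 1') ∣} 0<2P)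
   where
   l : ∀ e p -> e +' p +' -' e ≡ p
   l = ℤsolve

  V₊ : c ≤ q -> ∏ (Vₛ c r)(\z -> a (z +' ê c r)) ≅ γ 2P
  V₊ c≤q = V-piece c≤q (proj₁ (ê-bounds {c} {r} c≤q in-range))(l (+ P)(dbl (β̂ c r)))(pos⇒NZ≤ {∣ + L +' r ∣} 0<2P)
   where
   l : ∀ p b -> p -' b +' (p +' b) ≡ p +' p
   l = ℤsolve

  V₋ : c ≤ q -> NZ (2P +' dbl (-' ê c r)) -> ∏ (Vₛ c r)(\z -> a (z +' -' ê c r)) ≅ γ (2P +' dbl (-' ê c r))
  V₋ c≤q nz = V-piece c≤q (proj₂ (ê-bounds {c} {r} c≤q in-range))(l (+ P)(dbl (β̂ c r)))(NZ⇒NZ≤ {∣ + L +' r ∣} {2P +' dbl (-' ê c r)} nz)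
   where
   l : ∀ p b -> p -' b +' -' (p +' b) ≡ (p +' p) +' (-' (p +' b) +' -' (p +' b))
   l = ℤsolve

 -- With X = h^x: (1 + τX)(1 - τX) = 1 - tX^2. The factor `φ` of a letter thus merges with the
 -- product over its own progression.
 φ-half : ∀ {x} -> x ≢ 0' -> 2P +' dbl x ≢ 0' -> φ x * ((1# - mono (+ P +' x)) * γ (2P +' dbl x)) ≈ γ x
 φ-half {x} x≢0 y≢0 = begin
  φ x * ((1# - m) * g) ≈⟨ *ʳ (φ-ratio x≢0) ⟩
  _ ≈⟨ solve 3 (\m h g -> (:1 :+ m) :* h :* ((:1 :- m) :* g) := h :* ((:1 :- m :* m) :* g)) rfl m (γ x) g ⟩
  _ ≈⟨ *ˡ (trans (*ʳ (+ˡ (-‿cong (trans (mono-mono _ _)(mono-cong (l (+ P) x))))))(one-minus y≢0)) ⟩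
  _ ≈⟨ *-identityʳ _ ⟩
  γ x ∎
  where
  m = mono (+ P +' x)
  g = γ (2P +' dbl x)
  l : ∀ p x -> p +' x +' (p +' x) ≡ (p +' p) +' (x +' x)
  l = ℤsolve

 γ-flip : ∀ {x} -> x ≢ 0' -> γ (-' x) ≈ - mono x * γ x
 γ-flip {x} x≢0 = trans (γ-neg x≢0)(sym (trans (sym (-‿distribˡ-* _ _))(trans (-‿cong (mono-γ x≢0))(solve 1 (\g -> :- (g :- :1) := :1 :- g) rfl _))))

 μ : ℕ -> ℤ -> ℤ -> Carrier
 μ c r y = mono (dbl (Γ c r)) * δ̂ (β̂ c r) y

 -- Turns the boundary terms left by telescoping into the ratio of μ at r + 1 and at r. Here s
 -- collects what the old and the new letter share, and z is the extra factor of the move.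
 step-core : ∀ c r y {f f' M₊ M₋ s z} -> Invertible s -> NZ (dbl (β̂ c r) +' dbl y) -> NZ (dbl (β̂ c r) -' dbl y) -> f' * M₊ ≈ f * M₋ ->
  M₊ ≅ s * (γ (2P +' (dbl (β̂ c r) +' dbl y)) * γ (2P +' (dbl (β̂ c r) -' dbl y))) ->
  M₋ ≅ s * z * (γ (-' (dbl (β̂ c r) -' dbl y)) * γ (-' (dbl (β̂ c r) +' dbl y))) ->
  f' * μ c r y ≅ f * (z * μ c (r +' 1') y)
 step-core c r y {f} {f'} {M₊} {M₋} {s} {z} (i , is) nz₊ nz₋ move p₊ p₋ = ≅-cancel is
  (_ ≅⟨ ≅-reflexive (sym (trans (solve 7 (\f s g h p q m -> f :* (s :* (g :* h)) :* (p :* q :* m) := f :* m :* s :* ((p :* g) :* (q :* h))) rfl _ _ _ _ _ _ _)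
      (trans (*ˡ (trans (*-cong (one-minus (shifted nz₊))(one-minus (shifted nz₋)))(*-identityˡ 1#)))(*-identityʳ _)))) ⟩
   _ ≅⟨ ≅-*ʳ _ (≅-trans (≅-* (≅-refl {f'})(≅-sym p₊))(≅-trans (≅-reflexive move)(≅-* ≅-refl p₋))) ⟩
   ≅-reflexive (trans (solve 8 (\f s z g h p q m -> f :* (s :* z :* (g :* h)) :* (p :* q :* m) := f :* (z :* (p :* q :* (g :* h) :* m)) :* s) rfl _ _ _ _ _ _ _ _)
    (*ʳ (*ˡ (*ˡ (trans (δ̂-step {β̂ c r} {y} {Γ c r} nz₊ nz₋ (Γ-suc c r))(*ˡ (reflexive (cong (\b -> δ̂ b y)(≡.sym (β̂-suc c r)))))))))))
  where
  shifted : ∀ {x} -> NZ x -> 2P +' x ≢ 0'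
  shifted {x} nz = NZ-0 (NZ-shift 1' (l 2P x) nz)
   where
   l : ∀ p x -> p +' x ≡ x +' p *' 1'
   l = ℤsolve

 cross-comm : ∀ X Z -> cross X Z ≈ cross Z X
 cross-comm X Z = trans (∏-swap X Z _)(∏-cong Z (\z -> ∏-cong X (\x -> a-cong (ℤP.+-comm x z))))

 private
  e1 : ∀ p x y -> p +' y +' (p +' x) ≡ (p +' p) +' (x +' y)
  e1 = ℤsolve
  e2 : ∀ p x y -> p -' y +' (p +' x) ≡ (p +' p) +' (x -' y)
  e2 = ℤsolve
  e3 : ∀ p x y -> p +' y +' -' (p +' x) ≡ -' (x -' y)
  e3 = ℤsolve
  e4 : ∀ p x y -> p -' y +' -' (p +' x) ≡ -' (x +' y)
  e4 = ℤsolve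
  eP : ∀ p x -> p +' x ≡ x +' p *' 1'
  eP = ℤsolve

  ≅-γ : ∀ {x y z} -> x ≡ y -> (NZ x -> z ≅ γ x) -> NZ y -> z ≅ γ y
  ≅-γ refl f = f

  NZ-2P+ : ∀ {x} -> NZ x -> NZ (2P +' x)
  NZ-2P+ {x} = NZ-shift 1' (eP 2P x)

 module _ {c r c' r'} (r≥ : -' (+ R) ≤' r)(r< : r <' + R)(c≤q : c ≤ q)(c'≤q : c' ≤ q)(c≢c' : c ≢ c')(r'≤R : ∣ r' ∣ ≤ R) where
  private
   bounds = ê-bounds {c} {r} c≤q (in-range {c} {r} r≥ r<)
   nz₊ = NZ₊ r r' c≢c' c≤q c'≤q
   nz₋ = NZ₋ r r' c≢c' c≤q c'≤q
   b = dbl (β̂ c r)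
   y = dbl (β̂ c' r')

  front₊ : ∏ (prog (ê c' r') ∣ + L -' r' ∣)(\z -> a (z +' ê c r)) ≅ γ (2P +' (b +' y))
  front₊ = ≅-γ (e1 (+ P) b y)(∏-front {c'} r' (ê c r) c'≤q r'≤R (proj₁ bounds))(NZ-2P+ nz₊)
  back₊ : ∏ (prog (+ P -' y) ∣ + L +' r' ∣)(\z -> a (z +' ê c r)) ≅ γ (2P +' (b -' y))
  back₊ = ≅-γ (e2 (+ P) b y)(∏-back {c'} r' (ê c r) c'≤q r'≤R (proj₁ bounds))(NZ-2P+ nz₋)
  front₋ : ∏ (prog (ê c' r') ∣ + L -' r' ∣)(\z -> a (z +' -' ê c r)) ≅ γ (-' (b -' y))
  front₋ = ≅-γ (e3 (+ P) b y)(∏-front {c'} r' (-' ê c r) c'≤q r'≤R (proj₂ bounds))(NZ-neg nz₋)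
  back₋ : ∏ (prog (+ P -' y) ∣ + L +' r' ∣)(\z -> a (z +' -' ê c r)) ≅ γ (-' (b +' y))
  back₋ = ≅-γ (e4 (+ P) b y)(∏-back {c'} r' (-' ê c r) c'≤q r'≤R (proj₂ bounds))(NZ-neg nz₊)

  cross-move : ∀ {X X' U} -> X ↭ ê c r ∷ U -> X' ↭ -' ê c r ∷ U ->
   cross X' (blk c' r') * μ c r (β̂ c' r') ≅ cross X (blk c' r') * μ c (r +' 1')(β̂ c' r')
  cross-move old new = ≅-trans (step-core c r (β̂ c' r') Inv-1 nz₊ nz₋ (Move.cross-step old new (blk c' r'))
    (≅-trans (≅-reflexive (∏-++ (prog (ê c' r') ∣ + L -' r' ∣) _ _))(≅-trans (≅-* front₊ back₊)(≅-reflexive (sym (*-identityˡ _)))))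
    (≅-trans (≅-reflexive (∏-++ (prog (ê c' r') ∣ + L -' r' ∣) _ _))(≅-trans (≅-* front₋ back₋)(≅-reflexive (solve 1 (\x -> x := :1 :* :1 :* x) rfl _)))))
   (≅-reflexive (*ˡ (*-identityˡ _)))

 Inv-μ : ∀ {c} r {c'} r' -> c ≢ c' -> c ≤ q -> c' ≤ q -> Invertible (μ c r (β̂ c' r'))
 Inv-μ {c} r {c'} r' ne p p' = Inv-* (Inv-mono _)(Inv-δ̂ {β̂ c r} {β̂ c' r'} (NZ-0 (NZ₊ r r' ne p p'))(NZ-0 (NZ₋ r r' ne p p')))

 β̂-0 : ∀ c -> β̂ c 0' ≡ + c
 β̂-0 c = ≡.trans (cong (\z -> + c +' z)(ℤP.*-zeroʳ (+ P)))(ℤP.+-identityʳ _)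

 μ-0 : ∀ c y -> μ c 0' y ≈ δ̂ (β̂ c 0') y
 μ-0 c y = trans (*ʳ (trans (mono-cong (cong dbl (l (+ P)(+ c)))) mono-0))(*-identityˡ _)
  where
  l : ∀ P c -> P *' (0' *' 0') +' (c +' c) *' 0' ≡ 0'
  l = ℤsolve

 -- Joins the move of r at fixed r' with the move of r' at r = 0, in which the two classes exchange
 -- their roles.
 combine : ∀ {X X1 X₀ g g' δβy δcy δcc δc'c δyc} -> Invertible δcy -> δcc ≈ - δc'c -> δcy ≈ - δyc ->
  X * δcy ≅ X1 * (g * δβy) -> X1 * δc'c ≅ X₀ * (g' * δyc) -> X * δcc ≅ X₀ * (g * g' * δβy)
 combine {X} {X1} {X₀} {g} {g'} {δβy} {δcy} {δcc} {δc'c} {δyc} (_ , i) e e' p p' = ≅-cancel i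
  (_ ≅⟨ ≅-reflexive (x*y*z≈x*z*y _ _ _) ⟩
   _ ≅⟨ ≅-* p (≅-reflexive e) ⟩
   _ ≅⟨ ≅-reflexive (solve 4 (\x g d c -> x :* (g :* d) :* :- c := x :* c :* (:- (g :* d))) rfl _ _ _ _) ⟩
   _ ≅⟨ ≅-*ʳ _ p' ⟩
   ≅-reflexive (trans (solve 5 (\x h c g d -> x :* (h :* c) :* (:- (g :* d)) := x :* (g :* h :* d) :* :- c) rfl _ _ _ _ _)(*ˡ (sym e'))))

 δ̂-swap : ∀ x y -> δ̂ x y ≈ - δ̂ y x
 δ̂-swap x y = solve 2 (\a b -> a :- b := :- (b :- a)) rfl (X̂ x)(X̂ y)

 Inv-δ̂0 : ∀ {c c'} r r' -> c ≢ c' -> c ≤ q -> c' ≤ q -> Invertible (δ̂ (β̂ c r)(β̂ c' r'))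
 Inv-δ̂0 {c} {c'} r r' ne p p' = Inv-δ̂ {β̂ c r} {β̂ c' r'} (NZ-0 (NZ₊ r r' ne p p'))(NZ-0 (NZ₋ r r' ne p p'))

 cross-chain : ∀ {c c'} r r' -> c ≢ c' -> c ≤ q -> c' ≤ q -> ∣ r ∣ ≤ R -> ∣ r' ∣ ≤ R ->
  cross (blk c r)(blk c' r') * δ̂ (β̂ c 0')(β̂ c' r') ≅ cross (blk c 0')(blk c' r') * μ c r (β̂ c' r')
 cross-chain {c} {c'} r r' ne p p' r≤ r'≤ = ≅-trans (≅-reflexive (*ˡ (sym (μ-0 c (β̂ c' r')))))
  (ratio-chain R (\r -> cross (blk c r)(blk c' r'))(\r -> μ c r (β̂ c' r'))(\r -> Inv-μ r r' ne p p')
   (\r r≥ r< -> cross-move r≥ r< p p' ne r'≤ (blk-old r≥ r<)(blk-new r≥ r<)) r r≤)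

 cross-pair : ∀ {c c'} r r' -> c ≢ c' -> c ≤ q -> c' ≤ q -> ∣ r ∣ ≤ R -> ∣ r' ∣ ≤ R ->
  cross (blk c r)(blk c' r') * δ̂ (β̂ c 0')(β̂ c' 0')
   ≅ cross (blk c 0')(blk c' 0') * (mono (dbl (Γ c r)) * mono (dbl (Γ c' r')) * δ̂ (β̂ c r)(β̂ c' r'))
 cross-pair {c} {c'} r r' ne p p' r≤ r'≤ = combine (Inv-δ̂0 0' r' ne p p')(δ̂-swap (β̂ c 0')(β̂ c' 0'))(δ̂-swap (β̂ c 0')(β̂ c' r'))(cross-chain r r' ne p p' r≤ r'≤)
  (≅-trans (≅-*ʳ _ (≅-reflexive (cross-comm (blk c 0')(blk c' r'))))(≅-trans (cross-chain r' 0' (ne ∘ ≡.sym) p' p r'≤ z≤n)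
   (≅-*ʳ _ (≅-reflexive (cross-comm (blk c' 0')(blk c 0'))))))

 σ : ℤ -> Carrier
 σ r = (- 1#) ^ ∣ r ∣

 σ-suc : ∀ r -> σ (r +' 1') ≈ - σ r
 σ-suc (+ n) = trans (reflexive (cong (\k -> (- 1#) ^ k)(ℕP.+-comm n 1)))(solve 1 (\x -> :- :1 :* x := :- x) rfl _)
 σ-suc -[1+ zero ] = solve 0 (:1 := :- (:- :1 :* :1)) rfl
 σ-suc -[1+ suc n ] = solve 1 (\x -> x := :- (:- :1 :* x)) rfl _

 ζ : ℕ -> ℤ -> Carrier
 ζ c r = σ r * mono (Γ c r)

 ζ-suc : ∀ c r -> ζ c (r +' 1') ≈ ζ c r * - mono (ê c r)
 ζ-suc c r = trans (*-cong (σ-suc r)(trans (mono-cong (≡.trans (Γ-suc c r)(cong (\z -> Γ c r +' z)(ℤP.+-comm (dbl (β̂ c r))(+ P)))))(mono-+ _ _)))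
  (solve 3 (\s g e -> :- s :* (g :* e) := s :* g :* :- e) rfl _ _ _)

 Inv-ζ : ∀ c r -> Invertible (ζ c r)
 Inv-ζ c r = Inv-* (Inv-σ ∣ r ∣)(Inv-mono _)
  where
  Inv-σ : ∀ k -> Invertible ((- 1#) ^ k)
  Inv-σ zero = Inv-1
  Inv-σ (suc k) = Inv-* (Inv-neg Inv-1)(Inv-σ k)

 ζ-0 : ∀ c -> ζ c 0' ≈ 1#
 ζ-0 c = trans (*-identityˡ _)(trans (mono-cong (l (+ P)(+ c))) mono-0)
  where
  l : ∀ P c -> P *' (0' *' 0') +' (c +' c) *' 0' ≡ 0'
  l = ℤsolve

 ∏-prog≈ : ∀ b k w {x y} -> b +' w ≡ x -> x +' 2P *' + k ≡ y -> NZ≤ k x -> ∏ (prog b k)(\z -> a (z +' w)) ≈ (1# - mono y) * γ x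
 ∏-prog≈ b k w refl refl nz = ∏-prog b k w nz

 private
  k≤R⇒ : ∀ {k} -> k < R -> -' (+ R) ≤' + k × + k <' + R
  k≤R⇒ p = ℤP.≤-trans (ℤP.neg-mono-≤ (ℤ.+≤+ (z≤n {R})))(ℤ.+≤+ z≤n) , ℤ.+<+ p

  end : ∀ P k w -> P -' (0' +' P *' k +' (0' +' P *' k)) +' w +' (P +' P) *' k ≡ P +' w
  end = ℤsolve

  back-end : ∀ k {w x} -> + P -' dbl (β̂ 0 (+ k)) +' w ≡ x -> x +' 2P *' + k ≡ + P +' w
  back-end k {w} refl = end (+ P)(+ k) w

 module _ {c r k} (r≥ : -' (+ R) ≤' r)(r< : r <' + R)(0<c : 0 < c)(c≤q : c ≤ q)(k≤R : k ≤ R) where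
  private
   e = ê c r
   c≢0 : c ≢ 0
   c≢0 = ℕP.<⇒≢ 0<c ∘ ≡.sym
   b = dbl (β̂ c r)
   y = dbl (β̂ 0 (+ k))
   nz₊ = NZ₊ r (+ k) c≢0 c≤q z≤n
   nz₋ = NZ₋ r (+ k) c≢0 c≤q z≤n
   nz4 : NZ (2P +' dbl (-' e))
   nz4 = NZ-shift 0' (l (+ P) b)(NZ-neg (NZ-self r 0<c c≤q))
    where
    l : ∀ p b -> (p +' p) +' (-' (p +' b) +' -' (p +' b)) ≡ -' (b +' b) +' (p +' p) *' 0'
    l = ℤsolve
   nz4' : NZ (2P +' dbl e)
   nz4' = NZ-shift (1' +' 1')(l (+ P) b)(NZ-self r 0<c c≤q)
    where
    l : ∀ p b -> (p +' p) +' ((p +' b) +' (p +' b)) ≡ b +' b +' (p +' p) *' (1' +' 1')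
    l = ℤsolve
   e≢0 : e ≢ 0'
   e≢0 z = NZ-0 nz4' (≡.trans (cong (\x -> 2P +' dbl x) z)(≡.trans (ℤP.+-identityʳ 2P)(⊥-elim (NZ.avoid nz4' -1ℤ (≡.trans (cong (\x -> 2P +' dbl x +' 2P *' -1ℤ) z)(l 2P))))))
    where
    l : ∀ p -> p +' 0' +' p *' -1ℤ ≡ 0'
    l = ℤsolve
   2P≢0' : 2P ≢ 0'
   2P≢0' z = ℕP.<-irrefl (≡.sym (ℤP.+-injective z))(ℕP.≤-trans 0<P (ℕP.m≤m+n P P))

   tail₊ : ∏ (prog (+ P -' y) k)(\z -> a (z +' e)) ≈ (1# - mono (+ P +' e)) * γ (2P +' (b -' y))
   tail₊ = ∏-prog≈ (+ P -' y) k e (e2 (+ P) b y)(back-end k (e2 (+ P) b y))(NZ⇒NZ≤ (NZ-2P+ nz₋))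
   tail₋ : ∏ (prog (+ P -' y) k)(\z -> a (z +' -' e)) ≈ (1# - mono (+ P +' -' e)) * γ (-' (b +' y))
   tail₋ = ∏-prog≈ (+ P -' y) k (-' e)(e4 (+ P) b y)(back-end k (e4 (+ P) b y))(NZ⇒NZ≤ (NZ-neg nz₊))

  -- The class of c = 0 consists of one progression, so its reflected part is finite and leaves the
  -- end factor 1 - h^(P+e). This is the factor that `φ-half` wants for φ e, which is why a class is
  -- moved against itself and against the class of 0 at the same time.
  half-move : A (blk c (r +' 1')) * cross (blk c (r +' 1'))(blk0 k) * μ c r (β̂ 0 (+ k))
   ≅ A (blk c r) * cross (blk c r)(blk0 k) * (- mono e * μ c (r +' 1')(β̂ 0 (+ k)))
  half-move = step-core c r (β̂ 0 (+ k)) {s = γ e * γ 2P} (Inv-* (Inv-γ e≢0)(Inv-γ 2P≢0')) nz₊ nz₋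
   (trans (x*y*[z*u]≈x*z*[y*u] _ _ _ _)
    (trans (*-cong (Move.A-step (blk-old r≥ r<)(blk-new r≥ r<))(Move.cross-step (blk-old r≥ r<)(blk-new r≥ r<)(blk0 k)))
     (solve 4 (\a c s t -> a :* s :* (c :* t) := a :* c :* (s :* t)) rfl _ _ _ _)))
   (≅-trans (≅-* (≅-* ≅-refl (≅-trans (≅-reflexive (∏-++ (Uₛ c r)(Vₛ c r) _))(≅-* (U₊ r≥ r< c≤q (NZ⇒NZ≤ nz4'))(V₊ r≥ r< c≤q))))
     (≅-trans (≅-reflexive (∏-++ (prog (ê 0 (+ k)) ∣ + L -' + k ∣) _ _))(≅-* (front₊ r≥ r< c≤q z≤n c≢0 k≤R)(≅-reflexive tail₊))))
    (≅-reflexive (trans (solve 6 (\f g p x n z -> f :* (g :* p) :* (x :* (n :* z)) := f :* (n :* g) :* p :* (x :* z)) rfl _ _ _ _ _ _)(*ʳ (*ʳ (φ-half e≢0 (NZ-0 nz4')))))))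
   (≅-trans (≅-* (≅-* ≅-refl (≅-trans (≅-reflexive (∏-++ (Uₛ c r)(Vₛ c r) _))(≅-* (U₋ r≥ r< c≤q)(V₋ r≥ r< c≤q nz4))))
     (≅-trans (≅-reflexive (∏-++ (prog (ê 0 (+ k)) ∣ + L -' + k ∣) _ _))(≅-* (front₋ r≥ r< c≤q z≤n c≢0 k≤R)(≅-reflexive tail₋))))
    (≅-reflexive (trans (solve 6 (\f p g x n z -> f :* (p :* g) :* (x :* (n :* z)) := f :* (n :* g) :* p :* (x :* z)) rfl _ _ _ _ _ _)(*ʳ
     (trans (*ʳ (trans (φ-half (neg≢0 e≢0)(NZ-0 nz4))(γ-flip e≢0)))(solve 3 (\m g p -> m :* g :* p := g :* p :* m) rfl _ _ _))))))

 U0 : ℕ -> List ℤ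
 U0 k = Uₛ 0 (+ k) ++ prog (+ P -' dbl (β̂ 0 (+ k))) k

 private
  +suc : ∀ k -> + k +' 1' ≡ + suc k
  +suc k = cong +_ (ℕP.+-comm k 1)

 blk0-old : ∀ {k} -> k < R -> blk0 k ↭ ê 0 (+ k) ∷ U0 k
 blk0-old {k} k<R = ↭-reflexive (cong (_++ prog (+ P -' dbl (β̂ 0 (+ k))) k)(front-old {0} {+ k} (proj₁ (k≤R⇒ k<R))(proj₂ (k≤R⇒ k<R))))

 blk0-new : ∀ {k} -> k < R -> blk0 (suc k) ↭ -' ê 0 (+ k) ∷ U0 k
 blk0-new {k} k<R = Perm.trans (↭-reflexive (≡.trans (cong (\z -> prog (+ P +' dbl (β̂ 0 z)) ∣ + L -' z ∣ ++ prog (+ P -' dbl (β̂ 0 z))(suc k))(≡.sym (+suc k)))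
  (cong₂ _++_ (cong (\b -> prog b ∣ + L -' (+ k +' 1') ∣)(ê-suc 0 (+ k)))
   (≡.trans (cong (\b -> prog b (suc k))(-ê-suc 0 (+ k)))(cong (\b -> -' ê 0 (+ k) ∷ prog b k)(-ê+2P 0 (+ k)))))))
  (PermP.shift (-' ê 0 (+ k))(Uₛ 0 (+ k)) _)

 cross-chain0 : ∀ {c} k -> 0 < c -> c ≤ q -> k ≤ R ->
  cross (blk0 k)(blk c 0') * δ̂ (β̂ 0 0')(β̂ c 0') ≅ cross (blk0 0)(blk c 0') * μ 0 (+ k)(β̂ c 0')
 cross-chain0 {c} k 0<c c≤q k≤R = ≅-trans (≅-reflexive (*ˡ (sym (μ-0 0 (β̂ c 0')))))
  (chain-up R (\k -> cross (blk0 k)(blk c 0'))(\k -> μ 0 (+ k)(β̂ c 0'))(\k -> Inv-μ (+ k) 0' (ℕP.<⇒≢ 0<c) z≤n c≤q)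
   (\k k<R -> subst (\z -> cross (blk0 (suc k))(blk c 0') * μ 0 (+ k)(β̂ c 0') ≅ cross (blk0 k)(blk c 0') * μ 0 z (β̂ c 0'))(+suc k)
    (cross-move (proj₁ (k≤R⇒ k<R))(proj₂ (k≤R⇒ k<R)) z≤n c≤q (ℕP.<⇒≢ 0<c) z≤n (blk0-old k<R)(blk0-new k<R))) k k≤R)

 half-pair : ∀ {c} r k -> 0 < c -> c ≤ q -> ∣ r ∣ ≤ R -> k ≤ R ->
  A (blk c r) * cross (blk c r)(blk0 k) * δ̂ (β̂ c 0')(β̂ 0 0')
   ≅ A (blk c 0') * cross (blk c 0')(blk0 0) * (ζ c r * mono (dbl (Γ c r)) * mono (dbl (Γ 0 (+ k))) * δ̂ (β̂ c r)(β̂ 0 (+ k)))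
 half-pair {c} r k 0<c c≤q r≤R k≤R = combine (Inv-δ̂0 0' (+ k) c≢0 c≤q z≤n)(δ̂-swap (β̂ c 0')(β̂ 0 0'))(δ̂-swap (β̂ c 0')(β̂ 0 (+ k)))
  (_ ≅⟨ ≅-reflexive (*ˡ (sym (trans (*-cong (ζ-0 c)(μ-0 c (β̂ 0 (+ k))))(*-identityˡ _)))) ⟩
   _ ≅⟨ ratio-chain R f m (\r -> Inv-* (Inv-ζ c r)(Inv-μ r (+ k) c≢0 c≤q z≤n)) step r r≤R ⟩
   ≅-reflexive (*ˡ (sym (*-assoc _ _ _))))
  (≅-trans (≅-reflexive (trans (*ʳ (*ˡ (cross-comm (blk c 0')(blk0 k))))(*-assoc _ _ _)))
   (≅-trans (≅-* ≅-refl (cross-chain0 k 0<c c≤q k≤R))(≅-reflexive (trans (sym (*-assoc _ _ _))(*ʳ (*ˡ (cross-comm (blk0 0)(blk c 0'))))))))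
  where
  c≢0 : c ≢ 0
  c≢0 = ℕP.<⇒≢ 0<c ∘ ≡.sym
  f m : ℤ -> Carrier
  f r = A (blk c r) * cross (blk c r)(blk0 k)
  m r = ζ c r * μ c r (β̂ 0 (+ k))
  step : ∀ r -> -' (+ R) ≤' r -> r <' + R -> f (r +' 1') * m r ≅ f r * m (r +' 1')
  step r r≥ r< = _ ≅⟨ ≅-reflexive (x*[y*z]≈x*z*y _ _ _) ⟩
   _ ≅⟨ ≅-*ʳ _ (half-move r≥ r< 0<c c≤q k≤R) ⟩
   ≅-reflexive (trans (solve 4 (\f e u z -> f :* (e :* u) :* z := f :* (z :* e :* u)) rfl _ _ _ _)(*ˡ (*ʳ (sym (ζ-suc c r)))))

 -- In the class of c = 0 only shifts k ≥ 0 occur; counted twice for k > 0, they will form a sum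
 -- over all integers like that of the other classes.
 mult : ℕ -> Carrier
 mult zero = 1#
 mult (suc _) = 1# + 1#

 private
  module Zero {k} (k<R : k < R) where
   e : ℤ
   e = ê 0 (+ k)
   k≥ = proj₁ (k≤R⇒ k<R)
   k< = proj₂ (k≤R⇒ k<R)
   e≡ : e ≡ + (P ℕ.+ (P ℕ.* k ℕ.+ P ℕ.* k))
   e≡ = cong (\z -> + P +' dbl z)(≡.trans (ℤP.+-identityˡ _)(≡.sym (ℤP.pos-* P k)))
   e>0 : 0' <' e
   e>0 = subst (0' <'_)(≡.sym e≡)(ℤ.+<+ (ℕP.≤-trans 0<P (ℕP.m≤m+n P _)))
   0<2P : 0' <' 2P
   0<2P = ℤ.+<+ (ℕP.≤-trans 0<P (ℕP.m≤m+n P P))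
   pos : 0' <' 2P +' dbl e
   pos = ℤP.+-mono-< 0<2P (ℤP.+-mono-< e>0 e>0)
   ≢0 : ∀ {x} -> 0' <' x -> x ≢ 0'
   ≢0 p z = ℤP.<-irrefl (≡.sym z) p
   b₊ : + P -' dbl (β̂ 0 (+ k)) +' e ≡ 2P
   b₊ = l (+ P)(dbl (β̂ 0 (+ k)))
    where
    l : ∀ p b -> p -' b +' (p +' b) ≡ p +' p
    l = ℤsolve
   b₋ : + P -' dbl (β̂ 0 (+ k)) +' -' e ≡ 2P +' dbl (-' e)
   b₋ = l (+ P)(dbl (β̂ 0 (+ k)))
    where
    l : ∀ p b -> p -' b +' -' (p +' b) ≡ (p +' p) +' (-' (p +' b) +' -' (p +' b))
    l = ℤsolve
   M₊ : φ e * ∏ (U0 k)(\z -> a (z +' e)) ≅ γ e * γ 2P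
   M₊ = ≅-trans (≅-* ≅-refl (≅-trans (≅-reflexive (∏-++ (Uₛ 0 (+ k)) _ _))(≅-* (U₊ k≥ k< z≤n (pos⇒NZ≤ pos))
       (≅-reflexive (∏-prog≈ (+ P -' dbl (β̂ 0 (+ k))) k e b₊ (back-end k b₊)(pos⇒NZ≤ 0<2P))))))
      (≅-reflexive (trans (solve 4 (\f g n p -> f :* (g :* (n :* p)) := f :* (n :* g) :* p) rfl _ _ _ _)(*ʳ (φ-half (≢0 e>0)(≢0 pos)))))
   finish : ∀ {w} -> φ (-' e) * ∏ (U0 k)(\z -> a (z +' -' e)) ≅ w * γ (-' e) * γ 2P -> A (blk0 (suc k)) ≅ A (blk0 k) * (w * - mono e)
   finish {w} p = ≅-cancel (proj₂ (Inv-* (Inv-γ (≢0 e>0))(Inv-γ (≢0 0<2P))))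
    (_ ≅⟨ ≅-* ≅-refl (≅-sym M₊) ⟩
     _ ≅⟨ ≅-reflexive (Move.A-step (blk0-old k<R)(blk0-new k<R)) ⟩
     _ ≅⟨ ≅-* ≅-refl p ⟩
     ≅-reflexive (trans (*ˡ (*ʳ (*ˡ (γ-flip (≢0 e>0)))))(solve 5 (\a w m g p -> a :* (w :* (m :* g) :* p) := a :* (w :* m) :* (g :* p)) rfl _ _ _ _ _)))

  -- For k = 0 the letter is h^P, and φ(-P) = 2γ(-P): here the 2 of `mult` arises. `φ-half` does not
  -- apply, as 2P - 2e = 0.
  first : 0 < R -> A (blk0 1) ≅ A (blk0 0) * (mult 1 * - mono (ê 0 0'))
  first 0<R = finish (≅-trans (≅-* (≅-reflexive φ₋)(≅-trans (≅-reflexive (∏-++ (Uₛ 0 0') [] _))(≅-* (U₋ k≥ k< z≤n) ≅-refl)))(≅-reflexive (*ˡ (*-identityʳ _))))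
   where
   open Zero 0<R
   φ₋ : φ (-' e) ≈ mult 1 * γ (-' e)
   φ₋ = trans (φ-ratio (neg≢0 (≢0 e>0)))(*ʳ (+ˡ (trans (mono-cong (l (+ P))) mono-0)))
    where
    l : ∀ P -> P +' -' (P +' (0' +' P *' 0' +' (0' +' P *' 0'))) ≡ 0'
    l = ℤsolve

  later : ∀ {k} -> suc k < R -> A (blk0 (suc (suc k))) ≅ A (blk0 (suc k)) * - mono (ê 0 (+ suc k))
  later {k} k<R = ≅-trans (finish (≅-trans (≅-* ≅-refl (≅-trans (≅-reflexive (∏-++ (Uₛ 0 (+ suc k)) _ _))(≅-* (U₋ k≥ k< z≤n)
    (≅-reflexive (∏-prog≈ (+ P -' dbl (β̂ 0 (+ suc k)))(suc k)(-' e) b₋ (back-end (suc k) b₋) nz₋)))))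
   (≅-reflexive (trans (solve 4 (\f p n g -> f :* (p :* (n :* g)) := f :* (n :* g) :* p) rfl _ _ _ _)
    (*ʳ (trans (φ-half (neg≢0 (≢0 e>0))(NZ≤-0 nz₋))(sym (*-identityˡ _))))))))
   (≅-reflexive (*ˡ (*-identityˡ _)))
   where
   open Zero k<R
   nz₋ : NZ≤ (suc k)(2P +' dbl (-' e))
   nz₋ = mkNZ≤ \j j≤ z -> 2P≢0 (k ℕ.+ (suc k ∸ j))(≡.trans (cong (2P *'_)(eq j j≤))(≡.trans (l (+ P)(+ suc k)(+ j))(cong -'_ z)))
    where
    eq : ∀ j -> j ≤ suc k -> + suc (k ℕ.+ (suc k ∸ j)) ≡ + suc k +' (+ suc k -' + j)
    eq j j≤ = cong (\z -> + suc k +' z)(≡.trans (≡.sym (ℤP.⊖-≥ j≤))(≡.sym (ℤP.m-n≡m⊖n (suc k) j)))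
    l : ∀ P k j -> (P +' P) *' (k +' (k -' j)) ≡ -' ((P +' P) +' (-' (P +' (0' +' P *' k +' (0' +' P *' k))) +' -' (P +' (0' +' P *' k +' (0' +' P *' k)))) +' (P +' P) *' j)
    l = ℤsolve

 A-blk0 : ∀ k -> k ≤ R -> A (blk0 k) ≅ A (blk0 0) * (mult k * ζ 0 (+ k))
 A-blk0 zero _ = ≅-reflexive (sym (trans (*ˡ (trans (*-identityˡ _)(ζ-0 0)))(*-identityʳ _)))
 A-blk0 (suc zero) p = ≅-trans (first p)(≅-reflexive (*ˡ (*ˡ (sym (trans (ζ-suc 0 0')(trans (*ʳ (ζ-0 0))(*-identityˡ _)))))))
 A-blk0 (suc (suc k)) p = ≅-trans (later p)(≅-trans (≅-*ʳ _ (A-blk0 (suc k)(ℕP.<⇒≤ p)))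
  (≅-reflexive (trans (trans (*-assoc _ _ _)(*ˡ (*-assoc _ _ _)))(*ˡ (*ˡ (trans (sym (ζ-suc 0 (+ suc k)))(reflexive (cong (ζ 0)(+suc (suc k))))))))))

 van : List ℤ -> Carrier
 van [] = 1#
 van (x ∷ xs) = ∏ xs (δ̂ x) * van xs

 State : Set
 State = List (ℕ × ℤ)

 config : State -> ℕ -> List ℤ
 config [] k = blk0 k
 config ((c , r) ∷ s) k = blk c r ++ config s k

 pts : State -> ℕ -> List ℤ
 pts s k = map (\p -> β̂ (proj₁ p)(proj₂ p)) s ++ β̂ 0 (+ k) ∷ []

 rest-state : State -> State
 rest-state = map (\p -> proj₁ p , 0')

 wt : ℕ -> ℕ × ℤ -> Carrier
 wt n (c , r) = σ r * mono (+ n *' Γ c r)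

 Admissible : State -> Set
 Admissible s = All (\p -> 0 < proj₁ p × proj₁ p ≤ q × ∣ proj₂ p ∣ ≤ R) s × AllPairs (\p p' -> proj₁ p ≢ proj₁ p') s

 private
  wt-1 : ∀ c r -> wt 1 (c , r) ≈ ζ c r
  wt-1 c r = *ˡ (mono-cong (ℤP.*-identityˡ (Γ c r)))

  wt-2+ : ∀ n p -> wt (suc (suc n)) p ≈ wt n p * mono (dbl (Γ (proj₁ p)(proj₂ p)))
  wt-2+ n (c , r) = trans (*ˡ (trans (mono-cong (l (+ n)(Γ c r)))(mono-+ _ _)))(sym (*-assoc _ _ _))
   where
   l : ∀ n g -> (1' +' (1' +' n)) *' g ≡ n *' g +' (g +' g)
   l = ℤsolve

  dblΓ : ℕ × ℤ -> Carrier
  dblΓ p = mono (dbl (Γ (proj₁ p)(proj₂ p)))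

  wt-odd : ∀ c r (s : State) -> ζ c r * ∏ s (\_ -> dblΓ (c , r)) ≈ wt (odd (length s))(c , r)
  wt-odd c r [] = trans (*-identityʳ _)(sym (wt-1 c r))
  wt-odd c r (_ ∷ s) = trans (x*[y*z]≈x*z*y _ _ _)(trans (*ʳ (wt-odd c r s))(sym (wt-2+ (odd (length s))(c , r))))

  cross-config : ∀ X s k -> cross X (config s k) ≈ ∏ s (\p -> cross X (blk (proj₁ p)(proj₂ p))) * cross X (blk0 k)
  cross-config X [] k = sym (*-identityˡ _)
  cross-config X ((c , r) ∷ s) k = trans (trans (∏-cong X (\x -> ∏-++ (blk c r)(config s k) _))(∏-* X _ _))(trans (*ˡ (cross-config X s k))(sym (*-assoc _ _ _)))

  ∏-pts : ∀ x s k -> ∏ (pts s k)(δ̂ x) ≈ ∏ s (\p -> δ̂ x (β̂ (proj₁ p)(proj₂ p))) * δ̂ x (β̂ 0 (+ k))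
  ∏-pts x s k = trans (∏-++ (map _ s) _ _)(*-cong (∏-map _ s _)(*-identityʳ _))

  pairs-eval : ∀ {c r} s -> c ≤ q -> ∣ r ∣ ≤ R -> All (\p -> 0 < proj₁ p × proj₁ p ≤ q × ∣ proj₂ p ∣ ≤ R) s -> All (\p -> c ≢ proj₁ p) s ->
   ∏ s (\p -> cross (blk c r)(blk (proj₁ p)(proj₂ p))) * ∏ (rest-state s)(\p -> δ̂ (β̂ c 0')(β̂ (proj₁ p)(proj₂ p)))
    ≅ ∏ (rest-state s)(\p -> cross (blk c 0')(blk (proj₁ p)(proj₂ p))) * (∏ s (\_ -> dblΓ (c , r)) * ∏ s dblΓ * ∏ s (\p -> δ̂ (β̂ c r)(β̂ (proj₁ p)(proj₂ p))))
  pairs-eval [] _ _ _ _ = ≅-reflexive (solve 0 (:1 :* :1 := :1 :* (:1 :* :1 :* :1)) rfl)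
  pairs-eval {c} {r} ((c' , r') ∷ s) c≤ r≤ ((_ , c'≤ , r'≤) ∷ as)(ne ∷ nes) =
   _ ≅⟨ ≅-reflexive (x*y*[z*u]≈x*z*[y*u] _ _ _ _) ⟩
   _ ≅⟨ ≅-* (cross-pair r r' ne c≤ c'≤ r≤ r'≤)(pairs-eval s c≤ r≤ as nes) ⟩
   ≅-reflexive (solve 8 (\x a b d y e f g -> x :* (a :* b :* d) :* (y :* (e :* f :* g)) := x :* y :* (a :* e :* (b :* f) :* (d :* g))) rfl _ _ _ _ _ _ _ _)

 -- Each class contributes the exponent 1 on its own and 2 for each of the other |s| classes, hence
 -- the weight exponent 2|s| + 1; the factors `δ̂` of all pairs make up the Vandermonde product.
 A-config : ∀ s k -> Admissible s -> k ≤ R ->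
  A (config s k) * van (pts (rest-state s) 0) ≅ A (config (rest-state s) 0) * (mult k * (∏ s (wt (odd (length s))) * wt (odd (length s))(0 , + k)) * van (pts s k))
 A-config [] k _ k≤R = ≅-trans (≅-*ʳ _ (A-blk0 k k≤R))(≅-reflexive (trans
  (*ʳ (*ˡ (*ˡ (sym (wt-1 0 (+ k))))))(solve 3 (\a m w -> a :* (m :* w) :* (:1 :* :1) := a :* (m :* (:1 :* w) :* (:1 :* :1))) rfl _ _ _)))
 A-config ((c , r) ∷ s) k ((0<c , c≤q , r≤R) ∷ as , ne ∷ nes) k≤R =
  _ ≅⟨ ≅-reflexive (*-cong (trans (A-++ (blk c r)(config s k))(*ˡ (cross-config (blk c r) s k)))(*ʳ (∏-pts (β̂ c 0')(rest-state s) 0))) ⟩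
  _ ≅⟨ ≅-reflexive (solve 7 (\a e p x d f v -> a :* e :* (p :* x) :* (d :* f :* v) := (a :* x :* f) :* ((p :* d) :* (e :* v))) rfl _ _ _ _ _ _ _) ⟩
  _ ≅⟨ ≅-* (half-pair r k 0<c c≤q r≤R k≤R)(≅-* (pairs-eval s c≤q r≤R as ne)(A-config s k (as , nes) k≤R)) ⟩
  _ ≅⟨ ≅-reflexive (regroup _ _ _ _ _ _ _ _ _ _ _ _ _ _ _) ⟩
  ≅-reflexive (*-cong (sym (trans (A-++ (blk c 0')(config (rest-state s) 0))(*ˡ (cross-config (blk c 0')(rest-state s) 0))))
   (*-cong (*ˡ (*-cong (*-cong (wt-odd c r ((c , r) ∷ s))(trans (sym (∏-* s _ _))(∏-cong s (\p -> sym (wt-2+ (odd (length s)) p)))))(sym (wt-2+ (odd (length s))(0 , + k)))))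
    (*ʳ (sym (∏-pts (β̂ c r) s k)))))
  where
  regroup : ∀ a x z g h d p e f i b m w w' v ->
   a * x * (z * g * h * d) * (p * (e * f * i) * (b * (m * (w * w') * v))) ≈ a * b * (p * x) * (m * (z * (g * e) * (w * f) * (w' * h)) * (i * d * v))
  regroup a x z g h d p e f i b m w w' v = solve 15 (\a x z g h d p e f i b m w w' v ->
   a :* x :* (z :* g :* h :* d) :* (p :* (e :* f :* i) :* (b :* (m :* (w :* w') :* v))) := a :* b :* (p :* x) :* (m :* (z :* (g :* e) :* (w :* f) :* (w' :* h)) :* (i :* d :* v))) rfl a x z g h d p e f i b m w w' v

-- Determinants, Chebyshev polynomials and the exchange of P and w.

module Determinant (𝓕 : Frame) where
 open Sums 𝓕

 Σ± : ∀ {A : Set} -> List A -> (A -> List A -> Carrier) -> Carrier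
 Σ± [] F = 0#
 Σ± (x ∷ xs) F = F x xs - Σ± xs (\y ys -> F y (x ∷ ys))

 module _ {A : Set} where
  Σ±-cong : ∀ xs {F G : A -> List A -> Carrier} -> (∀ {x ys} -> Sel x ys xs -> F x ys ≈ G x ys) -> Σ± xs F ≈ Σ± xs G
  Σ±-cong [] p = rfl
  Σ±-cong (x ∷ xs) p = +-cong (p here)(-‿cong (Σ±-cong xs (\s -> p (there s))))

  Σ±-0 : ∀ xs -> Σ± xs (\(_ : A) _ -> 0#) ≈ 0#
  Σ±-0 [] = rfl
  Σ±-0 (x ∷ xs) = trans (+ˡ (trans (-‿cong (Σ±-0 xs)) -0#≈0#))(+-identityˡ 0#)

  Σ±-+ : ∀ xs (F G : A -> List A -> Carrier) -> Σ± xs (\x ys -> F x ys + G x ys) ≈ Σ± xs F + Σ± xs G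
  Σ±-+ [] F G = sym (+-identityˡ 0#)
  Σ±-+ (x ∷ xs) F G = trans (+ˡ (-‿cong (Σ±-+ xs _ _)))(x+y-[z+u]≈x-z+[y-u] _ _ _ _)

  Σ±-*ˡ : ∀ c xs (F : A -> List A -> Carrier) -> Σ± xs (\x ys -> c * F x ys) ≈ c * Σ± xs F
  Σ±-*ˡ c [] F = sym (zeroʳ c)
  Σ±-*ˡ c (x ∷ xs) F = trans (+ˡ (-‿cong (Σ±-*ˡ c xs _)))(x*y-x*z≈x*[y-z] _ _ _)

  Σ±-neg : ∀ xs (F : A -> List A -> Carrier) -> Σ± xs (\x ys -> - F x ys) ≈ - Σ± xs F
  Σ±-neg [] F = sym -0#≈0#
  Σ±-neg (x ∷ xs) F = trans (+ˡ (-‿cong (Σ±-neg xs _)))(solve 2 (\a b -> :- a :- :- b := :- (a :- b)) rfl _ _)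

  Σ±-∑ : ∀ {B : Set} xs (zs : List B)(F : A -> List A -> B -> Carrier) -> Σ± xs (\x ys -> ∑ zs (F x ys)) ≈ ∑ zs (\z -> Σ± xs (\x ys -> F x ys z))
  Σ±-∑ xs [] F = Σ±-0 xs
  Σ±-∑ xs (z ∷ zs) F = trans (Σ±-+ xs _ _)(+ˡ (Σ±-∑ xs zs F))

  Σ±-swap : ∀ {B : Set} xs (zs : List B)(F : A -> List A -> B -> List B -> Carrier) ->
   Σ± xs (\x ys -> Σ± zs (F x ys)) ≈ Σ± zs (\z ws -> Σ± xs (\x ys -> F x ys z ws))
  Σ±-swap xs [] F = Σ±-0 xs
  Σ±-swap xs (z ∷ zs) F = trans (Σ±-+ xs _ _)(+ˡ (trans (Σ±-neg xs _)(-‿cong (Σ±-swap xs zs _))))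

 det : ∀ {A B : Set} -> (B -> A -> Carrier) -> List B -> List A -> Carrier
 det e [] [] = 1#
 det e [] (_ ∷ _) = 0#
 det e (b ∷ bs) as = Σ± as (\a rest -> e b a * det e bs rest)

 det-cong : ∀ {A B : Set} {e f : B -> A -> Carrier} -> (∀ b a -> e b a ≈ f b a) -> ∀ bs as -> det e bs as ≈ det f bs as
 det-cong p [] [] = rfl
 det-cong p [] (_ ∷ _) = rfl
 det-cong p (b ∷ bs) as = Σ±-cong as (\ {a} {rest} _ -> *-cong (p b a)(det-cong p bs rest))

 -- The expansions along the first row and the first column are exchanged; invariance under
 -- transposition follows.
 det-column : ∀ {A B : Set} (e : B -> A -> Carrier) bs a as -> det e bs (a ∷ as) ≈ Σ± bs (\b rest -> e b a * det e rest as)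
 det-column e [] a as = rfl
 det-column e (b ∷ bs) a as = +ˡ (-‿cong (begin
  Σ± as (\a' rest -> e b a' * det e bs (a ∷ rest))
   ≈⟨ Σ±-cong as (\ {a'} {rest} _ -> trans (*ˡ (det-column e bs a rest))(sym (Σ±-*ˡ (e b a') bs _))) ⟩
  _
   ≈⟨ Σ±-swap as bs _ ⟩
  _
   ≈⟨ Σ±-cong bs (\ {b'} {rest'} _ -> trans (Σ±-cong as (\_ -> x*[y*z]≈y*[x*z] _ _ _))(Σ±-*ˡ (e b' a) as _)) ⟩
  Σ± bs (\b' rest' -> e b' a * det e (b ∷ rest') as) ∎))

 det-transpose : ∀ {A B : Set} (e : B -> A -> Carrier) bs as -> det e bs as ≈ det (\a b -> e b a) as bs
 det-transpose e [] [] = rfl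
 det-transpose e (b ∷ bs) [] = rfl
 det-transpose e bs (a ∷ as) = trans (det-column e bs a as)(Σ±-cong bs (\ {b} {rest} _ -> *ˡ (det-transpose e rest as)))

 -- p is a polynomial function of degree ≤ k whose coefficient in degree k is c.
 Deg : ℕ -> Carrier -> (Carrier -> Carrier) -> Set
 Deg zero c p = ∀ x -> p x ≈ c
 Deg (suc k) c p = ∀ x0 -> ∃ \q -> Deg k c q × (∀ x -> p x - p x0 ≈ (x - x0) * q x)

 Deg-+ : ∀ k {c d p r} -> Deg k c p -> Deg k d r -> Deg k (c + d)(\x -> p x + r x)
 Deg-+ zero u v x = +-cong (u x)(v x)
 Deg-+ (suc k) u v x0 with u x0 | v x0
 ... | q , dq , e | q' , dq' , e' = _ , Deg-+ k dq dq' , \x -> trans (x+y-[z+u]≈x-z+[y-u] _ _ _ _)(trans (+-cong (e x)(e' x))(sym (distribˡ _ _ _)))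

 Deg-* : ∀ k {c p} s -> Deg k c p -> Deg k (s * c)(\x -> s * p x)
 Deg-* zero s u x = *ˡ (u x)
 Deg-* (suc k) s u x0 with u x0
 ... | q , dq , e = _ , Deg-* k s dq , \x -> trans (x*y-x*z≈x*[y-z] _ _ _)(trans (*ˡ (e x))(x*[y*z]≈y*[x*z] _ _ _))

 Deg-pad : ∀ k {c p} -> Deg k c p -> Deg (suc k) 0# p
 Deg-pad zero u x0 = (\_ -> 0#) , (\_ -> rfl) , \x -> trans (trans (+-cong (u x)(-‿cong (u x0)))(-‿inverseʳ _))(sym (zeroʳ _))
 Deg-pad (suc k) u x0 with u x0
 ... | q , dq , e = q , Deg-pad k dq , e

 Deg-resp : ∀ k {c d p} -> c ≈ d -> Deg k c p -> Deg k d p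
 Deg-resp zero e u x = trans (u x) e
 Deg-resp (suc k) e u x0 with u x0
 ... | q , dq , h = q , Deg-resp k e dq , h

 Deg-x* : ∀ k {c p} -> Deg k c p -> Deg (suc k) c (\x -> x * p x)
 Deg-x* zero {c} {p} u x0 = p , u , \x -> trans (+-cong (*ˡ (u x))(-‿cong (*ˡ (u x0))))(trans (solve 3 (\x y c -> x :* c :- y :* c := (x :- y) :* c) rfl _ _ _)(*ˡ (sym (u x))))
 Deg-x* (suc k) {c} {p} u x0 with u x0
 ... | q , dq , e = _ , Deg-resp (suc k)(trans (+ˡ (zeroʳ _))(+-identityʳ _))(Deg-+ (suc k) u (Deg-* (suc k) x0 (Deg-pad k dq))) ,
  \x -> trans (solve 4 (\x y a b -> x :* a :- y :* b := (x :- y) :* a :+ y :* (a :- b)) rfl _ _ _ _)(trans (+ˡ (*ˡ (e x)))(solve 4 (\x y a b -> (x :- y) :* a :+ y :* ((x :- y) :* b) := (x :- y) :* (a :+ y :* b)) rfl _ _ _ _))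

 -- Rescaled Chebyshev polynomials of the first kind: U j takes z + 1/z to z^j + z^(-j). Accordingly
 -- U 0 = 2, the source of the factor 2 in front of the determinants.
 U : ℕ -> Carrier -> Carrier
 U zero x = 1# + 1#
 U (suc zero) x = x
 U (suc (suc j)) x = x * U (suc j) x - U j x

 top : ℕ -> Carrier
 top zero = 1# + 1#
 top (suc _) = 1#

 Deg-U-pair : ∀ j -> Deg j (top j)(U j) × Deg (suc j) 1# (U (suc j))
 Deg-U-pair zero = (\_ -> rfl) , \x0 -> (\_ -> 1#) , (\_ -> rfl) , \x -> sym (*-identityʳ _)
 Deg-U-pair (suc j) = d1 , \x0 -> let (r , dr , e) = sum x0 in r , dr , \x -> trans (+-cong (shape x)(-‿cong (shape x0)))(e x)
  where
  d0 = proj₁ (Deg-U-pair j)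
  d1 = proj₂ (Deg-U-pair j)
  sum : Deg (suc (suc j)) 1# (\x -> x * U (suc j) x + - 1# * U j x)
  sum = Deg-resp (suc (suc j))(trans (+ˡ (zeroʳ (- 1#)))(+-identityʳ 1#))(Deg-+ (suc (suc j))(Deg-x* (suc j) d1)(Deg-* (suc (suc j))(- 1#)(Deg-pad (suc j)(Deg-pad j d0))))
  shape : ∀ x -> U (suc (suc j)) x ≈ x * U (suc j) x + - 1# * U j x
  shape x = solve 2 (\a b -> a :- b := a :+ :- :1 :* b) rfl _ _

 sgn : ℕ -> Carrier
 sgn zero = 1#
 sgn (suc n) = - 1# * sgn n

 interval : ℕ -> List ℤ
 interval R = map +_ (upTo (suc R)) ++ map -[1+_] (upTo R)

 ∑-interval : ∀ R F -> ∑ (interval R) F ≈ F 0' + ∑ (upTo R)(\k -> F (+ suc k)) + ∑ (upTo R)(\k -> F -[1+ k ])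
 ∑-interval R F = trans (∑-++ (map +_ (upTo (suc R))) _ F)(+-cong (trans (∑-map +_ (upTo (suc R)) F)(∑-upTo-suc R _))(∑-map -[1+_] (upTo R) F))

 ∑-reflect : ∀ R F -> ∑ (interval R) F ≈ ∑ (interval R)(\r -> F (-' r))
 ∑-reflect R F = trans (∑-interval R F)(trans (solve 3 (\a b c -> a :+ b :+ c := a :+ c :+ b) rfl _ _ _)(sym (∑-interval R _)))

 cosh : ℤ -> Carrier
 cosh x = mono x + mono (-' x)

 U-cosh : ∀ j x -> U j (cosh x) ≈ cosh (+ j *' x)
 U-cosh zero x = sym (+-cong mono-0 mono-0)
 U-cosh (suc zero) x = +-cong (mono-cong (≡.sym (ℤP.*-identityˡ x)))(mono-cong (cong -'_ (≡.sym (ℤP.*-identityˡ x))))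
 U-cosh (suc (suc j)) x = begin
  cosh x * U (suc j)(cosh x) - U j (cosh x)
   ≈⟨ +-cong (*ˡ (U-cosh (suc j) x))(-‿cong (U-cosh j x)) ⟩
  _
   ≈⟨ +ʳ (solve 4 (\a b c d -> (a :+ b) :* (c :+ d) := a :* c :+ b :* d :+ (a :* d :+ b :* c)) rfl _ _ _ _) ⟩
  _
   ≈⟨ +ʳ (+-cong (+-cong (fold (l1 x (+ j)))(fold (l2 x (+ j))))(+-cong (fold (l3 x (+ j)))(fold (l4 x (+ j))))) ⟩
  _
   ≈⟨ solve 3 (\a b c -> a :+ (b :+ c) :- (c :+ b) := a) rfl _ _ _ ⟩
  cosh (+ suc (suc j) *' x) ∎
  where
  y = + suc j *' x
  fold : ∀ {x y z} -> x +' y ≡ z -> mono x * mono y ≈ mono z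
  fold {x} {y} refl = sym (mono-+ x y)
  l1 : ∀ x j -> x +' (1' +' j) *' x ≡ (1' +' (1' +' j)) *' x
  l1 = ℤsolve
  l2 : ∀ x j -> -' x +' -' ((1' +' j) *' x) ≡ -' ((1' +' (1' +' j)) *' x)
  l2 = ℤsolve
  l3 : ∀ x j -> x +' -' ((1' +' j) *' x) ≡ -' (j *' x)
  l3 = ℤsolve
  l4 : ∀ x j -> -' x +' (1' +' j) *' x ≡ j *' x
  l4 = ℤsolve

 V0 : List ℕ -> Carrier
 V0 [] = 1#
 V0 (c ∷ cs) = ∏ cs (\c' -> cosh (+ c +' + c) - cosh (+ c' +' + c')) * V0 cs

 entry : ℕ -> ℕ -> ℕ -> ℕ -> ℕ -> Carrier
 entry R P w j c = ∑ (interval R)(\r -> sgn ∣ r ∣ * mono (+ w *' (+ P *' (r *' r) +' (+ c +' + c) *' r)) * cosh (+ j *' ((+ c +' + P *' r) +' (+ c +' + P *' r))))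

 -- The exponents are wPr^2 + 2(wc + Pj)r + 2jc and wPr^2 + 2(wc - Pj)r - 2jc. Exchanging P with w
 -- and j with c fixes the first and takes the second to itself after r is replaced by -r.
 entry-dual : ∀ R P w j c -> entry R P w j c ≈ entry R w P c j
 entry-dual R P w j c = trans (half P w j c)(trans (+-cong (∑-cong (interval R) same)(trans (∑-reflect R _)(∑-cong (interval R) opposite)))(sym (half w P c j)))
  where
  e₊ e₋ : ℕ -> ℕ -> ℕ -> ℕ -> ℤ -> ℤ
  e₊ P w j c r = + w *' (+ P *' (r *' r) +' (+ c +' + c) *' r) +' + j *' ((+ c +' + P *' r) +' (+ c +' + P *' r))
  e₋ P w j c r = + w *' (+ P *' (r *' r) +' (+ c +' + c) *' r) +' -' (+ j *' ((+ c +' + P *' r) +' (+ c +' + P *' r)))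
  half : ∀ P w j c -> entry R P w j c ≈ ∑ (interval R)(\r -> sgn ∣ r ∣ * mono (e₊ P w j c r)) + ∑ (interval R)(\r -> sgn ∣ r ∣ * mono (e₋ P w j c r))
  half P w j c = trans (∑-cong (interval R)(\r -> trans (solve 4 (\s g a b -> s :* g :* (a :+ b) := s :* (g :* a) :+ s :* (g :* b)) rfl _ _ _ _)
   (+-cong (*ˡ (sym (mono-+ _ _)))(*ˡ (sym (mono-+ _ _))))))(∑-+ (interval R) _ _)
  same : ∀ r -> sgn ∣ r ∣ * mono (e₊ P w j c r) ≈ sgn ∣ r ∣ * mono (e₊ w P c j r)
  same r = *ˡ (mono-cong (l (+ P)(+ w)(+ j)(+ c) r))
   where
   l : ∀ P w j c r -> w *' (P *' (r *' r) +' (c +' c) *' r) +' j *' ((c +' P *' r) +' (c +' P *' r)) ≡ P *' (w *' (r *' r) +' (j +' j) *' r) +' c *' ((j +' w *' r) +' (j +' w *' r))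
   l = ℤsolve
  opposite : ∀ r -> sgn ∣ -' r ∣ * mono (e₋ P w j c (-' r)) ≈ sgn ∣ r ∣ * mono (e₋ w P c j r)
  opposite r = *-cong (reflexive (cong sgn (ℤP.∣-i∣≡∣i∣ r)))(mono-cong (l (+ P)(+ w)(+ j)(+ c) r))
   where
   l : ∀ P w j c r -> w *' (P *' ((-' r) *' (-' r)) +' (c +' c) *' (-' r)) +' -' (j *' ((c +' P *' (-' r)) +' (c +' P *' (-' r)))) ≡ P *' (w *' (r *' r) +' (j +' j) *' r) +' -' (c *' ((j +' w *' r) +' (j +' w *' r)))
   l = ℤsolve

down : ℕ -> List ℕ
down zero = []
down (suc n) = n ∷ down n

classes : ℕ -> List ℕ
classes zero = []
classes (suc n) = suc n ∷ classes n

prog2 : ℤ -> ℕ -> List ℤ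
prog2 b zero = []
prog2 b (suc k) = b ∷ prog2 (b +' + 2) k

prog2-+ : ∀ b k l -> prog2 b (k ℕ.+ l) ≡ prog2 b k ++ prog2 (b +' + 2 *' + k) l
prog2-+ b zero l = cong (\z -> prog2 z l)(≡.sym (ℤP.+-identityʳ b))
prog2-+ b (suc k) l = cong (b ∷_)(≡.trans (prog2-+ (b +' + 2) k l)(cong (\z -> prog2 (b +' + 2) k ++ prog2 z l)(lem b (+ k))))
 where
 lem : ∀ b k -> b +' + 2 +' + 2 *' k ≡ b +' + 2 *' (1' +' k)
 lem = ℤsolve

prog2-map : ∀ b k z -> map (\x -> x +' z)(prog2 b k) ≡ prog2 (b +' z) k
prog2-map b zero z = refl
prog2-map b (suc k) z = cong (b +' z ∷_)(≡.trans (prog2-map (b +' + 2) k z)(cong (\y -> prog2 y k)(lem b z)))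
 where
 lem : ∀ b z -> b +' + 2 +' z ≡ b +' z +' + 2
 lem = ℤsolve

prog2-bounds : ∀ b k -> All (\x -> b ≤' x × x <' b +' + 2 *' + k)(prog2 b k)
prog2-bounds b zero = []
prog2-bounds b (suc k) = (ℤP.≤-refl , subst (b <'_)(cong (\z -> b +' z)(ℤP.pos-* 2 (suc k)))(subst (_<' b +' + (2 ℕ.* suc k))(ℤP.+-identityʳ b)(ℤP.+-monoʳ-< b (ℤ.+<+ (s≤s z≤n)))))
 ∷ All.map (\ { (p , q) -> ℤP.≤-trans (ℤP.i≤i+j b (+ 2)) p , subst (_ <'_)(lem b (+ k)) q })(prog2-bounds (b +' + 2) k)
 where
 lem : ∀ b k -> b +' + 2 +' + 2 *' k ≡ b +' + 2 *' (1' +' k)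
 lem = ℤsolve

private
 b<b+2 : ∀ b -> b <' b +' + 2
 b<b+2 b = subst (_<' b +' + 2)(ℤP.+-identityʳ b)(ℤP.+-monoʳ-< b (ℤ.+<+ (s≤s z≤n)))

prog2-sorted : ∀ b k -> AllPairs _<'_ (prog2 b k)
prog2-sorted b zero = []
prog2-sorted b (suc k) = All.map (\p -> ℤP.<-≤-trans (b<b+2 b)(proj₁ p))(prog2-bounds (b +' + 2) k) ∷ prog2-sorted (b +' + 2) k

sorted⇒Good : ∀ {Y} -> All (0' <'_) Y -> AllPairs _<'_ Y -> Good Y
sorted⇒Good {Y} ps as = AllP.map⁺ (All.map (\p e -> ℤP.<-irrefl (≡.sym (ℤP.∣i∣≡0⇒i≡0 (≡.sym e))) p) ps) ∷ pairs ps as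
 where
 abs-inj : ∀ {x y} -> 0' <' x -> 0' <' y -> ∣ x ∣ ≡ ∣ y ∣ -> x ≡ y
 abs-inj {+ _} {+ _} _ _ e = cong +_ e
 pairs : ∀ {Y} -> All (0' <'_) Y -> AllPairs _<'_ Y -> AllPairs _≢_ (map ∣_∣ Y)
 pairs [] [] = []
 pairs (p ∷ ps)(a ∷ as) = AllP.map⁺ (All.zipWith (\ { (p' , lt) e -> ℤP.<-irrefl (abs-inj p p' e) lt })(ps , a)) ∷ pairs ps as

-- The signed sum over a union of progressions.

module Alphabet (𝓕 : Frame)(P : ℕ)(0<P : 0 < P)(K : ℕ)(0<K : 0 < K)(q : ℕ)(2q<P : q ℕ.+ q < P)(R : ℕ)(K≤R : K ≤ R)(m : ℕ) where
 open Steps 𝓕 P 0<P K 0<K q 2q<P R public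

 Σs-++ : ∀ {A : Set} (X Y : List A) F -> Σs (X ++ Y) F ≈ Σs X (\J I -> Σs Y (\J' I' -> F (J ++ J')(I ++ I')))
 Σs-++ [] Y F = sym (+-identityʳ _)
 Σs-++ (x ∷ X) Y F = trans (Σs-∷ x (X ++ Y) F)(trans (+-cong (Σs-++ X Y _)(Σs-++ X Y _))(sym (Σs-∷ x X _)))

 ^-* : ∀ x y k -> (x * y) ^ k ≈ x ^ k * y ^ k
 ^-* x y zero = sym (*-identityˡ 1#)
 ^-* x y (suc k) = trans (*ˡ (^-* x y k))(x*y*[z*u]≈x*z*[y*u] _ _ _ _)

 ^-cong : ∀ {x y} k -> x ≈ y -> x ^ k ≈ y ^ k
 ^-cong zero p = rfl
 ^-cong (suc k) p = *-cong p (^-cong k p)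

 1^ : ∀ k -> 1# ^ k ≈ 1#
 1^ zero = rfl
 1^ (suc k) = trans (*-identityˡ _)(1^ k)

 Int-^ : ∀ {x} k -> Int x -> Int (x ^ k)
 Int-^ zero _ = Int-1
 Int-^ (suc k) i = Int-* i (Int-^ k i)

 ∏-zero : ∀ {A : Set} {x : A} {X F} -> x ∈ X -> F x ≈ 0# -> ∏ X F ≈ 0#
 ∏-zero (Any.here refl) p = trans (*ʳ p)(zeroˡ _)
 ∏-zero (Any.there i) p = trans (*ˡ (∏-zero i p))(zeroʳ _)

 a-zero : ∀ {x} -> x ≡ -' 2P -> a x ≈ 0#
 a-zero refl = trans (a-ratio (neg≢0 (\z -> 2P≢0 0 (≡.trans (ℤP.*-identityʳ 2P) z))))(trans (*ʳ (trans (+ˡ (-‿cong (trans (mono-cong (ℤP.+-inverseˡ 2P)) mono-0)))(-‿inverseʳ 1#)))(zeroˡ _))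

 -- The numerator 1 - t h^z of `a` vanishes at z = -2P; these zeros thin out the signed sum.
 A-vanish : ∀ {x y X Z} -> x ∈ X -> y ∈ Z -> x +' y ≡ -' 2P -> A (X ++ Z) ≈ 0#
 A-vanish {X = X} {Z} x∈ y∈ e = trans (A-++ X Z)(trans (*ˡ (∏-zero x∈ (∏-zero y∈ (a-zero e))))(zeroʳ _))

 A-zeroˡ : ∀ X Z -> A X ≈ 0# -> A (X ++ Z) ≈ 0#
 A-zeroˡ X Z p = trans (A-++ X Z)(trans (*ʳ (trans (*ʳ p)(zeroˡ _)))(zeroˡ _))

 A-zeroʳ : ∀ X Z -> A Z ≈ 0# -> A (X ++ Z) ≈ 0#
 A-zeroʳ X Z p = trans (A-++ X Z)(trans (*ʳ (trans (*ˡ p)(zeroʳ _)))(zeroˡ _))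

 prog-+ : ∀ b k l -> prog b (k ℕ.+ l) ≡ prog b k ++ prog (b +' 2P *' + k) l
 prog-+ b zero l = cong (\z -> prog z l)(≡.sym (≡.trans (cong (\z -> b +' z)(ℤP.*-zeroʳ 2P))(ℤP.+-identityʳ b)))
 prog-+ b (suc k) l = cong (b ∷_)(≡.trans (prog-+ (b +' 2P) k l)(cong (\z -> prog (b +' 2P) k ++ prog z l)(lem b 2P (+ k))))
  where
  lem : ∀ b p k -> b +' p +' p *' k ≡ b +' p *' (1' +' k)
  lem = ℤsolve

 rest : ℤ -> ℕ -> ℕ -> List ℤ
 rest b r k = prog (b +' 2P *' + r)(k ∸ r)

 -- If x ∈ I and x + 2P ∈ J forces F J I to vanish, then only the prefixes J survive.
 prefix : ∀ b k (F : List ℤ -> List ℤ -> Carrier) -> (∀ {x J I} -> x ∈ I -> x +' 2P ∈ J -> F J I ≈ 0#) ->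
  Σs (prog b k) F ≈ ∑ (upTo (suc k))(\r -> F (prog b r)(rest b r k))
 prefix b zero F v = rfl
 prefix b (suc k) F v = begin
  Σs (prog b (suc k)) F
   ≈⟨ Σs-∷ b (prog (b +' 2P) k) F ⟩
  _
   ≈⟨ +-cong (prefix (b +' 2P) k _ (\i j -> v i (Any.there j)))(prefix (b +' 2P) k _ (\i j -> v (Any.there i) j)) ⟩
  _
   ≈⟨ +-cong (∑-cong (upTo (suc k))(\r -> reflexive (cong (\z -> F (prog b (suc r))(prog z (k ∸ r)))(lem b 2P (+ r)))))
      (trans (∑-upTo-suc k _)(trans (+-cong (reflexive (cong (\z -> F [] (b ∷ prog z k))(l0 (b +' 2P))))(∑-zero (upTo k)(\r -> v (Any.here refl)(Any.here refl))))(+-identityʳ _))) ⟩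
  _
   ≈⟨ +-comm _ _ ⟩
  _
   ≈⟨ +ʳ (reflexive (cong (\z -> F [] (prog z (suc k)))(≡.sym (l0 b)))) ⟩
  _
   ≈⟨ sym (∑-upTo-suc (suc k)(\r -> F (prog b r)(rest b r (suc k)))) ⟩
  ∑ (upTo (suc (suc k)))(\r -> F (prog b r)(rest b r (suc k))) ∎
  where
  lem : ∀ b p k -> b +' p +' p *' k ≡ b +' p *' (1' +' k)
  lem = ℤsolve
  l0 : ∀ b -> b +' 2P *' 0' ≡ b
  l0 b = ≡.trans (cong (\z -> b +' z)(ℤP.*-zeroʳ 2P))(ℤP.+-identityʳ b)

 seg : ℤ -> ℕ -> List ℤ
 seg b r = neg (prog b r) ++ rest b r L

 tracks : List ℤ -> List ℤ
 tracks = concatMap (\b -> prog b L)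

 -- E holds the letters whose signs are settled, the second list the starts of the progressions
 -- still to be signed.
 Ψ : List ℤ -> List ℤ -> Carrier
 Ψ E [] = A E
 Ψ E (b ∷ bs) = ∑ (upTo (suc L))(\r -> mon (prog b r) ^ m * Ψ (E ++ seg b r) bs)

 private
  ↭-mid : ∀ (E a b c d : List ℤ) -> E ++ ((a ++ b) ++ (c ++ d)) ↭ (E ++ (a ++ c)) ++ (b ++ d)
  ↭-mid E a b c d = Perm.trans (PermP.++⁺ˡ E (Perm.trans (↭-reflexive (ListP.++-assoc a b (c ++ d)))
   (Perm.trans (PermP.++⁺ˡ a (PermP.shifts b c {d}))(↭-reflexive (≡.sym (ListP.++-assoc a c (b ++ d)))))))(↭-reflexive (≡.sym (ListP.++-assoc E (a ++ c)(b ++ d))))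

 signed-Ψ : ∀ E bs -> Σs (tracks bs)(\J I -> mon J ^ m * A (E ++ (neg J ++ I))) ≈ Ψ E bs
 signed-Ψ E [] = trans (+-identityʳ _)(trans (*-cong (1^ m)(A-↭ (↭-reflexive (ListP.++-identityʳ E))))(*-identityˡ _))
 signed-Ψ E (b ∷ bs) = begin
  Σs (prog b L ++ tracks bs)(\J I -> mon J ^ m * A (E ++ (neg J ++ I)))
   ≈⟨ Σs-++ (prog b L)(tracks bs) _ ⟩
  _
   ≈⟨ Σs-cong (prog b L)(\ {J} {I} _ -> trans (Σs-cong (tracks bs)(\ {J'} {I'} _ -> split J I J' I'))(∑-*ˡ _ (splits (tracks bs)) _)) ⟩
  _
   ≈⟨ prefix b L _ (\ {x} {J} {I} x∈ y∈ -> trans (*ˡ (∑-zero (splits (tracks bs))(\p -> trans (*ˡ (A-zeroˡ (E ++ (neg J ++ I)) _ (A-zeroʳ E (neg J ++ I)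
      (A-vanish (MemP.∈-map⁺ (\x -> -' x) y∈) x∈ (lem x 2P)))))(zeroʳ _))))(zeroʳ _)) ⟩
  _ ≈⟨ ∑-cong (upTo (suc L))(\r -> *ˡ (signed-Ψ (E ++ seg b r) bs)) ⟩
  Ψ E (b ∷ bs) ∎
  where
  lem : ∀ x p -> -' (x +' p) +' x ≡ -' p
  lem = ℤsolve
  split : ∀ J I J' I' -> mon (J ++ J') ^ m * A (E ++ (neg (J ++ J') ++ (I ++ I'))) ≈ mon J ^ m * (mon J' ^ m * A ((E ++ (neg J ++ I)) ++ (neg J' ++ I')))
  split J I J' I' = trans (*-cong (trans (^-cong m (∏-++ J J' mono))(^-* _ _ m))
   (A-↭ (Perm.trans (↭-reflexive (cong (\z -> E ++ (z ++ (I ++ I')))(ListP.map-++ (\x -> -' x) J J')))(↭-mid E (neg J)(neg J') I I'))))(*-assoc _ _ _)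

 Ψ-↭ : ∀ {E E'} bs -> E ↭ E' -> Ψ E bs ≈ Ψ E' bs
 Ψ-↭ [] p = A-↭ p
 Ψ-↭ (b ∷ bs) p = ∑-cong (upTo (suc L))(\r -> *ˡ (Ψ-↭ bs (PermP.++⁺ʳ _ p)))

 Ψ-zero : ∀ E bs -> A E ≈ 0# -> Ψ E bs ≈ 0#
 Ψ-zero E [] p = p
 Ψ-zero E (b ∷ bs) p = ∑-zero (upTo (suc L))(\r -> trans (*ˡ (Ψ-zero (E ++ seg b r) bs (A-zeroˡ E (seg b r) p)))(zeroʳ _))

 infix 4 _~_
 _~_ : List ℤ -> List ℤ -> Set
 X ~ Y = map ∣_∣ X ↭ map ∣_∣ Y

 Good-~ : ∀ {X Y} -> X ~ Y -> Good Y -> Good X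
 Good-~ p = AllPairs-↭ (\ne e -> ne (≡.sym e))(prep 0 (↭-sym p))

 ↭⇒~ : ∀ {X Y} -> X ↭ Y -> X ~ Y
 ↭⇒~ = PermP.map⁺ ∣_∣

 ~-++ : ∀ {X X' Y Y'} -> X ~ X' -> Y ~ Y' -> X ++ Y ~ X' ++ Y'
 ~-++ {X} {X'} {Y} {Y'} p p' = Perm.trans (↭-reflexive (ListP.map-++ ∣_∣ X Y))(Perm.trans (PermP.++⁺ p p')(↭-reflexive (≡.sym (ListP.map-++ ∣_∣ X' Y'))))

 prog-rest : ∀ b {r} -> r ≤ L -> prog b L ≡ prog b r ++ rest b r L
 prog-rest b {r} r≤L = ≡.trans (cong (prog b)(≡.sym (ℕP.m+[n∸m]≡n r≤L)))(prog-+ b r (L ∸ r))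

 seg-~ : ∀ b {r} -> r ≤ L -> seg b r ~ prog b L
 seg-~ b {r} r≤L = Perm.trans (~-++ {neg (prog b r)} {prog b r} {rest b r L} {rest b r L} (↭-reflexive (map-abs-neg (prog b r))) ↭-refl)(↭-reflexive (cong (map ∣_∣)(≡.sym (prog-rest b r≤L))))

 private
  seg-step : ∀ E b {r} bs -> r ≤ L -> Good (E ++ tracks (b ∷ bs)) -> Good ((E ++ seg b r) ++ tracks bs)
  seg-step E b {r} bs r≤L = Good-~ {(E ++ seg b r) ++ tracks bs} (Perm.trans (↭-reflexive (cong (map ∣_∣)(ListP.++-assoc E (seg b r)(tracks bs))))
   (~-++ {E} {E} ↭-refl (~-++ {seg b r} {prog b L} {tracks bs} (seg-~ b r≤L) ↭-refl)))

  apart : ∀ y {Y} -> Good (y ∷ Y) -> All (\x -> ∣ y ∣ ≢ ∣ x ∣) Y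
  apart y (_ ∷ p ∷ _) = AllP.map⁻ p

 Positive : List ℤ -> Set
 Positive = All (0' <'_)

 Int-A : ∀ {E} -> Good E -> Int (A E)
 Int-A {[]} g = Int-1
 Int-A {e ∷ E} g = Int-* (Int-* (Int-+ (Int-- (Int-mono P))(Int-* (Int-+ Int-1 (Int-mono P))(Int-γ (Good⇒≢0 {e} {E} g))))
  (Int-∏ (All.map (\ {x} ne -> Int-a (abs≢⇒+≢0 e x ne))(apart e g))))(Int-A (Good-tail {e} g))

 φ-small : ∀ {x} -> 0' <' x -> Small 1 (φ (-' x))
 φ-small {+ suc n} _ = Small-+ (Small-neg (Small-mono P 0<P))(Int-*Small (Int-+ Int-1 (Int-mono P))
  (Small-resp (trans (-‿distribˡ-* _ _)(sym (γ-flip {+ suc n} (\()))))(Small-neg (Small-*Int (Small-mono (suc n)(s≤s z≤n))(Int-γ (\()))))))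
 φ-small {+ zero} (ℤ.+<+ ())

 -- For x > 0 the factor φ(-x) is divisible by h, so every negative letter raises the order; long
 -- reflected prefixes are negligible.
 A-small : ∀ J {E} -> Positive J -> Good (neg J ++ E) -> Small (length J)(A (neg J ++ E))
 A-small [] _ g = Int⇒Small (Int-A g)
 A-small (j ∷ J)(p ∷ ps) g = Small-* (Small-*Int (φ-small p)(Int-∏ (All.map (\ {x} ne -> Int-a (abs≢⇒+≢0 (-' j) x ne))(apart (-' j) g))))(A-small J ps (Good-tail { -' j} g))

 Small-∑ : ∀ {k} {A : Set} {xs : List A} {F : A -> Carrier} -> All (\x -> Small k (F x)) xs -> Small k (∑ xs F)
 Small-∑ [] = Small-0
 Small-∑ (p ∷ ps) = Small-+ p (Small-∑ ps)

 prog-Positive : ∀ {b} k -> 0' <' b -> Positive (prog b k)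
 prog-Positive zero p = []
 prog-Positive (suc k) p = p ∷ prog-Positive k (ℤP.<-≤-trans p (ℤP.i≤i+j _ 2P))

 Int-mon : ∀ {Y} -> Positive Y -> Int (mon Y)
 Int-mon ps = Int-∏ (All.map (\p -> Int-mono≥0 (ℤP.<⇒≤ p)) ps)

 Ψ-small : ∀ J {E} bs -> Positive J -> Positive bs -> Good ((neg J ++ E) ++ tracks bs) -> Small (length J)(Ψ (neg J ++ E) bs)
 Ψ-small J {E} [] pj pb g = A-small J pj (subst Good (ListP.++-identityʳ (neg J ++ E)) g)
 Ψ-small J {E} (b ∷ bs) pj (p ∷ pb) g = Small-∑ (All.map (\ {r} r≤ -> Int-*Small (Int-^ m (Int-mon (prog-Positive r p)))
  (Small-resp (Ψ-↭ bs (↭-reflexive (≡.sym (ListP.++-assoc (neg J) E (seg b r)))))(Ψ-small J bs pj pb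
   (subst (\z -> Good (z ++ tracks bs))(ListP.++-assoc (neg J) E (seg b r))(seg-step (neg J ++ E) b bs r≤ g)))))(upTo-≤ L))

 length-prog : ∀ b k -> length (prog b k) ≡ k
 length-prog b zero = refl
 length-prog b (suc k) = cong suc (length-prog _ k)

 Ψ-small-↭ : ∀ {E} J E' bs -> E ↭ neg J ++ E' -> K ≤ length J -> Positive J -> Positive bs -> Good (E ++ tracks bs) -> Small K (Ψ E bs)
 Ψ-small-↭ J E' bs perm K≤ pj pb g = Small-≤ K≤ (Small-resp (Ψ-↭ bs (↭-sym perm))(Ψ-small J bs pj pb (Good-↭ (PermP.++⁺ʳ (tracks bs) perm) g)))

 truncate : ∀ d n {F : ℕ -> Carrier} -> (∀ r -> n ≤ r -> r < d ℕ.+ n -> Small K (F r)) -> ∑ (upTo (d ℕ.+ n)) F ≡[ K ] ∑ (upTo n) F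
 truncate zero n s = ≡[]-reflexive rfl
 truncate (suc d) n {F} s = ≡[]-trans (≡[]-reflexive (∑-upTo-last (d ℕ.+ n) F))(≡[]-trans
  (≡[]-+ (truncate d n (\r n≤ r< -> s r n≤ (ℕP.<-trans r< ℕP.≤-refl)))(Small⇒≡[]0 (s (d ℕ.+ n)(ℕP.m≤n+m n d) ℕP.≤-refl)))(≡[]-reflexive (+-identityʳ _)))

 mon-prog : ∀ b r -> mon (prog b r) ≈ mono (b *' + r +' (+ P *' (+ r *' + r) -' + P *' + r))
 mon-prog b zero = sym (trans (mono-cong (l b (+ P))) mono-0)
  where
  l : ∀ b P -> b *' 0' +' (P *' (0' *' 0') -' P *' 0') ≡ 0'
  l = ℤsolve
 mon-prog b (suc r) = trans (*ˡ (mon-prog (b +' 2P) r))(trans (mono-mono _ _)(mono-cong (l b (+ P)(+ r))))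
  where
  l : ∀ b P r -> b +' ((b +' (P +' P)) *' r +' (P *' (r *' r) -' P *' r)) ≡ b *' (1' +' r) +' (P *' ((1' +' r) *' (1' +' r)) -' P *' (1' +' r))
  l = ℤsolve

 neg-prog : ∀ b r -> neg (prog b r) ↭ prog (2P -' b -' 2P *' + r) r
 neg-prog b zero = ↭-refl
 neg-prog b (suc r) = Perm.trans (prep (-' b)(neg-prog (b +' 2P) r))(Perm.trans (PermP.∷↭∷ʳ (-' b) _)
  (↭-reflexive (≡.sym (≡.trans (cong (prog x)(ℕP.+-comm 1 r))(≡.trans (prog-+ x r 1)(cong₂ (\u v -> prog u r ++ v ∷ [])(l1 b 2P (+ r))(l2 b 2P (+ r))))))))
  where
  x = 2P -' b -' 2P *' + suc r
  l1 : ∀ b p r -> p -' b -' p *' (1' +' r) ≡ p -' (b +' p) -' p *' r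
  l1 = ℤsolve
  l2 : ∀ b p r -> p -' b -' p *' (1' +' r) +' p *' r ≡ -' b
  l2 = ℤsolve

 reflect : ∀ b b' r -> b +' b' ≡ 2P -> neg (prog b r) ++ prog b' L ↭ prog (2P -' b -' 2P *' + r)(L ℕ.+ r)
 reflect b b' r e = Perm.trans (PermP.++⁺ʳ _ (neg-prog b r))(↭-reflexive (≡.sym (≡.trans (cong (prog x)(ℕP.+-comm L r))
  (≡.trans (prog-+ x r L)(cong (\z -> prog x r ++ prog z L)(≡.trans (l b 2P (+ r))(≡.trans (cong (_-' b)(≡.sym e))(l' b b'))))))))
  where
  x = 2P -' b -' 2P *' + r
  l : ∀ b p r -> p -' b -' p *' r +' p *' r ≡ p -' b
  l = ℤsolve
  l' : ∀ b b' -> b +' b' -' b ≡ b'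
  l' = ℤsolve

 b₊ b₋ : ℕ -> ℤ
 b₊ c = + P +' dbl (+ c)
 b₋ c = + P -' dbl (+ c)

 private
  b₊+b₋ : ∀ c -> b₊ c +' b₋ c ≡ 2P
  b₊+b₋ c = l (+ P)(dbl (+ c))
   where
   l : ∀ p c -> p +' c +' (p -' c) ≡ p +' p
   l = ℤsolve

  abs-∸ : ∀ {r} -> r ≤ L -> ∣ + L -' + r ∣ ≡ L ∸ r
  abs-∸ {r} p = cong ∣_∣ (≡.trans (ℤP.m-n≡m⊖n L r)(ℤP.⊖-≥ p))

  l0 : ∀ b -> b +' 2P *' 0' ≡ b
  l0 b = ≡.trans (cong (\z -> b +' z)(ℤP.*-zeroʳ 2P))(ℤP.+-identityʳ b)

 class₊ : ∀ c {r} -> r ≤ L -> seg (b₊ c) r ++ seg (b₋ c) 0 ↭ blk c (+ r)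
 class₊ c {r} r≤L = Perm.trans (PermP.++⁺ʳ _ (PermP.++-comm (neg (prog (b₊ c) r))(rest (b₊ c) r L)))(Perm.trans (↭-reflexive (ListP.++-assoc (rest (b₊ c) r L) _ _))
  (PermP.++⁺ (↭-reflexive (cong₂ prog (l1 (+ P)(+ c)(+ r))(≡.sym (abs-∸ r≤L))))
   (Perm.trans (↭-reflexive (cong (\z -> neg (prog (b₊ c) r) ++ prog z L)(l0 (b₋ c))))(Perm.trans (reflect (b₊ c)(b₋ c) r (b₊+b₋ c))(↭-reflexive (cong (\z -> prog z (L ℕ.+ r))(l2 (+ P)(+ c)(+ r))))))))
  where
  l1 : ∀ P c r -> P +' (c +' c) +' (P +' P) *' r ≡ P +' (c +' P *' r +' (c +' P *' r))
  l1 = ℤsolve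
  l2 : ∀ P c r -> (P +' P) -' (P +' (c +' c)) -' (P +' P) *' r ≡ P -' (c +' P *' r +' (c +' P *' r))
  l2 = ℤsolve

 class₋ : ∀ c {r} -> suc r ≤ L -> seg (b₊ c) 0 ++ seg (b₋ c)(suc r) ↭ blk c -[1+ r ]
 class₋ c {r} r≤L = Perm.trans (↭-reflexive (≡.sym (ListP.++-assoc (rest (b₊ c) 0 L)(neg (prog (b₋ c)(suc r))) _)))
  (PermP.++⁺ (Perm.trans (PermP.++-comm (rest (b₊ c) 0 L) _)(Perm.trans (↭-reflexive (cong (\z -> neg (prog (b₋ c)(suc r)) ++ prog z L)(l0 (b₊ c))))
    (Perm.trans (reflect (b₋ c)(b₊ c)(suc r)(≡.trans (ℤP.+-comm (b₋ c)(b₊ c))(b₊+b₋ c)))(↭-reflexive (cong (\z -> prog z (L ℕ.+ suc r))(l2 (+ P)(+ c)(+ suc r)))))))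
   (↭-reflexive (cong₂ prog (l1 (+ P)(+ c)(+ suc r))(≡.sym (cong ∣_∣ (ℤP.⊖-≥ r≤L))))))
  where
  l1 : ∀ P c r -> P -' (c +' c) +' (P +' P) *' r ≡ P -' (c +' P *' (-' r) +' (c +' P *' (-' r)))
  l1 = ℤsolve
  l2 : ∀ P c r -> (P +' P) -' (P -' (c +' c)) -' (P +' P) *' r ≡ P +' (c +' P *' (-' r) +' (c +' P *' (-' r)))
  l2 = ℤsolve

 class0 : ∀ {k} -> k ≤ L -> seg (+ P) k ↭ blk0 k
 class0 {k} k≤L = Perm.trans (PermP.++-comm (neg (prog (+ P) k))(rest (+ P) k L))(PermP.++⁺ (↭-reflexive (cong₂ prog (l1 (+ P)(+ k))(≡.sym (abs-∸ k≤L))))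
  (Perm.trans (neg-prog (+ P) k)(↭-reflexive (cong (\z -> prog z k)(l2 (+ P)(+ k))))))
  where
  l1 : ∀ P r -> P +' (P +' P) *' r ≡ P +' (0' +' P *' r +' (0' +' P *' r))
  l1 = ℤsolve
  l2 : ∀ P r -> (P +' P) -' P -' (P +' P) *' r ≡ P -' (0' +' P *' r +' (0' +' P *' r))
  l2 = ℤsolve

 mon-b₊ : ∀ c r -> mon (prog (b₊ c) r) ≈ mono (Γ c (+ r))
 mon-b₊ c r = trans (mon-prog (b₊ c) r)(mono-cong (l (+ P)(+ c)(+ r)))
  where
  l : ∀ P c r -> (P +' (c +' c)) *' r +' (P *' (r *' r) -' P *' r) ≡ P *' (r *' r) +' (c +' c) *' r
  l = ℤsolve

 mon-b₋ : ∀ c r -> mon (prog (b₋ c) r) ≈ mono (Γ c (-' + r))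
 mon-b₋ c r = trans (mon-prog (b₋ c) r)(mono-cong (l (+ P)(+ c)(+ r)))
  where
  l : ∀ P c r -> (P -' (c +' c)) *' r +' (P *' (r *' r) -' P *' r) ≡ P *' ((-' r) *' (-' r)) +' (c +' c) *' (-' r)
  l = ℤsolve

 mon-b0 : ∀ r -> mon (prog (+ P) r) ≈ mono (Γ 0 (+ r))
 mon-b0 r = trans (mon-prog (+ P) r)(mono-cong (l (+ P)(+ r)))
  where
  l : ∀ P r -> P *' r +' (P *' (r *' r) -' P *' r) ≡ P *' (r *' r) +' (0' +' 0') *' r
  l = ℤsolve

 range : List ℤ
 range = map +_ (upTo (suc R)) ++ map -[1+_] (upTo R)

 ∑-range : ∀ F -> ∑ range F ≈ ∑ (upTo (suc R))(\r -> F (+ r)) + ∑ (upTo R)(\r -> F -[1+ r ])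
 ∑-range F = trans (∑-++ (map +_ (upTo (suc R))) _ F)(+-cong (∑-map +_ (upTo (suc R)) F)(∑-map -[1+_] (upTo R) F))

 private
  R≤L' : R ≤ L
  R≤L' = ℕP.m≤m+n R (suc K)
  upTo-< : ∀ n -> All (_< n)(upTo n)
  upTo-< zero = []
  upTo-< (suc n) = All.map s≤s (upTo-≤ n)

 range-≤ : All (\r -> ∣ r ∣ ≤ R) range
 range-≤ = AllP.++⁺ (AllP.map⁺ (upTo-≤ R))(AllP.map⁺ (upTo-< R))

 0<b₊ : ∀ c -> 0' <' b₊ c
 0<b₊ c = ℤ.+<+ (ℕP.≤-trans 0<P (ℕP.m≤m+n P _))

 0<b₋ : ∀ {c} -> c ≤ q -> 0' <' b₋ c
 0<b₋ {c} c≤q = subst (0' <'_)(≡.sym (≡.trans (ℤP.m-n≡m⊖n P (c ℕ.+ c))(ℤP.⊖-≥ (ℕP.<⇒≤ lt))))(ℤ.+<+ (ℕP.m<n⇒0<n∸m lt))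
  where
  lt : c ℕ.+ c < P
  lt = ℕP.≤-<-trans (ℕP.+-mono-≤ c≤q c≤q) 2q<P

 blk-~ : ∀ c {r} -> ∣ r ∣ ≤ R -> blk c r ~ prog (b₊ c) L ++ prog (b₋ c) L
 blk-~ c {+ r} r≤ = Perm.trans (↭⇒~ (↭-sym (class₊ c (ℕP.≤-trans r≤ R≤L'))))(~-++ {seg (b₊ c) r} {prog (b₊ c) L} (seg-~ (b₊ c)(ℕP.≤-trans r≤ R≤L'))(seg-~ (b₋ c) z≤n))
 blk-~ c { -[1+ r ]} r≤ = Perm.trans (↭⇒~ (↭-sym (class₋ c (ℕP.≤-trans r≤ R≤L'))))(~-++ {seg (b₊ c) 0} {prog (b₊ c) L} (seg-~ (b₊ c) z≤n)(seg-~ (b₋ c)(ℕP.≤-trans r≤ R≤L')))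

 Int-Γ : ∀ {c} r -> c ≤ q -> Int (mono (Γ c r) ^ m)
 Int-Γ {c} (+ r) _ = Int-^ m (Int-resp (mon-b₊ c r)(Int-mon (prog-Positive r (0<b₊ c))))
 Int-Γ {c} -[1+ r ] c≤q = Int-^ m (Int-resp (mon-b₋ c (suc r))(Int-mon (prog-Positive (suc r)(0<b₋ c≤q))))

 -- The progressions from P + 2c and P - 2c cannot both have reflected letters, because their starts
 -- add up to 2P. One integer r therefore describes the pair, its sign telling which of the two is
 -- reflected. Terms with |r| > R are negligible, as R ≥ K.
 pair-sum : ∀ E {c} bs -> c ≤ q -> Positive bs -> Good (E ++ tracks (b₊ c ∷ b₋ c ∷ bs)) ->
  Ψ E (b₊ c ∷ b₋ c ∷ bs) ≡[ K ] ∑ range (\r -> mono (Γ c r) ^ m * Ψ (E ++ blk c r) bs)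
 pair-sum E {c} bs c≤q pb g = ≡[]-trans (≡[]-reflexive exact)(≡[]-trans (≡[]-+ cut₊ cut₋)
  (≡[]-reflexive (sym (trans (∑-range _)(+-cong (∑-congAll (All.map (\ {r} p -> sym (term₊ r (ℕP.≤-trans p R≤L')))(upTo-≤ R)))
   (∑-congAll (All.map (\ {r} p -> sym (term₋ r (ℕP.≤-trans p R≤L')))(upTo-< R))))))))
  where
  F : ℕ -> ℕ -> Carrier
  F r r' = mon (prog (b₊ c) r) ^ m * (mon (prog (b₋ c) r') ^ m * Ψ ((E ++ seg (b₊ c) r) ++ seg (b₋ c) r') bs)
  neg2 : ∀ x y -> -' x +' -' y ≡ -' (x +' y)
  neg2 = ℤsolve
  vanish : ∀ r r' -> F (suc r)(suc r') ≈ 0#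
  vanish r r' = trans (*ˡ (trans (*ˡ (Ψ-zero ((E ++ seg (b₊ c)(suc r)) ++ seg (b₋ c)(suc r')) bs (A-vanish {X = E ++ seg (b₊ c)(suc r)} (MemP.∈-++⁺ʳ E (Any.here refl))(Any.here refl)
   (≡.trans (neg2 (b₊ c)(b₋ c))(cong -'_ (b₊+b₋ c))))))(zeroʳ _)))(zeroʳ _)
  exact : Ψ E (b₊ c ∷ b₋ c ∷ bs) ≈ ∑ (upTo (suc L))(\r -> F r 0) + ∑ (upTo L)(\r' -> F 0 (suc r'))
  exact = begin
   Ψ E (b₊ c ∷ b₋ c ∷ bs)
    ≈⟨ ∑-cong (upTo (suc L))(\r -> trans (sym (∑-*ˡ _ (upTo (suc L)) _))(∑-upTo-suc L (F r))) ⟩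
   _
    ≈⟨ ∑-+ (upTo (suc L)) _ _ ⟩
   _ ≈⟨ +ˡ (trans (∑-upTo-suc L _)(trans (+ˡ (∑-zero (upTo L)(\r -> ∑-zero (upTo L)(vanish r))))(+-identityʳ _))) ⟩
   _ ∎
  good : ∀ r r' -> r ≤ L -> r' ≤ L -> Good (((E ++ seg (b₊ c) r) ++ seg (b₋ c) r') ++ tracks bs)
  good r r' p p' = seg-step (E ++ seg (b₊ c) r)(b₋ c) bs p' (seg-step E (b₊ c)(b₋ c ∷ bs) p g)
  Int₊ : ∀ r -> Int (mon (prog (b₊ c) r) ^ m)
  Int₊ r = Int-^ m (Int-mon (prog-Positive r (0<b₊ c)))
  Int₋ : ∀ r -> Int (mon (prog (b₋ c) r) ^ m)
  Int₋ r = Int-^ m (Int-mon (prog-Positive r (0<b₋ c≤q)))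
  long : ∀ b r -> R ≤ r -> K ≤ length (prog b r)
  long b r p = subst (K ≤_)(≡.sym (length-prog b r))(ℕP.≤-trans K≤R p)
  cut₊ : ∑ (upTo (suc L))(\r -> F r 0) ≡[ K ] ∑ (upTo (suc R))(\r -> F r 0)
  cut₊ = subst (\n -> ∑ (upTo n)(\r -> F r 0) ≡[ K ] ∑ (upTo (suc R))(\r -> F r 0)) L-eq (truncate (suc K)(suc R)(\r R< r< ->
   let r≤L = ℕP.≤-pred (subst (r <_) L-eq r<) in
   Int-*Small (Int₊ r)(Int-*Small (Int₋ 0)(Ψ-small-↭ (prog (b₊ c) r)((E ++ rest (b₊ c) r L) ++ seg (b₋ c) 0) bs (perm r)(long (b₊ c) r (ℕP.<⇒≤ R<))
    (prog-Positive r (0<b₊ c)) pb (good r 0 r≤L z≤n)))))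
   where
   L-eq : suc K ℕ.+ suc R ≡ suc L
   L-eq = cong suc (≡.trans (ℕP.+-comm K (suc R))(≡.sym (ℕP.+-suc R K)))
   perm : ∀ r -> (E ++ seg (b₊ c) r) ++ seg (b₋ c) 0 ↭ neg (prog (b₊ c) r) ++ ((E ++ rest (b₊ c) r L) ++ seg (b₋ c) 0)
   perm r = Perm.trans (PermP.++⁺ʳ (seg (b₋ c) 0)(PermP.shifts E (neg (prog (b₊ c) r))))(↭-reflexive (ListP.++-assoc (neg (prog (b₊ c) r)) _ _))
  cut₋ : ∑ (upTo L)(\r -> F 0 (suc r)) ≡[ K ] ∑ (upTo R)(\r -> F 0 (suc r))
  cut₋ = subst (\n -> ∑ (upTo n)(\r -> F 0 (suc r)) ≡[ K ] ∑ (upTo R)(\r -> F 0 (suc r)))(ℕP.+-comm (suc K) R)(truncate (suc K) R (\r R≤ r< ->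
   Int-*Small (Int₊ 0)(Int-*Small (Int₋ (suc r))(Ψ-small-↭ (prog (b₋ c)(suc r))((E ++ seg (b₊ c) 0) ++ rest (b₋ c)(suc r) L) bs (PermP.shifts (E ++ seg (b₊ c) 0)(neg (prog (b₋ c)(suc r))))(long (b₋ c)(suc r)(ℕP.m≤n⇒m≤1+n R≤))
    (prog-Positive (suc r)(0<b₋ c≤q)) pb (good 0 (suc r) z≤n (subst (r <_)(ℕP.+-comm (suc K) R) r<))))))
  term₊ : ∀ r -> r ≤ L -> F r 0 ≈ mono (Γ c (+ r)) ^ m * Ψ (E ++ blk c (+ r)) bs
  term₊ r p = *-cong (^-cong m (mon-b₊ c r))(trans (*-cong (1^ m)(Ψ-↭ bs (Perm.trans (↭-reflexive (ListP.++-assoc E (seg (b₊ c) r) _))(PermP.++⁺ˡ E (class₊ c p)))))(*-identityˡ _))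
  term₋ : ∀ r -> suc r ≤ L -> F 0 (suc r) ≈ mono (Γ c -[1+ r ]) ^ m * Ψ (E ++ blk c -[1+ r ]) bs
  term₋ r p = trans (*ʳ (1^ m))(trans (*-identityˡ _)(*-cong (^-cong m (mon-b₋ c (suc r)))(Ψ-↭ bs (Perm.trans (↭-reflexive (ListP.++-assoc E (seg (b₊ c) 0) _))(PermP.++⁺ˡ E (class₋ c p))))))

 zero-sum : ∀ E -> Good (E ++ tracks (+ P ∷ [])) -> Ψ E (+ P ∷ []) ≡[ K ] ∑ (upTo (suc R))(\k -> mono (Γ 0 (+ k)) ^ m * A (E ++ blk0 k))
 zero-sum E g = ≡[]-trans (subst (\n -> ∑ (upTo n) F ≡[ K ] ∑ (upTo (suc R)) F) L-eq (truncate (suc K)(suc R)(\r R< r< ->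
   Int-*Small (Int-^ m (Int-mon (prog-Positive r 0<P')))(Ψ-small-↭ (prog (+ P) r)(E ++ rest (+ P) r L) [] (PermP.shifts E (neg (prog (+ P) r)))
    (subst (K ≤_)(≡.sym (length-prog (+ P) r))(ℕP.≤-trans K≤R (ℕP.<⇒≤ R<)))(prog-Positive r 0<P') [] (seg-step E (+ P) [] (ℕP.≤-pred (subst (r <_) L-eq r<)) g)))))
  (≡[]-reflexive (∑-congAll (All.map (\ {k} p -> *-cong (^-cong m (mon-b0 k))(A-↭ (PermP.++⁺ˡ E (class0 (ℕP.≤-trans p R≤L')))))(upTo-≤ R))))
  where
  F : ℕ -> Carrier
  F r = mon (prog (+ P) r) ^ m * A (E ++ seg (+ P) r)
  0<P' : 0' <' + P
  0<P' = ℤ.+<+ 0<P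
  L-eq : suc K ℕ.+ suc R ≡ suc L
  L-eq = cong suc (≡.trans (ℕP.+-comm K (suc R))(≡.sym (ℕP.+-suc R K)))

 starts : List ℕ -> List ℤ
 starts [] = + P ∷ []
 starts (c ∷ cs) = b₊ c ∷ b₋ c ∷ starts cs

 Classes : List ℕ -> Set
 Classes = All (\c -> 0 < c × c ≤ q)

 starts-Positive : ∀ {cs} -> Classes cs -> Positive (starts cs)
 starts-Positive {[]} [] = ℤ.+<+ 0<P ∷ []
 starts-Positive {c ∷ cs} ((_ , p) ∷ ps) = 0<b₊ c ∷ 0<b₋ p ∷ starts-Positive ps

 Θ : List ℤ -> List ℕ -> Carrier
 Θ E [] = ∑ (upTo (suc R))(\k -> mono (Γ 0 (+ k)) ^ m * A (E ++ blk0 k))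
 Θ E (c ∷ cs) = ∑ range (\r -> mono (Γ c r) ^ m * Θ (E ++ blk c r) cs)

 Ψ-Θ : ∀ E {cs} -> Classes cs -> Good (E ++ tracks (starts cs)) -> Ψ E (starts cs) ≡[ K ] Θ E cs
 Ψ-Θ E [] g = zero-sum E g
 Ψ-Θ E {c ∷ cs} ((0<c , c≤q) ∷ ps) g = ≡[]-trans (pair-sum E (starts cs) c≤q (starts-Positive ps) g)
  (≡[]-∑ (All.map (\ {r} r≤ -> ≡[]-*ˡ (Int-Γ r c≤q)(Ψ-Θ (E ++ blk c r) ps (Good-~ {(E ++ blk c r) ++ tracks (starts cs)} (~ r r≤) g))) range-≤))
  where
  ~ : ∀ r -> ∣ r ∣ ≤ R -> (E ++ blk c r) ++ tracks (starts cs) ~ E ++ tracks (starts (c ∷ cs))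
  ~ r r≤ = Perm.trans (↭-reflexive (cong (map ∣_∣)(ListP.++-assoc E (blk c r)(tracks (starts cs)))))(~-++ {E} {E} ↭-refl
   (Perm.trans (~-++ {blk c r} {prog (b₊ c) L ++ prog (b₋ c) L} {tracks (starts cs)} (blk-~ c {r} r≤) ↭-refl)(↭-reflexive (cong (map ∣_∣)(ListP.++-assoc (prog (b₊ c) L) _ _)))))

 states : List ℕ -> List State
 states [] = [] ∷ []
 states (c ∷ cs) = concatMap (\r -> map ((c , r) ∷_)(states cs)) range

 ∑-states : ∀ c cs F -> ∑ (states (c ∷ cs)) F ≈ ∑ range (\r -> ∑ (states cs)(\s -> F ((c , r) ∷ s)))
 ∑-states c cs F = trans (∑-concatMap (\r -> map ((c , r) ∷_)(states cs)) range F)(∑-cong range (\r -> ∑-map ((c , r) ∷_)(states cs) F))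

 gauss : ℕ × ℤ -> Carrier
 gauss p = mono (Γ (proj₁ p)(proj₂ p)) ^ m

 Θ-states : ∀ E cs -> Θ E cs ≈ ∑ (states cs)(\s -> ∑ (upTo (suc R))(\k -> ∏ s gauss * gauss (0 , + k) * A (E ++ config s k)))
 Θ-states E [] = sym (trans (+-identityʳ _)(∑-cong (upTo (suc R))(\k -> *ʳ (*-identityˡ _))))
 Θ-states E (c ∷ cs) = sym (trans (∑-states c cs _)(∑-cong range (\r -> sym
  (trans (*ˡ (Θ-states (E ++ blk c r) cs))(trans (sym (∑-*ˡ (gauss (c , r))(states cs) _))(∑-cong (states cs)(\s -> trans (sym (∑-*ˡ (gauss (c , r))(upTo (suc R)) _))(∑-cong (upTo (suc R))(\k ->
   trans (solve 4 (\g p h a -> g :* (p :* h :* a) := g :* p :* h :* a) rfl (gauss (c , r))(∏ s gauss)(gauss (0 , + k)) _)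
    (*ˡ (A-↭ (↭-reflexive (ListP.++-assoc E (blk c r)(config s k))))))))))))))

 Over : List ℕ -> State -> Set
 Over cs s = map proj₁ s ≡ cs × All (\p -> ∣ proj₂ p ∣ ≤ R) s

 states-Over : ∀ cs -> All (Over cs)(states cs)
 states-Over [] = (refl , []) ∷ []
 states-Over (c ∷ cs) = AllP.concat⁺ (AllP.map⁺ (All.map (\r≤ -> AllP.map⁺ (All.map (\ { (e , as) -> cong (c ∷_) e , r≤ ∷ as })(states-Over cs))) range-≤))

 zero-state : List ℕ -> State
 zero-state = map (_, 0')

 rest-Over : ∀ {cs} s -> map proj₁ s ≡ cs -> rest-state s ≡ zero-state cs
 rest-Over s refl = ListP.map-∘ s

 config-~ : ∀ s {k} -> All (\p -> ∣ proj₂ p ∣ ≤ R) s -> k ≤ R -> config s k ~ tracks (starts (map proj₁ s))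
 config-~ [] {k} _ k≤ = Perm.trans (↭⇒~ (↭-sym (class0 (ℕP.≤-trans k≤ R≤L'))))(Perm.trans (seg-~ (+ P)(ℕP.≤-trans k≤ R≤L'))(↭-reflexive (cong (map ∣_∣)(≡.sym (ListP.++-identityʳ (prog (+ P) L))))))
 config-~ ((c , r) ∷ s) {k} (r≤ ∷ as) k≤ = Perm.trans (~-++ {blk c r} {prog (b₊ c) L ++ prog (b₋ c) L} {config s k} (blk-~ c {r} r≤)(config-~ s as k≤))(↭-reflexive (cong (map ∣_∣)(ListP.++-assoc (prog (b₊ c) L) _ _)))

 -- Equality up to a unit close to 1 becomes a congruence once one side is known to be integral.
 ≅⇒≡ : ∀ {x y} -> Int x -> x ≅ y -> x ≡[ K ] y
 ≅⇒≡ {x} {y} ix x≅y with ≅-sym x≅y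
 ... | u , U , p = cgr (Small-resp (trans (-[[x-1]*y]≈y-x*y u x)(+ˡ (-‿cong (sym p))))(Small-neg (Small-*Int (near-1 U) ix)))

 Inv-van : ∀ {cs} -> Classes cs -> AllPairs _≢_ cs -> Invertible (van (pts (zero-state cs) 0))
 Inv-van {[]} _ _ = Inv-* Inv-1 Inv-1
 Inv-van {c ∷ cs} ((0<c , c≤q) ∷ ps)(ne ∷ nes) = Inv-* (Inv-∏ (pts (zero-state cs) 0)(AllP.++⁺ (AllP.map⁺ (AllP.map⁺ (inner ps ne)))(Inv-δ̂0 0' 0' (\e -> ℕP.<⇒≢ 0<c (≡.sym e)) c≤q z≤n ∷ [])))(Inv-van ps nes)
  where
  inner : ∀ {cs} -> Classes cs -> All (c ≢_) cs -> All (\c' -> Invertible (δ̂ (β̂ c 0')(β̂ c' 0'))) cs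
  inner [] [] = []
  inner ((_ , p) ∷ ps)(ne ∷ nes) = Inv-δ̂0 0' 0' ne c≤q p ∷ inner ps nes

 Det : ℕ -> List ℕ -> Carrier
 Det w cs = ∑ (states cs)(\s -> ∑ (upTo (suc R))(\k -> mult k * (∏ s (wt w) * wt w (0 , + k)) * van (pts s k)))

 gauss-wt : ∀ w p -> gauss p * wt w p ≈ wt (m ℕ.+ w) p
 gauss-wt w (c , r) = trans (x*[y*z]≈y*[x*z] _ _ _)(*ˡ (pow m))
  where
  l : ∀ n g -> (1' +' n) *' g ≡ g +' n *' g
  l = ℤsolve
  pow : ∀ m -> mono (Γ c r) ^ m * mono (+ w *' Γ c r) ≈ mono (+ (m ℕ.+ w) *' Γ c r)
  pow zero = *-identityˡ _
  pow (suc m) = trans (*-assoc _ _ _)(trans (*ˡ (pow m))(trans (mono-mono _ _)(mono-cong (≡.sym (l (+ (m ℕ.+ w))(Γ c r))))))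

 -- Every surviving term is the value of `A` at the unsigned alphabet times an explicit ratio from
 -- `A-config`; the power mon J^m raises the weight exponent 2|cs| + 1 by m.
 signed-Det : ∀ {cs} (ps : Classes cs)(nes : AllPairs _≢_ cs) -> Good (tracks (starts cs)) ->
  signed m (tracks (starts cs)) ≡[ K ] A (config (zero-state cs) 0) * (proj₁ (Inv-van ps nes) * Det (m ℕ.+ odd (length cs)) cs)
 signed-Det {cs} ps nes g = ≡[]-trans (≡[]-reflexive (signed-Ψ [] (starts cs)))(≡[]-trans (Ψ-Θ [] ps g)(≡[]-trans (≡[]-reflexive (Θ-states [] cs))
  (≡[]-trans (≡[]-∑ (All.map (\ {s} ov -> ≡[]-∑ (All.map (\ {k} k≤ -> term s k ov k≤)(upTo-≤ R)))(states-Over cs)))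
   (≡[]-reflexive (trans (∑-cong (states cs)(\s -> trans (∑-cong (upTo (suc R))(\k -> sym (*-assoc A0 iV _)))(∑-*ˡ (A0 * iV)(upTo (suc R)) _)))(trans (∑-*ˡ (A0 * iV)(states cs) _)(*-assoc _ _ _)))))))
  where
  A0 = A (config (zero-state cs) 0)
  V0 = van (pts (zero-state cs) 0)
  iV = proj₁ (Inv-van ps nes)
  w = m ℕ.+ odd (length cs)
  adm : ∀ {cs} s -> map proj₁ s ≡ cs -> All (\p -> ∣ proj₂ p ∣ ≤ R) s -> Classes cs -> AllPairs _≢_ cs -> Admissible s
  adm s refl as ps nes = zip s as (AllP.map⁻ ps) , AllPairsP.map⁻ nes
   where
   zip : ∀ s -> All (\p -> ∣ proj₂ p ∣ ≤ R) s -> All (\p -> 0 < proj₁ p × proj₁ p ≤ q) s -> All (\p -> 0 < proj₁ p × proj₁ p ≤ q × ∣ proj₂ p ∣ ≤ R) s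
   zip [] [] [] = []
   zip (_ ∷ s)(a ∷ as)((x , y) ∷ ps) = (x , y , a) ∷ zip s as ps
  Int-gauss : ∀ {cs} s -> map proj₁ s ≡ cs -> Classes cs -> Int (∏ s gauss)
  Int-gauss s refl ps = Int-∏ (All.map (\ {p} c -> Int-Γ (proj₂ p)(proj₂ c))(AllP.map⁻ ps))
  eval : ∀ s k -> Over cs s -> k ≤ R -> A (config s k) ≅ A0 * (iV * (mult k * (∏ s (wt (odd (length cs))) * wt (odd (length cs))(0 , + k)) * van (pts s k)))
  eval s k (e , as) k≤ = ≅-cancel {V0} (proj₂ (Inv-van ps nes))
   (_ ≅⟨ subst₂ (\z n -> A (config s k) * van (pts z 0) ≅ A (config z 0) * (mult k * (∏ s (wt (odd n)) * wt (odd n)(0 , + k)) * van (pts s k)))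
       (rest-Over s e)(≡.trans (≡.sym (ListP.length-map proj₁ s))(cong length e))(A-config s k (adm s e as ps nes) k≤) ⟩
    ≅-reflexive (sym (trans (solve 4 (\a i d v -> a :* (i :* d) :* v := a :* ((i :* v) :* d)) rfl _ _ _ _)(*ˡ (trans (*ʳ (proj₂ (Inv-van ps nes)))(*-identityˡ _))))))
  term : ∀ s k -> Over cs s -> k ≤ R -> ∏ s gauss * gauss (0 , + k) * A (config s k) ≡[ K ] A0 * (iV * (mult k * (∏ s (wt w) * wt w (0 , + k)) * van (pts s k)))
  term s k (e , as) k≤ = ≡[]-trans (≡[]-*ˡ (Int-* (Int-gauss s e ps)(Int-Γ {0} (+ k) z≤n))
    (≅⇒≡ (Int-A (Good-~ {config s k} (subst (\z -> config s k ~ tracks (starts z)) e (config-~ s as k≤)) g))(eval s k (e , as) k≤)))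
   (≡[]-reflexive (trans (solve 8 (\g h a i n p z v -> g :* h :* (a :* (i :* (n :* (p :* z) :* v))) := a :* (i :* (n :* ((g :* p) :* (h :* z)) :* v))) rfl _ _ _ _ _ _ _ _)
    (*ˡ (*ˡ (*ʳ (*ˡ (*-cong (trans (sym (∏-* s _ _))(∏-cong s (gauss-wt _)))(gauss-wt _ (0 , + k)))))))))

 -- The sum over shifts as a determinant.

 open Determinant 𝓕

 private
  Apart : List ℤ -> Set
  Apart = AllPairs (\x y -> Invertible (δ̂ x y))

  V± : List ℤ -> Carrier
  V± xs = Σ± xs (\_ r -> van r)

  ∏-van : ∀ x0 {x r xs} -> Sel x r xs -> δ̂ x0 x * (∏ r (δ̂ x0) * van r) ≈ ∏ xs (δ̂ x0) * van r
  ∏-van x0 s = trans (sym (*-assoc _ _ _))(*ʳ (∏-Sel _ s))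

  van-swap : ∀ x y zs -> van (x ∷ y ∷ zs) ≈ - van (y ∷ x ∷ zs)
  van-swap x y zs = trans (*ʳ (*ʳ (δ̂-swap x y)))(solve 4 (\d p r v -> :- d :* p :* (r :* v) := :- (d :* r :* (p :* v))) rfl _ _ _ _)

  Σ±-swap2 : ∀ x y zs (f : ℤ -> Carrier) -> Σ± (x ∷ y ∷ zs)(\z r -> f z * van r) ≈ - Σ± (y ∷ x ∷ zs)(\z r -> f z * van r)
  Σ±-swap2 x y zs f = trans (+ˡ (-‿cong (+ˡ (-‿cong (trans (Σ±-cong zs (\ {_} {r} _ -> trans (*ˡ (van-swap x y r))(sym (-‿distribʳ-* _ _))))(Σ±-neg zs _))))))
   (solve 3 (\a b c -> a :- (b :- :- c) := :- (b :- (a :- c))) rfl _ _ _)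

  -- Allows multiplication of `V±` by X̂ x - X̂ y: both products become the same alternating sum, up
  -- to a sign.
  moment : ∀ x0 ys -> V± ys ≈ 0# -> X̂ x0 * V± (x0 ∷ ys) ≈ Σ± (x0 ∷ ys)(\x r -> X̂ x * van r)
  moment x0 ys p = trans (solve 3 (\a v s -> a :* (v :- s) := a :* v :- a :* s) rfl _ _ _)(+ˡ (-‿cong (begin
   X̂ x0 * Σ± ys (\_ r -> van (x0 ∷ r)) ≈⟨ sym (Σ±-*ˡ _ ys _) ⟩
   _ ≈⟨ Σ±-cong ys (\ {x} s -> trans (x*z≈y*z+[x-y]*z (X̂ x0)(X̂ x) _)(+ˡ (∏-van x0 s))) ⟩
   _ ≈⟨ trans (Σ±-+ ys _ _)(+ˡ (Σ±-*ˡ _ ys _)) ⟩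
   _ ≈⟨ trans (+ˡ (trans (*ˡ p)(zeroʳ _)))(+-identityʳ _) ⟩
   Σ± ys (\x r -> X̂ x * van (x0 ∷ r)) ∎)))

  -- In terms of determinants, this is the expansion of one with two equal rows of ones. It is
  -- proved by multiplying with the invertible difference X̂ x - X̂ y.
  V±-zero : ∀ x y zs -> Apart (x ∷ y ∷ zs) -> V± (x ∷ y ∷ zs) ≈ 0#
  V±-zero x y [] _ = solve 0 (:1 :* :1 :- (:1 :* :1 :- :0) := :0) rfl
  V±-zero x y (z ∷ zs)((ixy ∷ ax) ∷ ay ∷ as) = unit-cancel (proj₂ ixy)(trans (begin
   (X̂ x - X̂ y) * V± (x ∷ y ∷ z ∷ zs) ≈⟨ solve 3 (\a b s -> (a :- b) :* s := a :* s :+ b :* :- s) rfl _ _ _ ⟩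
   _ ≈⟨ +-cong (moment x (y ∷ z ∷ zs)(V±-zero y z zs (ay ∷ as)))
                                   (trans (*ˡ swapped)(moment y (x ∷ z ∷ zs)(V±-zero x z zs (ax ∷ as)))) ⟩
   _ ≈⟨ +ʳ (Σ±-swap2 x y (z ∷ zs) X̂) ⟩
   _ ≈⟨ -‿inverseˡ _ ⟩
   0# ∎)(sym (zeroʳ _)))
   where
   one : ∀ ys -> V± ys ≈ Σ± ys (\_ r -> 1# * van r)
   one ys = Σ±-cong ys (\_ -> sym (*-identityˡ _))
   swapped : - V± (x ∷ y ∷ z ∷ zs) ≈ V± (y ∷ x ∷ z ∷ zs)
   swapped = trans (-‿cong (trans (one (x ∷ y ∷ z ∷ zs))(Σ±-swap2 x y (z ∷ zs)(\_ -> 1#))))(trans (-‿involutive _)(sym (one (y ∷ x ∷ z ∷ zs))))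

  -- In p(X) = p(X_0) + (X - X_0) q(X) the constant drops out by `V±-zero`, the factor X - X_0
  -- completes the Vandermonde product over the remaining points, and q has lower degree with the
  -- same leading coefficient.
  laplace : ∀ n {c p} xs -> length xs ≡ suc n -> Deg n c p -> Apart xs -> Σ± xs (\x r -> p (X̂ x) * van r) ≈ c * van xs
  laplace zero (x ∷ []) _ d _ = trans (+ʳ (*ʳ (d (X̂ x))))(solve 1 (\c -> c :* :1 :- :0 := c :* (:1 :* :1)) rfl _)
  laplace (suc n) {c} {p} (x0 ∷ y ∷ zs) e d (ax ∷ as) with d (X̂ x0)
  ... | q , dq , h = begin
   p (X̂ x0) * van xs - Σ± xs (\x r -> p (X̂ x) * van (x0 ∷ r))
    ≈⟨ +ˡ (-‿cong (trans (Σ±-cong xs (\ {x} {r} s -> expand s))(trans (Σ±-+ xs (\_ r -> p (X̂ x0) * van (x0 ∷ r))(\x r -> - ∏ xs (δ̂ x0) * (q (X̂ x) * van r)))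
       (+-cong (Σ±-*ˡ (p (X̂ x0)) xs (\_ r -> van (x0 ∷ r)))(Σ±-*ˡ (- ∏ xs (δ̂ x0)) xs (\x r -> q (X̂ x) * van r)))))) ⟩
   _
    ≈⟨ solve 5 (\a v s π l -> a :* v :- (a :* s :+ :- π :* l) := a :* (v :- s) :+ π :* l) rfl _ _ _ _ _ ⟩
   _
    ≈⟨ +-cong (trans (*ˡ (V±-zero x0 y zs (ax ∷ as)))(zeroʳ _))(*ˡ (laplace n xs (ℕP.suc-injective e) dq as)) ⟩
   _
    ≈⟨ solve 3 (\ π c v -> :0 :+ π :* (c :* v) := c :* (π :* v)) rfl _ _ _ ⟩
   c * van (x0 ∷ xs) ∎
   where
   xs = y ∷ zs
   expand : ∀ {x r} -> Sel x r xs -> p (X̂ x) * van (x0 ∷ r) ≈ p (X̂ x0) * van (x0 ∷ r) + - ∏ xs (δ̂ x0) * (q (X̂ x) * van r)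
   expand {x} {r} s = begin
    p (X̂ x) * van (x0 ∷ r)
     ≈⟨ x*z≈y*z+[x-y]*z (p (X̂ x))(p (X̂ x0)) _ ⟩
    _
     ≈⟨ +ˡ (*ʳ (h (X̂ x))) ⟩
    _
     ≈⟨ +ˡ (solve 4 (\a b q v -> (a :- b) :* q :* v := :- (q :* ((b :- a) :* v))) rfl (X̂ x)(X̂ x0) _ _) ⟩
    _
     ≈⟨ +ˡ (trans (-‿cong (*ˡ (∏-van x0 s)))(solve 3 (\q π v -> :- (q :* (π :* v)) := :- π :* (q :* v)) rfl _ _ _)) ⟩
    p (X̂ x0) * van (x0 ∷ r) + - ∏ xs (δ̂ x0) * (q (X̂ x) * van r) ∎

  AllPairs-rest : ∀ {Q : ℤ -> ℤ -> Set} {x r xs} -> Sel x r xs -> AllPairs Q xs -> AllPairs Q r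
  AllPairs-rest here (_ ∷ as) = as
  AllPairs-rest (there s)(a ∷ as) = drop s a ∷ AllPairs-rest s as
   where
   drop : ∀ {Q : ℤ -> Set} {x r xs} -> Sel x r xs -> All Q xs -> All Q r
   drop here (_ ∷ as) = as
   drop (there s)(a ∷ as) = a ∷ drop s as

 vandermonde : ∀ n xs -> length xs ≡ suc n -> Apart xs -> det (\j x -> U j (X̂ x))(down (suc n)) xs ≈ (1# + 1#) * van xs
 vandermonde zero (x ∷ []) e as = solve 0 ((:1 :+ :1) :* :1 :- :0 := (:1 :+ :1) :* (:1 :* :1)) rfl
 vandermonde (suc n) xs e as = trans
  (Σ±-cong xs (\ {x} {r} s -> trans (*ˡ (vandermonde n r (ℕP.suc-injective (≡.trans (≡.sym (Sel-length s)) e))(AllPairs-rest s as)))(solve 2 (\u v -> u :* ((:1 :+ :1) :* v) := (:1 :+ :1) :* (u :* v)) rfl _ _)))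
  (trans (Σ±-*ˡ _ xs _)(*ˡ (trans (laplace (suc n) xs e (proj₂ (Deg-U-pair n)) as)(*-identityˡ _))))

 private
  term : ℕ -> ℕ -> ℕ -> ℤ -> Carrier
  term w j c r = wt w (c , r) * U j (X̂ (β̂ c r))

  column : ℕ -> ℕ -> ℕ -> Carrier
  column w j zero = ∑ (upTo (suc R))(\k -> mult k * term w j 0 (+ k))
  column w j (suc c) = ∑ range (term w j (suc c))

  F : ℕ -> ℤ -> Carrier
  F j x = U j (X̂ x)

 -- Multilinearity: the column of each class depends on the shift of that class alone, so the sums
 -- over shifts move into the columns.
 det-states : ∀ w js {cs} -> Classes cs ->
  ∑ (states cs)(\s -> ∑ (upTo (suc R))(\k -> mult k * (∏ s (wt w) * wt w (0 , + k)) * det F js (pts s k))) ≈ det (column w) js (cs ++ 0 ∷ [])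
 det-states w js [] = trans (+-identityʳ _)(sym (trans (det-column (column w) js 0 [])(begin
  Σ± js (\j rest -> column w j 0 * det (column w) rest [])
   ≈⟨ Σ±-cong js (\ {j} {rest} _ -> trans (sym (∑-*ʳ _ (upTo (suc R)) _))(∑-cong (upTo (suc R))(\k -> trans (solve 4 (\m w u d -> m :* (w :* u) :* d := m :* (:1 :* w) :* (u :* d)) rfl _ _ _ _)(*ˡ (*ˡ (empty rest)))))) ⟩
  _
   ≈⟨ Σ±-∑ js (upTo (suc R)) _ ⟩
  _
   ≈⟨ ∑-cong (upTo (suc R))(\k -> trans (Σ±-*ˡ _ js _)(*ˡ (sym (det-column F js (β̂ 0 (+ k)) [])))) ⟩
  ∑ (upTo (suc R))(\k -> mult k * (1# * wt w (0 , + k)) * det F js (pts [] k)) ∎)))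
  where
  empty : ∀ js -> det (column w) js [] ≈ det F js []
  empty [] = rfl
  empty (j ∷ js) = rfl
 det-states w js {suc c ∷ cs} (_ ∷ ps) = trans (∑-states (suc c) cs _)(sym (trans (det-column (column w) js (suc c)(cs ++ 0 ∷ []))(begin
  Σ± js (\j rest -> column w j (suc c) * det (column w) rest (cs ++ 0 ∷ []))
   ≈⟨ Σ±-cong js (\ {j} {rest} _ -> trans (sym (∑-*ʳ _ range _))(∑-cong range (\r -> trans (*ˡ (sym (det-states w rest ps)))(inner j rest r)))) ⟩
  _
   ≈⟨ trans (Σ±-∑ js range _)(∑-cong range (\r -> trans (Σ±-∑ js (states cs) _)(∑-cong (states cs)(\s -> trans (Σ±-∑ js (upTo (suc R)) _)(∑-cong (upTo (suc R))(\k ->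
      trans (Σ±-*ˡ _ js _)(*ˡ (sym (det-column F js (β̂ (suc c) r)(pts s k)))))))))) ⟩
  _ ∎)))
  where
  Wᵍ : ℤ -> State -> ℕ -> Carrier
  Wᵍ r s k = mult k * (wt w (suc c , r) * ∏ s (wt w) * wt w (0 , + k))
  inner : ∀ j rest r -> term w j (suc c) r * ∑ (states cs)(\s -> ∑ (upTo (suc R))(\k -> mult k * (∏ s (wt w) * wt w (0 , + k)) * det F rest (pts s k)))
   ≈ ∑ (states cs)(\s -> ∑ (upTo (suc R))(\k -> Wᵍ r s k * (F j (β̂ (suc c) r) * det F rest (pts s k))))
  inner j rest r = trans (sym (∑-*ˡ _ (states cs) _))(∑-cong (states cs)(\s -> trans (sym (∑-*ˡ _ (upTo (suc R)) _))(∑-cong (upTo (suc R))(\k ->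
   solve 6 (\w u m p z d -> w :* u :* (m :* (p :* z) :* d) := m :* (w :* p :* z) :* (u :* d)) rfl _ _ _ _ _ _))))

 private
  σ≈sgn : ∀ r -> σ r ≈ sgn ∣ r ∣
  σ≈sgn r = pow ∣ r ∣
   where
   pow : ∀ k -> (- 1#) ^ k ≈ sgn k
   pow zero = rfl
   pow (suc k) = *ˡ (pow k)

  term-entry : ∀ w j c r -> term w j c r ≈ sgn ∣ r ∣ * mono (+ w *' Γ c r) * cosh (+ j *' dbl (β̂ c r))
  term-entry w j c r = *-cong (*ʳ (σ≈sgn r))(U-cosh j (dbl (β̂ c r)))

  term-even : ∀ w j k -> term w j 0 -[1+ k ] ≈ term w j 0 (+ suc k)
  term-even w j k = trans (term-entry w j 0 -[1+ k ])(trans (*-cong (*ˡ (mono-cong (cong (\z -> + w *' z)(l1 (+ P)(+ suc k)))))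
   (trans (+-comm _ _)(+-cong (mono-cong (l2 (+ j)(+ P)(+ suc k)))(mono-cong (l3 (+ j)(+ P)(+ suc k))))))(sym (term-entry w j 0 (+ suc k))))
   where
   l1 : ∀ P k -> P *' ((-' k) *' (-' k)) +' (0' +' 0') *' (-' k) ≡ P *' (k *' k) +' (0' +' 0') *' k
   l1 = ℤsolve
   l2 : ∀ j P k -> -' (j *' (0' +' P *' (-' k) +' (0' +' P *' (-' k)))) ≡ j *' (0' +' P *' k +' (0' +' P *' k))
   l2 = ℤsolve
   l3 : ∀ j P k -> j *' (0' +' P *' (-' k) +' (0' +' P *' (-' k))) ≡ -' (j *' (0' +' P *' k +' (0' +' P *' k)))
   l3 = ℤsolve

 column-entry : ∀ w j c -> column w j c ≈ entry R P w j c
 column-entry w j (suc c) = ∑-cong range (term-entry w j (suc c))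
 column-entry w j zero = begin
  column w j 0
   ≈⟨ trans (∑-upTo-suc R _)(+-cong (*-identityˡ _)(trans (∑-cong (upTo R)(\k -> solve 1 (\x -> (:1 :+ :1) :* x := x :+ x) rfl _))(∑-+ (upTo R) _ _))) ⟩
  _
   ≈⟨ trans (sym (+-assoc _ _ _))(+ˡ (∑-cong (upTo R)(\k -> sym (term-even w j k)))) ⟩
  _
   ≈⟨ sym (∑-interval R _) ⟩
  _
   ≈⟨ ∑-cong range (term-entry w j 0) ⟩
  entry R P w j 0 ∎

 pts-Apart : ∀ {cs} s k -> map proj₁ s ≡ cs -> Classes cs -> AllPairs _≢_ cs -> Apart (pts s k)
 pts-Apart [] k refl _ _ = [] ∷ []
 pts-Apart ((c , r) ∷ s) k refl ((0<c , c≤q) ∷ ps)(ne ∷ nes) = AllP.++⁺ (inner s ps ne)(Inv-δ̂0 r (+ k)(\e -> ℕP.<⇒≢ 0<c (≡.sym e)) c≤q z≤n ∷ []) ∷ pts-Apart s k refl ps nes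
  where
  inner : ∀ s -> Classes (map proj₁ s) -> All (c ≢_)(map proj₁ s) -> All (\y -> Invertible (δ̂ (β̂ c r) y))(map (\p -> β̂ (proj₁ p)(proj₂ p)) s)
  inner [] _ _ = []
  inner ((c' , r') ∷ s)((_ , p) ∷ ps)(ne ∷ nes) = Inv-δ̂0 r r' ne c≤q p ∷ inner s ps nes

 Det-det : ∀ w {cs} -> Classes cs -> AllPairs _≢_ cs -> (1# + 1#) * Det w cs ≈ det (entry R P w)(down (suc (length cs)))(cs ++ 0 ∷ [])
 Det-det w {cs} ps nes = trans (trans (sym (∑-*ˡ _ (states cs) _))(∑-congAll (All.map (\ {s} ov -> trans (sym (∑-*ˡ _ (upTo (suc R)) _))(∑-cong (upTo (suc R))(\k ->
   trans (solve 2 (\g v -> (:1 :+ :1) :* (g :* v) := g :* ((:1 :+ :1) :* v)) rfl _ _)(*ˡ (sym (vandermonde (length cs)(pts s k)(len s k (proj₁ ov))(pts-Apart s k (proj₁ ov) ps nes)))))))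
  (states-Over cs))))(trans (det-states w (down (suc (length cs))) ps)(det-cong (column-entry w)(down (suc (length cs)))(cs ++ 0 ∷ [])))
  where
  len : ∀ s k -> map proj₁ s ≡ cs -> length (pts s k) ≡ suc (length cs)
  len s k e = ≡.trans (ListP.length-++ (map _ s))(≡.trans (ℕP.+-comm _ 1)(cong suc (≡.trans (ListP.length-map _ s)(≡.trans (≡.sym (ListP.length-map proj₁ s))(cong length e)))))

 -- The alphabet in increasing order.

 starts-↭ : ∀ n -> starts (classes n) ↭ prog2 (b₋ n)(suc (n ℕ.+ n))
 starts-↭ zero = ↭-reflexive (cong (_∷ [])(≡.sym (ℤP.+-identityʳ (+ P))))
 starts-↭ (suc n) = Perm.trans (swap _ _ (starts-↭ n))(prep _ (Perm.trans (PermP.∷↭∷ʳ (b₊ (suc n)) _)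
  (↭-reflexive (≡.trans (cong₂ (\u v -> prog2 u (suc (n ℕ.+ n)) ++ v ∷ [])(l1 (+ P)(+ n))(l2 (+ P)(+ n)))
   (≡.sym (≡.trans (cong (prog2 (b₋ (suc n) +' + 2))(≡.trans (cong suc (ℕP.+-suc n n))(ℕP.+-comm 1 (suc (n ℕ.+ n)))))(prog2-+ _ (suc (n ℕ.+ n)) 1)))))))
  where
  l1 : ∀ P n -> P -' (n +' n) ≡ P -' ((1' +' n) +' (1' +' n)) +' + 2
  l1 = ℤsolve
  l2 : ∀ P n -> P +' ((1' +' n) +' (1' +' n)) ≡ P -' ((1' +' n) +' (1' +' n)) +' + 2 +' + 2 *' (1' +' (n +' n))
  l2 = ℤsolve

 trackL : List ℤ -> ℕ -> List ℤ
 trackL bs k = concatMap (\b -> prog b k) bs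

 tracks-↭ : ∀ {bs bs'} k -> bs ↭ bs' -> trackL bs k ↭ trackL bs' k
 tracks-↭ k Perm.refl = ↭-refl
 tracks-↭ k (prep b p) = PermP.++⁺ˡ (prog b k)(tracks-↭ k p)
 tracks-↭ k (swap b b' p) = Perm.trans (PermP.shifts (prog b k)(prog b' k))(PermP.++⁺ˡ (prog b' k)(PermP.++⁺ˡ (prog b k)(tracks-↭ k p)))
 tracks-↭ k (Perm.trans p r) = Perm.trans (tracks-↭ k p)(tracks-↭ k r)

 trackL-suc : ∀ bs k -> trackL bs (suc k) ↭ bs ++ trackL (map (\b -> b +' 2P) bs) k
 trackL-suc [] k = ↭-refl
 trackL-suc (b ∷ bs) k = prep b (Perm.trans (PermP.++⁺ˡ (prog (b +' 2P) k)(trackL-suc bs k))(PermP.shifts (prog (b +' 2P) k) bs))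

 -- The progressions read level by level. In this order the letters increase, which shows that the
 -- alphabet is `Good`.
 ladder : ℤ -> ℕ -> ℕ -> List ℤ
 ladder b n zero = []
 ladder b n (suc k) = prog2 b n ++ ladder (b +' 2P) n k

 trackL-ladder : ∀ b n k -> trackL (prog2 b n) k ↭ ladder b n k
 trackL-ladder b n zero = ↭-reflexive (empty (prog2 b n))
  where
  empty : ∀ bs -> trackL bs 0 ≡ []
  empty [] = refl
  empty (_ ∷ bs) = empty bs
 trackL-ladder b n (suc k) = Perm.trans (trackL-suc (prog2 b n) k)(PermP.++⁺ˡ (prog2 b n)(Perm.trans (↭-reflexive (cong (\bs -> trackL bs k)(prog2-map b n 2P)))(trackL-ladder (b +' 2P) n k)))

 ladder-≥ : ∀ b n k -> All (b ≤'_)(ladder b n k)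
 ladder-≥ b n zero = []
 ladder-≥ b n (suc k) = AllP.++⁺ (All.map proj₁ (prog2-bounds b n))(All.map (ℤP.≤-trans (ℤP.i≤i+j b 2P))(ladder-≥ (b +' 2P) n k))

 ladder-sorted : ∀ b n k -> n ≤ P -> AllPairs _<'_ (ladder b n k)
 ladder-sorted b n zero n≤P = []
 ladder-sorted b n (suc k) n≤P = AllPairsP.++⁺ (prog2-sorted b n)(ladder-sorted (b +' 2P) n k n≤P)
  (All.map (\ { (_ , lt) -> All.map (\ge -> ℤP.<-≤-trans lt (ℤP.≤-trans top≤ ge))(ladder-≥ (b +' 2P) n k) })(prog2-bounds b n))
  where
  top≤ : b +' + 2 *' + n ≤' b +' 2P
  top≤ = ℤP.+-monoʳ-≤ b (subst (_≤' 2P)(ℤP.pos-* 2 n)(ℤ.+≤+ (subst (_≤ P ℕ.+ P)(≡.sym (cong (n ℕ.+_)(ℕP.+-identityʳ n)))(ℕP.+-mono-≤ n≤P n≤P))))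

 alphabet-↭ : tracks (starts (classes q)) ↭ ladder (b₋ q)(suc (q ℕ.+ q)) L
 alphabet-↭ = Perm.trans (tracks-↭ L (starts-↭ q))(trackL-ladder (b₋ q)(suc (q ℕ.+ q)) L)

 alphabet-Good : Good (tracks (starts (classes q)))
 alphabet-Good = Good-↭ (↭-sym alphabet-↭)(sorted⇒Good (All.map (ℤP.<-≤-trans (0<b₋ ℕP.≤-refl))(ladder-≥ (b₋ q) _ L))(ladder-sorted (b₋ q) _ L 2q<P))

 classes-Classes : ∀ {n} -> n ≤ q -> Classes (classes n)
 classes-Classes {zero} _ = []
 classes-Classes {suc n} p = (s≤s z≤n , p) ∷ classes-Classes (ℕP.<⇒≤ p)

 private
  factor : ℤ -> Carrier
  factor x = 1# - mono x

 -- The value of `A` at a union of progressions.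

 self : ℤ -> ℕ -> Carrier
 self b k = ∏ (prog b k)(\x -> factor x * factor (+ P +' x))

 -- The reciprocal of that value. By telescoping, φ of a letter e times its products with the later
 -- letters of its progression is 1/((1 - h^e)(1 - h^(P+e))), and a letter x meets another
 -- progression from b' in 1/(1 - h^(b'+x)).
 QT : List ℤ -> Carrier
 QT [] = 1#
 QT (b ∷ bs) = self b L * ∏ bs (\b' -> ∏ (prog b L)(\x -> factor (b' +' x))) * QT bs

 private
  pos≢0 : ∀ {x} -> 0' <' x -> x ≢ 0'
  pos≢0 p z = ℤP.<-irrefl (≡.sym z) p

  K≤2PL : + K ≤' 2P *' + L
  K≤2PL = subst (+ K ≤'_)(ℤP.pos-* (P ℕ.+ P) L)(ℤ.+≤+ (ℕP.≤-trans (ℕP.≤-trans (ℕP.n≤1+n K)(ℕP.m≤n+m (suc K) R))(ℕP.m≤n*m L (P ℕ.+ P) {{ℕ.>-nonZero (ℕP.≤-trans 0<P (ℕP.m≤m+n P P))}})))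

  ≅1-* : ∀ {x y z w} -> x * z ≅ 1# -> y * w ≅ 1# -> x * y * (z * w) ≅ 1#
  ≅1-* p p' = _ ≅⟨ ≅-reflexive (x*y*[z*u]≈x*z*[y*u] _ _ _ _) ⟩ _ ≅⟨ ≅-* p p' ⟩ ≅-reflexive (*-identityˡ 1#)

  ≅γ-1 : ∀ {x z} -> 0' <' x -> z ≅ γ x -> z * factor x ≅ 1#
  ≅γ-1 p e = ≅-trans (≅-*ʳ _ e)(≅-reflexive (γ-inv (pos≢0 p)))

 A-prog : ∀ b k -> 0' <' b -> + K ≤' b +' 2P *' + k -> A (prog b k) * self b k ≅ 1#
 A-prog b zero _ _ = ≅-reflexive (*-identityˡ 1#)
 A-prog b (suc k) 0<b K≤ = ≅1-* {φ b * ∏ (prog (b +' 2P) k)(\x -> a (b +' x))} {A (prog (b +' 2P) k)} head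
   (A-prog (b +' 2P) k (ℤP.<-≤-trans 0<b (ℤP.i≤i+j b 2P))(subst (+ K ≤'_)(≡.sym (l b 2P (+ k))) K≤))
  where
  l : ∀ b p k -> b +' p +' p *' k ≡ b +' p *' (1' +' k)
  l = ℤsolve
  l2 : ∀ b p k -> b +' (b +' p *' (1' +' k)) ≡ b +' p +' b +' p *' k
  l2 = ℤsolve
  l3 : ∀ b p -> b +' p +' b ≡ p +' (b +' b)
  l3 = ℤsolve
  0<2b : 0' <' 2P +' dbl b
  0<2b = ℤP.+-mono-≤-< (ℤ.+≤+ z≤n)(ℤP.+-mono-< 0<b 0<b)
  0<2b' : 0' <' b +' 2P +' b
  0<2b' = subst (0' <'_)(≡.sym (l3 b 2P)) 0<2b
  pr : ∏ (prog (b +' 2P) k)(\x -> a (b +' x)) ≅ γ (2P +' dbl b)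
  pr = _ ≅⟨ ≅-reflexive (∏-cong (prog (b +' 2P) k)(\x -> a-cong (ℤP.+-comm b x))) ⟩
     _ ≅⟨ ∏-prog≅ (b +' 2P) k b (pos⇒NZ≤ 0<2b')(subst (+ K ≤'_)(l2 b 2P (+ k))(ℤP.≤-trans K≤ (subst (_≤' b +' (b +' 2P *' + suc k))(ℤP.+-identityˡ _)(ℤP.+-monoˡ-≤ _ (ℤP.<⇒≤ 0<b))))) ⟩
     ≅-reflexive (γ-cong (l3 b 2P))
  head : φ b * ∏ (prog (b +' 2P) k)(\x -> a (b +' x)) * (factor b * factor (+ P +' b)) ≅ 1#
  head = _ ≅⟨ ≅-*ʳ _ (≅-* ≅-refl pr) ⟩
   ≅-reflexive (trans (solve 4 (\f g x y -> f :* g :* (x :* y) := f :* (y :* g) :* x) rfl _ _ _ _)(trans (*ʳ (φ-half (pos≢0 0<b)(pos≢0 0<2b)))(γ-inv (pos≢0 0<b))))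

 cross-progs : ∀ X b' -> Positive X -> 0' <' b' -> cross X (prog b' L) * ∏ X (\x -> factor (b' +' x)) ≅ 1#
 cross-progs [] b' _ _ = ≅-reflexive (*-identityˡ 1#)
 cross-progs (x ∷ X) b' (p ∷ ps) 0<b' = ≅1-* {∏ (prog b' L)(\z -> a (x +' z))} {cross X (prog b' L)} (≅γ-1 0<b'+x
   (≅-trans (≅-reflexive (∏-cong (prog b' L)(\z -> a-cong (ℤP.+-comm x z))))(∏-prog≅ b' L x (pos⇒NZ≤ 0<b'+x)
    (ℤP.≤-trans K≤2PL (subst (_≤' b' +' x +' 2P *' + L)(ℤP.+-identityˡ _)(ℤP.+-monoˡ-≤ _ (ℤP.<⇒≤ 0<b'+x)))))))(cross-progs X b' ps 0<b')
  where
  0<b'+x : 0' <' b' +' x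
  0<b'+x = ℤP.+-mono-< 0<b' p

 cross-tracks : ∀ X bs -> Positive X -> Positive bs -> cross X (tracks bs) * ∏ bs (\b' -> ∏ X (\x -> factor (b' +' x))) ≅ 1#
 cross-tracks X [] _ _ = ≅-reflexive (trans (*-identityʳ _)(∏-1 X))
 cross-tracks X (b ∷ bs) px (p ∷ ps) = ≅-trans (≅-*ʳ _ (≅-reflexive (trans (∏-cong X (\x -> ∏-++ (prog b L)(tracks bs) _))(∏-* X _ _))))(≅1-* (cross-progs X b px p)(cross-tracks X bs px ps))

 A-tracks : ∀ {bs} -> Positive bs -> A (tracks bs) * QT bs ≅ 1#
 A-tracks {[]} _ = ≅-reflexive (*-identityˡ 1#)
 A-tracks {b ∷ bs} (p ∷ ps) = _ ≅⟨ ≅-*ʳ _ (≅-reflexive (trans (A-++ (prog b L)(tracks bs))(x*y*z≈x*z*y _ _ _))) ⟩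
  ≅1-* (≅1-* (A-prog b L p (ℤP.≤-trans K≤2PL (subst (_≤' b +' 2P *' + L)(ℤP.+-identityˡ _)(ℤP.+-monoˡ-≤ _ (ℤP.<⇒≤ p)))))(cross-tracks (prog b L) bs (prog-Positive L p) ps))(A-tracks ps)

 config-zero : ∀ cs -> config (zero-state cs) 0 ↭ tracks (starts cs)
 config-zero [] = Perm.trans (↭-sym (class0 z≤n))(↭-reflexive (≡.trans (cong (\b -> prog b L)(l0 (+ P)))(≡.sym (ListP.++-identityʳ (prog (+ P) L)))))
 config-zero (c ∷ cs) = Perm.trans (PermP.++⁺ (Perm.trans (↭-sym (class₊ c z≤n))(↭-reflexive (cong₂ (\u v -> prog u L ++ prog v L)(l0 (b₊ c))(l0 (b₋ c)))))(config-zero cs))(↭-reflexive (ListP.++-assoc (prog (b₊ c) L) _ _))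

odds : ℕ -> ℕ -> List ℕ
odds i zero = []
odds i (suc k) = suc (i ℕ.+ i) ∷ odds (suc i) k

odds-prog2 : ∀ i k -> map +_ (odds i k) ≡ prog2 (+ suc (i ℕ.+ i)) k
odds-prog2 i zero = refl
odds-prog2 i (suc k) = cong (+ suc (i ℕ.+ i) ∷_)(≡.trans (odds-prog2 (suc i) k)(cong (\z -> prog2 (+ z) k)(lem i)))
 where
 lem : ∀ i -> suc (suc i ℕ.+ suc i) ≡ suc (i ℕ.+ i) ℕ.+ 2
 lem = ℕsolve

length-prog2 : ∀ b k -> length (prog2 b k) ≡ k
length-prog2 b zero = refl
length-prog2 b (suc k) = cong suc (length-prog2 _ k)

length-classes : ∀ n -> length (classes n) ≡ n
length-classes zero = refl
length-classes (suc n) = cong suc (length-classes n)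

classes-down : ∀ n -> classes n ++ 0 ∷ [] ≡ down (suc n)
classes-down zero = refl
classes-down (suc n) = cong (suc n ∷_)(classes-down n)

classes-distinct : ∀ n -> AllPairs _≢_ (classes n)
classes-distinct zero = []
classes-distinct (suc n) = All.map (\p e -> ℕP.<-irrefl (≡.sym e)(s≤s p))(bounded n) ∷ classes-distinct n
 where
 bounded : ∀ n -> All (_≤ n)(classes n)
 bounded zero = []
 bounded (suc n) = ℕP.≤-refl ∷ All.map ℕP.m≤n⇒m≤1+n (bounded n)

odd≡ : ∀ n -> odd n ≡ suc (n ℕ.+ n)
odd≡ zero = refl
odd≡ (suc n) = cong suc (≡.trans (cong suc (odd≡ n))(cong suc (≡.sym (ℕP.+-suc n n))))

-- Independence of the order of the letters.

module Symmetry (𝓕 : Frame)(P : ℕ) where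
 open Bounded 𝓕 P

 Σs-↭ : ∀ {A : Set} {X Y : List A} -> X ↭ Y -> ∀ (F : List A -> List A -> Carrier) -> (∀ {J J' I I'} -> J ↭ J' -> I ↭ I' -> F J I ≈ F J' I') -> Σs X F ≈ Σs Y F
 Σs-↭ Perm.refl F h = rfl
 Σs-↭ (prep {X} {Y} x p) F h = trans (Σs-∷ x X F)(trans (+-cong (Σs-↭ p _ (\j i -> h (prep x j) i))(Σs-↭ p _ (\j i -> h j (prep x i))))(sym (Σs-∷ x Y F)))
 Σs-↭ (swap {X} {Y} x y p) F h = begin
  Σs (x ∷ y ∷ X) F
   ≈⟨ trans (Σs-∷ x (y ∷ X) F)(+-cong (Σs-∷ y X _)(Σs-∷ y X _)) ⟩
  _
   ≈⟨ [x+y]+[z+u]≈[x+z]+[y+u] _ _ _ _ ⟩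
  _
   ≈⟨ +-cong (+-cong (trans (Σs-cong X (\_ -> h (swap x y ↭-refl) ↭-refl))(Σs-↭ p _ (\j i -> h (prep y (prep x j)) i)))(Σs-↭ p _ (\j i -> h (prep y j)(prep x i))))
      (+-cong (Σs-↭ p _ (\j i -> h (prep x j)(prep y i)))(trans (Σs-cong X (\_ -> h ↭-refl (swap x y ↭-refl)))(Σs-↭ p _ (\j i -> h j (prep y (prep x i)))))) ⟩
  _
   ≈⟨ sym (trans (Σs-∷ y (x ∷ Y) F)(+-cong (Σs-∷ x Y _)(Σs-∷ x Y _))) ⟩
  Σs (y ∷ x ∷ Y) F ∎
 Σs-↭ (Perm.trans p r) F h = trans (Σs-↭ p F h)(Σs-↭ r F h)

 signed-↭ : ∀ k {X Y} -> X ↭ Y -> signed k X ≈ signed k Y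
 signed-↭ k p = Σs-↭ p _ (\j i -> *-cong (pow k (∏-↭ mono j))(A-↭ (PermP.++⁺ (PermP.map⁺ (\x -> -' x) j) i)))
  where
  pow : ∀ {x y} k -> x ≈ y -> x ^ k ≈ y ^ k
  pow zero e = rfl
  pow (suc k) e = *-cong e (pow k e)

-- The alphabet of all odd powers of h.

module Odds (𝓕 : Frame)(K : ℕ)(0<K : 0 < K)(q : ℕ)(R : ℕ)(K≤R : K ≤ R)(m : ℕ) where
 N : ℕ
 N = suc (q ℕ.+ q)
 open Alphabet 𝓕 N (s≤s z≤n) K 0<K q ℕP.≤-refl R K≤R m public

 br : ℕ -> Carrier
 br e = 1# - mono (+ (e ℕ.+ e))

 rise : ℕ -> ℕ -> Carrier
 rise e n = ∏ (upTo n)(\l -> br (e ℕ.+ l))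

 private
  br-cong : ∀ {d e} -> d ≡ e -> br d ≈ br e
  br-cong p = reflexive (cong br p)

  rise-suc : ∀ e n -> br e * rise (suc e) n ≈ rise e n * br (e ℕ.+ n)
  rise-suc e n = trans (sym (trans (∏-upTo-suc n _)(*-cong (br-cong (ℕP.+-identityʳ e))(∏-cong (upTo n)(\l -> br-cong (ℕP.+-suc e l))))))(∏-upTo-last n _)

  a-rise : ∀ {x} e -> 0 < e -> x ≡ + (e ℕ.+ e) -> a x * rise e N ≈ rise (suc e) N
  a-rise e 0<e refl = begin
   a x * rise e N ≈⟨ *ʳ (a-ratio x≢0) ⟩
   _ ≈⟨ *ʳ (*ʳ (+ˡ (-‿cong (mono-cong (cong +_ (l e N)))))) ⟩
   _ ≈⟨ solve 3 (\b g r -> b :* g :* r := g :* (r :* b)) rfl _ _ _ ⟩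
   _ ≈⟨ *ˡ (sym (rise-suc e N)) ⟩
   _ ≈⟨ trans (sym (*-assoc _ _ _))(trans (*ʳ (γ-inv x≢0))(*-identityˡ _)) ⟩
   rise (suc e) N ∎
   where
   x = + (e ℕ.+ e)
   x≢0 : x ≢ 0'
   x≢0 z = ℕP.<-irrefl (≡.sym (ℤP.+-injective z))(ℕP.≤-trans 0<e (ℕP.m≤m+n e e))
   l : ∀ e N -> e ℕ.+ e ℕ.+ (N ℕ.+ N) ≡ e ℕ.+ N ℕ.+ (e ℕ.+ N)
   l = ℕsolve

  ∏-a : ∀ y x k e -> 0 < e -> y +' x ≡ + (e ℕ.+ e) -> ∏ (prog2 x k)(\z -> a (y +' z)) * rise e N ≈ rise (e ℕ.+ k) N
  ∏-a y x zero e _ _ = trans (*-identityˡ _)(reflexive (cong (\z -> rise z N)(≡.sym (ℕP.+-identityʳ e))))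
  ∏-a y x (suc k) e 0<e eq = trans (solve 3 (\a p r -> a :* p :* r := p :* (a :* r)) rfl _ _ _)(trans (*ˡ (a-rise e 0<e eq))
   (trans (∏-a y (x +' + 2) k (suc e)(s≤s z≤n)(≡.trans (≡.sym (ℤP.+-assoc y x (+ 2)))(≡.trans (cong (_+' + 2) eq)(cong +_ (l e)))))(reflexive (cong (\z -> rise z N)(≡.sym (ℕP.+-suc e k))))))
   where
   l : ∀ e -> e ℕ.+ e ℕ.+ 2 ≡ suc e ℕ.+ suc e
   l = ℕsolve

  rise-unit : ∀ e n -> K ≤ e -> rise e n ≅ 1#
  rise-unit e n K≤e = ≅-trans (≅-∏ (upTo n) {G = \_ -> 1#} (\l -> _ , large-unit (ℤ.+≤+ (ℕP.≤-trans K≤e (ℕP.≤-trans (ℕP.m≤m+n e l)(ℕP.m≤m+n _ _)))) , sym (*-identityʳ _)))(≅-reflexive (∏-1 (upTo n)))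

 -- The reciprocal of the factors of `A` in which h^(2i+1) is the smallest letter. The letters are
 -- taken in increasing order and the products telescope in steps of h^2, which yields factors 1 -
 -- q^e that `QT` would not show.
 oddFactor : ℕ -> Carrier
 oddFactor i = (1# - mono (+ suc (i ℕ.+ i))) * (br (suc q ℕ.+ i) * rise (suc (suc (i ℕ.+ i)))(q ℕ.+ q))

 A-odds : ∀ i k -> K ≤ i ℕ.+ k -> A (prog2 (+ suc (i ℕ.+ i)) k) * ∏ (upTo k)(\j -> oddFactor (i ℕ.+ j)) ≅ 1#
 A-odds i zero _ = ≅-reflexive (*-identityˡ 1#)
 A-odds i (suc k) K≤ = _ ≅⟨ ≅-*ʳ _ (≅-reflexive (*-cong (*ˡ (∏-list))(A-list))) ⟩
  _ ≅⟨ ≅-reflexive (*ˡ (trans (∏-upTo-suc k _)(*-cong (reflexive (cong oddFactor (ℕP.+-identityʳ i)))(∏-cong (upTo k)(\j -> reflexive (cong oddFactor (ℕP.+-suc i j))))))) ⟩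
  _ ≅⟨ ≅-reflexive (x*y*[z*u]≈x*z*[y*u] _ _ _ _) ⟩
  _ ≅⟨ ≅-* head (A-odds (suc i) k (subst (K ≤_)(ℕP.+-suc i k) K≤)) ⟩
  ≅-reflexive (*-identityˡ 1#)
  where
  x = + suc (i ℕ.+ i)
  x' = + suc (suc i ℕ.+ suc i)
  x+2 : x +' + 2 ≡ x'
  x+2 = cong +_ (l i)
   where
   l : ∀ i -> suc (i ℕ.+ i) ℕ.+ 2 ≡ suc (suc i ℕ.+ suc i)
   l = ℕsolve
  ∏-list : ∏ (prog2 (x +' + 2) k)(\z -> a (x +' z)) ≈ ∏ (prog2 x' k)(\z -> a (x +' z))
  ∏-list = reflexive (cong (\b -> ∏ (prog2 b k)(\z -> a (x +' z))) x+2)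
  A-list : A (prog2 (x +' + 2) k) ≈ A (prog2 x' k)
  A-list = reflexive (cong (\b -> A (prog2 b k)) x+2)
  e = suc (suc (i ℕ.+ i))
  M = mono (+ N +' x)
  φ-part : φ x * ((1# - mono x) * br (suc q ℕ.+ i)) ≈ br (e ℕ.+ (q ℕ.+ q))
  φ-part = begin
   φ x * ((1# - mono x) * br (suc q ℕ.+ i))
    ≈⟨ *-cong (φ-ratio {x} (\()))(*ˡ (+ˡ (-‿cong (mono-cong (cong +_ (l1 q i)))))) ⟩
   _
    ≈⟨ solve 3 (\m g n -> (:1 :+ m) :* g :* (n :* (:1 :- m)) := (:1 :- m :* m) :* (g :* n)) rfl _ _ _ ⟩
   _
    ≈⟨ trans (*ˡ (γ-inv {x} (\())))(*-identityʳ _) ⟩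
   _
    ≈⟨ +ˡ (-‿cong (trans (mono-mono _ _)(mono-cong (cong +_ (l2 q i))))) ⟩
   br (e ℕ.+ (q ℕ.+ q)) ∎
   where
   l1 : ∀ q i -> suc q ℕ.+ i ℕ.+ (suc q ℕ.+ i) ≡ suc (q ℕ.+ q) ℕ.+ suc (i ℕ.+ i)
   l1 = ℕsolve
   l2 : ∀ q i -> suc (q ℕ.+ q) ℕ.+ suc (i ℕ.+ i) ℕ.+ (suc (q ℕ.+ q) ℕ.+ suc (i ℕ.+ i)) ≡ suc (suc (i ℕ.+ i)) ℕ.+ (q ℕ.+ q) ℕ.+ (suc (suc (i ℕ.+ i)) ℕ.+ (q ℕ.+ q))
   l2 = ℕsolve
  head : φ x * ∏ (prog2 x' k)(\z -> a (x +' z)) * oddFactor i ≅ 1#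
  head = _ ≅⟨ ≅-reflexive (begin
    φ x * ∏ (prog2 x' k)(\z -> a (x +' z)) * oddFactor i
     ≈⟨ solve 5 (\f p n b r -> f :* p :* (n :* (b :* r)) := p :* (r :* (f :* (n :* b)))) rfl _ _ _ _ _ ⟩
    _
     ≈⟨ *ˡ (trans (*ˡ φ-part)(sym (∏-upTo-last (q ℕ.+ q) _))) ⟩
    _
     ≈⟨ ∏-a x x' k e (s≤s z≤n)(cong +_ (l3 i)) ⟩
    rise (e ℕ.+ k) N ∎) ⟩
   rise-unit (e ℕ.+ k) N (ℕP.≤-trans K≤ (subst (_≤ e ℕ.+ k)(≡.sym (ℕP.+-suc i k))(ℕP.+-monoˡ-≤ k {suc i} {e} (s≤s (ℕP.≤-trans (ℕP.m≤m+n i i)(ℕP.n≤1+n _))))))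
   where
   l3 : ∀ i -> suc (i ℕ.+ i) ℕ.+ suc (suc i ℕ.+ suc i) ≡ suc (suc (i ℕ.+ i)) ℕ.+ suc (suc (i ℕ.+ i))
   l3 = ℕsolve

 b₋-1 : b₋ q ≡ 1'
 b₋-1 = ≡.trans (ℤP.m-n≡m⊖n N (q ℕ.+ q))(≡.trans (ℤP.⊖-≥ (ℕP.n≤1+n (q ℕ.+ q)))(cong +_ (ℕP.m+n∸n≡m 1 (q ℕ.+ q))))

 ladder-odds : ∀ b k -> ladder b N k ≡ prog2 b (k ℕ.* N)
 ladder-odds b zero = refl
 ladder-odds b (suc k) = ≡.trans (cong (prog2 b N ++_)(≡.trans (ladder-odds (b +' 2P) k)(cong (\z -> prog2 (b +' z)(k ℕ.* N))(≡.trans (cong (\z -> + (N ℕ.+ z))(≡.sym (ℕP.+-identityʳ N)))(ℤP.pos-* 2 N)))))(≡.sym (prog2-+ b N (k ℕ.* N)))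

 size≥K : K ≤ L ℕ.* N
 size≥K = ℕP.≤-trans (ℕP.≤-trans (ℕP.n≤1+n K)(ℕP.m≤n+m (suc K) R))(ℕP.m≤m*n L N)

 -- For P = 2q + 1 the starts P - 2q, ..., P + 2q are 1, 3, ..., 4q + 1, one in each odd class
 -- modulo 2P.
 all-odds : tracks (starts (classes q)) ↭ prog2 1' (L ℕ.* N)
 all-odds = Perm.trans alphabet-↭ (↭-reflexive (≡.trans (cong (\b -> ladder b N L) b₋-1)(ladder-odds 1' L)))

 Qodd : Carrier
 Qodd = ∏ (upTo (L ℕ.* N)) oddFactor

 A-tracks-odd : A (config (zero-state (classes q)) 0) * Qodd ≅ 1#
 A-tracks-odd = ≅-trans (≅-*ʳ _ (≅-reflexive (A-↭ (Perm.trans (config-zero (classes q)) all-odds))))(A-odds 0 (L ℕ.* N) size≥K)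

 alphabet-odds : alphabet (odds 0 N) L ↭ tracks (starts (classes q))
 alphabet-odds = Perm.trans (↭-reflexive (≡.trans (tr (odds 0 N))(cong tracks (≡.trans (odds-prog2 0 N)(cong (\b -> prog2 b N)(≡.sym b₋-1))))))(tracks-↭ L (↭-sym (starts-↭ q)))
  where
  tr : ∀ zs -> alphabet zs L ≡ tracks (map +_ zs)
  tr [] = refl
  tr (z ∷ zs) = cong (prog (+ z) L ++_)(tr zs)

-- Infinite products modulo h^K, and the denominator.

module Products (𝓕 : Frame)(K : ℕ)(0<K : 0 < K) where
 open Core 𝓕

 infix 4 _≎_
 -- Congruence bundled with the integrality of both sides, so that such congruences can be
 -- multiplied freely.
 record _≎_ (x y : Carrier) : Set where
  constructor mk≎
  field
   Intˡ : Int x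
   Intʳ : Int y
   cong≎ : x ≡[ K ] y
 open _≎_ public

 ≎-≈ : ∀ {x y} -> Int x -> x ≈ y -> x ≎ y
 ≎-≈ i e = mk≎ i (Int-resp e i)(≡[]-reflexive e)

 ≎-refl : ∀ {x} -> Int x -> x ≎ x
 ≎-refl i = ≎-≈ i rfl

 ≎-sym : ∀ {x y} -> x ≎ y -> y ≎ x
 ≎-sym (mk≎ i j p) = mk≎ j i (≡[]-sym p)

 ≎-trans : ∀ {x y z} -> x ≎ y -> y ≎ z -> x ≎ z
 ≎-trans (mk≎ i _ p)(mk≎ _ k r) = mk≎ i k (≡[]-trans p r)

 ≎-* : ∀ {x y z w} -> x ≎ y -> z ≎ w -> x * z ≎ y * w
 ≎-* (mk≎ i j p)(mk≎ k l r) = mk≎ (Int-* i k)(Int-* j l)(≡[]-* k j p r)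

 ≎-∏ : ∀ {A : Set} {xs : List A} {F G : A -> Carrier} -> All (\x -> F x ≎ G x) xs -> ∏ xs F ≎ ∏ xs G
 ≎-∏ [] = ≎-refl Int-1
 ≎-∏ (p ∷ ps) = ≎-* p (≎-∏ ps)

 ≎-then : ∀ {x y z} -> x ≎ y -> y ≈ z -> x ≎ z
 ≎-then p e = ≎-trans p (≎-≈ (Intʳ p) e)

 ≈-then : ∀ {x y z} -> x ≈ y -> y ≎ z -> x ≎ z
 ≈-then e p = ≎-trans (≎-≈ (Int-resp (sym e)(Intˡ p)) e) p

 fac : ℕ -> Carrier
 fac e = 1# - mono (+ e)

 fac-cong : ∀ {d e} -> d ≡ e -> fac d ≈ fac e
 fac-cong p = reflexive (cong fac p)

 Int-fac : ∀ e -> Int (fac e)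
 Int-fac e = Int-+ Int-1 (Int-- (Int-mono e))

 fac-large : ∀ {e} -> K ≤ e -> fac e ≎ 1#
 fac-large {e} p = mk≎ (Int-fac e) Int-1 (cgr (Small-resp (-x≈1-x-1 _)(Small-neg (Small-mono e p))))

 Pn : ℕ -> ℕ -> ℕ -> Carrier
 Pn α β k = ∏ (upTo k)(\j -> fac (α ℕ.+ j ℕ.* β))

 Int-Pn : ∀ α β k -> Int (Pn α β k)
 Int-Pn α β k = Int-∏ (All.universal (\j -> Int-fac (α ℕ.+ j ℕ.* β))(upTo k))

 Pn-cong : ∀ {α α'} β k -> α ≡ α' -> Pn α β k ≈ Pn α' β k
 Pn-cong β k p = reflexive (cong (\z -> Pn z β k) p)

 Pn-stable : ∀ α {β} {k} -> 0 < β -> K ≤ k -> Pn α β k ≎ Pn α β K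
 Pn-stable α {β} {k} 0<β K≤k = subst (\z -> Pn α β z ≎ Pn α β K)(ℕP.m∸n+n≡m K≤k)(go (k ∸ K))
  where
  go : ∀ d -> Pn α β (d ℕ.+ K) ≎ Pn α β K
  go zero = ≎-refl (Int-Pn α β K)
  go (suc d) = ≈-then (∏-upTo-last (d ℕ.+ K) _)(≎-then (≎-* (go d)(fac-large (ℕP.≤-trans (ℕP.m≤n+m K d)(ℕP.≤-trans (ℕP.m≤m*n (d ℕ.+ K) β {{ℕ.>-nonZero 0<β}})(ℕP.m≤n+m _ α)))))(*-identityʳ _))

 -- (h^α; h^β)_∞ cut after K factors; for β ≥ 1 the factors left out are congruent to 1.
 P∞ : ℕ -> ℕ -> Carrier
 P∞ α β = Pn α β K

 P∞-suc : ∀ α {β} -> 0 < β -> fac α * P∞ (β ℕ.+ α) β ≎ P∞ α β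
 P∞-suc α {β} 0<β = ≎-trans (≎-≈ (Int-* (Int-fac α)(Int-Pn _ β K))(sym (trans (∏-upTo-suc K _)(*-cong (fac-cong (ℕP.+-identityʳ α))(∏-cong (upTo K)(\j -> fac-cong (l α β (j ℕ.* β))))))))(Pn-stable α 0<β (ℕP.n≤1+n K))
  where
  l : ∀ α β x -> α ℕ.+ (β ℕ.+ x) ≡ β ℕ.+ α ℕ.+ x
  l = ℕsolve

 ϑ : ℕ -> ℕ -> Carrier
 ϑ α β = P∞ α β * P∞ (β ∸ α) β

 ∏-upTo-+ : ∀ k l (f : ℕ -> Carrier) -> ∏ (upTo (k ℕ.+ l)) f ≈ ∏ (upTo k) f * ∏ (upTo l)(\j -> f (k ℕ.+ j))
 ∏-upTo-+ zero l f = sym (*-identityˡ _)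
 ∏-upTo-+ (suc k) l f = trans (∏-upTo-suc (k ℕ.+ l) f)(trans (*ˡ (∏-upTo-+ k l (f ∘ suc)))(trans (sym (*-assoc _ _ _))(*ʳ (sym (∏-upTo-suc k f)))))

 ∏-pairs : ∀ k (f : ℕ -> Carrier) -> ∏ (upTo (k ℕ.+ k)) f ≈ ∏ (upTo k)(\i -> f (i ℕ.+ i) * f (suc (i ℕ.+ i)))
 ∏-pairs zero f = rfl
 ∏-pairs (suc k) f = trans (reflexive (cong (\z -> ∏ (upTo z) f)(cong suc (ℕP.+-suc k k))))(trans (∏-upTo-last (suc (k ℕ.+ k)) f)(trans (*ʳ (∏-upTo-last (k ℕ.+ k) f))
  (trans (*-assoc _ _ _)(trans (*ʳ (∏-pairs k f))(sym (∏-upTo-last k _))))))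

 ∏-reverse : ∀ n (f : ℕ -> Carrier) -> ∏ (upTo n) f ≈ ∏ (upTo n)(\c -> f (n ∸ suc c))
 ∏-reverse zero f = rfl
 ∏-reverse (suc n) f = trans (∏-upTo-last n f)(trans (*-comm _ _)(trans (*ˡ (∏-reverse n f))(sym (∏-upTo-suc n (\c -> f (suc n ∸ suc c))))))

 _^'_ : Carrier -> ℕ -> Carrier
 x ^' zero = 1#
 x ^' suc n = x * x ^' n

 br : ℕ -> Carrier
 br e = fac (e ℕ.+ e)

 F : ℕ -> Carrier
 F k = ∏ (upTo k)(\e -> br (suc e))

 F-stable : ∀ {k} -> K ≤ k -> F k ≎ P∞ 2 2
 F-stable {k} p = ≈-then (∏-cong (upTo k)(\e -> fac-cong (l e)))(Pn-stable 2 (s≤s z≤n) p)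
  where
  l : ∀ e -> suc e ℕ.+ suc e ≡ 2 ℕ.+ e ℕ.* 2
  l = ℕsolve

 F-+ : ∀ k l -> F k * ∏ (upTo l)(\j -> br (suc k ℕ.+ j)) ≈ F (k ℕ.+ l)
 F-+ k l = sym (∏-upTo-+ k l _)

 -- The factors (1 - q^(j-i))(1 - q^(i+j)) that `QT` lacks in comparison with the theta functions.
 -- The same factors complete `oddFactor` to full products, so numerator and denominator are both
 -- multiplied by them.
 corr : ℕ -> Carrier
 corr n = ∏ (upTo n)(\j -> ∏ (upTo j)(\i -> br (j ∸ i) * br (i ℕ.+ j)))

 -- In row j the exponents j - i run over 1, ..., j and the exponents i + j over j, ..., 2j - 1;
 -- regrouped across rows, they fill up finite products (q; q)_k.
 corr-F : ∀ q -> corr (suc q) ≈ F q * ∏ (upTo q)(\p -> F (suc (p ℕ.+ p)))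
 corr-F zero = rfl
 corr-F (suc q) = begin
  corr (suc n) ≈⟨ ∏-upTo-last n _ ⟩
  _ ≈⟨ *-cong (corr-F q)(trans (∏-* (upTo n) _ _)(*-cong reversed (∏-cong (upTo n)(\i -> fac-cong (cong₂ ℕ._+_ (ℕP.+-comm i n)(ℕP.+-comm i n)))))) ⟩
  _ ≈⟨ solve 4 (\f p g r -> f :* p :* (g :* r) := g :* (p :* (f :* r))) rfl _ _ _ _ ⟩
  _ ≈⟨ *ˡ (*ˡ (trans (F-+ q n)(reflexive (cong F (ℕP.+-suc q q))))) ⟩
  _ ≈⟨ *ˡ (sym (∏-upTo-last q _)) ⟩
  F n * ∏ (upTo n)(\p -> F (suc (p ℕ.+ p))) ∎
  where
  n = suc q
  Π = ∏ (upTo q)(\p -> F (suc (p ℕ.+ p)))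
  reversed : ∏ (upTo n)(\i -> br (n ∸ i)) ≈ F n
  reversed = trans (∏-reverse n _)(∏-congAll (All.map (\ {c} c≤q -> fac-cong (cong₂ ℕ._+_ (lem c≤q)(lem c≤q)))(bounded q)))
   where
   bounded : ∀ q -> All (_≤ q)(upTo (suc q))
   bounded q = AllP.applyUpTo⁺₁ id (suc q) ℕP.≤-pred
   lem : ∀ {c} -> c ≤ q -> n ∸ (q ∸ c) ≡ suc c
   lem {c} c≤q = ≡.trans (ℕP.+-∸-assoc 1 (ℕP.m∸n≤m q c))(cong suc (ℕP.m∸[m∸n]≡n c≤q))

 module _ (q M : ℕ)(K≤M : K ≤ M) where
  -- The factors 1 - h^(2i+1) together with one copy of (q; q)_∞ make up (h; h)_∞. The other 2q
  -- sequences pair up to q copies of (q; q)_∞, whose initial factors come from `corr`.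
  denominator : ∏ (upTo M)(\i -> fac (suc (i ℕ.+ i)) * (br (suc q ℕ.+ i) * ∏ (upTo (q ℕ.+ q))(\l -> br (suc (suc (i ℕ.+ i)) ℕ.+ l)))) * corr (suc q) ≎ (P∞ 2 2 ^' q) * P∞ 1 1
  denominator = ≈-then (trans (*-cong (trans (∏-* (upTo M) _ _)(*ˡ (trans (∏-* (upTo M) _ _)(*ˡ rises))))(corr-F q))
    (trans (solve 5 (\o b r f g -> o :* (b :* r) :* (f :* g) := (g :* r) :* (o :* (f :* b))) rfl _ _ _ _ _)(*-cong (sym (∏-* (upTo q) _ _))(*ˡ (F-+ q M)))))
   (≎-* (powers q (\p -> F (suc (p ℕ.+ p)) * G p)(\p -> ≈-then (F-G p)(F-stable {suc (p ℕ.+ p) ℕ.+ (M ℕ.+ M)} (ℕP.≤-trans K≤M (ℕP.≤-trans (ℕP.m≤m+n M M)(ℕP.m≤n+m (M ℕ.+ M)(suc (p ℕ.+ p))))))))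
    (≎-trans (≎-* (≎-refl (Int-∏ (All.universal (\i -> Int-fac _)(upTo M))))(≎-trans (F-stable (ℕP.≤-trans K≤M (ℕP.m≤n+m M q)))(≎-sym (F-stable K≤M))))
     (≈-then (trans (sym (∏-* (upTo M) _ _))(trans (∏-cong (upTo M)(\i -> *-cong (fac-cong (l1 i))(fac-cong (l2 i))))(sym (∏-pairs M (\e -> fac (1 ℕ.+ e ℕ.* 1))))))(Pn-stable 1 (s≤s z≤n)(ℕP.≤-trans K≤M (ℕP.m≤m+n M M))))))
   where
   G : ℕ -> Carrier
   G p = ∏ (upTo M)(\i -> br (suc (suc (i ℕ.+ i)) ℕ.+ (p ℕ.+ p)) * br (suc (suc (i ℕ.+ i)) ℕ.+ suc (p ℕ.+ p)))
   l1 : ∀ i -> suc (i ℕ.+ i) ≡ 1 ℕ.+ (i ℕ.+ i) ℕ.* 1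
   l1 = ℕsolve
   l2 : ∀ i -> suc i ℕ.+ suc i ≡ 1 ℕ.+ suc (i ℕ.+ i) ℕ.* 1
   l2 = ℕsolve
   rises : ∏ (upTo M)(\i -> ∏ (upTo (q ℕ.+ q))(\l -> br (suc (suc (i ℕ.+ i)) ℕ.+ l))) ≈ ∏ (upTo q) G
   rises = trans (∏-cong (upTo M)(\i -> ∏-pairs q _))(∏-swap (upTo M)(upTo q) _)
   F-G : ∀ p -> F (suc (p ℕ.+ p)) * G p ≈ F (suc (p ℕ.+ p) ℕ.+ (M ℕ.+ M))
   F-G p = trans (*ˡ (sym (trans (∏-pairs M (\j -> br (suc (suc (p ℕ.+ p)) ℕ.+ j)))(∏-cong (upTo M)(\i -> *-cong (fac-cong (cong₂ ℕ._+_ (e1 i p)(e1 i p)))(fac-cong (cong₂ ℕ._+_ (e2 i p)(e2 i p))))))))(F-+ (suc (p ℕ.+ p))(M ℕ.+ M))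
    where
    e1 : ∀ i p -> suc (suc (p ℕ.+ p)) ℕ.+ (i ℕ.+ i) ≡ suc (suc (i ℕ.+ i)) ℕ.+ (p ℕ.+ p)
    e1 = ℕsolve
    e2 : ∀ i p -> suc (suc (p ℕ.+ p)) ℕ.+ suc (i ℕ.+ i) ≡ suc (suc (i ℕ.+ i)) ℕ.+ suc (p ℕ.+ p)
    e2 = ℕsolve
   powers : ∀ q (f : ℕ -> Carrier) -> (∀ p -> f p ≎ P∞ 2 2) -> ∏ (upTo q) f ≎ P∞ 2 2 ^' q
   powers zero f h = ≎-refl Int-1
   powers (suc q) f h = ≈-then (∏-upTo-suc q f)(≎-* (h 0)(powers q (f ∘ suc)(h ∘ suc)))

-- The numerator as a product of theta functions.

module Numerator (𝓕 : Frame)(P : ℕ)(0<P : 0 < P)(K : ℕ)(0<K : 0 < K)(q : ℕ)(2q<P : q ℕ.+ q < P)(R : ℕ)(K≤R : K ≤ R)(m : ℕ) where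
 open Alphabet 𝓕 P 0<P K 0<K q 2q<P R K≤R m
 open Products 𝓕 K 0<K

 private
  D : ℕ
  D = P ℕ.+ P
  0<D : 0 < D
  0<D = ℕP.≤-trans 0<P (ℕP.m≤m+n P P)
  K≤L : K ≤ L
  K≤L = ℕP.≤-trans (ℕP.n≤1+n K)(ℕP.m≤n+m (suc K) R)

  Π∞ : ℕ -> Carrier
  Π∞ α = P∞ α D

  ∏-prog-upTo : ∀ b k (f : ℤ -> Carrier) -> ∏ (prog (+ b) k) f ≈ ∏ (upTo k)(\j -> f (+ (b ℕ.+ j ℕ.* D)))
  ∏-prog-upTo b zero f = rfl
  ∏-prog-upTo b (suc k) f = sym (trans (∏-upTo-suc k _)(*-cong (reflexive (cong (\z -> f (+ z))(ℕP.+-identityʳ b)))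
   (trans (∏-cong (upTo k)(\j -> reflexive (cong (\z -> f (+ z))(≡.sym (ℕP.+-assoc b D (j ℕ.* D))))))(sym (∏-prog-upTo (b ℕ.+ D) k f)))))

  pair : ∀ b b' {x} -> b' ℕ.+ b ≡ x -> ∏ (prog (+ b) L)(\x -> 1# - mono (+ b' +' x)) ≎ Π∞ x
  pair b b' refl = ≈-then (trans (∏-prog-upTo b L _)(∏-cong (upTo L)(\j -> fac-cong (≡.sym (ℕP.+-assoc b' b (j ℕ.* D))))))(Pn-stable (b' ℕ.+ b) 0<D K≤L)

  self≎ : ∀ b -> self (+ b) L ≎ Π∞ b * Π∞ (P ℕ.+ b)
  self≎ b = ≈-then (∏-* (prog (+ b) L) _ _)(≎-* (≈-then (∏-prog-upTo b L _)(Pn-stable b 0<D K≤L))(pair b P refl))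

  _⊝_ : ℕ -> ℕ -> ℕ
  x ⊝ c = x ∸ (c ℕ.+ c)

  b₋≡ : ∀ {c} -> c ≤ q -> b₋ c ≡ + (P ⊝ c)
  b₋≡ {c} p = ≡.trans (ℤP.m-n≡m⊖n P (c ℕ.+ c))(ℤP.⊖-≥ (ℕP.<⇒≤ (ℕP.≤-<-trans (ℕP.+-mono-≤ p p) 2q<P)))

  2c≤P : ∀ {c} -> c ≤ q -> c ℕ.+ c ≤ P
  2c≤P p = ℕP.<⇒≤ (ℕP.≤-<-trans (ℕP.+-mono-≤ p p) 2q<P)

  -- The product over pairs of letters starts at the exponent D + 2d, the theta function at 2d; the
  -- factor from `corr` fills the gap.
  ϑ-br : ∀ d {x} -> x ≡ D ⊝ d -> br d * (Π∞ (D ℕ.+ (d ℕ.+ d)) * Π∞ x) ≎ ϑ (d ℕ.+ d) D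
  ϑ-br d refl = ≈-then (sym (*-assoc _ _ _))(≎-* (P∞-suc (d ℕ.+ d) 0<D)(≎-refl (Int-Pn _ D K)))

  cross∏ : ℤ -> List ℤ -> Carrier
  cross∏ b bs = ∏ bs (\b' -> ∏ (prog b L)(\x -> 1# - mono (b' +' x)))

  thetas : ℕ -> ℕ -> Carrier
  thetas c j = ∏ (upTo j)(\i -> ϑ (c ∸ i ℕ.+ (c ∸ i)) D * ϑ (i ℕ.+ c ℕ.+ (i ℕ.+ c)) D)

  brs : ℕ -> ℕ -> Carrier
  brs c j = ∏ (upTo j)(\i -> br (c ∸ i) * br (i ℕ.+ c))

  module _ {c} (c≤q : c ≤ q) where
   -- The class c against the smaller classes. For i = 0 both theta functions have the argument
   -- h^(2c): one comes from the pairing with the class of 0, the other from the factors 1 - h^(P+x)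
   -- of the class c itself.
   row : ∀ j -> j < c -> brs c (suc j) * (Π∞ (P ℕ.+ (P ℕ.+ (c ℕ.+ c))) * Π∞ (P ℕ.+ (P ⊝ c)) * (cross∏ (b₊ c)(starts (classes j)) * cross∏ (b₋ c)(starts (classes j)))) ≎ thetas c (suc j)
   row zero _ = ≈-then (trans (*ʳ (*-identityʳ _))(solve 6 (\x y a b u v -> x :* y :* (a :* b :* (u :* :1 :* (v :* :1))) := x :* (a :* b) :* (y :* (u :* v))) rfl _ _ _ _ _ _))
    (≎-then (≎-* (≈-then (*ˡ (*ʳ (Pn-cong D K (≡.sym (ℕP.+-assoc P P (c ℕ.+ c))))))(ϑ-br c (e₋ P c≤q)))
     (≎-trans (≎-* (≎-refl (Int-fac _))(≎-* (pair (P ℕ.+ (c ℕ.+ c)) P refl)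
      (≈-then (reflexive (cong (\b -> ∏ (prog b L)(\x -> 1# - mono (+ P +' x)))(b₋≡ c≤q)))(pair (P ⊝ c) P refl))))
      (≈-then (*ˡ (*ʳ (Pn-cong D K (≡.sym (ℕP.+-assoc P P (c ℕ.+ c))))))(ϑ-br c (e₋ P c≤q)))))(sym (*-identityʳ _)))
    where
    e₋ : ∀ x -> c ≤ q -> P ℕ.+ (P ⊝ c) ≡ D ⊝ c
    e₋ _ p = ≡.sym (ℕP.+-∸-assoc P (2c≤P p))
   row (suc j) j<c = ≈-then (trans (*ʳ (∏-upTo-last (suc j) _))(solve 11 (\B x y a b s t C u v C' -> B :* (x :* y) :* (a :* b :* (s :* (t :* C) :* (u :* (v :* C')))) := B :* (a :* b :* (C :* C')) :* (x :* (t :* u) :* (y :* (s :* v)))) rfl _ _ _ _ _ _ _ _ _ _ _))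
    (≎-then (≎-* (row j (ℕP.<⇒≤ j<c))(≎-* minus plus))(sym (∏-upTo-last (suc j) _)))
    where
    d = suc j
    d≤q : d ≤ q
    d≤q = ℕP.≤-trans (ℕP.<⇒≤ j<c) c≤q
    d≤c : d ≤ c
    d≤c = ℕP.<⇒≤ j<c
    at : ∀ {b b⁺ b' b′⁺ x} -> b ≡ + b⁺ -> b' ≡ + b′⁺ -> b′⁺ ℕ.+ b⁺ ≡ x -> ∏ (prog b L)(\x -> 1# - mono (b' +' x)) ≎ Π∞ x
    at {b⁺ = b} {b′⁺ = b'} refl refl e = pair b b' e
    c≡ : c ∸ d ℕ.+ d ≡ c
    c≡ = ℕP.m∸n+n≡m d≤c
    D≡ : ∀ {x y} z -> x ℕ.+ z ≡ D ℕ.+ y -> z ≡ D ℕ.+ y ∸ x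
    D≡ {x} {y} z e = ≡.sym (≡.trans (cong (_∸ x)(≡.sym e))(ℕP.m+n∸m≡n x z))
    minus : br (c ∸ d) * (∏ (prog (b₊ c) L)(\x -> 1# - mono (b₋ d +' x)) * ∏ (prog (b₋ c) L)(\x -> 1# - mono (b₊ d +' x))) ≎ ϑ (c ∸ d ℕ.+ (c ∸ d)) D
    minus = ≎-trans (≎-* (≎-refl (Int-fac _))(≎-* (at refl (b₋≡ d≤q) e1)(at (b₋≡ c≤q) refl refl)))(ϑ-br (c ∸ d) e2)
     where
     r = c ∸ d
     e1 : P ⊝ d ℕ.+ (P ℕ.+ (c ℕ.+ c)) ≡ D ℕ.+ (r ℕ.+ r)
     e1 = ≡.trans (cong (\z -> P ⊝ d ℕ.+ (P ℕ.+ (z ℕ.+ z)))(≡.sym c≡))(≡.trans (l (P ⊝ d) d P r)(cong (\z -> z ℕ.+ (P ℕ.+ (r ℕ.+ r)))(ℕP.m∸n+n≡m (2c≤P d≤q)) ⟨≡⟩ l' P r))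
      where
      infixl 1 _⟨≡⟩_
      _⟨≡⟩_ : ∀ {x y z : ℕ} -> x ≡ y -> y ≡ z -> x ≡ z
      _⟨≡⟩_ = ≡.trans
      l : ∀ x d P r -> x ℕ.+ (P ℕ.+ (r ℕ.+ d ℕ.+ (r ℕ.+ d))) ≡ x ℕ.+ (d ℕ.+ d) ℕ.+ (P ℕ.+ (r ℕ.+ r))
      l = ℕsolve
      l' : ∀ P r -> P ℕ.+ (P ℕ.+ (r ℕ.+ r)) ≡ P ℕ.+ P ℕ.+ (r ℕ.+ r)
      l' = ℕsolve
     e2 : P ℕ.+ (d ℕ.+ d) ℕ.+ (P ⊝ c) ≡ D ⊝ r
     e2 = ≡.sym (≡.trans (cong (_∸ (r ℕ.+ r))(≡.trans (cong (P ℕ.+_)(≡.sym (ℕP.m∸n+n≡m (2c≤P c≤q))))(≡.trans (cong (\z -> P ℕ.+ (P ⊝ c ℕ.+ (z ℕ.+ z)))(≡.sym c≡))(l P (P ⊝ c) r d))))(ℕP.m+n∸m≡n (r ℕ.+ r) _))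
      where
      l : ∀ P x r d -> P ℕ.+ (x ℕ.+ (r ℕ.+ d ℕ.+ (r ℕ.+ d))) ≡ r ℕ.+ r ℕ.+ (P ℕ.+ (d ℕ.+ d) ℕ.+ x)
      l = ℕsolve
    plus : br (d ℕ.+ c) * (∏ (prog (b₊ c) L)(\x -> 1# - mono (b₊ d +' x)) * ∏ (prog (b₋ c) L)(\x -> 1# - mono (b₋ d +' x))) ≎ ϑ (d ℕ.+ c ℕ.+ (d ℕ.+ c)) D
    plus = ≎-trans (≎-* (≎-refl (Int-fac _))(≎-* (at refl refl (l1 P d c))(at (b₋≡ c≤q)(b₋≡ d≤q) refl)))(ϑ-br (d ℕ.+ c) e2)
     where
     l1 : ∀ P d c -> P ℕ.+ (d ℕ.+ d) ℕ.+ (P ℕ.+ (c ℕ.+ c)) ≡ P ℕ.+ P ℕ.+ (d ℕ.+ c ℕ.+ (d ℕ.+ c))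
     l1 = ℕsolve
     e2 : P ⊝ d ℕ.+ (P ⊝ c) ≡ D ⊝ (d ℕ.+ c)
     e2 = ≡.sym (≡.trans (cong (_∸ (d ℕ.+ c ℕ.+ (d ℕ.+ c)))(≡.trans (cong₂ ℕ._+_ (≡.sym (ℕP.m∸n+n≡m (2c≤P d≤q)))(≡.sym (ℕP.m∸n+n≡m (2c≤P c≤q))))(l (P ⊝ d)(P ⊝ c) d c)))(ℕP.m+n∸m≡n (d ℕ.+ c ℕ.+ (d ℕ.+ c)) _))
      where
      l : ∀ x y d c -> x ℕ.+ (d ℕ.+ d) ℕ.+ (y ℕ.+ (c ℕ.+ c)) ≡ d ℕ.+ c ℕ.+ (d ℕ.+ c) ℕ.+ (x ℕ.+ y)
      l = ℕsolve

 numer : ℕ -> Carrier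
 numer n = Π∞ D ^' n * ∏ (upTo n)(\c -> ϑ (P ⊝ c) D) * ∏ (upTo n)(\j -> thetas j j)

 -- In the class of 0, the closed form (h^P; h^(2P)) of the level-0 sum is the second half of the
 -- theta function of h^P, and (h^(2P); h^(2P)) remains. Each further class adds its row and one
 -- more such factor.
 numerator : ∀ j k -> j ≤ q -> K ≤ k -> corr (suc j) * (QT (starts (classes j)) * Pn P D k) ≎ numer (suc j)
 numerator zero k _ K≤k = ≈-then (solve 2 (\s p -> :1 :* :1 :* (s :* :1 :* :1 :* p) := s :* p) rfl _ _)
  (≎-then (≎-* (self≎ P)(Pn-stable P 0<D K≤k))(trans (*ˡ (Pn-cong D K (≡.sym (ℕP.m+n∸m≡n P P))))(solve 3 (\x y z -> x :* y :* z := y :* :1 :* (x :* z :* :1) :* (:1 :* :1)) rfl _ _ _)))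
 numerator (suc j) k c≤q K≤k = ≈-then (trans (*ʳ (∏-upTo-last c _))(solve 10 (\C B s u X s' Y Q p z -> C :* B :* (s :* (u :* X) :* (s' :* Y :* Q) :* p) := C :* (Q :* p) :* (u :* (B :* (s :* s' :* (X :* Y))))) rfl _ _ _ _ _ _ _ _ _ 1#))
  (≎-trans (≎-* (numerator j k (ℕP.<⇒≤ c≤q) K≤k)(≎-* (at0 (P⊝+ c≤q))(≎-trans (≎-* (≎-refl (Int-∏ (All.universal (\i -> Int-* (Int-fac _)(Int-fac _))(upTo c))))(≎-* (≎-* (self≎ (P ℕ.+ (c ℕ.+ c)))(≈-then (reflexive (cong (\b -> self b L)(b₋≡ c≤q)))(self≎ (P ⊝ c))))(≎-refl Int-XY)))
    (≈-then (solve 7 (\B a b e f X Y -> B :* (a :* b :* (e :* f) :* (X :* Y)) := a :* e :* (B :* (b :* f :* (X :* Y)))) rfl _ _ _ _ _ _ _)(≎-* (≎-refl (Int-* (Int-Pn _ D K)(Int-Pn _ D K)))(row c≤q j ℕP.≤-refl))))))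
   (≎-≈ (Int-* (Intʳ (numerator j k (ℕP.<⇒≤ c≤q) K≤k))(Int-* (Int-Pn _ D K)(Int-* (Int-* (Int-Pn _ D K)(Int-Pn _ D K))(Intʳ (row c≤q j ℕP.≤-refl)))))
    (trans (solve 7 (\w x y u e f v -> w :* x :* y :* (u :* (e :* f :* v)) := u :* w :* (x :* (f :* e)) :* (y :* v)) rfl _ _ _ _ _ _ _)
     (*-cong (*ˡ (trans (*ˡ (*ˡ (Pn-cong D K refl-sub)))(sym (∏-upTo-last c _))))(sym (∏-upTo-last c _))))))
  where
  c = suc j
  P⊝+ : c ≤ q -> P ⊝ c ℕ.+ (P ℕ.+ (c ℕ.+ c)) ≡ D
  P⊝+ p = ≡.trans (l (P ⊝ c) P (c ℕ.+ c))(cong (ℕ._+ P)(ℕP.m∸n+n≡m (2c≤P p)))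
   where
   l : ∀ x P c -> x ℕ.+ (P ℕ.+ c) ≡ x ℕ.+ c ℕ.+ P
   l = ℕsolve
  refl-sub : P ℕ.+ (c ℕ.+ c) ≡ D ∸ (P ⊝ c)
  refl-sub = ≡.sym (≡.trans (cong (_∸ (P ⊝ c))(≡.sym (P⊝+ c≤q)))(ℕP.m+n∸m≡n (P ⊝ c) _))
  at0 : ∀ {x} -> P ⊝ c ℕ.+ (P ℕ.+ (c ℕ.+ c)) ≡ x -> ∏ (prog (b₊ c) L)(\x -> 1# - mono (b₋ c +' x)) ≎ Π∞ x
  at0 e = ≈-then (reflexive (cong (\b -> ∏ (prog (b₊ c) L)(\x -> 1# - mono (b +' x)))(b₋≡ c≤q)))(pair (P ℕ.+ (c ℕ.+ c))(P ⊝ c) e)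
  Int-cross : ∀ {b} bs -> 0' <' b -> Positive bs -> Int (cross∏ b bs)
  Int-cross {b} bs 0<b ps = Int-∏ (All.map (\p -> Int-∏ (All.map (\p' -> Int-+ Int-1 (Int-- (Int-mono≥0 (ℤP.<⇒≤ (ℤP.+-mono-< p p')))))(prog-Positive L 0<b))) ps)
  Int-XY : Int (cross∏ (b₊ c)(starts (classes j)) * cross∏ (b₋ c)(starts (classes j)))
  Int-XY = Int-* (Int-cross _ (0<b₊ c) ps)(Int-cross _ (0<b₋ c≤q) ps)
   where
   ps = starts-Positive (classes-Classes (ℕP.<⇒≤ c≤q))

-- Quantities that do not depend on the ratio of the progressions.

module ZeroState (𝓕 : Frame)(P : ℕ)(0<P : 0 < P)(K : ℕ)(0<K : 0 < K)(q : ℕ)(2q<P : q ℕ.+ q < P)(R : ℕ)(K≤R : K ≤ R)(m : ℕ) where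
 open Alphabet 𝓕 P 0<P K 0<K q 2q<P R K≤R m
 open Determinant 𝓕
 open Products 𝓕 K 0<K

 -- The Vandermonde product of the unshifted points is determined by the classes alone, so it is the
 -- same for both alphabets.
 van-zero : ∀ cs -> van (pts (zero-state cs) 0) ≈ V0 (cs ++ 0 ∷ [])
 van-zero cs = trans (reflexive (cong van (points cs)))(van-map (cs ++ 0 ∷ []))
  where
  points : ∀ cs -> pts (zero-state cs) 0 ≡ map +_ (cs ++ 0 ∷ [])
  points [] = cong (_∷ [])(β̂-0 0)
  points (c ∷ cs) = cong₂ _∷_ (β̂-0 c)(points cs)
  van-map : ∀ cs -> van (map +_ cs) ≈ V0 cs
  van-map [] = rfl
  van-map (c ∷ cs) = *-cong (∏-map +_ cs _)(van-map cs)

 length-tracks : length (tracks (starts (classes q))) ≡ L ℕ.* suc (q ℕ.+ q)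
 length-tracks = ≡.trans (PermP.↭-length alphabet-↭)(ladder-length (b₋ q) L)
  where
  ladder-length : ∀ b k -> length (ladder b (suc (q ℕ.+ q)) k) ≡ k ℕ.* suc (q ℕ.+ q)
  ladder-length b zero = refl
  ladder-length b (suc k) = ≡.trans (ListP.length-++ (prog2 b (suc (q ℕ.+ q))))(cong₂ ℕ._+_ (length-prog2 b (suc (q ℕ.+ q)))(ladder-length (b +' 2P) k))

 pochτ-Pn : ∀ k -> pochτ k ≈ Pn P (P ℕ.+ P) k
 pochτ-Pn zero = rfl
 pochτ-Pn (suc k) = sym (trans (∏-upTo-last k _)(*-cong (sym (pochτ-Pn k))(+ˡ (-‿cong (trans (mono-+ (+ P)(+ (k ℕ.* (P ℕ.+ P))))(*ˡ (power k)))))))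
  where
  power : ∀ k -> mono (+ (k ℕ.* (P ℕ.+ P))) ≈ t ^ k
  power zero = mono-0
  power (suc k) = trans (mono-+ (+ (P ℕ.+ P))(+ (k ℕ.* (P ℕ.+ P))))(*ˡ (power k))

-- The exchange of N and κ.

module Dual (𝓕 : Frame)(K : ℕ)(0<K : 0 < K)(q m : ℕ) where
 N κ : ℕ
 N = suc (q ℕ.+ q)
 κ = suc m ℕ.+ N

 2q<κ : q ℕ.+ q < κ
 2q<κ = s≤s (ℕP.≤-trans (ℕP.n≤1+n (q ℕ.+ q))(ℕP.m≤n+m N m))

 open Core 𝓕
 open Determinant 𝓕
 open Products 𝓕 K 0<K
 private
  -- In 𝐚 the ratio exponent is P = N and the weight exponent (m + 1) + N = κ; in 𝐛 it is P = κ with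
  -- weight exponent 0 + N. The bound of the statement is m + 1 here.
  module 𝐚 = Odds 𝓕 K 0<K q K ℕP.≤-refl (suc m)
  module 𝐛 = Alphabet 𝓕 κ (s≤s z≤n) K 0<K q 2q<κ K ℕP.≤-refl 0

 private
  cs = classes q
  nes = classes-distinct q
  psₐ = 𝐚.classes-Classes ℕP.≤-refl
  psᵦ = 𝐛.classes-Classes ℕP.≤-refl

 size : ℕ
 size = 𝐚.L ℕ.* N

 private
  Δ : ℕ -> ℕ -> Carrier
  Δ P w = det (entry K P w)(down (suc q))(down (suc q))

  to-Δ : ∀ P {w w'} -> w ≡ w' -> det (entry K P w)(down (suc (length cs)))(cs ++ 0 ∷ []) ≈ Δ P w'
  to-Δ P {w} {w'} e = reflexive (≡.trans (cong₂ (\x y -> det (entry K P x)(down (suc y))(cs ++ 0 ∷ [])) e (length-classes q))(cong (det (entry K P w')(down (suc q)))(classes-down q)))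

  odd-q : odd (length cs) ≡ N
  odd-q = ≡.trans (cong odd (length-classes q))(odd≡ q)

  -- `entry-dual` exchanges N and κ as well as the two indices; transposing restores the indices, as
  -- rows and columns both run over q, ..., 0.
  Det≈ : 𝐚.Det (suc m ℕ.+ odd (length cs)) cs ≈ 𝐛.Det (0 ℕ.+ odd (length cs)) cs
  Det≈ = halve (trans (trans (𝐚.Det-det (suc m ℕ.+ odd (length cs)) psₐ nes)(to-Δ N {suc m ℕ.+ odd (length cs)} {κ} (cong (suc m ℕ.+_) odd-q)))
   (trans (trans (det-cong (entry-dual K N κ)(down (suc q))(down (suc q)))(det-transpose (\j c -> entry K κ N c j)(down (suc q))(down (suc q))))
    (sym (trans (𝐛.Det-det (odd (length cs)) psᵦ nes)(to-Δ κ {odd (length cs)} {N} odd-q)))))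

  iVₐ = proj₁ (𝐚.Inv-van psₐ nes)
  iVᵦ = proj₁ (𝐛.Inv-van psᵦ nes)

  iV≈ : iVₐ ≈ iVᵦ
  iV≈ = unit-cancel (proj₂ (𝐚.Inv-van psₐ nes))(trans (trans (*-comm _ _)(proj₂ (𝐚.Inv-van psₐ nes)))
   (sym (trans (trans (*ʳ (trans ((ZeroState.van-zero 𝓕 N (s≤s z≤n) K 0<K q ℕP.≤-refl K ℕP.≤-refl (suc m)) cs)(sym ((ZeroState.van-zero 𝓕 κ (s≤s z≤n) K 0<K q 2q<κ K ℕP.≤-refl 0) cs))))(*-comm _ _))(proj₂ (𝐛.Inv-van psᵦ nes)))))

  Aₐ = 𝐚.A (𝐚.config (𝐚.zero-state cs) 0)
  Aᵦ = 𝐛.A (𝐛.config (𝐛.zero-state cs) 0)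
  X = iVᵦ * 𝐛.Det (0 ℕ.+ odd (length cs)) cs
  Q = 𝐛.QT (𝐛.starts cs)
  poch' = Pn κ (κ ℕ.+ κ) size

  unit : Aᵦ * Q 𝐛.≅ 1#
  unit = 𝐛.≅-trans (𝐛.≅-*ʳ _ (𝐛.≅-reflexive (𝐛.A-↭ (𝐛.config-zero cs))))(𝐛.A-tracks (𝐛.starts-Positive psᵦ))

  u = proj₁ unit
  U1 = proj₁ (proj₂ unit)
  AQ≈u : Aᵦ * Q ≈ u
  AQ≈u = trans (proj₂ (proj₂ unit))(*-identityʳ u)

  -- At level 0 the signed sum is also known from `signed-sum`, as a Pochhammer product that sees
  -- only the number of letters.
  poch≡ : poch' ≡[ K ] Aᵦ * X
  poch≡ = ≡[]-trans (≡[]-reflexive (sym (trans (𝐛.Σs-cong Y (\_ -> *-identityˡ _))(trans (𝐛.signed-sum Y 𝐛.alphabet-Good)(trans ((ZeroState.pochτ-Pn 𝓕 κ (s≤s z≤n) K 0<K q 2q<κ K ℕP.≤-refl 0) (length Y))(reflexive (cong (Pn κ (κ ℕ.+ κ)) (ZeroState.length-tracks 𝓕 κ (s≤s z≤n) K 0<K q 2q<κ K ℕP.≤-refl 0))))))))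
   (𝐛.signed-Det psᵦ nes 𝐛.alphabet-Good)
   where Y = 𝐛.tracks (𝐛.starts cs)

  Int-Q : ∀ {bs} -> 𝐛.Positive bs -> Int (𝐛.QT bs)
  Int-Q {[]} _ = Int-1
  Int-Q {b ∷ bs} (p ∷ ps) = Int-* (Int-* (Int-∏ (All.map (\p' -> Int-* (factor p')(factor (ℤP.+-mono-< (ℤ.+<+ (s≤s z≤n)) p')))(𝐛.prog-Positive 𝐛.L p)))
   (Int-∏ (All.map (\p″ -> Int-∏ (All.map (\p' -> factor (ℤP.+-mono-< p″ p'))(𝐛.prog-Positive 𝐛.L p))) ps)))(Int-Q ps)
   where
   factor : ∀ {x} -> 0' <' x -> Int (1# - mono x)
   factor p = Int-+ Int-1 (Int-- (𝐛.Int-mono≥0 (ℤP.<⇒≤ p)))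

  iQ : Int Q
  iQ = Int-Q (𝐛.starts-Positive psᵦ)

  Int-AX : Int (Aᵦ * X)
  Int-AX = Int-resp (solve 2 (\p a -> p :- (p :- a) := a) rfl _ _)(Int-+ (Int-Pn κ (κ ℕ.+ κ) size)(Int-- (Small⇒Int (small poch≡))))

  QAX : Q * (Aᵦ * X) ≈ u * X
  QAX = trans (x*[y*z]≈y*x*z _ _ _)(*ʳ AQ≈u)

  -- X is a quotient, but u X = Q (Aᵦ X), where the right side is integral and u is a unit of the
  -- power series.
  Int-X : Int X
  Int-X = Int-resp (trans (*ˡ QAX)(trans (sym (*-assoc _ _ _))(trans (*ʳ (trans (*-comm _ _)(𝐛.inverse U1)))(*-identityˡ _))))(Int-* (𝐛.Int-inv U1)(Int-* iQ Int-AX))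

  near : ∀ {v x} -> Small K (v - 1#) -> Int x -> v * x ≡[ K ] x
  near s i = cgr (Small-resp (solve 2 (\u x -> (u :- :1) :* x := u :* x :- x) rfl _ _)(Small-*Int s i))

  -- Divides `poch≡` by Aᵦ, whose reciprocal is Q up to the unit u.
  X≡ : X ≡[ K ] Q * poch'
  X≡ = ≡[]-sym (≡[]-trans (≡[]-*ˡ iQ poch≡)(≡[]-trans (≡[]-reflexive QAX)(near (𝐛.near-1 U1) Int-X)))

  Y' = alphabetₐ
   where alphabetₐ = 𝐚.alphabet (odds 0 N) 𝐚.L

  good : Good Y'
  good = Good-↭ (↭-sym 𝐚.alphabet-odds) 𝐚.alphabet-Good

  Int-Aₐ : Int Aₐ
  Int-Aₐ = 𝐚.Int-A (Good-↭ (↭-sym (𝐚.config-zero cs)) 𝐚.alphabet-Good)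

 multisum-eval : ∀ {B} -> size ≤ B -> 𝐚.multisum m B (odds 0 N) ≡[ K ] Aₐ * (Q * poch')
 multisum-eval {B} size≤B = ≡[]-trans (≡[]-sym (𝐚.S-multisum m B 𝐚.L (odds 0 N) good K≤ (subst (_≤ B)(≡.sym (≡.trans (PermP.↭-length 𝐚.alphabet-odds) (ZeroState.length-tracks 𝓕 N (s≤s z≤n) K 0<K q ℕP.≤-refl K ℕP.≤-refl (suc m)))) size≤B)))
  (≡[]-trans (≡[]-reflexive (trans (𝐚.bounded-littlewood m Y' good)(Symmetry.signed-↭ 𝓕 N (suc m) 𝐚.alphabet-odds)))
   (≡[]-trans (𝐚.signed-Det psₐ nes 𝐚.alphabet-Good)(≡[]-trans (≡[]-reflexive (*ˡ (*-cong iV≈ Det≈)))(≡[]-*ˡ Int-Aₐ X≡))))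
  where
  K≤ : K ≤ (N ℕ.+ N) ℕ.* 𝐚.L
  K≤ = ℕP.≤-trans (ℕP.≤-trans (ℕP.n≤1+n K)(ℕP.m≤n+m (suc K) K))(ℕP.m≤n*m 𝐚.L (N ℕ.+ N))

 multisum-product : ∀ {B} -> size ≤ B -> 𝐚.multisum m B (odds 0 N) * ((P∞ 2 2 ^' q) * P∞ 1 1) ≡[ K ] (Numerator.numer 𝓕 κ (s≤s z≤n) K 0<K q 2q<κ K ℕP.≤-refl 0) (suc q)
 multisum-product {B} size≤B = ≡[]-trans (≡[]-*ʳ (Intʳ den≎)(multisum-eval size≤B))(≡[]-trans (≡[]-*ˡ (Int-* Int-Aₐ Int-Qp)(≡[]-sym (cong≎ den≎)))
  (≡[]-trans (≡[]-reflexive (trans (solve 5 (\a q p o c -> a :* (q :* p) :* (o :* c) := a :* o :* (c :* (q :* p))) rfl _ _ _ _ _)(*ʳ (trans (proj₂ (proj₂ unitₐ))(*-identityʳ _)))))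
   (≡[]-trans (near (𝐚.near-1 (proj₁ (proj₂ unitₐ)))(Intˡ num≎))(cong≎ num≎))))
  where
  unitₐ = 𝐚.A-tracks-odd
  den≎ : 𝐚.Qodd * corr (suc q) ≎ (P∞ 2 2 ^' q) * P∞ 1 1
  den≎ = denominator q size 𝐚.size≥K
  num≎ : corr (suc q) * (Q * poch') ≎ (Numerator.numer 𝓕 κ (s≤s z≤n) K 0<K q 2q<κ K ℕP.≤-refl 0) (suc q)
  num≎ = (Numerator.numerator 𝓕 κ (s≤s z≤n) K 0<K q 2q<κ K ℕP.≤-refl 0) q size ℕP.≤-refl 𝐚.size≥K
  Int-Qp : Int (Q * poch')
  Int-Qp = Int-* iQ (Int-Pn κ (κ ℕ.+ κ) size)

-- Power series inside Laurent series.

record Embedding (𝓕 : Frame) : Set where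
 open Core 𝓕
 field
  ι : Series -> Carrier
  ι-cong : ∀ {f g} -> f ≋ g -> ι f ≈ ι g
  ι-+ : ∀ f g -> ι (f ⊕ g) ≈ ι f + ι g
  ι-* : ∀ f g -> ι (f ⊛ g) ≈ ι f * ι g
  ι-neg : ∀ f -> ι (negS f) ≈ - ι f
  ι-0 : ι zeroS ≈ 0#
  ι-1 : ι oneS ≈ 1#
  ι-X : ∀ n -> ι (X^ n) ≈ mono (+ n)
  Int-ι : ∀ f -> Int (ι f)
  mono-≥0 : ∀ {j n} -> ¬ (mono -[1+ j ] ≈ mono (+ n))
  congruent⇒coefficients : ∀ {K f g} -> ι f ≡[ K ] ι g -> ∀ {k} -> k < K -> f k ≡ g k
  coefficients⇒congruent : ∀ {K f g} -> (∀ {k} -> k < K -> f k ≡ g k) -> ι f ≡[ K ] ι g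

one-X : ℕ -> Series
one-X e = oneS ⊕ monoS -1ℤ e

one-X≋ : ∀ e -> one-X e ≋ oneS ⊕ negS (X^ e)
one-X≋ e k with k ≡ᵇ e
... | true = refl
... | false = refl

-- Construction of the Laurent series.

module Laurent where
 open RingTools seriesAlgebra

 -- The pair (d , f) stands for h^{-d} f.
 Carrierᴸ : Set
 Carrierᴸ = ℕ × Series

 infix 4 _≈ᴸ_
 record _≈ᴸ_ (x y : Carrierᴸ) : Set where
  constructor eq
  field unfold : X^ (proj₁ y) * proj₂ x ≈ X^ (proj₁ x) * proj₂ y
 open _≈ᴸ_

 _+ᴸ_ _*ᴸ_ : Carrierᴸ -> Carrierᴸ -> Carrierᴸ
 (d , f) +ᴸ (e , g) = d ℕ.+ e , X^ e * f + X^ d * g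
 (d , f) *ᴸ (e , g) = d ℕ.+ e , f * g

 -ᴸ_ : Carrierᴸ -> Carrierᴸ
 -ᴸ (d , f) = d , - f

 ι : Series -> Carrierᴸ
 ι f = 0 , f

 private
  X0 : X^ 0 ≈ 1#
  X0 zero = refl
  X0 (suc _) = refl

  X-cong : ∀ {d e} -> d ≡ e -> X^ d ≈ X^ e
  X-cong refl = rfl

  same : ∀ {d e f g} -> d ≡ e -> f ≈ g -> (d , f) ≈ᴸ (e , g)
  same {d} refl p = eq (*ˡ {x = X^ d} p)

  symᴸ : ∀ {x y} -> x ≈ᴸ y -> y ≈ᴸ x
  symᴸ (eq p) = eq (sym p)

  transᴸ : ∀ {x y z} -> x ≈ᴸ y -> y ≈ᴸ z -> x ≈ᴸ z
  transᴸ {dx , fx} {dy , fy} {dz , fz} (eq p)(eq r) = eq (X^-cancel dy (begin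
   X^ dy * (X^ dz * fx) ≈⟨ x*[y*z]≈y*[x*z] (X^ dy)(X^ dz) fx ⟩
   _ ≈⟨ *ˡ {x = X^ dz} p ⟩
   _ ≈⟨ x*[y*z]≈y*[x*z] (X^ dz)(X^ dx) fy ⟩
   _ ≈⟨ *ˡ {x = X^ dx} r ⟩
   _ ≈⟨ x*[y*z]≈y*[x*z] (X^ dx)(X^ dy) fz ⟩
   X^ dy * (X^ dx * fz) ∎))

  +-congᴸ : ∀ {x x' y y'} -> x ≈ᴸ x' -> y ≈ᴸ y' -> x +ᴸ y ≈ᴸ x' +ᴸ y'
  +-congᴸ {d , f} {d' , f'} {e , g} {e' , g'} (eq p)(eq r) = eq (begin
   X^ (d' ℕ.+ e') * (X^ e * f + X^ d * g) ≈⟨ *ʳ {x = X^ e * f + X^ d * g} (X^-+ d' e') ⟩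
   _
    ≈⟨ solve 6 (\u v e f d g -> u :* v :* (e :* f :+ d :* g) := v :* e :* (u :* f) :+ u :* d :* (v :* g)) rfl (X^ d')(X^ e')(X^ e) f (X^ d) g ⟩
   _ ≈⟨ +-cong (*ˡ {x = X^ e' * X^ e} p)(*ˡ {x = X^ d' * X^ d} r) ⟩
   _
    ≈⟨ solve 6 (\u v e f d g -> v :* e :* (d :* f) :+ u :* d :* (e :* g) := d :* e :* (v :* f :+ u :* g)) rfl (X^ d')(X^ e')(X^ e) f' (X^ d) g' ⟩
   _ ≈⟨ *ʳ {x = X^ e' * f' + X^ d' * g'} (sym (X^-+ d e)) ⟩
   X^ (d ℕ.+ e) * (X^ e' * f' + X^ d' * g') ∎)

  *-congᴸ : ∀ {x x' y y'} -> x ≈ᴸ x' -> y ≈ᴸ y' -> x *ᴸ y ≈ᴸ x' *ᴸ y'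
  *-congᴸ {d , f} {d' , f'} {e , g} {e' , g'} (eq p)(eq r) = eq (begin
   X^ (d' ℕ.+ e') * (f * g) ≈⟨ *ʳ {x = f * g} (X^-+ d' e') ⟩
   _ ≈⟨ x*y*[z*u]≈[x*z]*[y*u] (X^ d')(X^ e') f g ⟩
   _ ≈⟨ *-cong p r ⟩
   _ ≈⟨ solve 4 (\u v f g -> (u :* f) :* (v :* g) := u :* v :* (f :* g)) rfl (X^ d)(X^ e) f' g' ⟩
   _ ≈⟨ *ʳ {x = f' * g'} (sym (X^-+ d e)) ⟩
   X^ (d ℕ.+ e) * (f' * g') ∎)

  +-assocᴸ : ∀ x y z -> (x +ᴸ y) +ᴸ z ≈ᴸ x +ᴸ (y +ᴸ z)
  +-assocᴸ (d , f)(e , g)(k , h) = same (ℕP.+-assoc d e k)(trans (+ˡ {x = X^ k * (X^ e * f + X^ d * g)} (*ʳ {x = h} (X^-+ d e)))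
   (trans (solve 6 (\d e k f g h -> k :* (e :* f :+ d :* g) :+ d :* e :* h := e :* k :* f :+ d :* (k :* g :+ e :* h)) rfl (X^ d)(X^ e)(X^ k) f g h)
    (+ʳ {x = X^ d * (X^ k * g + X^ e * h)} (*ʳ {x = f} (sym (X^-+ e k))))))

  +-commᴸ : ∀ x y -> x +ᴸ y ≈ᴸ y +ᴸ x
  +-commᴸ (d , f)(e , g) = same (ℕP.+-comm d e)(+-comm (X^ e * f)(X^ d * g))

  +-identityˡᴸ : ∀ x -> ι 0# +ᴸ x ≈ᴸ x
  +-identityˡᴸ (d , f) = same refl (trans (+-cong (zeroʳ (X^ d))(trans (*ʳ {x = f} X0)(*-identityˡ f)))(+-identityˡ f))

  -‿inverseˡᴸ : ∀ x -> (-ᴸ x) +ᴸ x ≈ᴸ ι 0#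
  -‿inverseˡᴸ (d , f) = eq (trans (solve 3 (\u v f -> u :* (v :* (:- f) :+ v :* f) := :0) rfl (X^ 0)(X^ d) f)(sym (zeroʳ (X^ (d ℕ.+ d)))))

  distribʳᴸ : ∀ x y z -> (y +ᴸ z) *ᴸ x ≈ᴸ (y *ᴸ x) +ᴸ (z *ᴸ x)
  distribʳᴸ (d , f)(e , g)(k , h) = eq (begin
   X^ (e ℕ.+ d ℕ.+ (k ℕ.+ d)) * ((X^ k * g + X^ e * h) * f)
    ≈⟨ *ʳ {x = (X^ k * g + X^ e * h) * f} (trans (X-cong (l e d k))(X^-+ (e ℕ.+ k ℕ.+ d) d)) ⟩
   _
    ≈⟨ solve 7 (\w d k e g h f -> w :* d :* ((k :* g :+ e :* h) :* f) := w :* (k :* d :* (g :* f) :+ e :* d :* (h :* f))) rfl (X^ (e ℕ.+ k ℕ.+ d))(X^ d)(X^ k)(X^ e) g h f ⟩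
   _
    ≈⟨ *ˡ {x = X^ (e ℕ.+ k ℕ.+ d)} (+-cong (*ʳ {x = g * f} (sym (X^-+ k d)))(*ʳ {x = h * f} (sym (X^-+ e d)))) ⟩
   X^ (e ℕ.+ k ℕ.+ d) * (X^ (k ℕ.+ d) * (g * f) + X^ (e ℕ.+ d) * (h * f)) ∎)
   where
   l : ∀ e d k -> e ℕ.+ d ℕ.+ (k ℕ.+ d) ≡ e ℕ.+ k ℕ.+ d ℕ.+ d
   l = ℕsolve

  *-commᴸ : ∀ x y -> x *ᴸ y ≈ᴸ y *ᴸ x
  *-commᴸ (d , f)(e , g) = same (ℕP.+-comm d e)(*-comm f g)

 ringᴸ : CommutativeRing 0ℓ 0ℓ
 ringᴸ = record
  { Carrier = Carrierᴸ ; _≈_ = _≈ᴸ_ ; _+_ = _+ᴸ_ ; _*_ = _*ᴸ_ ; -_ = -ᴸ_ ; 0# = ι 0# ; 1# = ι 1#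
  ; isCommutativeRing = record
   { isRing = record
    { +-isAbelianGroup = record
     { isGroup = record
      { isMonoid = record
       { isSemigroup = record
        { isMagma = record { isEquivalence = record { refl = same refl rfl ; sym = symᴸ ; trans = transᴸ } ; ∙-cong = +-congᴸ }
        ; assoc = +-assocᴸ }
       ; identity = +-identityˡᴸ , \x -> transᴸ (+-commᴸ x (ι 0#))(+-identityˡᴸ x) }
      ; inverse = -‿inverseˡᴸ , \x -> transᴸ (+-commᴸ x (-ᴸ x))(-‿inverseˡᴸ x)
      ; ⁻¹-cong = \ { {d , f} {e , g} (eq p) -> eq (trans (sym (-‿distribʳ-* (X^ e) f))(trans (-‿cong p)(-‿distribʳ-* (X^ d) g))) } }
     ; comm = +-commᴸ }
    ; *-cong = *-congᴸ
    ; *-assoc = \ { (d , f)(e , g)(k , h) -> same (ℕP.+-assoc d e k)(*-assoc f g h) }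
    ; *-identity = (\ { (d , f) -> same refl (*-identityˡ f) }) , \ { (d , f) -> same (ℕP.+-identityʳ d)(*-identityʳ f) }
    ; distrib = (\x y z -> transᴸ (*-commᴸ x (y +ᴸ z))(transᴸ (distribʳᴸ x y z)(+-congᴸ (*-commᴸ y x)(*-commᴸ z x)))) , distribʳᴸ }
   ; *-comm = *-commᴸ } }

 ι-cong : ∀ {f g} -> f ≈ g -> ι f ≈ᴸ ι g
 ι-cong = same refl

 ι-+ : ∀ f g -> ι (f + g) ≈ᴸ ι f +ᴸ ι g
 ι-+ f g = same refl (sym (+-cong (trans (*ʳ {x = f} X0)(*-identityˡ f))(trans (*ʳ {x = g} X0)(*-identityˡ g))))

 ι-injective : ∀ {f g} -> ι f ≈ᴸ ι g -> f ≈ g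
 ι-injective (eq p) = X^-cancel 0 p

 algebraᴸ : ℤ-Algebra
 algebraᴸ = record
  { commRing = ringᴸ ; const = \c -> ι (const c)
  ; const-+ = \x y -> transᴸ (ι-cong (const-+ x y))(ι-+ (const x)(const y))
  ; const-* = \x y -> ι-cong (const-* x y) ; const-- = \x -> ι-cong (const-- x) ; const-0 = ι-cong const-0 ; const-1 = ι-cong const-1 }

 pos neg' : ℤ -> ℕ
 pos (+ n) = n
 pos -[1+ n ] = 0
 neg' (+ n) = 0
 neg' -[1+ n ] = suc n

 monoᴸ : ℤ -> Carrierᴸ
 monoᴸ x = neg' x , X^ (pos x)

 private
  split : ∀ x -> + pos x -' + neg' x ≡ x
  split (+ n) = ℤP.+-identityʳ (+ n)
  split -[1+ n ] = refl

  mono-+ᴸ : ∀ x y -> monoᴸ (x +' y) ≈ᴸ monoᴸ x *ᴸ monoᴸ y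
  mono-+ᴸ x y = eq (trans (sym (X^-+ (neg' x ℕ.+ neg' y)(pos (x +' y))))(trans (X-cong (ℤP.+-injective (≡.trans (l (+ pos x)(+ neg' x)(+ pos y)(+ neg' y)(+ pos (x +' y))(+ neg' (x +' y))(≡.trans (split (x +' y))(cong₂ _+'_ (≡.sym (split x))(≡.sym (split y))))) refl)))
   (trans (X^-+ (neg' (x +' y))(pos x ℕ.+ pos y))(*ˡ {x = X^ (neg' (x +' y))} (X^-+ (pos x)(pos y))))))
   where
   l : ∀ p n p' n′ p″ n″ -> p″ -' n″ ≡ (p -' n) +' (p' -' n′) -> (n +' n′) +' p″ ≡ n″ +' (p +' p')
   l p n p' n′ p″ n″ e = ≡.trans (l1 n n′ p″ n″)(≡.trans (cong (\z -> n +' n′ +' n″ +' z) e)(l2 p n p' n′ n″))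
    where
    l1 : ∀ n n′ p″ n″ -> (n +' n′) +' p″ ≡ n +' n′ +' n″ +' (p″ -' n″)
    l1 = ℤsolve
    l2 : ∀ p n p' n′ n″ -> n +' n′ +' n″ +' ((p -' n) +' (p' -' n′)) ≡ n″ +' (p +' p')
    l2 = ℤsolve

 -- For negative exponents 1/(1 - h^(-k)) = 1 - 1/(1 - h^k) is again a power series. The value at 0
 -- is a default.
 γᴸ : ℤ -> Carrierᴸ
 γᴸ (+ zero) = ι 0#
 γᴸ (+ suc n) = ι (invS (one-X (suc n)))
 γᴸ -[1+ n ] = ι (1# - invS (one-X (suc n)))

 Intᴸ : Carrierᴸ -> Set
 Intᴸ x = ∃ \f -> x ≈ᴸ ι f

 private
  module ᴸ = RingTools algebraᴸ

  one-minus-ι : ∀ f -> ι 1# ᴸ.- ι f ≈ᴸ ι (1# - f)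
  one-minus-ι f = symᴸ (ι-+ 1# (- f))

  inv-X : ∀ n -> invS (one-X (suc n)) * (1# - X^ (suc n)) ≈ 1#
  inv-X n = trans (*-comm (invS (one-X (suc n)))(1# - X^ (suc n)))(trans (*ʳ {x = invS (one-X (suc n))} (sym (one-X≋ (suc n))))(invS-inverseʳ (one-X (suc n)) refl))

  γ-invᴸ : ∀ {x} -> x ≢ 0' -> γᴸ x *ᴸ (ι 1# ᴸ.- monoᴸ x) ≈ᴸ ι 1#
  γ-invᴸ {+ zero} ne = contradiction refl ne
  γ-invᴸ {+ suc n} _ = transᴸ (*-congᴸ {ι g} {ι g} (same refl rfl)(one-minus-ι (X^ (suc n))))(ι-cong (inv-X n))
   where g = invS (one-X (suc n))
  γ-invᴸ { -[1+ n ]} _ = eq (begin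
   X^ 0 * ((1# - g) * (X^ (suc n) * 1# + X^ 0 * - X^ 0))
    ≈⟨ *-cong X0 (*ˡ {x = 1# - g} (+ˡ {x = X^ (suc n) * 1#} (*-cong X0 (-‿cong X0)))) ⟩
   _
    ≈⟨ solve 2 (\g m -> :1 :* ((:1 :- g) :* (m :* :1 :+ :1 :* :- :1)) := m :- :1 :+ g :* (:1 :- m)) rfl g (X^ (suc n)) ⟩
   _
    ≈⟨ +ˡ {x = X^ (suc n) - 1#} (inv-X n) ⟩
   _
    ≈⟨ solve 1 (\m -> m :- :1 :+ :1 := m :* :1) rfl (X^ (suc n)) ⟩
   X^ (suc n) * 1# ∎)
   where g = invS (one-X (suc n))

  halveᴸ : ∀ {x y} -> (ι 1# +ᴸ ι 1#) *ᴸ x ≈ᴸ (ι 1# +ᴸ ι 1#) *ᴸ y -> x ≈ᴸ y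
  halveᴸ {d , f} {e , g} (eq p) = eq (\k -> ℤP.*-cancelˡ-≡ (+ 2) _ _ (two (X^ e * f) k ⟨≡⟩ (trans (sym (move e f))(trans p (move d g)) k) ⟨≡⟩ ≡.sym (two (X^ d * g) k)))
   where
   infixl 1 _⟨≡⟩_
   _⟨≡⟩_ : ∀ {x y z : ℤ} -> x ≡ y -> y ≡ z -> x ≡ z
   _⟨≡⟩_ = ≡.trans
   two : ∀ h k -> + 2 *' h k ≡ (h + h) k
   two h k = l (h k)
    where
    l : ∀ a -> + 2 *' a ≡ a +' a
    l = ℤsolve
   move : ∀ e f -> X^ e * ((X^ 0 * 1# + X^ 0 * 1#) * f) ≈ X^ e * f + X^ e * f
   move e f = trans (*ˡ {x = X^ e} (*ʳ {x = f} (+-cong (trans (*ʳ {x = 1#} X0)(*-identityˡ 1#))(trans (*ʳ {x = 1#} X0)(*-identityˡ 1#)))))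
    (solve 2 (\x f -> x :* ((:1 :+ :1) :* f) := x :* f :+ x :* f) rfl (X^ e) f)

 laurent : Frame
 laurent = record
  { algebra = algebraᴸ ; mono = monoᴸ ; mono-0 = ι-cong X0 ; mono-+ = mono-+ᴸ ; γ = γᴸ ; γ-inv = γ-invᴸ
  ; Int = Intᴸ ; Int-resp = \ { p (f , e) -> f , transᴸ (symᴸ p) e }
  ; Int-+ = \ { (f , p)(g , r) -> f + g , transᴸ (+-congᴸ p r)(symᴸ (ι-+ f g)) }
  ; Int-* = \ { (f , p)(g , r) -> f * g , *-congᴸ p r }
  ; Int-- = \ { (f , p) -> - f , ᴸ.-‿cong p }
  ; Int-1 = 1# , same refl rfl ; Int-mono = \n -> X^ n , same refl rfl
  ; Int-γ = \ { {+ zero} ne -> contradiction refl ne ; {+ suc n} _ -> _ , same refl rfl ; { -[1+ n ]} _ -> _ , same refl rfl }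
  ; halve = halveᴸ }

 open Core laurent using (Small; _≡[_]_; cgr; small)

 congruent⇒coefficients : ∀ {K f g} -> ι f ≡[ K ] ι g -> ∀ {k} -> k < K -> f k ≡ g k
 congruent⇒coefficients {K} {f} {g} (cgr (w , (v , e) , p)) {k} k<K = ℤP.i-j≡0⇒i≡j (f k)(g k)(≡.trans (diff k)(≡.trans (X^-⊛ K v k)(delay-small K v k<K)))
  where
  diff : f - g ≈ X^ K * v
  diff = ι-injective (transᴸ (ι-+ f (- g))(transᴸ p (*-congᴸ {ι (X^ K)} {ι (X^ K)} (same refl rfl) e)))

 coefficients⇒congruent : ∀ {K f g} -> (∀ {k} -> k < K -> f k ≡ g k) -> ι f ≡[ K ] ι g
 coefficients⇒congruent {K} {f} {g} h = cgr (ι (drop K) , (drop K , same refl rfl) , transᴸ (symᴸ (ι-+ f (- g)))(ι-cong (\k -> ≡.sym (≡.trans (X^-⊛ K (drop K) k)(restore K (\ {k} -> zero-below {k}) k)))))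
  where
  diff : Series
  diff = f - g
  zero-below : ∀ {k} -> k < K -> diff k ≡ 0'
  zero-below {k} k<K = ≡.trans (cong (_-' g k)(h k<K))(ℤP.+-inverseʳ (g k))
  drop : ℕ -> Series
  drop d k = diff (d ℕ.+ k)
  restore : ∀ d {u : Series} -> (∀ {k} -> k < d -> u k ≡ 0') -> ∀ k -> delay d (\k -> u (d ℕ.+ k)) k ≡ u k
  restore zero z k = refl
  restore (suc d) z zero = ≡.sym (z (s≤s z≤n))
  restore (suc d) z (suc k) = restore d (\lt -> z (s≤s lt)) k

 embedding : Embedding laurent
 embedding = record
  { ι = ι ; ι-cong = ι-cong ; ι-+ = ι-+ ; ι-* = \f g -> same refl rfl ; ι-neg = \f -> same refl rfl
  ; ι-0 = same refl rfl ; ι-1 = same refl rfl ; ι-X = \n -> same refl rfl ; Int-ι = \f -> f , same refl rfl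
  ; mono-≥0 = \ { {j} {n} (eq h) -> contradiction (≡.trans (≡.sym (⊛-zero (X^ 0)(X^ 0)))(≡.trans (h 0)(⊛-zero (X^ (suc j))(X^ n))))(\()) }
  ; congruent⇒coefficients = congruent⇒coefficients ; coefficients⇒congruent = coefficients⇒congruent }

-- Families as sequences of columns.

cons : ∀ {A : Set} {k} -> A -> (Fin k -> A) -> Fin (suc k) -> A
cons x g Fin.zero = x
cons x g (Fin.suc i) = g i

at : ∀ {m} -> (Fin m -> ℕ) -> ℕ -> ℕ
at {m} c i with i ℕ.<? m
... | yes p = c (fromℕ< p)
... | no _ = 0

prepend : ∀ {m N} -> (Fin m -> ℕ) -> Fam m N -> Fam m (suc N)
prepend c s i = cons (c i)(s i)

private
 fromℕ<-suc : ∀ {i m} (p : suc i ℕ.< suc m)(p' : i ℕ.< m) -> fromℕ< p ≡ Fin.suc (fromℕ< p')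
 fromℕ<-suc p p' = FinP.toℕ-injective (≡.trans (FinP.toℕ-fromℕ< p)(cong suc (≡.sym (FinP.toℕ-fromℕ< p'))))

at-suc : ∀ {m} x (c : Fin m -> ℕ) i -> at (cons x c)(suc i) ≡ at c i
at-suc {m} x c i with suc i ℕ.<? suc m | i ℕ.<? m
... | yes p | yes p' = cong (cons x c)(fromℕ<-suc p p')
... | yes p | no ¬p' = contradiction (ℕP.≤-pred p) ¬p'
... | no ¬p | yes p' = contradiction (s≤s p') ¬p
... | no _ | no _ = refl

at-≥ : ∀ {m} (c : Fin m -> ℕ) i -> m ≤ i -> at c i ≡ 0
at-≥ {m} c i m≤i with i ℕ.<? m
... | yes p = contradiction m≤i (ℕP.<⇒≱ p)
... | no _ = refl

ext-0 : ∀ {m N} (c : Fin m -> ℕ)(s : Fam m N) i -> ext (prepend c s) i 0 ≡ at c i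
ext-0 {m} {N} c s i with i ℕ.<? m | 0 ℕ.<? suc N
... | yes p | yes r = refl
... | yes p | no ¬r = contradiction (s≤s z≤n) ¬r
... | no _ | _ = refl

ext-suc : ∀ {m N} (c : Fin m -> ℕ)(s : Fam m N) i a -> ext (prepend c s) i (suc a) ≡ ext s i a
ext-suc {m} {N} c s i a with i ℕ.<? m | suc a ℕ.<? suc N | a ℕ.<? N
... | yes p | yes r | yes r' = cong (cons (c (fromℕ< p))(s (fromℕ< p)))(fromℕ<-suc r r')
... | yes p | yes r | no ¬r' = contradiction (ℕP.≤-pred r) ¬r'
... | yes p | no ¬r | yes r' = contradiction (s≤s r') ¬r
... | yes p | no _ | no _ = refl
... | no _ | _ | yes _ = refl
... | no _ | _ | no _ = refl

ext-≥ʳ : ∀ {m N} (s : Fam m N) i a -> N ≤ a -> ext s i a ≡ 0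
ext-≥ʳ {m} {N} s i a N≤a with i ℕ.<? m | a ℕ.<? N
... | yes _ | yes r = contradiction N≤a (ℕP.<⇒≱ r)
... | yes _ | no _ = refl
... | no _ | _ = refl

ext-cong : ∀ {m N} {s s' : Fam m N} -> (∀ i j -> s i j ≡ s' i j) -> ∀ i a -> ext s i a ≡ ext s' i a
ext-cong {m} {N} h i a with i ℕ.<? m | a ℕ.<? N
... | yes p | yes r = h (fromℕ< p)(fromℕ< r)
... | yes _ | no _ = refl
... | no _ | _ = refl

column : (ℕ -> ℕ) -> (m : ℕ) -> Vec ℤ m
column e zero = []
column e (suc m) = + e 0 ∷ column (e ∘ suc) m

column-cong : ∀ m {e e' : ℕ -> ℕ} -> (∀ i -> e i ≡ e' i) -> column e m ≡ column e' m
column-cong zero h = refl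
column-cong (suc m) h = cong₂ (\x v -> + x ∷ v)(h 0)(column-cong m (h ∘ suc))

hd-column : ∀ m (e : ℕ -> ℕ) -> e m ≡ 0 -> hd (column e m) ≡ + e 0
hd-column zero e z = cong +_ (≡.sym z)
hd-column (suc m) e z = refl

module FamilySums (𝓕 : Frame) where
 open Core 𝓕

 private
  -- `funs` builds its functions by pattern matching, so they agree with `cons x g` pointwise only;
  -- the summands therefore have to respect pointwise equality.
  Ext : ∀ {A : Set} {k} -> ((Fin k -> A) -> Carrier) -> Set
  Ext {A} {k} F = ∀ {f g : Fin k -> A} -> (∀ i -> f i ≡ g i) -> F f ≈ F g

  Ext2 : ∀ {m N} -> (Fam m N -> Carrier) -> Set
  Ext2 {m} {N} F = ∀ {f g : Fam m N} -> (∀ i j -> f i j ≡ g i j) -> F f ≈ F g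

 ∑-funs : ∀ {A : Set} k (xs : List A) F -> Ext F -> ∑ (funs (suc k) xs) F ≈ ∑ xs (\x -> ∑ (funs k xs)(\g -> F (cons x g)))
 ∑-funs k xs F h = trans (∑-concatMap _ xs F)(∑-cong xs (\x -> trans (∑-map _ (funs k xs) F)(∑-cong (funs k xs)(\g -> h (\ { Fin.zero -> refl ; (Fin.suc i) -> refl })))))

 ∑-box-funs : ∀ B m F -> ∑ (box B m) F ≈ ∑ (funs m (upTo (suc B)))(\c -> F (column (at c) m))
 ∑-box-funs B zero F = rfl
 ∑-box-funs B (suc m) F = trans (trans (∑-concatMap (\s -> map (+ s ∷_)(box B m))(upTo (suc B)) F)(∑-cong (upTo (suc B))(\s -> trans (∑-map (+ s ∷_)(box B m) F)(∑-box-funs B m (\v -> F (+ s ∷ v))))))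
  (sym (trans (∑-funs m (upTo (suc B)) _ (\ {f} {g} h -> reflexive (cong F (column-cong (suc m)(at-cong h)))))
   (∑-cong (upTo (suc B))(\s -> ∑-cong (funs m (upTo (suc B)))(\c -> reflexive (cong (\v -> F (+ s ∷ v))(column-cong m (at-suc s c))))))))
  where
  at-cong : ∀ {m} {f g : Fin m -> ℕ} -> (∀ i -> f i ≡ g i) -> ∀ i -> at f i ≡ at g i
  at-cong {m} h i with i ℕ.<? m
  ... | yes p = h (fromℕ< p)
  ... | no _ = refl

 ∑-empty : ∀ m (xs : List ℕ)(F : Fam m 0 -> Carrier) -> Ext2 F -> ∀ s -> ∑ (funs m (funs 0 xs)) F ≈ F s
 ∑-empty zero xs F h s = trans (+-identityʳ _)(h (\()))
 ∑-empty (suc m) xs F h s = trans (∑-funs m (funs 0 xs) F (\e -> h (\i j -> cong (\r -> r j)(e i))))(trans (+-identityʳ _)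
  (trans (∑-empty m xs (\g -> F (cons (\()) g))(\e -> h (\ { Fin.zero () ; (Fin.suc i)() }))(\i -> s (Fin.suc i)))(h (\i ()))))

 ∑-prepend : ∀ m N (xs : List ℕ)(F : Fam m (suc N) -> Carrier) -> Ext2 F ->
  ∑ (funs m (funs (suc N) xs)) F ≈ ∑ (funs m xs)(\c -> ∑ (funs m (funs N xs))(\s -> F (prepend c s)))
 ∑-prepend zero N xs F h = +ʳ (sym (trans (+-identityʳ _)(h (\()))))
 ∑-prepend (suc m) N xs F h = begin
  ∑ (funs (suc m)(funs (suc N) xs)) F
   ≈⟨ ∑-funs m (funs (suc N) xs) F (\e -> h (\i j -> cong (\r -> r j)(e i))) ⟩
  _
   ≈⟨ ∑-funs N xs _ (\e -> ∑-cong (funs m (funs (suc N) xs))(\g -> h (\ { Fin.zero j -> e j ; (Fin.suc i) j -> refl }))) ⟩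
  _
   ≈⟨ ∑-cong xs (\x -> ∑-cong (funs N xs)(\r -> ∑-prepend m N xs (\g -> F (cons (cons x r) g))(\e -> h (\ { Fin.zero j -> refl ; (Fin.suc i) j -> e i j })))) ⟩
  _
   ≈⟨ ∑-cong xs (\x -> ∑-swap (funs N xs)(funs m xs) _) ⟩
  _
   ≈⟨ ∑-cong xs (\x -> ∑-cong (funs m xs)(\c -> trans (∑-cong (funs N xs)(\r -> ∑-cong (funs m (funs N xs))(\s -> h (\ { Fin.zero j -> refl ; (Fin.suc i) j -> refl }))))
      (sym (∑-funs m (funs N xs)(\s -> F (prepend (cons x c) s))(\e -> h (\i -> \ { Fin.zero -> refl ; (Fin.suc j) -> cong (\r -> r j)(e i) })))))) ⟩
  _
   ≈⟨ sym (∑-funs m xs _ (\e -> ∑-cong (funs (suc m)(funs N xs))(\s -> h (\i -> \ { Fin.zero -> e i ; (Fin.suc j) -> refl })))) ⟩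
  ∑ (funs (suc m) xs)(\c -> ∑ (funs (suc m)(funs N xs))(\s -> F (prepend c s))) ∎

-- The chain of skew functions as a sum over families.

module Multisum (𝓕 : Frame)(P : ℕ)(0<P : 0 < P)(m0 B : ℕ) where
 open Chain 𝓕 P 0<P hiding (B)
 open FamilySums 𝓕

 m : ℕ
 m = suc m0

 cells : ℕ -> (ℕ -> ℕ -> ℕ) -> ℕ -> Carrier
 cells z E a = ∏ (upTo m)(\i -> cell (+ suc (z ℕ.+ z))(+ E i a)(+ E i (suc a))(+ E (suc i) a)(+ E (suc i)(suc a)))

 Term : ℕ -> ℕ -> (ℕ -> ℕ -> ℕ) -> Carrier
 Term z N E = ∏ (upTo N)(\a -> cells (z ℕ.+ a) E a)

 cells-cong : ∀ z {E E' : ℕ -> ℕ -> ℕ} a a' -> (∀ i -> E i a ≡ E' i a') -> (∀ i -> E i (suc a) ≡ E' i (suc a')) -> cells z E a ≈ cells z E' a'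
 cells-cong z {E} {E'} a a' h h' = ∏-cong (upTo m)(\i -> reflexive (≡.trans
  (cong₂ (\x y -> cell (+ suc (z ℕ.+ z))(+ x)(+ y)(+ E (suc i) a)(+ E (suc i)(suc a)))(h i)(h' i))
  (cong₂ (\x y -> cell (+ suc (z ℕ.+ z))(+ E' i a')(+ E' i (suc a'))(+ x)(+ y))(h (suc i))(h' (suc i)))))

 Term-cong : ∀ z N {E E' : ℕ -> ℕ -> ℕ} -> (∀ i a -> E i a ≡ E' i a) -> Term z N E ≈ Term z N E'
 Term-cong z N {E} {E'} h = ∏-cong (upTo N)(\a -> cells-cong (z ℕ.+ a) {E} {E'} a a (\i -> h i a)(\i -> h i (suc a)))

 W-column : ∀ k z (e e' : ℕ -> ℕ) -> e k ≡ 0 -> e' k ≡ 0 -> W z (column e k)(column e' k) ≈ ∏ (upTo k)(\i -> cell z (+ e i)(+ e' i)(+ e (suc i))(+ e' (suc i)))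
 W-column zero z e e' p p' = rfl
 W-column (suc k) z e e' p p' = sym (trans (∏-upTo-suc k _)(*-cong (reflexive (≡.sym (cong₂ (cell z (+ e 0)(+ e' 0))(hd-column k (e ∘ suc) p)(hd-column k (e' ∘ suc) p'))))
  (sym (W-column k z (e ∘ suc)(e' ∘ suc) p p'))))

 -- The chain ends at the empty alphabet, where only the zero columns survive: this is the
 -- convention that the column of index N is 0.
 ∑-Pc-[] : ∀ k (F : Vec ℤ k -> Carrier) -> ∑ (box B k)(\v -> F v * Pc v []) ≈ F (column (\_ -> 0) k)
 ∑-Pc-[] zero F = trans (+-identityʳ _)(*-identityʳ _)
 ∑-Pc-[] (suc k) F = trans (∑-box B k _)(trans (∑-cong (upTo (suc B))(\s -> trans (∑-cong (box B k)(\v -> trans (*ˡ (+-identityʳ _))(solve 3 (\f i p -> f :* (:1 :* (i :* (:1 :* p))) := i :* (f :* p)) rfl _ _ _)))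
  (trans (∑-*ˡ (is 0 (+ s))(box B k) _)(*ˡ (∑-Pc-[] k (\v -> F (+ s ∷ v)))))))(∑-is 0 B (\s -> F (s ∷ column (\_ -> 0) k)) z≤n))

 private
  xs : List ℕ
  xs = upTo (suc B)

 chain-sum : ∀ k i (c : Fin m -> ℕ) -> chain B (odds i (suc k))(column (at c) m) ≈ ∑ (funs m (funs k xs))(\s -> Term i (suc k)(ext (prepend c s)))
 chain-sum zero i c = begin
  ∑ (box B m)(\v -> W z (column (at c) m) v * Pc v [])
   ≈⟨ ∑-Pc-[] m (W z (column (at c) m)) ⟩
  _
   ≈⟨ W-column m z (at c)(\_ -> 0)(at-≥ c m ℕP.≤-refl) refl ⟩
  _
   ≈⟨ sym (trans (*-identityʳ _)(trans (reflexive (cong (\y -> cells y (ext (prepend c s0)) 0)(ℕP.+-identityʳ i)))(cells-cong i {ext (prepend c s0)} {\j -> \ { zero -> at c j ; (suc _) -> 0 }} 0 0 (ext-0 c s0)(\j -> ext-≥ʳ (prepend c s0) j 1 ℕP.≤-refl)))) ⟩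
  _
   ≈⟨ sym (∑-empty m xs (\s -> Term i 1 (ext (prepend c s)))(\ {f} {g} e -> Term-cong i 1 {ext (prepend c f)} {ext (prepend c g)} (ext-cong {s = prepend c f} {prepend c g} (\j -> \ { Fin.zero -> refl ; (Fin.suc a) -> e j a }))) s0) ⟩
  ∑ (funs m (funs 0 xs))(\s -> Term i 1 (ext (prepend c s))) ∎
  where
  z = + suc (i ℕ.+ i)
  s0 : Fam m 0
  s0 _ ()
 chain-sum (suc k) i c = begin
  ∑ (box B m)(\v -> W z (column (at c) m) v * chain B (odds (suc i)(suc k)) v)
   ≈⟨ ∑-box-funs B m _ ⟩
  _
   ≈⟨ ∑-cong (funs m xs)(\c' -> trans (*ˡ (chain-sum k (suc i) c'))(trans (sym (∑-*ˡ _ (funs m (funs k xs)) _))(∑-cong (funs m (funs k xs))(\s -> sym (step c' s))))) ⟩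
  _
   ≈⟨ sym (∑-prepend m k xs (\s -> Term i (suc (suc k))(ext (prepend c s)))(\ {f} {g} e -> Term-cong i (suc (suc k)) {ext (prepend c f)} {ext (prepend c g)} (ext-cong {s = prepend c f} {prepend c g} (\j -> \ { Fin.zero -> refl ; (Fin.suc a) -> e j a })))) ⟩
  ∑ (funs m (funs (suc k) xs))(\s -> Term i (suc (suc k))(ext (prepend c s))) ∎
  where
  z = + suc (i ℕ.+ i)
  step : ∀ c' s -> Term i (suc (suc k))(ext (prepend c (prepend c' s))) ≈ W z (column (at c) m)(column (at c') m) * Term (suc i)(suc k)(ext (prepend c' s))
  step c' s = trans (∏-upTo-suc (suc k) _)(*-cong
   (trans (trans (reflexive (cong (\y -> cells y (ext (prepend c (prepend c' s))) 0)(ℕP.+-identityʳ i)))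
     (cells-cong i {ext (prepend c (prepend c' s))} {\j -> \ { zero -> at c j ; (suc _) -> at c' j }} 0 0 (ext-0 c (prepend c' s))(\j -> ≡.trans (ext-suc c (prepend c' s) j 0)(ext-0 c' s j))))
    (sym (W-column m z (at c)(at c')(at-≥ c m ℕP.≤-refl)(at-≥ c' m ℕP.≤-refl))))
   (∏-cong (upTo (suc k))(\a -> trans (reflexive (cong (\y -> cells y (ext (prepend c (prepend c' s)))(suc a))(ℕP.+-suc i a)))(cells-cong (suc i ℕ.+ a) {ext (prepend c (prepend c' s))} {ext (prepend c' s)} (suc a) a (\j -> ext-suc c (prepend c' s) j a)(\j -> ext-suc c (prepend c' s) j (suc a))))))

 links : (ℕ -> ℕ -> ℕ) -> Carrier
 links E = ∏ (upTo m0)(\i -> χℤ (+ E i 0 -' + E (suc i) 0))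

 link-column : ∀ k (e : ℕ -> ℕ) -> link (+ e 0)(column (e ∘ suc) k) ≈ ∏ (upTo k)(\i -> χℤ (+ e i -' + e (suc i)))
 link-column zero e = rfl
 link-column (suc k) e = trans (*ˡ (link-column k (e ∘ suc)))(sym (∏-upTo-suc k _))

 multisum-families : ∀ k -> multisum m0 B (odds 0 (suc k)) ≈ ∑ (funs m (funs (suc k) xs))(\s -> links (ext s) * Term 0 (suc k)(ext s))
 multisum-families k = begin
  multisum m0 B (odds 0 (suc k))
   ≈⟨ sym (∑-box B m0 G') ⟩
  _
   ≈⟨ ∑-box-funs B m G' ⟩
  _
   ≈⟨ ∑-cong (funs m xs)(\c -> trans (*-cong (link-column m0 (at c))(chain-sum k 0 c))(trans (sym (∑-*ˡ _ (funs m (funs k xs)) _))(∑-cong (funs m (funs k xs))(\s -> *ʳ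
      (∏-cong (upTo m0)(\i -> reflexive (cong₂ (\x y -> χℤ (+ x -' + y))(≡.sym (ext-0 c s i))(≡.sym (ext-0 c s (suc i)))))))))) ⟩
  _
   ≈⟨ sym (∑-prepend m k xs (\s -> links (ext s) * Term 0 (suc k)(ext s))(\ {f} {g} e -> *-cong (∏-cong (upTo m0)(\i -> reflexive (cong₂ (\x y -> χℤ (+ x -' + y))(ext-cong {s = f} {g} e i 0)(ext-cong {s = f} {g} e (suc i) 0))))(Term-cong 0 (suc k) {ext f} {ext g} (ext-cong {s = f} {g} e)))) ⟩
  ∑ (funs m (funs (suc k) xs))(\s -> links (ext s) * Term 0 (suc k)(ext s)) ∎
  where
  G' : Vec ℤ m -> Carrier
  G' (s ∷ ss) = link s ss * chain B (odds 0 (suc k))(s ∷ ss)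

-- Translation of the left-hand side.

module Embedded (𝓕 : Frame)(𝓔 : Embedding 𝓕) where
 open Core 𝓕
 open Embedding 𝓔

 prodS-++ : ∀ xs ys -> prodS (xs ++ ys) ≋ prodS xs ⊛ prodS ys
 prodS-++ [] ys k = ≡.sym (⊛-identityˡ (prodS ys) k)
 prodS-++ (x ∷ xs) ys k = ≡.trans (⊛-cong {x} {x} (\_ -> refl)(prodS-++ xs ys) k)(≡.sym (⊛-assoc x (prodS xs)(prodS ys) k))

 ι-∏ : ∀ {A : Set} (f : A -> Series) xs -> ι (prodS (map f xs)) ≈ ∏ xs (\x -> ι (f x))
 ι-∏ f [] = ι-1
 ι-∏ f (x ∷ xs) = trans (ι-* (f x)(prodS (map f xs)))(*ˡ (ι-∏ f xs))

 ι-∏∏ : ∀ {A C : Set} (f : A -> C -> Series)(ys : A -> List C) xs -> ι (prodS (concatMap (\x -> map (f x)(ys x)) xs)) ≈ ∏ xs (\x -> ∏ (ys x)(\y -> ι (f x y)))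
 ι-∏∏ f ys [] = ι-1
 ι-∏∏ f ys (x ∷ xs) = trans (trans (ι-cong (prodS-++ (map (f x)(ys x))(concatMap (\x -> map (f x)(ys x)) xs)))(ι-* (prodS (map (f x)(ys x)))(prodS (concatMap (\x -> map (f x)(ys x)) xs))))(*-cong (ι-∏ (f x)(ys x))(ι-∏∏ f ys xs))

 ι-fac : ∀ e -> ι (oneS ⊕ monoS -1ℤ e) ≈ 1# - mono (+ e)
 ι-fac e = trans (ι-cong (one-X≋ e))(trans (ι-+ oneS (negS (X^ e)))(+-cong ι-1 (trans (ι-neg (X^ e))(-‿cong (ι-X e)))))

 ι-poch : ∀ α β j -> ι (poch (+ 1) α β j) ≈ ∏ (upTo j)(\i -> 1# - mono (+ (α ℕ.+ i ℕ.* β)))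
 ι-poch α β j = trans (ι-∏ _ (upTo j))(∏-cong (upTo j)(\i -> ι-fac (α ℕ.+ i ℕ.* β)))

 poch-0 : ∀ α β j -> poch (+ 1)(suc α) β j 0 ≡ 1'
 poch-0 α β j = go (upTo j)
  where
  go : ∀ xs -> prodS (map (\i -> oneS ⊕ monoS -1ℤ (suc α ℕ.+ i ℕ.* β)) xs) 0 ≡ 1'
  go [] = refl
  go (x ∷ xs) = ≡.trans (⊛-zero (oneS ⊕ monoS -1ℤ (suc α ℕ.+ x ℕ.* β))(prodS (map (\i -> oneS ⊕ monoS -1ℤ (suc α ℕ.+ i ℕ.* β)) xs)))(cong (1' *'_)(go xs))

summandᴺ : ∀ m0 N -> Fam (suc m0) N -> Series
summandᴺ m0 N s = shiftZ (twoA s +' + colSum s 0)(calB (2 ℕ.* N) s ⊛ prodS (map (\i -> poch (-' (+ 1)) N N (ext s i 0 ∸ ext s (suc i) 0))(upTo m0)))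

-- Abstract, so that conversion checking does not unfold the two sides of the theorem.
abstract
 lhsᴺ : ℕ -> ℕ -> ℕ -> Series
 lhsᴺ m0 N B K = sumℤ (map (\s -> summandᴺ m0 N s K)(filterᵇ valid (funs (suc m0)(funs N (upTo (suc B))))))

 lhsᴺ-def : ∀ m0 N B K -> lhsᴺ m0 N B K ≡ sumℤ (map (\s -> summandᴺ m0 N s K)(filterᵇ valid (funs (suc m0)(funs N (upTo (suc B))))))
 lhsᴺ-def m0 N B K = refl

 lhsPartial-lhsᴺ : ∀ m0 n B K -> lhsPartial (suc m0) n B K ≡ lhsᴺ m0 (n′ n) B K
 lhsPartial-lhsᴺ m0 n B K = refl

module Translate (𝓕 : Frame)(𝓔 : Embedding 𝓕)(k m0 B : ℕ) where
 N : ℕ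
 N = suc k
 open Embedding 𝓔
 open Embedded 𝓕 𝓔
 open Chain 𝓕 N (s≤s z≤n) hiding (B)
 open Multisum 𝓕 N (s≤s z≤n) m0 B

 ι-qp : ∀ j -> ι (qp (2 ℕ.* N) j) ≈ qf (+ j)
 ι-qp j = trans (ι-poch (2 ℕ.* N)(2 ℕ.* N) j)(go j)
  where
  l : ∀ N j -> 2 ℕ.* N ℕ.+ j ℕ.* (2 ℕ.* N) ≡ (N ℕ.+ N) ℕ.* suc j
  l = ℕsolve
  go : ∀ j -> ∏ (upTo j)(\i -> 1# - mono (+ (2 ℕ.* N ℕ.+ i ℕ.* (2 ℕ.* N)))) ≈ qf (+ j)
  go zero = rfl
  go (suc j) = trans (∏-upTo-last j _)(*-cong (go j)(+ˡ (-‿cong (mono-cong (≡.trans (cong +_ (l N j))(ℤP.pos-* (N ℕ.+ N)(suc j)))))))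

 ι-χ : ∀ j -> ι (poch (-' (+ 1)) N N j) ≈ χ j
 ι-χ j = trans (ι-∏ _ (upTo j))(go j)
  where
  power : ∀ j -> mono (+ (j ℕ.* N)) ≈ τ ^ j
  power zero = mono-0
  power (suc j) = trans (mono-+ (+ N)(+ (j ℕ.* N)))(*ˡ (power j))
  go : ∀ j -> ∏ (upTo j)(\i -> ι (oneS ⊕ monoS (+ 1)(N ℕ.+ i ℕ.* N))) ≈ χ j
  go zero = rfl
  go (suc j) = trans (∏-upTo-last j _)(*-cong (go j)(trans (ι-+ oneS (X^ (N ℕ.+ j ℕ.* N)))(+-cong ι-1 (trans (ι-X (N ℕ.+ j ℕ.* N))(power (suc j))))))

 ι-inverse : ∀ f {x y} -> f 0 ≡ 1' -> ι f ≈ x -> x * y ≈ 1# -> ι (invS f) ≈ y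
 ι-inverse f {x} {y} f0 p r = unit-cancel {ι f} {ι (invS f)} (trans (*-comm (ι (invS f))(ι f)) inv1)(trans inv1 (sym (trans (*ʳ p) r)))
  where
  inv1 : ι f * ι (invS f) ≈ 1#
  inv1 = trans (sym (ι-* f (invS f)))(trans (ι-cong (invS-inverseʳ f f0)) ι-1)

 ι-iq : ∀ j -> ι (invS (qp (2 ℕ.* N) j)) ≈ iq (+ j)
 ι-iq j = ι-inverse (qp (2 ℕ.* N) j)(poch-0 _ (2 ℕ.* N) j)(ι-qp j)(qf-iq j)

 ι-iq2 : ∀ i j -> ι (invS (qp (2 ℕ.* N) i ⊛ qp (2 ℕ.* N) j)) ≈ iq (+ i) * iq (+ j)
 ι-iq2 i j = ι-inverse (qp (2 ℕ.* N) i ⊛ qp (2 ℕ.* N) j)(≡.trans (⊛-zero (qp (2 ℕ.* N) i)(qp (2 ℕ.* N) j))(cong₂ _*'_ (poch-0 _ (2 ℕ.* N) i)(poch-0 _ (2 ℕ.* N) j)))(trans (ι-* (qp (2 ℕ.* N) i)(qp (2 ℕ.* N) j))(*-cong (ι-qp i)(ι-qp j)))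
  (trans (x*y*[z*u]≈x*z*[y*u] (qf (+ i))(qf (+ j))(iq (+ i))(iq (+ j)))(trans (*-cong (qf-iq i)(qf-iq j))(*-identityˡ 1#)))

 shiftZ-+ : ∀ n F -> shiftZ (+ n) F ≋ X^ n ⊛ F
 shiftZ-+ n F K = ≡.trans (unfolded (+ n) K)(≡.trans (cong (sh F)(ℤP.m-n≡m⊖n K n))(≡.trans (delayed n K)(≡.sym (X^-⊛ n F K))))
  where
  sh : Series -> ℤ -> ℤ
  sh F (+ j) = F j
  sh F -[1+ _ ] = 0'
  unfolded : ∀ e K -> shiftZ e F K ≡ sh F ((+ K) -' e)
  unfolded e K with (+ K) -' e
  ... | + _ = refl
  ... | -[1+ _ ] = refl
  delayed : ∀ n K -> sh F (K ⊖ n) ≡ delay n F K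
  delayed zero K = refl
  delayed (suc n) zero = refl
  delayed (suc n)(suc K) = ≡.trans (cong (sh F)(ℤP.[1+m]⊖[1+n]≡m⊖n K n))(delayed n K)

 -- The sign of e is not computed: h^e is also known as a nonnegative power, so a negative e is
 -- excluded by `mono-≥0`.
 ι-shiftZ : ∀ {e x} F -> mono e ≈ x -> (∃ \n -> x ≈ mono (+ n)) -> ι (shiftZ e F) ≈ mono e * ι F
 ι-shiftZ {+ n} F _ _ = trans (ι-cong (shiftZ-+ n F))(trans (ι-* (X^ n) F)(*ʳ (ι-X n)))
 ι-shiftZ { -[1+ j ]} F p (n , r) = ⊥-elim (mono-≥0 (trans p r))

 ∏-bound : ∀ n {F G : ℕ -> Carrier} -> (∀ i -> i < n -> F i ≈ G i) -> ∏ (upTo n) F ≈ ∏ (upTo n) G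
 ∏-bound n h = ∏-congAll (AllP.applyUpTo⁺₁ id n (\ {i} -> h i))

 monomial : ∀ n {F : ℕ -> Carrier} -> (∀ i -> i < n -> ∃ \j -> F i ≈ mono (+ j)) -> ∃ \j -> ∏ (upTo n) F ≈ mono (+ j)
 monomial zero h = 0 , sym mono-0
 monomial (suc n) {F} h with monomial n {F} (\i i<n -> h i (ℕP.m<n⇒m<1+n i<n)) | h n ℕP.≤-refl
 ... | j , p | j' , p' = j ℕ.+ j' , trans (∏-upTo-last n F)(trans (*-cong p p')(sym (mono-+ (+ j)(+ j'))))

 mono-sum : ∀ {A : Set} c (f : A -> ℤ) xs -> mono (c *' sumℤ (map f xs)) ≈ ∏ xs (\x -> mono (c *' f x))
 mono-sum c f [] = trans (mono-cong (ℤP.*-zeroʳ c)) mono-0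
 mono-sum c f (x ∷ xs) = trans (mono-cong (ℤP.*-distribˡ-+ c (f x) _))(trans (mono-+ _ _)(*ˡ (mono-sum c f xs)))

 ind : Bool -> Carrier
 ind b = if b then 1# else 0#

 allB-∏ : ∀ xs (p : ℕ -> Bool) -> ind (allB xs p) ≈ ∏ xs (\x -> ind (p x))
 allB-∏ [] p = rfl
 allB-∏ (x ∷ xs) p with p x
 ... | true = trans (allB-∏ xs p)(sym (*-identityˡ (∏ xs (\x -> ind (p x)))))
 ... | false = sym (zeroˡ (∏ xs (\x -> ind (p x))))

 allB-true : ∀ n (p : ℕ -> Bool) -> T (allB (upTo n) p) -> ∀ i -> i < n -> T (p i)
 allB-true n p t i i<n = AllP.applyUpTo⁻ id n (go (upTo n) t) i<n
  where
  go : ∀ xs -> T (allB xs p) -> All (\x -> T (p x)) xs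
  go [] _ = []
  go (x ∷ xs) t with p x in e
  ... | true = subst T (≡.sym e) tt ∷ go xs t

 module Summand (E : ℕ -> ℕ -> ℕ)(E-zero : ∀ i a -> N ≤ a -> E i a ≡ 0) where
  private
   d H A' : ℕ -> ℕ -> ℤ
   d i a = + E i a -' + E i (suc a)
   H i a = + E i a -' + E (suc i) a
   A' i a = + E i a -' + E (suc i)(suc a)

   ok : ℕ -> ℕ -> Bool
   ok i j = (E (suc i) j ≤ᵇ E i j) ∧ (E i (suc j) ≤ᵇ E i j)

   C : ℕ -> ℕ -> Carrier
   C a i = cell (+ suc (a ℕ.+ a))(+ E i a)(+ E i (suc a))(+ E (suc i) a)(+ E (suc i)(suc a))

   iq-zero : ∀ x y -> ¬ (x ≤ y) -> iq (+ y -' + x) ≈ 0#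
   iq-zero x y ¬p with sign-cases (+ y -' + x)
   ... | inj₁ nn = contradiction (ℤP.drop‿+≤+ (ℤP.0≤i-j⇒j≤i nn)) ¬p
   ... | inj₂ z = z

   -- The differences that validity wants to be nonnegative are arguments of `iq` in the cell, so a
   -- violated inequality makes the cell vanish; filtering by `valid` changes nothing.
   C-ok : ∀ a i -> C a i ≈ C a i * ind (ok i a)
   C-ok a i with E (suc i) a ≤ᵇ E i a in e1 | E i (suc a) ≤ᵇ E i a in e2
   ... | true | true = sym (*-identityʳ _)
   ... | true | false = trans (trans (*ʳ (*ˡ (trans (*ʳ (trans (*ˡ (iq-zero (E i (suc a))(E i a)(\p -> subst T e2 (ℕP.≤⇒≤ᵇ p))))(zeroʳ (qf (A' i a)))))(zeroˡ (tC (d i a))))))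
     (trans (*ʳ (zeroʳ (mono (+ suc (a ℕ.+ a) *' d i a))))(zeroˡ (iq (H i a)))))(sym (zeroʳ (C a i)))
   ... | false | _ = trans (trans (*ˡ (iq-zero (E (suc i) a)(E i a)(\p -> subst T e1 (ℕP.≤⇒≤ᵇ p))))(zeroʳ _))(sym (zeroʳ (C a i)))

   validᴱ : Bool
   validᴱ = allB (upTo m)(\i -> allB (upTo N)(ok i))

   colSumᴱ : ℕ -> ℕ
   colSumᴱ j = foldr ℕ._+_ 0 (map (\i -> E i j)(upTo m))

   twoAᴱ : ℤ
   twoAᴱ = -' ((+ N) *' (+ colSumᴱ 0)) +' (+ 2) *' sumℤ (map (\j -> + colSumᴱ (suc j))(upTo k))
    +' (+ N) *' sumℤ (map (\i -> sumℤ (map (\a -> d i a *' d i a)(upTo N)))(upTo m))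

   A⁻ H⁻ : ℕ -> ℕ -> ℕ
   A⁻ i a = E i a ∸ E (suc i)(suc a)
   H⁻ i a = E i a ∸ E (suc i) a

   body : ℕ -> ℕ -> Series
   body i a = qp (2 ℕ.* N)(A⁻ i a) ⊛ invS (qp (2 ℕ.* N)(E i a ∸ E i (suc a)) ⊛ qp (2 ℕ.* N)(H⁻ i (suc a)))

   last : ℕ -> Series
   last i = invS (qp (2 ℕ.* N)(H⁻ i 0))

   calBᴱ tailᴱ : Series
   calBᴱ = prodS (concatMap (\i -> map (body i)(upTo N))(upTo m)) ⊛ prodS (map last (upTo m))
   tailᴱ = prodS (map (\i -> poch (-' (+ 1)) N N (H⁻ i 0))(upTo m0))

  Term-valid : Term 0 N E ≈ Term 0 N E * ind validᴱ
  Term-valid = begin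
   ∏ (upTo N)(\a -> ∏ (upTo m)(C a))
    ≈⟨ ∏-cong (upTo N)(\a -> trans (∏-cong (upTo m)(C-ok a))(∏-* (upTo m)(C a)(\i -> ind (ok i a)))) ⟩
   ∏ (upTo N)(\a -> ∏ (upTo m)(C a) * ∏ (upTo m)(\i -> ind (ok i a)))
    ≈⟨ ∏-* (upTo N) _ _ ⟩
   Term 0 N E * ∏ (upTo N)(\a -> ∏ (upTo m)(\i -> ind (ok i a)))
    ≈⟨ *ˡ (trans (∏-swap (upTo N)(upTo m) _)(sym (trans (allB-∏ (upTo m) _)(∏-cong (upTo m)(\i -> allB-∏ (upTo N)(ok i)))))) ⟩
   Term 0 N E * ind validᴱ ∎

  module _ (v : T validᴱ) where
   private
    down-i : ∀ i j -> i < m -> j < N -> E (suc i) j ≤ E i j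
    down-i i j i<m j<N with E (suc i) j ≤ᵇ E i j in e | allB-true N (ok i)(allB-true m (\i -> allB (upTo N)(ok i)) v i i<m) j j<N
    ... | true | _ = ℕP.≤ᵇ⇒≤ (E (suc i) j)(E i j)(subst T (≡.sym e) tt)

    down-j : ∀ i j -> i < m -> j < N -> E i (suc j) ≤ E i j
    down-j i j i<m j<N with E (suc i) j ≤ᵇ E i j | E i (suc j) ≤ᵇ E i j in e | allB-true N (ok i)(allB-true m (\i -> allB (upTo N)(ok i)) v i i<m) j j<N
    ... | true | true | _ = ℕP.≤ᵇ⇒≤ (E i (suc j))(E i j)(subst T (≡.sym e) tt)

    down-i' : ∀ i j -> i < m -> E (suc i) j ≤ E i j
    down-i' i j i<m with ℕP.<-≤-connex j N
    ... | inj₁ j<N = down-i i j i<m j<N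
    ... | inj₂ N≤j = subst (_≤ E i j)(≡.sym (E-zero (suc i) j N≤j)) z≤n

    monus : ∀ {x y} -> y ≤ x -> + (x ∸ y) ≡ + x -' + y
    monus {x} {y} p = ≡.sym (≡.trans (ℤP.m-n≡m⊖n x y)(ℤP.⊖-≥ p))

   expo : ℕ -> ℕ -> ℤ
   expo i a = + suc (a ℕ.+ a) *' d i a +' + N *' (d i a *' d i a -' d i a)

   private
    colSum-cast : ∀ j -> + colSumᴱ j ≡ sumℤ (map (\i -> + E i j)(upTo m))
    colSum-cast j = go (upTo m)
     where
     go : ∀ xs -> + foldr ℕ._+_ 0 (map (\i -> E i j) xs) ≡ sumℤ (map (\i -> + E i j) xs)
     go [] = refl
     go (x ∷ xs) = cong (\z -> + E x j +' z)(go xs)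

    mono-colSum : ∀ c j -> mono (c *' + colSumᴱ j) ≈ ∏ (upTo m)(\i -> mono (c *' + E i j))
    mono-colSum c j = trans (mono-cong (cong (c *'_)(colSum-cast j)))(mono-sum c _ (upTo m))

    lin : ℕ -> ℕ -> ℤ
    lin i a = (+ suc (a ℕ.+ a) -' + N) *' d i a

    -- Summation by parts in the row i.
    abel : ∀ i j -> ∏ (upTo (suc j))(\a -> mono (lin i a)) ≈ mono (-' + N *' + E i 0) * mono (1' *' + E i 0) * ∏ (upTo j)(\a -> mono (+ 2 *' + E i (suc a))) * mono ((+ N -' 1' -' + 2 *' + j) *' + E i (suc j))
    abel i zero = trans (*-identityʳ _)(trans (mono-cong (l (+ N)(+ E i 0)(+ E i 1)))(trans (mono-+ _ _)(trans (*ʳ (mono-+ _ _))(*ʳ (sym (*-identityʳ _))))))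
     where
     l : ∀ N x y -> (1' -' N) *' (x -' y) ≡ -' N *' x +' 1' *' x +' (N -' 1' -' + 2 *' 0') *' y
     l = ℤsolve
    abel i (suc j) = trans (∏-upTo-last (suc j) _)(trans (*ʳ (abel i j))(trans (*-assoc _ _ _)(trans (*ˡ (trans (sym (mono-+ _ _))(trans (mono-cong (l (+ N)(+ j)(+ E i (suc j))(+ E i (suc (suc j)))))(mono-+ _ _))))
     (trans (solve 4 (\u p x y -> u :* p :* (x :* y) := u :* (p :* x) :* y) rfl _ _ _ _)(*ʳ (*ˡ (sym (∏-upTo-last j _))))))))
     where
     l : ∀ N j x y -> (N -' 1' -' + 2 *' j) *' x +' (1' +' (1' +' j +' (1' +' j)) -' N) *' (x -' y) ≡ + 2 *' x +' (N -' 1' -' + 2 *' (1' +' j)) *' y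
     l = ℤsolve

    -- The quadratic parts agree at sight, with d the difference of neighbouring columns. The linear
    -- part of a cell is (2a + 1 - N) d, and summing it by parts along a row produces the
    -- coefficients -N + 1 at column 0 and 2 at the columns in between.
    expo-product : mono (twoAᴱ +' + colSumᴱ 0) ≈ ∏ (upTo m)(\i -> ∏ (upTo N)(\a -> mono (expo i a)))
    expo-product = begin
     mono (-' (+ N *' C0) +' + 2 *' S1 +' + N *' Q2 +' C0)
      ≈⟨ trans (mono-cong (l (+ N) C0 (+ 2 *' S1)(+ N *' Q2)))(trans (mono-+ _ _)(*-cong (trans (mono-+ _ _)(*ʳ (mono-+ _ _))) rfl)) ⟩
     mono (-' + N *' C0) * mono (1' *' C0) * mono (+ 2 *' S1) * mono (+ N *' Q2)
      ≈⟨ *-cong (*-cong (*-cong (mono-colSum (-' + N) 0)(mono-colSum 1' 0))(trans (mono-sum (+ 2) _ (upTo k))(trans (∏-cong (upTo k)(\j -> mono-colSum (+ 2)(suc j)))(∏-swap (upTo k)(upTo m) _))))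
         (trans (mono-sum (+ N) _ (upTo m))(∏-cong (upTo m)(\i -> mono-sum (+ N)(\a -> d i a *' d i a)(upTo N)))) ⟩
     _ * _ * _ * _
      ≈⟨ *ʳ (trans (*ʳ (sym (∏-* (upTo m) _ _)))(sym (∏-* (upTo m) _ _))) ⟩
     ∏ (upTo m)(\i -> mono (-' + N *' + E i 0) * mono (1' *' + E i 0) * ∏ (upTo k)(\a -> mono (+ 2 *' + E i (suc a)))) * ∏ (upTo m)(\i -> ∏ (upTo N)(\a -> mono (+ N *' (d i a *' d i a))))
      ≈⟨ *ʳ (∏-cong (upTo m)(\i -> sym (trans (abel i k)(trans (*ˡ (trans (mono-cong (≡.trans (cong (\z -> (+ N -' 1' -' + 2 *' + k) *' + z)(E-zero i N ℕP.≤-refl))(ℤP.*-zeroʳ (+ N -' 1' -' + 2 *' + k)))) mono-0))(*-identityʳ _))))) ⟩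
     ∏ (upTo m)(\i -> ∏ (upTo N)(\a -> mono (lin i a))) * ∏ (upTo m)(\i -> ∏ (upTo N)(\a -> mono (+ N *' (d i a *' d i a))))
      ≈⟨ trans (sym (∏-* (upTo m) _ _))(∏-cong (upTo m)(\i -> trans (sym (∏-* (upTo N) _ _))(∏-cong (upTo N)(\a -> trans (sym (mono-+ _ _))(mono-cong (l' (+ suc (a ℕ.+ a))(+ N)(d i a))))))) ⟩
     ∏ (upTo m)(\i -> ∏ (upTo N)(\a -> mono (expo i a))) ∎
     where
     C0 = + colSumᴱ 0
     S1 = sumℤ (map (\j -> + colSumᴱ (suc j))(upTo k))
     Q2 = sumℤ (map (\i -> sumℤ (map (\a -> d i a *' d i a)(upTo N)))(upTo m))
     l : ∀ N c x y -> -' (N *' c) +' x +' y +' c ≡ -' N *' c +' 1' *' c +' x +' y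
     l = ℤsolve
     l' : ∀ z N d -> (z -' N) *' d +' N *' (d *' d) ≡ z *' d +' N *' (d *' d -' d)
     l' = ℤsolve

    expo-monomial : ∃ \n -> ∏ (upTo m)(\i -> ∏ (upTo N)(\a -> mono (expo i a))) ≈ mono (+ n)
    expo-monomial = monomial m (\i i<m -> monomial N (\a a<N -> _ , mono-cong (nat (suc (a ℕ.+ a))(E i a ∸ E i (suc a))(monus (down-j i a i<m a<N)))))
     where
     nat : ∀ z x {y} -> + x ≡ y -> + z *' y +' + N *' (y *' y -' y) ≡ + (z ℕ.* x ℕ.+ N ℕ.* (x ℕ.* (x ∸ 1)))
     nat z zero refl = ≡.trans (cong₂ _+'_ (ℤP.*-zeroʳ (+ z))(ℤP.*-zeroʳ (+ N)))(cong +_ (≡.sym (cong₂ ℕ._+_ (ℕP.*-zeroʳ z)(ℕP.*-zeroʳ N))))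
     nat z (suc x) refl = ≡.sym (≡.trans (cong₂ _+'_ (ℤP.pos-* z (suc x))(≡.trans (ℤP.pos-* N (suc x ℕ.* x))(cong (+ N *'_)(ℤP.pos-* (suc x) x))))(cong (\w -> + z *' + suc x +' + N *' w)(l (+ x))))
      where
      l : ∀ x -> (1' +' x) *' x ≡ (1' +' x) *' (1' +' x) -' (1' +' x)
      l = ℤsolve

    -- `calB` has the inverses for the columns 1, ..., N in its cells and the one for column 0
    -- apart; the chain has those for 0, ..., N - 1. The one for column N is 1.
    heads : ∀ i -> ∏ (upTo N)(\a -> iq (H i (suc a))) * iq (H i 0) ≈ ∏ (upTo N)(\a -> iq (H i a))
    heads i = trans (*-comm _ _)(trans (sym (∏-upTo-suc N (\a -> iq (H i a))))(trans (∏-upTo-last N _)(trans (*ˡ (iq-cong (cong₂ (\x y -> + x -' + y)(E-zero i N ℕP.≤-refl)(E-zero (suc i) N ℕP.≤-refl))))(*-identityʳ _))))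

    ι-calB : ι calBᴱ ≈ ∏ (upTo m)(\i -> ∏ (upTo N)(\a -> qf (A' i a) * iq (d i a) * iq (H i a)))
    ι-calB = begin
     ι calBᴱ
      ≈⟨ trans (ι-* (prodS (concatMap (\i -> map (body i)(upTo N))(upTo m)))(prodS (map last (upTo m))))(*-cong (trans (ι-∏∏ body (\_ -> upTo N)(upTo m))(∏-bound m (\i i<m -> ∏-bound N (\a a<N -> trans (ι-* (qp (2 ℕ.* N)(A⁻ i a)) _)(*-cong
          (trans (ι-qp (A⁻ i a))(qf-cong (monus (ℕP.≤-trans (down-i' i (suc a) i<m)(down-j i a i<m a<N)))))
          (trans (ι-iq2 (E i a ∸ E i (suc a))(H⁻ i (suc a)))(*-cong (iq-cong (monus (down-j i a i<m a<N)))(iq-cong (monus (down-i' i (suc a) i<m))))))))))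
         (trans (ι-∏ last (upTo m))(∏-bound m (\i i<m -> trans (ι-iq (H⁻ i 0))(iq-cong (monus (down-i' i 0 i<m))))))) ⟩
     ∏ (upTo m)(\i -> ∏ (upTo N)(\a -> qf (A' i a) * (iq (d i a) * iq (H i (suc a))))) * ∏ (upTo m)(\i -> iq (H i 0))
      ≈⟨ sym (∏-* (upTo m) _ _) ⟩
     ∏ (upTo m)(\i -> ∏ (upTo N)(\a -> qf (A' i a) * (iq (d i a) * iq (H i (suc a)))) * iq (H i 0))
      ≈⟨ ∏-cong (upTo m)(\i -> trans (*ʳ (trans (∏-cong (upTo N)(\a -> sym (*-assoc _ _ _)))(∏-* (upTo N) _ _)))(trans (*-assoc _ _ _)(trans (*ˡ (heads i))(sym (∏-* (upTo N) _ _))))) ⟩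
     ∏ (upTo m)(\i -> ∏ (upTo N)(\a -> qf (A' i a) * iq (d i a) * iq (H i a))) ∎

    ι-links : ι tailᴱ ≈ links E
    ι-links = trans (ι-∏ (\i -> poch (-' (+ 1)) N N (H⁻ i 0))(upTo m0))(∏-bound m0 (\i i<m0 -> trans (ι-χ (H⁻ i 0))(reflexive (cong χℤ (monus (down-i' i 0 (ℕP.m<n⇒m<1+n i<m0)))))))

   summand-valid : ι (shiftZ (twoAᴱ +' + colSumᴱ 0)(calBᴱ ⊛ tailᴱ)) ≈ links E * Term 0 N E
   summand-valid = begin
    _
     ≈⟨ ι-shiftZ F expo-product expo-monomial ⟩
    mono (twoAᴱ +' + colSumᴱ 0) * ι F
     ≈⟨ *-cong expo-product (trans (ι-* calBᴱ tailᴱ)(*-cong ι-calB ι-links)) ⟩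
    ∏ (upTo m)(\i -> ∏ (upTo N)(\a -> mono (expo i a))) * (∏ (upTo m)(\i -> ∏ (upTo N)(\a -> qf (A' i a) * iq (d i a) * iq (H i a))) * links E)
     ≈⟨ trans (x*[y*z]≈z*[x*y] _ _ _)(*ˡ (sym (∏-* (upTo m) _ _))) ⟩
    links E * ∏ (upTo m)(\i -> ∏ (upTo N)(\a -> mono (expo i a)) * ∏ (upTo N)(\a -> qf (A' i a) * iq (d i a) * iq (H i a)))
     ≈⟨ *ˡ (trans (∏-cong (upTo m)(\i -> trans (sym (∏-* (upTo N) _ _))(∏-cong (upTo N)(\a -> trans (*ʳ (mono-+ _ _))(solve 5 (\x y p r h -> x :* y :* (p :* r :* h) := x :* (p :* r :* y) :* h) rfl _ _ _ _ _)))))(∏-swap (upTo m)(upTo N) _)) ⟩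
    links E * Term 0 N E ∎
    where
    F = calBᴱ ⊛ tailᴱ

 ι-sum : ∀ {A : Set} (F : A -> Series)(p : A -> Bool) xs -> ι (\K -> sumℤ (map (\x -> F x K)(filterᵇ p xs))) ≈ ∑ xs (\x -> if p x then ι (F x) else 0#)
 ι-sum F p [] = trans (ι-cong (\_ -> refl)) ι-0
 ι-sum F p (x ∷ xs) with p x
 ... | true = trans (ι-+ (F x)(\K -> sumℤ (map (\x -> F x K)(filterᵇ p xs))))(+ˡ (ι-sum F p xs))
 ... | false = trans (ι-sum F p xs)(sym (+-identityˡ _))

 by-validity : ∀ b {x y z} -> (T b -> x ≈ y * z) -> z ≈ z * ind b -> (if b then x else 0#) ≈ y * z
 by-validity true h _ = h tt
 by-validity false {y = y} _ p = sym (trans (*ˡ (trans p (zeroʳ _)))(zeroʳ y))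

 ι-lhs : ι (lhsᴺ m0 N B) ≈ multisum m0 B (odds 0 N)
 ι-lhs = trans (ι-cong (lhsᴺ-def m0 N B))(trans (ι-sum (summandᴺ m0 N) valid (funs m (funs N (upTo (suc B)))))(trans (∑-cong (funs m (funs N (upTo (suc B)))) term)(sym (multisum-families k))))
  where
  term : ∀ s -> (if valid s then ι (summandᴺ m0 N s) else 0#) ≈ links (ext s) * Term 0 N (ext s)
  term s = by-validity (valid s)(Summand.summand-valid (ext s)(ext-≥ʳ s))(Summand.Term-valid (ext s)(ext-≥ʳ s))

-- The right-hand side and the conclusion.

denominatorS : ℕ -> Series
denominatorS q = powS (pochInf (+ 1) 2 2) q ⊛ pochInf (+ 1) 1 1

singlesS pairsS numeratorS : ℕ -> ℕ -> ℕ -> Series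
singlesS q m D = prodS (map (\i' -> theta (2 ℕ.* i' ℕ.+ m ℕ.+ 1) D)(upTo (suc q)))
pairsS q m D = prodS (concatMap (\j' -> map (\i' -> theta (2 ℕ.* (j' ∸ i')) D ⊛ theta (2 ℕ.* (i' ℕ.+ j')) D)(upTo j'))(upTo (suc q)))
numeratorS q m D = powS (pochInf (+ 1) D D)(suc q) ⊛ singlesS q m D ⊛ pairsS q m D

abstract
 quotientS : ℕ -> ℕ -> ℕ -> Series
 quotientS q m D = numeratorS q m D ⊛ invS (denominatorS q)

 quotientS-def : ∀ q m D K -> quotientS q m D K ≡ (numeratorS q m D ⊛ invS (denominatorS q)) K
 quotientS-def q m D K = refl

 rhs-quotientS : ∀ m q K -> rhs m (suc q) K ≡ quotientS q m (2 ℕ.* (m ℕ.+ n′ (suc q))) K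
 rhs-quotientS m q K = refl

module RightSide (𝓕 : Frame)(𝓔 : Embedding 𝓕)(K0 q m0 : ℕ) where
 K : ℕ
 K = suc K0
 open Core 𝓕
 open Embedding 𝓔
 open Products 𝓕 K (s≤s z≤n)
 open Embedded 𝓕 𝓔

 private
  N κ size D : ℕ
  N = suc (q ℕ.+ q)
  κ = suc m0 ℕ.+ N
  size = Dual.size 𝓕 K (s≤s z≤n) q m0
  D = κ ℕ.+ κ
  singles pairs : Series
  singles = singlesS q (suc m0) D
  pairs = pairsS q (suc m0) D
  numer : Carrier
  numer = Numerator.numer 𝓕 κ (s≤s z≤n) K (s≤s z≤n) q (Dual.2q<κ 𝓕 K (s≤s z≤n) q m0) K ℕP.≤-refl 0 (suc q)

 -- `pochInf` uses for the coefficient of h^k its own number k + 1 of factors; below h^K all of them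
 -- give the same as K factors.
 pochInf≎ : ∀ α {β} -> 0 < β -> ι (pochInf (+ 1) α β) ≎ P∞ α β
 pochInf≎ α {β} 0<β = ≎-then (mk≎ (Int-ι (pochInf (+ 1) α β))(Int-ι (poch (+ 1) α β K))(coefficients⇒congruent \ {k} k<K ->
   congruent⇒coefficients (≡[]-trans (≡[]-reflexive (ι-poch α β (suc k)))(≡[]-trans (≡[]-sym (Products._≎_.cong≎ (Products.Pn-stable 𝓕 (suc k)(s≤s z≤n) α 0<β k<K)))(≡[]-reflexive (sym (ι-poch α β K))))) ℕP.≤-refl))
  (ι-poch α β K)

 theta≎ : ∀ α {β} -> 0 < β -> ι (theta α β) ≎ ϑ α β
 theta≎ α {β} 0<β = ≈-then (ι-* (pochInf (+ 1) α β)(pochInf (+ 1)(β ∸ α) β))(≎-* (pochInf≎ α 0<β)(pochInf≎ (β ∸ α) 0<β))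

 powS≎ : ∀ {f x} n -> ι f ≎ x -> ι (powS f n) ≎ x ^' n
 powS≎ zero p = ≎-≈ (Int-ι oneS) ι-1
 powS≎ {f} (suc n) p = ≈-then (ι-* f (powS f n))(≎-* p (powS≎ n p))

 0<κ : 0 < κ ℕ.+ κ
 0<κ = s≤s z≤n

 den-0 : denominatorS q 0 ≡ 1'
 den-0 = ≡.trans (⊛-zero (powS (pochInf (+ 1) 2 2) q)(pochInf (+ 1) 1 1))(cong₂ _*'_ (power q)(poch-0 0 1 1))
  where
  power : ∀ n -> powS (pochInf (+ 1) 2 2) n 0 ≡ 1'
  power zero = refl
  power (suc n) = ≡.trans (⊛-zero (pochInf (+ 1) 2 2)(powS (pochInf (+ 1) 2 2) n))(cong₂ _*'_ (poch-0 1 2 1)(power n))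

 den≎ : ι (denominatorS q) ≎ (P∞ 2 2 ^' q) * P∞ 1 1
 den≎ = ≈-then (ι-* (powS (pochInf (+ 1) 2 2) q)(pochInf (+ 1) 1 1))(≎-* (powS≎ q (pochInf≎ 2 (s≤s z≤n)))(pochInf≎ 1 (s≤s z≤n)))

 private
  -- The factors are matched in reverse order: the index i = q - c belongs to the class c, since 2i
  -- + m + 1 = κ - 2c.
  singles≎ : ι singles ≎ ∏ (upTo (suc q))(\c -> ϑ (κ ∸ (c ℕ.+ c)) D)
  singles≎ = ≈-then (ι-∏ (\i' -> theta (2 ℕ.* i' ℕ.+ suc m0 ℕ.+ 1) D)(upTo (suc q)))(≎-then (≎-∏ (All.universal (\i -> theta≎ (2 ℕ.* i ℕ.+ suc m0 ℕ.+ 1) 0<κ)(upTo (suc q))))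
   (trans (∏-reverse (suc q) _)(∏-congAll (AllP.applyUpTo⁺₁ id (suc q)(\ { {c} (s≤s c≤q) -> reflexive (cong (\x -> ϑ x D)(index c≤q)) })))))
   where
   l : ∀ r c m -> 2 ℕ.* r ℕ.+ suc m ℕ.+ 1 ℕ.+ (c ℕ.+ c) ≡ suc m ℕ.+ suc (r ℕ.+ c ℕ.+ (r ℕ.+ c))
   l = ℕsolve
   index : ∀ {c} -> c ≤ q -> 2 ℕ.* (q ∸ c) ℕ.+ suc m0 ℕ.+ 1 ≡ κ ∸ (c ℕ.+ c)
   index {c} p = ≡.sym (≡.trans (cong (_∸ (c ℕ.+ c))(≡.sym (≡.trans (l (q ∸ c) c m0)(cong (\z -> suc m0 ℕ.+ suc (z ℕ.+ z))(ℕP.m∸n+n≡m p)))))(ℕP.m+n∸n≡m _ (c ℕ.+ c)))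

  pairs≎ : ι pairs ≎ ∏ (upTo (suc q))(\j -> ∏ (upTo j)(\i -> ϑ (j ∸ i ℕ.+ (j ∸ i)) D * ϑ (i ℕ.+ j ℕ.+ (i ℕ.+ j)) D))
  pairs≎ = ≈-then (ι-∏∏ (\j' i' -> theta (2 ℕ.* (j' ∸ i')) D ⊛ theta (2 ℕ.* (i' ℕ.+ j')) D) upTo (upTo (suc q)))
   (≎-∏ (All.universal (\j -> ≎-∏ (All.universal (\i -> ≈-then (ι-* (theta (2 ℕ.* (j ∸ i)) D)(theta (2 ℕ.* (i ℕ.+ j)) D))(≎-* (dbl (j ∸ i))(dbl (i ℕ.+ j))))(upTo j)))(upTo (suc q))))
   where
   dbl : ∀ x -> ι (theta (2 ℕ.* x) D) ≎ ϑ (x ℕ.+ x) D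
   dbl x = subst (\y -> ι (theta y D) ≎ ϑ (x ℕ.+ x) D)(cong (x ℕ.+_)(≡.sym (ℕP.+-identityʳ x)))(theta≎ (x ℕ.+ x) 0<κ)

 num≎ : ι (numeratorS q (suc m0) D) ≎ numer
 num≎ = ≈-then (trans (ι-* (powS (pochInf (+ 1) D D)(suc q) ⊛ singles) pairs)(*ʳ (ι-* (powS (pochInf (+ 1) D D)(suc q)) singles)))(≎-* (≎-* (powS≎ (suc q)(pochInf≎ D 0<κ)) singles≎) pairs≎)

 lhs≈ : ∀ B -> ι (lhsᴺ m0 N B) ≈ Chain.multisum 𝓕 N (s≤s z≤n) m0 B (odds 0 N)
 lhs≈ B = Translate.ι-lhs 𝓕 𝓔 (q ℕ.+ q) m0 B

 -- Both sides are compared after multiplication by the denominator, which can be undone because its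
 -- constant term is 1; the coefficient of h^K0 is read off modulo h^(K0 + 1).
 identity : ∀ {B} -> size ≤ B -> lhsᴺ m0 N B K0 ≡ quotientS q (suc m0) D K0
 identity {B} size≤B = ≡.trans (congruent⇒coefficients (≡[]-trans (≡[]-reflexive (begin
   ι f ≈⟨ sym (*-identityʳ _) ⟩
   ι f * 1# ≈⟨ *ˡ (sym (trans (sym (ι-* (denominatorS q)(invS (denominatorS q))))(trans (ι-cong (invS-inverseʳ (denominatorS q) den-0)) ι-1))) ⟩
   ι f * (ι (denominatorS q) * ι (invS (denominatorS q))) ≈⟨ sym (*-assoc _ _ _) ⟩
   ι f * ι (denominatorS q) * ι (invS (denominatorS q)) ∎))
  (≡[]-trans (≡[]-*ʳ (Int-ι (invS (denominatorS q)))(≡[]-trans (≡[]-*ˡ (Int-ι f)(cong≎ den≎))(≡[]-trans (≡[]-reflexive (*ʳ (lhs≈ B)))(≡[]-trans (Dual.multisum-product 𝓕 K (s≤s z≤n) q m0 size≤B)(≡[]-sym (cong≎ num≎))))))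
   (≡[]-reflexive (sym (ι-* (numeratorS q (suc m0) D)(invS (denominatorS q))))))) ℕP.≤-refl)(≡.sym (quotientS-def q (suc m0) D K0))
  where f = lhsᴺ m0 N B

theorem1p6 : (m n : ℕ) → 1 ≤ m → 1 ≤ n → (K : ℕ) →
  ∃ λ B₀ → (B : ℕ) → B₀ ≤ B → lhsPartial m n B K ≡ rhs m n K
-- The witness is the number of letters of the truncated alphabet that suffices modulo h^(K + 1):
-- longer columns contribute 0.
theorem1p6 (suc m0)(suc q) _ _ K = Dual.size Laurent.laurent (suc K)(s≤s z≤n) q m0 , \B size≤B ->
 ≡.trans (≡.trans (lhsPartial-lhsᴺ m0 (suc q) B K)(cong (\N -> lhsᴺ m0 N B K) n'≡))(≡.trans (RightSide.identity Laurent.laurent Laurent.embedding K q m0 size≤B)(≡.trans (cong (\D -> quotientS q (suc m0) D K) D≡)(≡.sym (rhs-quotientS (suc m0) q K))))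
 where
 n'≡ : n′ (suc q) ≡ suc (q ℕ.+ q)
 n'≡ = ≡.trans (ℕP.+-suc q (q ℕ.+ 0))(cong (\x -> suc (q ℕ.+ x))(ℕP.+-identityʳ q))
 D≡ : suc m0 ℕ.+ suc (q ℕ.+ q) ℕ.+ (suc m0 ℕ.+ suc (q ℕ.+ q)) ≡ 2 ℕ.* (suc m0 ℕ.+ n′ (suc q))
 D≡ = ≡.trans (cong (\x -> suc m0 ℕ.+ x ℕ.+ (suc m0 ℕ.+ x))(≡.sym n'≡))(cong (\x -> suc m0 ℕ.+ n′ (suc q) ℕ.+ x)(≡.sym (ℕP.+-identityʳ (suc m0 ℕ.+ n′ (suc q)))))
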